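{- There exists a nonempty $\Pi^0_1$ class of Borel probability measures on $2^{\mathbb N}$ all of whose elements are neutral measures.
   Context: $2^{<\mathbb N}$ is the set of finite binary strings; for a Borel probability measure $\mu$ on $2^{\mathbb N}$ write $\mu(\sigma)=\mu([\sigma])$. A semimeasure is a function $f:2^{<\mathbb N}\to[0,1]$ with $f(\sigma)\ge f(\sigma\,\hat{}\,0)+f(\sigma\,\hat{}\,1)$; its undergraph is $\{(\sigma,q)\in2^{<\mathbb N}\times\mathbb Q: f(\sigma)>q\}$. A c.e. test is a computably enumerable set $T$ of elements $\big((\sigma_i,q_i)_{i<k},(\sigma,q)\big)\in(2^{<\mathbb N}\times\mathbb Q)^{<\mathbb N}\times(2^{<\mathbb N}\times\mathbb Q)$ such that for every Borel probability measure $\mu$ the set of $(\sigma,q)$ for which some $\big((\sigma_i,q_i)_{i<k},(\sigma,q)\big)\in T$ has $\mu(\sigma_i)>q_i$ for all $i<k$ is the undergraph of a semimeasure, denoted $T(\mu)$. A c.e. test $U$ is universal if for every c.e. test $T$ there is a rational $c>0$ with $U(\mu)(\sigma)\ge c\,T(\mu)(\sigma)$ for all $\mu,\sigma$. $\mu$ passes $T$ if $T(\mu)(\sigma)\le\mu(\sigma)$ for all $\sigma$; $\mu$ is neutral if it passes a universal c.e. test. A $\Pi^0_1$ class of measures is a set of Borel probability measures on $2^{\mathbb N}$ whose complement is the union of a computably enumerable family of basic open sets of the form $\{\mu:p_i<\mu(\sigma_i)<q_i,\ i=1,\dots,m\}$ with $\sigma_i\in2^{<\mathbb N}$ and $p_i<q_i$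 rational. -}

module Defs where

open import Data.Bool using (Bool; true; false)
open import Data.Fin using (Fin)
open import Data.Integer using (ℤ; +_; -[1+_])
open import Data.List using (List; []; _∷_; _∷ʳ_; applyUpTo; length)
open import Data.List.Relation.Unary.All using (All)
open import Data.Nat as ℕ using (ℕ; zero; suc)
open import Data.Product using (Σ-syntax; ∃-syntax; _×_; _,_; proj₁; proj₂)
open import Data.Rational as ℚ using (ℚ; 0ℚ; 1ℚ)
import Data.Rational.Properties as ℚₚ
open import Data.Vec as Vec using (Vec)
open import Data.Vec.Relation.Binary.Pointwise.Inductive using (Pointwise)
open import Function.Bundles using (_⇔_)
open import Level using (0ℓ)
open import Relation.Binary.PropositionalEquality using (_≡_; _≢_; refl; sym; subst)
open import Relation.Nullary using (¬_; yes; no)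
open import Relation.Unary using (Pred; _≐_)
open import Relation.Binary.Definitions using (tri<; tri≈; tri>)

------------------------------------------------------------------------
-- Real numbers

-- Classical Dedekind cuts, given by their lower halves: `Below x q` means
-- q < x.  The development is meant to be read under excluded middle, so no
-- upper half or locatedness is recorded.
record ℝ : Set₁ where
  field
    Below     : ℚ → Set
    nonempty  : ∃[ q ] Below q
    bounded   : ∃[ q ] ¬ Below q
    downward  : ∀ {p q} → p ℚ.< q → Below q → Below p
    noMaximum : ∀ {p} → Below p → ∃[ q ] (p ℚ.< q × Below q)

open ℝ using (Below)

infix 4 _≤_ _<_ _≈_
infixl 6 _+_
infixr 7 _·_

_≤_ : ℝ → ℝ → Set
x ≤ y = ∀ {q} → Below x q → Below y q

_<_ : ℝ → ℝ → Set
x < y = ∃[ q ] (¬ Below x q × Below y q)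

_≈_ : ℝ → ℝ → Set
x ≈ y = x ≤ y × y ≤ x

<⇒≱ : ∀ {p q} → p ℚ.< q → ¬ (q ℚ.≤ p)
<⇒≱ p<q q≤p = ℚₚ.<-irrefl refl (ℚₚ.<-≤-trans p<q q≤p)

below-≤ : (x : ℝ) → ∀ {p q} → p ℚ.≤ q → Below x q → Below x p
below-≤ x {p} {q} p≤q q∈x with ℚₚ.<-cmp p q
... | tri< p<q _ _ = ℝ.downward x p<q q∈x
... | tri≈ _ p≡q _ = subst (Below x) (sym p≡q) q∈x
... | tri> _ _ q<p with () ← <⇒≱ q<p p≤q

above : (x : ℝ) → ∀ {p q} → Below x p → ¬ Below x q → p ℚ.< q
above x {p} {q} p∈x q∉x with q ℚₚ.≤? p
... | yes q≤p with () ← q∉x (below-≤ x q≤p p∈x)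
... | no  q≰p = ℚₚ.≰⇒> q≰p

fromℚ : ℚ → ℝ
fromℚ r = record
  { Below     = ℚ._< r
  ; nonempty  = r ℚ.- 1ℚ
              , subst (r ℚ.- 1ℚ ℚ.<_) (ℚₚ.+-identityʳ r)
                  (ℚₚ.+-monoʳ-< r {ℚ.- 1ℚ} {0ℚ} (ℚₚ.negative⁻¹ (ℚ.- 1ℚ)))
  ; bounded   = r , ℚₚ.<-irrefl refl
  ; downward  = ℚₚ.<-trans
  ; noMaximum = λ p<r → ℚₚ.<-dense p<r
  }

0ℝ 1ℝ : ℝ
0ℝ = fromℚ 0ℚ
1ℝ = fromℚ 1ℚ

_+_ : ℝ → ℝ → ℝ
x + y = record
  { Below     = λ r → ∃[ p ] ∃[ q ] (Below x p × Below y q × r ℚ.≤ p ℚ.+ q)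
  ; nonempty  = let (p , p∈x) = ℝ.nonempty x ; (q , q∈y) = ℝ.nonempty y
                in p ℚ.+ q , p , q , p∈x , q∈y , ℚₚ.≤-refl
  ; bounded   = let (u , u∉x) = ℝ.bounded x ; (v , v∉y) = ℝ.bounded y
                in u ℚ.+ v , λ (p , q , p∈x , q∈y , u+v≤p+q) →
                     <⇒≱ (ℚₚ.+-mono-< (above x p∈x u∉x) (above y q∈y v∉y)) u+v≤p+q
  ; downward  = λ r<s (p , q , p∈x , q∈y , s≤) →
                  p , q , p∈x , q∈y , ℚₚ.≤-trans (ℚₚ.<⇒≤ r<s) s≤
  ; noMaximum = λ (p , q , p∈x , q∈y , r≤) →
                  let (p′ , p<p′ , p′∈x) = ℝ.noMaximum x p∈x
                  in p′ ℚ.+ q , ℚₚ.≤-<-trans r≤ (ℚₚ.+-monoˡ-< q p<p′)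
                   , p′ , q , p′∈x , q∈y , ℚₚ.≤-refl
  }

_·_ : (c : ℚ) .{{_ : ℚ.Positive c}} → ℝ → ℝ
_·_ c {{c>0}} x = record
  { Below     = λ r → ∃[ p ] (Below x p × r ℚ.≤ c ℚ.* p)
  ; nonempty  = let (p , p∈x) = ℝ.nonempty x in c ℚ.* p , p , p∈x , ℚₚ.≤-refl
  ; bounded   = let (u , u∉x) = ℝ.bounded x
                in c ℚ.* u , λ (p , p∈x , cu≤cp) →
                     u∉x (below-≤ x (ℚₚ.*-cancelˡ-≤-pos c cu≤cp) p∈x)
  ; downward  = λ r<s (p , p∈x , s≤) → p , p∈x , ℚₚ.≤-trans (ℚₚ.<⇒≤ r<s) s≤
  ; noMaximum = λ (p , p∈x , r≤) →
                  let (p′ , p<p′ , p′∈x) = ℝ.noMaximum x p∈x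
                  in c ℚ.* p′ , ℚₚ.≤-<-trans r≤ (ℚₚ.*-monoʳ-<-pos c p<p′)
                   , p′ , p′∈x , ℚₚ.≤-refl
  }

partialSum : (ℕ → ℝ) → ℕ → ℝ
partialSum a zero    = 0ℝ
partialSum a (suc n) = partialSum a n + a n

_ConvergesTo_ : (ℕ → ℝ) → ℝ → Set
a ConvergesTo x = ∀ (ε : ℚ) → 0ℚ ℚ.< ε →
  ∃[ N ] ∀ n → N ℕ.≤ n → (a n < x + fromℚ ε) × (x < a n + fromℚ ε)

------------------------------------------------------------------------
-- Borel probability measures on Cantor space

String : Set
String = List Bool

_^0 _^1 : String → String
σ ^0 = σ ∷ʳ false
σ ^1 = σ ∷ʳ true

Cantor : Set
Cantor = ℕ → Bool

-- Names for the Borel sets: cylinders form a countable base of the topology,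
-- so the closure of the cylinders under complement and countable union is
-- the Borel σ-algebra.  A set may have many names; a measure must not
-- distinguish them (field `cong`).
data Borel : Set where
  cylinder : String → Borel
  ∁        : Borel → Borel
  ⋃        : (ℕ → Borel) → Borel

⟦_⟧ : Borel → Pred Cantor 0ℓ
⟦ cylinder σ ⟧ α = applyUpTo α (length σ) ≡ σ
⟦ ∁ A ⟧        α = ¬ ⟦ A ⟧ α
⟦ ⋃ A ⟧        α = ∃[ n ] ⟦ A n ⟧ α

PairwiseDisjoint : (ℕ → Borel) → Set
PairwiseDisjoint A = ∀ {m n} → m ≢ n → ∀ α → ¬ (⟦ A m ⟧ α × ⟦ A n ⟧ α)

-- The empty set has measure 0 by σ-additivity, since all values are finite.
record ProbabilityMeasure : Set₁ where
  field
    measure     : Borel → ℝ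
    cong        : ∀ {A B} → ⟦ A ⟧ ≐ ⟦ B ⟧ → measure A ≈ measure B
    nonnegative : ∀ A → 0ℝ ≤ measure A
    total       : measure (cylinder []) ≈ 1ℝ
    σ-additive  : ∀ A → PairwiseDisjoint A →
                  partialSum (λ n → measure (A n)) ConvergesTo measure (⋃ A)

_⟨_⟩ : ProbabilityMeasure → String → ℝ
μ ⟨ σ ⟩ = ProbabilityMeasure.measure μ (cylinder σ)

------------------------------------------------------------------------
-- Computability

-- Partial recursive (μ-recursive) functions of n arguments.
data PartRec : ℕ → Set where
  zeroᶠ : PartRec 0
  sucᶠ  : PartRec 1
  proj  : ∀ {n} → Fin n → PartRec n
  comp  : ∀ {m n} → PartRec m → Vec (PartRec n) m → PartRec n
  prec  : ∀ {n} → PartRec n → PartRec (suc (suc n)) → PartRec (suc n)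
  min   : ∀ {n} → PartRec (suc n) → PartRec n

infix 4 _[_]⇓_

data _[_]⇓_ : ∀ {n} → PartRec n → Vec ℕ n → ℕ → Set where
  ⇓zero : zeroᶠ [ Vec.[] ]⇓ 0
  ⇓suc  : ∀ {x} → sucᶠ [ x Vec.∷ Vec.[] ]⇓ suc x
  ⇓proj : ∀ {n} {i : Fin n} {xs} → proj i [ xs ]⇓ Vec.lookup xs i
  ⇓comp : ∀ {m n} {f : PartRec m} {gs : Vec (PartRec n) m} {xs ys z} →
          Pointwise (λ g y → g [ xs ]⇓ y) gs ys → f [ ys ]⇓ z →
          comp f gs [ xs ]⇓ z
  ⇓prec-zero : ∀ {n} {g : PartRec n} {h xs z} →
          g [ xs ]⇓ z → prec g h [ zero Vec.∷ xs ]⇓ z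
  ⇓prec-suc : ∀ {n} {g : PartRec n} {h xs k y z} →
          prec g h [ k Vec.∷ xs ]⇓ y → h [ k Vec.∷ y Vec.∷ xs ]⇓ z →
          prec g h [ suc k Vec.∷ xs ]⇓ z
  ⇓min  : ∀ {n} {f : PartRec (suc n)} {xs k} →
          f [ k Vec.∷ xs ]⇓ 0 →
          (∀ j → j ℕ.< k → ∃[ y ] f [ j Vec.∷ xs ]⇓ suc y) →
          min f [ xs ]⇓ k

Coding : Set → Set
Coding A = A → ℕ

-- (a , b) ↦ 2ᵃ(2b + 1), a bijection onto the positive integers; with 0 for
-- the empty list it makes the list coding injective.
pair : ℕ → ℕ → ℕ
pair a b = 2 ℕ.^ a ℕ.* suc (2 ℕ.* b)

code-Bool : Coding Bool
code-Bool false = 0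
code-Bool true  = 1

code-ℤ : Coding ℤ
code-ℤ (+ n)    = 2 ℕ.* n
code-ℤ -[1+ n ] = suc (2 ℕ.* n)

code-ℚ : Coding ℚ
code-ℚ q = pair (code-ℤ (ℚ.numerator q)) (ℚ.denominator-1 q)

code-× : ∀ {A B} → Coding A → Coding B → Coding (A × B)
code-× c d (a , b) = pair (c a) (d b)

code-List : ∀ {A} → Coding A → Coding (List A)
code-List c []       = 0
code-List c (x ∷ xs) = pair (c x) (code-List c xs)

code-String : Coding String
code-String = code-List code-Bool

-- The domains, pulled back along the coding, of partial recursive functions.
CE : ∀ {A} → Coding A → Pred A 0ℓ → Set
CE code S = Σ[ f ∈ PartRec 1 ] ∀ x → S x ⇔ (∃[ y ] f [ code x Vec.∷ Vec.[] ]⇓ y)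

------------------------------------------------------------------------
-- Semimeasures, tests and neutral measures

record Semimeasure : Set₁ where
  field
    value         : String → ℝ
    nonnegative   : ∀ σ → 0ℝ ≤ value σ
    atMostOne     : ∀ σ → value σ ≤ 1ℝ
    superadditive : ∀ σ → value (σ ^0) + value (σ ^1) ≤ value σ

open Semimeasure using (value)

undergraph : Semimeasure → Pred (String × ℚ) 0ℓ
undergraph f (σ , q) = fromℚ q < value f σ

Condition : Set
Condition = String × ℚ

TestElement : Set
TestElement = List Condition × Condition

code-TestElement : Coding TestElement
code-TestElement = code-× (code-List code-Condition) code-Condition
  where
  code-Condition : Coding Condition
  code-Condition = code-× code-String code-ℚ

_⊨_ : ProbabilityMeasure → Condition → Set
μ ⊨ (σ , q) = fromℚ q < μ ⟨ σ ⟩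

enforced : Pred TestElement 0ℓ → ProbabilityMeasure → Pred Condition 0ℓ
enforced T μ c = ∃[ cs ] (T (cs , c) × All (μ ⊨_) cs)

record CETest : Set₁ where
  field
    elements : Pred TestElement 0ℓ
    ce       : CE code-TestElement elements
    isTest   : ∀ μ → Σ[ f ∈ Semimeasure ] enforced elements μ ≐ undergraph f

-- T(μ); a semimeasure is determined up to _≈_ by its undergraph.
_at_ : CETest → ProbabilityMeasure → Semimeasure
T at μ = proj₁ (CETest.isTest T μ)

Universal : CETest → Set₁
Universal U = ∀ (T : CETest) → Σ[ c ∈ ℚ ] Σ[ c>0 ∈ ℚ.Positive c ]
  ∀ μ σ → _·_ c {{c>0}} (value (T at μ) σ) ≤ value (U at μ) σ

_Passes_ : ProbabilityMeasure → CETest → Set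
μ Passes T = ∀ σ → value (T at μ) σ ≤ μ ⟨ σ ⟩

Neutral : ProbabilityMeasure → Set₁
Neutral μ = Σ[ U ∈ CETest ] (Universal U × μ Passes U)

------------------------------------------------------------------------
-- Effectively closed classes of measures

Constraint : Set
Constraint = String × ℚ × ℚ

code-Constraints : Coding (List Constraint)
code-Constraints = code-List (code-× code-String (code-× code-ℚ code-ℚ))

ProperInterval : Pred Constraint 0ℓ
ProperInterval (σ , p , q) = p ℚ.< q

Satisfies : ProbabilityMeasure → Pred Constraint 0ℓ
Satisfies μ (σ , p , q) = fromℚ p < μ ⟨ σ ⟩ × μ ⟨ σ ⟩ < fromℚ q

BasicOpen : List Constraint → Pred ProbabilityMeasure 0ℓ
BasicOpen cs μ = All (Satisfies μ) cs

IsΠ⁰₁ : Pred ProbabilityMeasure 0ℓ → Set₁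
IsΠ⁰₁ C = Σ[ W ∈ Pred (List Constraint) 0ℓ ]
  ( CE code-Constraints W
  × (∀ {cs} → W cs → All ProperInterval cs)
  × (∀ μ → (¬ C μ) ⇔ (∃[ cs ] (W cs × BasicOpen cs μ))) )

{-# OPTIONS --safe #-}
-- A set of conditions "mass at least q at σ" generates the least superadditive function
-- satisfying them.  The universal test generates, for each e, from
-- the outputs enabled by μ in the e-th c.e. set, scaled by 2^-(e+1).  To keep these masses
-- at most 1, the e-th set is trimmed to stages at which every finite subset either has
-- outputs that hold jointly in a uniform distribution on finitely many strings, or has
-- inputs that generate mass at least 1 and so cannot be exceeded by any measure.  Every
-- stage of a test is of this kind, so a test is untouched by the trimming.
--
-- The measures passing a c.e. test form a Π⁰₁ class, since a violation is an element of the
-- test whose inputs hold and whose output fails.  It is nonempty by compactness: for finitely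
-- many elements of the test, a discrete Brouwer theorem, obtained from Scarf's lemma by a
-- parity argument, gives an approximate fixed point of the averages, over many thresholds,
-- of distributions realising the enabled outputs.  Along a subsequence these
-- finite samples converge on all clopen sets, and Carathéodory's extension of the limit is a
-- measure passing the test.
module Submission where

-- Two obstacles shape the proof. First, being a test is not a c.e. property, so tests cannot be
-- listed and combined; a listing of all c.e. sets must be cut down uniformly by a Σ₁ condition on
-- finite stages. The clause about inputs of mass at least 1 is forced there, since a test says
-- nothing about outputs whose inputs no measure satisfies. And to show that a stage of a genuine
-- test meets the condition, its inputs have to be made true by an actual Borel measure, which is
-- why the extension theorem is applied to constant sequences of samples as well as to a convergent
-- one. Second, the outputs enabled at a measure jump as the measure moves, because the input
-- conditions are strict inequalities, so there is no continuous map for a fixed-point theorem.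
-- Demanding the inputs with many different margins and averaging makes the map nearly continuous: a
-- move to a nearby point changes the status of each element at no more than one margin. Excluded
-- middle enters the verification, not the programs: every c.e. set is given by an explicit Σ₁
-- formula.

-- Σ₁ formulas over the natural numbers and their compilation to partial recursive functions

module SigmaOneFormulas where

  open import Defs renaming (_+_ to _+ʳ_; _≤_ to _≤ʳ_; _<_ to _<ʳ_; _≈_ to _≈ʳ_)
  open import Data.Fin using (Fin; zero; suc)
  open import Data.Nat hiding (_⊔_)
  open import Data.Nat.Properties
  open import Data.Product using (Σ; Σ-syntax; ∃; ∃-syntax; _×_; _,_; proj₁; proj₂)
  open import Data.Sum using (_⊎_; inj₁; inj₂)
  open import Data.Vec using (Vec; []; _∷_; lookup; map; tabulate; tail)
  open import Data.Vec.Properties using (tabulate∘lookup)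
  open import Data.Vec.Relation.Binary.Pointwise.Inductive using (Pointwise; []; _∷_)
  open import Function using (_∘_; id)
  open import Function.Bundles using (mk⇔)
  open import Relation.Binary.PropositionalEquality
  open import Relation.Binary.Definitions using (tri<; tri≈; tri>)

  mutual
    ⇓-deterministic : ∀ {n} {f : PartRec n} {xs y z} → f [ xs ]⇓ y → f [ xs ]⇓ z → y ≡ z
    ⇓-deterministic ⇓zero ⇓zero = refl
    ⇓-deterministic ⇓suc ⇓suc = refl
    ⇓-deterministic ⇓proj ⇓proj = refl
    ⇓-deterministic (⇓comp gs f) (⇓comp gs′ f′)
      with refl ← ⇓-deterministic* gs gs′ = ⇓-deterministic f f′
    ⇓-deterministic (⇓prec-zero g) (⇓prec-zero g′) = ⇓-deterministic g g′
    ⇓-deterministic (⇓prec-suc r h) (⇓prec-suc r′ h′)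
      with refl ← ⇓-deterministic r r′ = ⇓-deterministic h h′
    ⇓-deterministic {y = y} {z} (⇓min f below) (⇓min f′ below′) with <-cmp y z
    ... | tri≈ _ y≡z _ = y≡z
    ... | tri< y<z _ _ with () ← ⇓-deterministic f (proj₂ (below′ y y<z))
    ... | tri> _ _ z<y with () ← ⇓-deterministic (proj₂ (below z z<y)) f′

    ⇓-deterministic* : ∀ {m n} {gs : Vec (PartRec n) m} {xs ys zs} →
      Pointwise (λ g y → g [ xs ]⇓ y) gs ys → Pointwise (λ g y → g [ xs ]⇓ y) gs zs → ys ≡ zs
    ⇓-deterministic* [] [] = refl
    ⇓-deterministic* (g ∷ gs) (g′ ∷ gs′) = cong₂ _∷_ (⇓-deterministic g g′) (⇓-deterministic* gs gs′)

  Computable : ∀ {n} → (Vec ℕ n → ℕ) → Set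
  Computable {n} f = Σ[ p ∈ PartRec n ] ∀ xs → p [ xs ]⇓ f xs

  ComputableVec : ∀ {n m} → (Vec ℕ n → Vec ℕ m) → Set
  ComputableVec {n} {m} gs = Σ[ ps ∈ Vec (PartRec n) m ] ∀ xs → Pointwise (λ p y → p [ xs ]⇓ y) ps (gs xs)

  -- Used in place of function extensionality, to replace a composite by the intended function.
  computable-ext : ∀ {n} {f g : Vec ℕ n → ℕ} → (∀ xs → f xs ≡ g xs) → Computable f → Computable g
  computable-ext f≗g (p , p⇓) = p , λ xs → subst (p [ xs ]⇓_) (f≗g xs) (p⇓ xs)

  infixr 5 _∷ᶜ_

  []ᶜ : ∀ {n} → ComputableVec {n} (λ _ → [])
  []ᶜ = [] , λ _ → []

  _∷ᶜ_ : ∀ {n m} {g : Vec ℕ n → ℕ} {gs : Vec ℕ n → Vec ℕ m} →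
    Computable g → ComputableVec gs → ComputableVec (λ xs → g xs ∷ gs xs)
  (p , p⇓) ∷ᶜ (ps , ps⇓) = p ∷ ps , λ xs → p⇓ xs ∷ ps⇓ xs

  compᶜ : ∀ {n m} {f : Vec ℕ m → ℕ} {gs : Vec ℕ n → Vec ℕ m} →
    Computable f → ComputableVec gs → Computable (λ xs → f (gs xs))
  compᶜ (p , p⇓) (ps , ps⇓) = comp p ps , λ xs → ⇓comp (ps⇓ xs) (p⇓ _)

  projᶜ : ∀ {n} (i : Fin n) → Computable (λ xs → lookup xs i)
  projᶜ i = proj i , λ _ → ⇓proj

  projsᶜ : ∀ {n m} (is : Fin m → Fin n) → ComputableVec (λ xs → tabulate (λ i → lookup xs (is i)))
  projsᶜ {m = zero} is = []ᶜ
  projsᶜ {m = suc m} is = projᶜ (is zero) ∷ᶜ projsᶜ (λ i → is (suc i))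

  computableVec-ext : ∀ {n m} {f g : Vec ℕ n → Vec ℕ m} →
    (∀ xs → f xs ≡ g xs) → ComputableVec f → ComputableVec g
  computableVec-ext f≗g (ps , ps⇓) = ps , λ xs → subst (Pointwise _ ps) (f≗g xs) (ps⇓ xs)

  reindexᶜ : ∀ {n m} {f : Vec ℕ m → ℕ} (is : Fin m → Fin n) → Computable f →
    Computable (λ xs → f (tabulate (λ i → lookup xs (is i))))
  reindexᶜ is c = compᶜ c (projsᶜ is)

  zeroᶜ : ∀ {n} → Computable {n} (λ _ → 0)
  zeroᶜ = comp zeroᶠ [] , λ _ → ⇓comp [] ⇓zero

  sucᶜ : ∀ {n} {f : Vec ℕ n → ℕ} → Computable f → Computable (λ xs → suc (f xs))
  sucᶜ (p , p⇓) = comp sucᶠ (p ∷ []) , λ xs → ⇓comp (p⇓ xs ∷ []) ⇓suc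

  litᶜ : ∀ {n} (k : ℕ) → Computable {n} (λ _ → k)
  litᶜ zero    = zeroᶜ
  litᶜ (suc k) = sucᶜ (litᶜ k)

  precᶜ : ∀ {n} (f : Vec ℕ (suc n) → ℕ) {g : Vec ℕ n → ℕ} {h : Vec ℕ (suc (suc n)) → ℕ} →
    Computable g → Computable h →
    (∀ xs → f (0 ∷ xs) ≡ g xs) → (∀ k xs → f (suc k ∷ xs) ≡ h (k ∷ f (k ∷ xs) ∷ xs)) →
    Computable f
  precᶜ f {g} {h} (p , p⇓) (q , q⇓) f0 fs = prec p q , λ { (k ∷ xs) → go k xs }
    where
    go : ∀ k xs → prec p q [ k ∷ xs ]⇓ f (k ∷ xs)
    go zero xs = subst (_ [ _ ]⇓_) (sym (f0 xs)) (⇓prec-zero (p⇓ xs))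
    go (suc k) xs = subst (_ [ _ ]⇓_) (sym (fs k xs)) (⇓prec-suc (go k xs) (q⇓ _))

  op₁ : (ℕ → ℕ) → Vec ℕ 1 → ℕ
  op₁ f (x ∷ []) = f x

  op₂ : (ℕ → ℕ → ℕ) → Vec ℕ 2 → ℕ
  op₂ f (x ∷ y ∷ []) = f x y

  p0 : ∀ {n} → Computable {suc n} _
  p0 = projᶜ zero
  p1 : ∀ {n} → Computable {suc (suc n)} _
  p1 = projᶜ (suc zero)
  p2 : ∀ {n} → Computable {suc (suc (suc n))} _
  p2 = projᶜ (suc (suc zero))

  add : Computable (op₂ _+_)
  add = precᶜ _ p0 (sucᶜ p1) (λ { (x ∷ []) → refl }) (λ { k (x ∷ []) → refl })

  mul : Computable (op₂ _*_)
  mul = precᶜ _ zeroᶜ (compᶜ add (p2 ∷ᶜ p1 ∷ᶜ []ᶜ)) (λ { (x ∷ []) → refl }) (λ { k (x ∷ []) → refl })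

  predecessor : Computable (op₁ pred)
  predecessor = precᶜ _ zeroᶜ p0 (λ { [] → refl }) (λ { k [] → refl })

  -- `prec` recurses on its first argument, so the number subtracted comes first.
  monusFlip : Computable (op₂ (λ y x → x ∸ y))
  monusFlip = precᶜ _ p0 (compᶜ predecessor (p1 ∷ᶜ []ᶜ)) (λ { (x ∷ []) → refl })
    (λ { k (x ∷ []) → sym (pred[m∸n]≡m∸[1+n] x k) })

  dist : ℕ → ℕ → ℕ
  dist x y = (x ∸ y) + (y ∸ x)

  distᶜ : Computable (op₂ dist)
  distᶜ = computable-ext (λ { (x ∷ y ∷ []) → refl })
    (compᶜ add (compᶜ monusFlip (p1 ∷ᶜ p0 ∷ᶜ []ᶜ) ∷ᶜ compᶜ monusFlip (p0 ∷ᶜ p1 ∷ᶜ []ᶜ) ∷ᶜ []ᶜ))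

  dist≡0⇒≡ : ∀ x y → dist x y ≡ 0 → x ≡ y
  dist≡0⇒≡ x y d = ≤-antisym (m∸n≡0⇒m≤n (m+n≡0⇒m≡0 (x ∸ y) d)) (m∸n≡0⇒m≤n (m+n≡0⇒n≡0 (x ∸ y) d))

  dist-refl : ∀ x → dist x x ≡ 0
  dist-refl x = cong₂ _+_ (n∸n≡0 x) (n∸n≡0 x)

  power2 : Computable (op₁ (2 ^_))
  power2 = precᶜ _ (litᶜ 1) (compᶜ mul (litᶜ 2 ∷ᶜ p1 ∷ᶜ []ᶜ)) (λ { [] → refl }) (λ { k [] → refl })

  opaque
    -- The pairing is opaque so that codes stay folded during unification; only injectivity and a
    -- few equations are exported.
    ⟪_,_⟫ : ℕ → ℕ → ℕ
    ⟪ a , b ⟫ = pair a b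

    ⟪⟫≡pair : ∀ a b → ⟪ a , b ⟫ ≡ pair a b
    ⟪⟫≡pair a b = refl

  pairᶜ : Computable (op₂ ⟪_,_⟫)
  pairᶜ = computable-ext (λ { (x ∷ y ∷ []) → sym (⟪⟫≡pair x y) })
    (compᶜ mul (compᶜ power2 (p0 ∷ᶜ []ᶜ) ∷ᶜ sucᶜ (compᶜ mul (litᶜ 2 ∷ᶜ p1 ∷ᶜ []ᶜ)) ∷ᶜ []ᶜ))

  -- With zero as truth, a sum acts as a bounded universal quantifier and a product as a bounded
  -- existential one.
  sumUpTo prodUpTo : (ℕ → ℕ) → ℕ → ℕ
  sumUpTo f zero = 0
  sumUpTo f (suc k) = sumUpTo f k + f k
  prodUpTo f zero = 1
  prodUpTo f (suc k) = prodUpTo f k * f k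

  module _ {n} {f : Vec ℕ (suc (suc n)) → ℕ} (fᶜ : Computable f) where
    private
      -- f takes (B ∷ x ∷ e); the recursion step sees (x ∷ accumulator ∷ B ∷ e).
      select : Fin (suc (suc n)) → Fin (suc (suc (suc n)))
      select zero = suc (suc zero)
      select (suc zero) = zero
      select (suc (suc i)) = suc (suc (suc i))

      step : Computable (λ xs → f (tabulate (λ i → lookup xs (select i))))
      step = reindexᶜ select fᶜ

      step≡ : ∀ k y B e → f (tabulate (λ i → lookup (k ∷ y ∷ B ∷ e) (select i))) ≡ f (B ∷ k ∷ e)
      step≡ k y B e = cong (λ v → f (B ∷ k ∷ v)) (tabulate∘lookup e)

    sumᶜ : Computable {suc (suc n)} (λ { (k ∷ B ∷ e) → sumUpTo (λ x → f (B ∷ x ∷ e)) k })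
    sumᶜ = precᶜ _ zeroᶜ (compᶜ add (p1 ∷ᶜ step ∷ᶜ []ᶜ)) (λ { (B ∷ e) → refl })
      (λ { k (B ∷ e) → cong (sumUpTo (λ x → f (B ∷ x ∷ e)) k +_) (sym (step≡ k (sumUpTo (λ x → f (B ∷ x ∷ e)) k) B e)) })

    prodᶜ : Computable {suc (suc n)} (λ { (k ∷ B ∷ e) → prodUpTo (λ x → f (B ∷ x ∷ e)) k })
    prodᶜ = precᶜ _ (litᶜ 1) (compᶜ mul (p1 ∷ᶜ step ∷ᶜ []ᶜ)) (λ { (B ∷ e) → refl })
      (λ { k (B ∷ e) → cong (prodUpTo (λ x → f (B ∷ x ∷ e)) k *_) (sym (step≡ k (prodUpTo (λ x → f (B ∷ x ∷ e)) k) B e)) })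

  sumUpTo≡0⇒ : ∀ f k → sumUpTo f k ≡ 0 → ∀ x → x < k → f x ≡ 0
  sumUpTo≡0⇒ f (suc k) s x x<k with m≤n⇒m<n∨m≡n (≤-pred x<k)
  ... | inj₁ x<k′ = sumUpTo≡0⇒ f k (m+n≡0⇒m≡0 _ s) x x<k′
  ... | inj₂ refl = m+n≡0⇒n≡0 (sumUpTo f k) s

  sumUpTo≡0⇐ : ∀ f k → (∀ x → x < k → f x ≡ 0) → sumUpTo f k ≡ 0
  sumUpTo≡0⇐ f zero h = refl
  sumUpTo≡0⇐ f (suc k) h = cong₂ _+_ (sumUpTo≡0⇐ f k (λ x x<k → h x (m<n⇒m<1+n x<k))) (h k ≤-refl)

  prodUpTo≡0⇒ : ∀ f k → prodUpTo f k ≡ 0 → ∃[ x ] (x < k × f x ≡ 0)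
  prodUpTo≡0⇒ f (suc k) p with m*n≡0⇒m≡0∨n≡0 (prodUpTo f k) p
  ... | inj₁ p′ = let (x , x<k , e) = prodUpTo≡0⇒ f k p′ in x , m<n⇒m<1+n x<k , e
  ... | inj₂ e = k , ≤-refl , e

  prodUpTo≡0⇐ : ∀ f k x → x < k → f x ≡ 0 → prodUpTo f k ≡ 0
  prodUpTo≡0⇐ f (suc k) x x<k e with m≤n⇒m<n∨m≡n (≤-pred x<k)
  ... | inj₁ x<k′ = cong (_* f k) (prodUpTo≡0⇐ f k x x<k′ e)
  ... | inj₂ refl = trans (cong (prodUpTo f k *_) e) (*-zeroʳ (prodUpTo f k))

  data Term (n : ℕ) : Set where
    var : Fin n → Term n
    app : ∀ {k} (f : Vec ℕ k → ℕ) → Computable f → Vec (Term n) k → Term n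

  infix  7 _≐_
  infixr 6 _∧_
  infixr 5 _∨_

  -- Negation is absent, so truth with witnesses below a bound is monotone in the bound. `call`
  -- evaluates a formula in an environment of its own, which lets formulas be used like predicates
  -- without substitution.
  data Fm (n : ℕ) : Set where
    _≐_     : Term n → Term n → Fm n
    _∧_ _∨_ : Fm n → Fm n → Fm n
    ∃′      : Fm (suc n) → Fm n
    ∀<      : Term n → Fm (suc n) → Fm n
    call    : ∀ {m} → Fm m → Vec (Term n) m → Fm n

  mutual
    eval : ∀ {n} → Term n → Vec ℕ n → ℕ
    eval (var i) e = lookup e i
    eval (app f _ ts) e = f (evals ts e)

    evals : ∀ {n k} → Vec (Term n) k → Vec ℕ n → Vec ℕ k
    evals [] e = []
    evals (t ∷ ts) e = eval t e ∷ evals ts e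

  mutual
    evalᶜ : ∀ {n} (t : Term n) → Computable (eval t)
    evalᶜ (var i) = projᶜ i
    evalᶜ (app f c ts) = compᶜ c (evalsᶜ ts)

    evalsᶜ : ∀ {n k} (ts : Vec (Term n) k) → ComputableVec (evals ts)
    evalsᶜ [] = []ᶜ
    evalsᶜ (t ∷ ts) = evalᶜ t ∷ᶜ evalsᶜ ts

  infix 4 _⊩_

  _⊩_ : ∀ {n} → Vec ℕ n → Fm n → Set
  e ⊩ s ≐ t     = eval s e ≡ eval t e
  e ⊩ φ ∧ ψ     = (e ⊩ φ) × (e ⊩ ψ)
  e ⊩ φ ∨ ψ     = (e ⊩ φ) ⊎ (e ⊩ ψ)
  e ⊩ ∃′ φ      = ∃[ x ] (x ∷ e ⊩ φ)
  e ⊩ ∀< t φ    = ∀ x → x < eval t e → x ∷ e ⊩ φ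
  e ⊩ call φ ts = evals ts e ⊩ φ

  -- `bounded φ (B ∷ e)` vanishes iff φ holds with all existential witnesses below B.
  bounded : ∀ {n} → Fm n → Vec ℕ (suc n) → ℕ
  bounded (s ≐ t)     (B ∷ e) = dist (eval s e) (eval t e)
  bounded (φ ∧ ψ)     (B ∷ e) = bounded φ (B ∷ e) + bounded ψ (B ∷ e)
  bounded (φ ∨ ψ)     (B ∷ e) = bounded φ (B ∷ e) * bounded ψ (B ∷ e)
  bounded (∃′ φ)      (B ∷ e) = prodUpTo (λ x → bounded φ (B ∷ x ∷ e)) B
  bounded (∀< t φ)    (B ∷ e) = sumUpTo (λ x → bounded φ (B ∷ x ∷ e)) (eval t e)
  bounded (call φ ts) (B ∷ e) = bounded φ (B ∷ evals ts e)

  tailᶜ : ∀ {n m} {f : Vec ℕ n → Vec ℕ m} → ComputableVec f → ComputableVec {suc n} (λ xs → f (tail xs))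
  tailᶜ {n} {f = f} (ps , ps⇓) = go ps ps⇓
    where
    sub : PartRec n → PartRec (suc n)
    sub p = comp p (proj₁ (projsᶜ suc))
    go : ∀ {m} {f : Vec ℕ n → Vec ℕ m} (ps : Vec (PartRec n) m) →
      (∀ xs → Pointwise (λ p y → p [ xs ]⇓ y) ps (f xs)) → ComputableVec {suc n} (λ xs → f (tail xs))
    go ps h = map sub ps , λ { (B ∷ e) → lift (h e) }
      where
      lift : ∀ {m} {qs : Vec (PartRec n) m} {B e} {ys : Vec ℕ m} → Pointwise (λ p y → p [ e ]⇓ y) qs ys →
        Pointwise (λ p y → p [ B ∷ e ]⇓ y) (map sub qs) ys
      lift [] = []
      lift {B = B} {e} (d ∷ ds) =
        ⇓comp (subst (Pointwise _ _) (tabulate∘lookup e) (proj₂ (projsᶜ suc) (B ∷ e))) d ∷ lift ds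

  weakenᶜ : ∀ {n} {f : Vec ℕ n → ℕ} → Computable f → Computable {suc n} (λ { (B ∷ e) → f e })
  weakenᶜ {f = f} c = computable-ext (λ { (B ∷ e) → cong f (tabulate∘lookup e) }) (reindexᶜ suc c)

  allProjsᶜ : ∀ {n} → ComputableVec {n} (λ e → e)
  allProjsᶜ = computableVec-ext tabulate∘lookup (projsᶜ id)

  boundedᶜ : ∀ {n} (φ : Fm n) → Computable (bounded φ)
  boundedᶜ (s ≐ t) = computable-ext (λ { (B ∷ e) → refl })
    (compᶜ distᶜ (weakenᶜ (evalᶜ s) ∷ᶜ weakenᶜ (evalᶜ t) ∷ᶜ []ᶜ))
  boundedᶜ (φ ∧ ψ) = computable-ext (λ { (B ∷ e) → refl })
    (compᶜ add (boundedᶜ φ ∷ᶜ boundedᶜ ψ ∷ᶜ []ᶜ))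
  boundedᶜ (φ ∨ ψ) = computable-ext (λ { (B ∷ e) → refl })
    (compᶜ mul (boundedᶜ φ ∷ᶜ boundedᶜ ψ ∷ᶜ []ᶜ))
  boundedᶜ (∃′ φ) = computable-ext (λ { (B ∷ e) → refl })
    (compᶜ (prodᶜ (boundedᶜ φ)) (p0 ∷ᶜ allProjsᶜ))
  boundedᶜ (∀< t φ) = computable-ext (λ { (B ∷ e) → refl })
    (compᶜ (sumᶜ (boundedᶜ φ)) (weakenᶜ (evalᶜ t) ∷ᶜ allProjsᶜ))
  boundedᶜ (call φ ts) = computable-ext (λ { (B ∷ e) → refl })
    (compᶜ (boundedᶜ φ) (p0 ∷ᶜ tailᶜ (evalsᶜ ts)))

  bounded-mono : ∀ {n} (φ : Fm n) {B B′} e → B ≤ B′ → bounded φ (B ∷ e) ≡ 0 → bounded φ (B′ ∷ e) ≡ 0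
  bounded-mono (s ≐ t) e B≤ h = h
  bounded-mono (φ ∧ ψ) e B≤ h = cong₂ _+_
    (bounded-mono φ e B≤ (m+n≡0⇒m≡0 _ h))
    (bounded-mono ψ e B≤ (m+n≡0⇒n≡0 (bounded φ _) h))
  bounded-mono (φ ∨ ψ) {B} {B′} e B≤ h with m*n≡0⇒m≡0∨n≡0 (bounded φ (B ∷ e)) h
  ... | inj₁ h′ = cong (_* bounded ψ (B′ ∷ e)) (bounded-mono φ e B≤ h′)
  ... | inj₂ h′ = trans (cong (bounded φ (B′ ∷ e) *_) (bounded-mono ψ e B≤ h′)) (*-zeroʳ (bounded φ (B′ ∷ e)))
  bounded-mono (∃′ φ) {B} {B′} e B≤ h =
    let (x , x<B , h′) = prodUpTo≡0⇒ _ B h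
    in prodUpTo≡0⇐ _ B′ x (<-≤-trans x<B B≤) (bounded-mono φ (x ∷ e) B≤ h′)
  bounded-mono (∀< t φ) e B≤ h = sumUpTo≡0⇐ _ (eval t e) λ x x< →
    bounded-mono φ (x ∷ e) B≤ (sumUpTo≡0⇒ _ (eval t e) h x x<)
  bounded-mono (call φ ts) e B≤ h = bounded-mono φ (evals ts e) B≤ h

  bounded-sound : ∀ {n} (φ : Fm n) {B} e → bounded φ (B ∷ e) ≡ 0 → e ⊩ φ
  bounded-sound (s ≐ t) e h = dist≡0⇒≡ _ _ h
  bounded-sound (φ ∧ ψ) e h =
    bounded-sound φ e (m+n≡0⇒m≡0 _ h) , bounded-sound ψ e (m+n≡0⇒n≡0 (bounded φ _) h)
  bounded-sound (φ ∨ ψ) {B} e h with m*n≡0⇒m≡0∨n≡0 (bounded φ (B ∷ e)) h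
  ... | inj₁ h′ = inj₁ (bounded-sound φ e h′)
  ... | inj₂ h′ = inj₂ (bounded-sound ψ e h′)
  bounded-sound (∃′ φ) {B} e h =
    let (x , _ , h′) = prodUpTo≡0⇒ _ B h in x , bounded-sound φ (x ∷ e) h′
  bounded-sound (∀< t φ) e h x x< = bounded-sound φ (x ∷ e) (sumUpTo≡0⇒ _ (eval t e) h x x<)
  bounded-sound (call φ ts) e h = bounded-sound φ (evals ts e) h

  -- Σ₁-collection: by monotonicity the sum of finitely many witnesses serves for all of them.
  collect : ∀ (P : ℕ → ℕ → Set) → (∀ {x B B′} → B ≤ B′ → P x B → P x B′) →
    ∀ k → (∀ x → x < k → ∃ (P x)) → ∃[ B ] ∀ x → x < k → P x B
  collect P mono zero h = 0 , λ _ ()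
  collect P mono (suc k) h =
    let (B , all) = collect P mono k (λ x x<k → h x (m<n⇒m<1+n x<k))
        (B′ , last) = h k ≤-refl
    in B + B′ , λ x x<k → go x (m≤n⇒m<n∨m≡n (≤-pred x<k)) B B′ all last
    where
    go : ∀ x → x < k ⊎ x ≡ k → ∀ B B′ → (∀ x → x < k → P x B) → P k B′ → P x (B + B′)
    go x (inj₁ x<k) B B′ all last = mono (m≤m+n B B′) (all x x<k)
    go x (inj₂ refl) B B′ all last = mono (m≤n+m B′ B) last

  bounded-complete : ∀ {n} (φ : Fm n) e → e ⊩ φ → ∃[ B ] bounded φ (B ∷ e) ≡ 0
  bounded-complete (s ≐ t) e h = 0 , trans (cong (dist (eval s e)) (sym h)) (dist-refl (eval s e))
  bounded-complete (φ ∧ ψ) e (h , h′) =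
    let (B , b) = bounded-complete φ e h ; (B′ , b′) = bounded-complete ψ e h′
    in B + B′ , cong₂ _+_ (bounded-mono φ e (m≤m+n B B′) b) (bounded-mono ψ e (m≤n+m B′ B) b′)
  bounded-complete (φ ∨ ψ) e (inj₁ h) =
    let (B , b) = bounded-complete φ e h in B , cong (_* bounded ψ (B ∷ e)) b
  bounded-complete (φ ∨ ψ) e (inj₂ h) =
    let (B , b) = bounded-complete ψ e h
    in B , trans (cong (bounded φ (B ∷ e) *_) b) (*-zeroʳ (bounded φ (B ∷ e)))
  bounded-complete (∃′ φ) e (x , h) =
    let (B , b) = bounded-complete φ (x ∷ e) h
    -- The bound must exceed the witness `x` strictly and also reach the bound `B` found for the
    -- body.
    in suc (x + B) , prodUpTo≡0⇐ _ _ x (s≤s (m≤m+n x B))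
         (bounded-mono φ (x ∷ e) (≤-trans (m≤n+m B x) (n≤1+n _)) b)
  bounded-complete (∀< t φ) e h =
    let (B , b) = collect (λ x B → bounded φ (B ∷ x ∷ e) ≡ 0) (λ {x} → bounded-mono φ (x ∷ e))
                    (eval t e) (λ x x< → bounded-complete φ (x ∷ e) (h x x<))
    in B , sumUpTo≡0⇐ _ (eval t e) b
  bounded-complete (call φ ts) e h = bounded-complete φ (evals ts e) h

  least-zero : ∀ (f : ℕ → ℕ) B → f B ≡ 0 → ∃[ k ] (f k ≡ 0 × ∀ j → j < k → ∃[ y ] f j ≡ suc y)
  least-zero f zero e = 0 , e , λ _ ()
  least-zero f (suc B) e with f 0 in eq
  ... | zero = 0 , eq , λ _ ()
  ... | suc y = let (k , ek , below) = least-zero (f ∘ suc) B e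
                in suc k , ek , λ { zero _ → y , eq ; (suc j) (s≤s j<k) → below j j<k }

  -- `bounded φ` is total, so the search for its least zero halts exactly when some bound on the
  -- witnesses works, that is, when `φ` holds.
  formula-CE : ∀ {A : Set} (code : Coding A) (φ : Fm 1) → CE code (λ x → code x ∷ [] ⊩ φ)
  formula-CE code φ = min p , λ x → mk⇔ (to x) (from x)
    where
    p = proj₁ (boundedᶜ φ)
    p⇓ = proj₂ (boundedᶜ φ)
    to : ∀ x → code x ∷ [] ⊩ φ → ∃[ y ] min p [ code x ∷ [] ]⇓ y
    to x h = let (B , b) = bounded-complete φ _ h
                 (k , ek , below) = least-zero (λ B → bounded φ (B ∷ code x ∷ [])) B b
             in k , ⇓min (subst (p [ k ∷ code x ∷ [] ]⇓_) ek (p⇓ (k ∷ code x ∷ [])))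
                         (λ j j<k → let (y , ey) = below j j<k in y , subst (p [ j ∷ code x ∷ [] ]⇓_) ey (p⇓ (j ∷ code x ∷ [])))
    from : ∀ x → ∃[ y ] min p [ code x ∷ [] ]⇓ y → code x ∷ [] ⊩ φ
    from x (k , ⇓min f _) = bounded-sound φ _ (⇓-deterministic (p⇓ (k ∷ code x ∷ [])) f)

-- Inductive definitions as Σ₁ formulas, and a universal evaluation relation

module UniversalFunction where

  open import Defs renaming (_+_ to _+ʳ_; _≤_ to _≤ʳ_; _<_ to _<ʳ_; _≈_ to _≈ʳ_)
  open SigmaOneFormulas
  open import Data.Bool using (Bool; true; false; if_then_else_)
  open import Data.Empty using (⊥; ⊥-elim)
  open import Data.Fin using (zero; suc; toℕ)
  open import Data.List using (List; []; _∷_; _++_)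
  open import Data.List.Membership.Propositional using (_∈_)
  open import Data.List.Membership.Propositional.Properties using (∈-++⁺ˡ; ∈-++⁺ʳ; ∈-++⁻)
  open import Data.List.Membership.DecPropositional using (_∈?_)
  open import Data.List.Relation.Unary.Any using (here; there)
  open import Data.Nat hiding (_⊔_)
  open import Data.Nat.Properties
  open import Data.Product using (Σ; Σ-syntax; ∃; ∃-syntax; _×_; _,_; proj₁; proj₂)
  open import Data.Sum using (inj₁; inj₂; [_,_]′)
  open import Data.Vec using (Vec; []; _∷_; lookup)
  open import Data.Vec.Relation.Binary.Pointwise.Inductive using (Pointwise; []; _∷_)
  open import Function using (_∘_; id)
  open import Relation.Binary.PropositionalEquality
  open import Relation.Nullary using (yes; no; does)
  open import Relation.Binary.Definitions using (tri<; tri≈; tri>)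
  open import Data.Nat.Tactic.RingSolver using (solve-∀)

  odd≢even : ∀ a b → suc (2 * a) ≢ 2 * b
  odd≢even zero (suc b) e with () ← trans e (*-suc 2 b)
  odd≢even (suc a) (suc b) e = odd≢even a b (suc-injective (suc-injective
    (trans (sym (cong suc (*-suc 2 a))) (trans e (*-suc 2 b)))))

  -- The first component is the exponent of 2, so parity decides whether a factor 2 can be stripped
  -- from both sides.
  pair-injective : ∀ a b {c d} → pair a b ≡ pair c d → a ≡ c × b ≡ d
  pair-injective zero b {zero} {d} e = refl ,
    *-cancelˡ-≡ b d 2 (suc-injective (trans (sym (*-identityˡ _)) (trans e (*-identityˡ _))))
  pair-injective zero b {suc c} {d} e = ⊥-elim (odd≢even b (pair c d)
    (trans (sym (*-identityˡ _)) (trans e (*-assoc 2 (2 ^ c) _))))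
  pair-injective (suc a) b {zero} {d} e = ⊥-elim (odd≢even d (pair a b)
    (trans (sym (*-identityˡ _)) (trans (sym e) (*-assoc 2 (2 ^ a) _))))
  pair-injective (suc a) b {suc c} {d} e =
    let (p , q) = pair-injective a b (*-cancelˡ-≡ _ _ 2
          (trans (sym (*-assoc 2 (2 ^ a) _)) (trans e (*-assoc 2 (2 ^ c) _))))
    in cong suc p , q

  opaque
    unfolding ⟪_,_⟫

    ⟪⟫-injective : ∀ {a b c d} → ⟪ a , b ⟫ ≡ ⟪ c , d ⟫ → a ≡ c × b ≡ d
    ⟪⟫-injective = pair-injective _ _

    ⟪⟫≢0 : ∀ {a b} → ⟪ a , b ⟫ ≢ 0
    ⟪⟫≢0 {a} {b} e with m*n≡0⇒m≡0∨n≡0 (2 ^ a) e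
    ... | inj₁ p = ≢-nonZero⁻¹ (2 ^ a) {{m^n≢0 2 a}} p

  ⟪⟫-injˡ : ∀ {a b c d} → ⟪ a , b ⟫ ≡ ⟪ c , d ⟫ → a ≡ c
  ⟪⟫-injˡ = proj₁ ∘ ⟪⟫-injective

  ⟪⟫-injʳ : ∀ {a b c d} → ⟪ a , b ⟫ ≡ ⟪ c , d ⟫ → b ≡ d
  ⟪⟫-injʳ = proj₂ ∘ ⟪⟫-injective

  v0 : ∀ {n} → Term (1 + n)
  v0 = var zero
  v1 : ∀ {n} → Term (2 + n)
  v1 = var (suc zero)
  v2 : ∀ {n} → Term (3 + n)
  v2 = var (suc (suc zero))
  v3 : ∀ {n} → Term (4 + n)
  v3 = var (suc (suc (suc zero)))
  v4 : ∀ {n} → Term (5 + n)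
  v4 = var (suc (suc (suc (suc zero))))
  v5 : ∀ {n} → Term (6 + n)
  v5 = var (suc (suc (suc (suc (suc zero)))))
  v6 : ∀ {n} → Term (7 + n)
  v6 = var (suc (suc (suc (suc (suc (suc zero))))))
  v7 : ∀ {n} → Term (8 + n)
  v7 = var (suc (suc (suc (suc (suc (suc (suc zero)))))))
  v8 : ∀ {n} → Term (9 + n)
  v8 = var (suc (suc (suc (suc (suc (suc (suc (suc zero))))))))

  -- The programs are hidden so that terms and formulas have small normal forms.
  opaque
    litProgram : ∀ k → Computable {0} (λ _ → k)
    litProgram = litᶜ

    sucProgram : Computable (op₁ suc)
    sucProgram = computable-ext (λ { (x ∷ []) → refl }) (sucᶜ p0)

    addProgram : Computable (op₂ _+_)
    addProgram = add

    mulProgram : Computable (op₂ _*_)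
    mulProgram = mul

    pairProgram : Computable (op₂ ⟪_,_⟫)
    pairProgram = pairᶜ

  lit : ∀ {n} → ℕ → Term n
  lit k = app (λ _ → k) (litProgram k) []

  S : ∀ {n} → Term n → Term n
  S t = app (op₁ suc) sucProgram (t ∷ [])

  infixl 9 _⊗_
  infixl 8 _⊕_

  _⊕_ _⊗_ ⦅_,_⦆ : ∀ {n} → Term n → Term n → Term n
  s ⊕ t = app (op₂ _+_) addProgram (s ∷ t ∷ [])
  s ⊗ t = app (op₂ _*_) mulProgram (s ∷ t ∷ [])
  ⦅ s , t ⦆ = app (op₂ ⟪_,_⟫) pairProgram (s ∷ t ∷ [])

  lessF leqF : Fm 2
  lessF = ∃′ (S (v1 ⊕ v0) ≐ v2)
  leqF = ∃′ (v1 ⊕ v0 ≐ v2)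

  ⊩less⇒ : ∀ {x y} → x ∷ y ∷ [] ⊩ lessF → x < y
  ⊩less⇒ {x} (d , refl) = s≤s (m≤m+n x d)

  ⊩less⇐ : ∀ {x y} → x < y → x ∷ y ∷ [] ⊩ lessF
  ⊩less⇐ {x} x<y = _ , m+[n∸m]≡n x<y

  ⊩leq⇒ : ∀ {x y} → x ∷ y ∷ [] ⊩ leqF → x ≤ y
  ⊩leq⇒ {x} (d , refl) = m≤m+n x d

  ⊩leq⇐ : ∀ {x y} → x ≤ y → x ∷ y ∷ [] ⊩ leqF
  ⊩leq⇐ {x} x≤y = _ , m+[n∸m]≡n x≤y

  -- Finite sets of numbers, given by the binary expansion of a number

  memF notMemF : Fm 2
  memF    = ∃′ (∃′ (v3 ≐ ⦅ v2 , v1 ⦆ ⊕ v0 ∧ call lessF (v0 ∷ ⦅ v2 , lit 0 ⦆ ∷ [])))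
  notMemF = ∃′ (∃′ (v3 ≐ ⦅ v2 , lit 0 ⦆ ⊗ (lit 2 ⊗ v1) ⊕ v0 ∧ call lessF (v0 ∷ ⦅ v2 , lit 0 ⦆ ∷ [])))

  -- `s` is 2^x times an odd number (for `Mem`) or an even number (for `NotMem`) plus a remainder
  -- below 2^x. Formulas have no negation, so absence needs a formula of its own.
  Mem NotMem : ℕ → ℕ → Set
  Mem x s = x ∷ s ∷ [] ⊩ memF
  NotMem x s = x ∷ s ∷ [] ⊩ notMemF

  opaque
    unfolding ⟪_,_⟫

    -- Because of this, `⦅ t , lit 0 ⦆` is written in formulas for a power of two.
    pow≡ : ∀ x → ⟪ x , 0 ⟫ ≡ 2 ^ x
    pow≡ x = *-identityʳ (2 ^ x)

    pow*≡ : ∀ x h → ⟪ x , h ⟫ ≡ 2 ^ x * suc (2 * h)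
    pow*≡ x h = refl

  quotient-unique : ∀ m a b {l l′} → l < m → l′ < m → m * a + l ≡ m * b + l′ → a ≡ b
  quotient-unique m a b {l} {l′} l<m l′<m e with <-cmp a b
  ... | tri≈ _ a≡b _ = a≡b
  ... | tri< a<b _ _ = ⊥-elim (n≮n (m * b + l′) (subst (_< m * b + l′) e (lemma a b l l′ l<m a<b)))
    where
    lemma : ∀ a b l l′ → l < m → a < b → m * a + l < m * b + l′
    lemma a b l l′ l<m a<b = begin-strict
      m * a + l   <⟨ +-monoʳ-< (m * a) l<m ⟩
      m * a + m   ≡⟨ trans (+-comm (m * a) m) (sym (*-suc m a)) ⟩
      m * suc a   ≤⟨ *-monoʳ-≤ m a<b ⟩
      m * b       ≤⟨ m≤m+n _ l′ ⟩
      m * b + l′  ∎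
      where open ≤-Reasoning
  ... | tri> _ _ b<a = ⊥-elim (n≮n (m * a + l) (subst (_< m * a + l) (sym e) lemma))
    where
    lemma : m * b + l′ < m * a + l
    lemma = begin-strict
      m * b + l′  <⟨ +-monoʳ-< (m * b) l′<m ⟩
      m * b + m   ≡⟨ trans (+-comm (m * b) m) (sym (*-suc m b)) ⟩
      m * suc b   ≤⟨ *-monoʳ-≤ m b<a ⟩
      m * a       ≤⟨ m≤m+n _ l ⟩
      m * a + l   ∎
      where open ≤-Reasoning

  mem-exclusive : ∀ {x s} → Mem x s → NotMem x s → ⊥
  mem-exclusive {x} {s} (h , l , e , l<) (h′ , l′ , e′ , l′<) =
    odd≢even h h′ (quotient-unique (2 ^ x) _ _
      (subst (l <_) (pow≡ x) (⊩less⇒ l<)) (subst (l′ <_) (pow≡ x) (⊩less⇒ l′<))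
      (trans (cong (_+ l) (sym (pow*≡ x h))) (trans (sym e)
        (trans e′ (cong (λ p → p * (2 * h′) + l′) (pow≡ x))))))

  bit : Bool → ℕ
  bit b = if b then 1 else 0

  fromBits : (ℕ → Bool) → ℕ → ℕ
  fromBits f zero = 0
  fromBits f (suc n) = fromBits f n + 2 ^ n * bit (f n)

  bit≤1 : ∀ b → bit b ≤ 1
  bit≤1 true = ≤-refl
  bit≤1 false = z≤n

  fromBits< : ∀ f n → fromBits f n < 2 ^ n
  fromBits< f zero = ≤-refl
  fromBits< f (suc n) = +-mono-<-≤ (fromBits< f n)
    (≤-trans (*-monoʳ-≤ (2 ^ n) (bit≤1 (f n))) (≤-reflexive (trans (*-identityʳ _) (sym (+-identityʳ _)))))

  fromBits-split : ∀ f n x → x < n →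
    ∃[ h ] fromBits f n ≡ 2 ^ x * (bit (f x) + 2 * h) + fromBits f x
  fromBits-split f (suc n) x x<n with m≤n⇒m<n∨m≡n (≤-pred x<n)
  ... | inj₂ refl = 0 , trans (+-comm (fromBits f x) _)
        (cong (λ b → 2 ^ x * b + fromBits f x) (sym (+-identityʳ _)))
  ... | inj₁ x<n′ =
    let (h , e) = fromBits-split f n x x<n′
        k = n ∸ suc x
        pow : 2 ^ n ≡ 2 ^ x * (2 * 2 ^ k)
        pow = trans (cong (2 ^_) (sym (trans (+-suc x k) (m+[n∸m]≡n x<n′)))) (^-distribˡ-+-* 2 x (suc k))
    in h + 2 ^ k * bit (f n) ,
       trans (cong₂ (λ u v → u + v * bit (f n)) e pow) (arith (2 ^ x) (bit (f x)) h (fromBits f x) (2 ^ k) (bit (f n)))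
    where
    arith : ∀ p b h r k c → p * (b + 2 * h) + r + p * (2 * k) * c ≡ p * (b + 2 * (h + k * c)) + r
    arith = solve-∀

  fromBits-mem : ∀ f n x → x < n → f x ≡ true → Mem x (fromBits f n)
  fromBits-mem f n x x<n fx with fromBits-split f n x x<n
  ... | h , e rewrite fx = h , fromBits f x ,
        trans e (cong (_+ fromBits f x) (sym (pow*≡ x h))) ,
        ⊩less⇐ (subst (fromBits f x <_) (sym (pow≡ x)) (fromBits< f x))

  fromBits-notMem : ∀ f n x → x < n → f x ≡ false → NotMem x (fromBits f n)
  fromBits-notMem f n x x<n fx with fromBits-split f n x x<n
  ... | h , e rewrite fx = h , fromBits f x ,
        trans e (cong (λ p → p * (2 * h) + fromBits f x) (sym (pow≡ x))) ,
        ⊩less⇐ (subst (fromBits f x <_) (sym (pow≡ x)) (fromBits< f x))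

  -- All rules have two premises; a rule with one premise is encoded by requiring the second to
  -- equal the first. Recursive notions enter formulas only through derivability in such systems.
  data Der (A : ℕ → Set) (R : ℕ → ℕ → ℕ → Set) : ℕ → Set where
    axiom : ∀ {c} → A c → Der A R c
    rule  : ∀ {c p q} → R c p q → Der A R p → Der A R q → Der A R c

  module Inductive (A : Fm 1) (R : Fm 3) where

    memBelowF : Fm 3
    memBelowF = call lessF (v0 ∷ v2 ∷ []) ∧ call memF (v0 ∷ v1 ∷ [])

    -- The set s of numbers below n codes a derivation: its elements are pairs of a
    -- rank and a conclusion, each justified by elements of smaller rank.
    justifiedF : Fm 3
    justifiedF = ∃′ (∃′ (v2 ≐ ⦅ v1 , v0 ⦆ ∧ (call A (v0 ∷ [])
      ∨ ∃′ (∃′ (∃′ (∃′ (call R (v4 ∷ v3 ∷ v2 ∷ [])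
          ∧ call lessF (v1 ∷ v5 ∷ []) ∧ call lessF (v0 ∷ v5 ∷ [])
          ∧ call memBelowF (⦅ v1 , v3 ⦆ ∷ v7 ∷ v8 ∷ []) ∧ call memBelowF (⦅ v0 , v2 ⦆ ∷ v7 ∷ v8 ∷ []))))))))

    opaque
      indF : Fm 1
      indF = ∃′ (∃′ (∃′ (call memBelowF (⦅ v0 , v3 ⦆ ∷ v2 ∷ v1 ∷ [])
        ∧ ∀< v1 (call notMemF (v0 ∷ v3 ∷ []) ∨ call justifiedF (v0 ∷ v3 ∷ v2 ∷ [])))))

    Ax : ℕ → Set
    Ax c = c ∷ [] ⊩ A

    Rl : ℕ → ℕ → ℕ → Set
    Rl c p q = c ∷ p ∷ q ∷ [] ⊩ R

    opaque
      unfolding indF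

      -- Ranks exclude circular justifications: premises have smaller rank, so the unwinding
      -- recurses on a bound `k` for the rank.
      ind-sound : ∀ {c} → c ∷ [] ⊩ indF → Der Ax Rl c
      ind-sound {c} (s , n , i , top , just) = go (suc i) i c ≤-refl top
        where
        go : ∀ k i c → i < k → ⟪ i , c ⟫ ∷ s ∷ n ∷ [] ⊩ memBelowF → Der Ax Rl c
        go (suc k) i c i<k (lt , m) with just ⟪ i , c ⟫ (⊩less⇒ lt)
        ... | inj₁ nm = ⊥-elim (mem-exclusive m nm)
        ... | inj₂ (i′ , c′ , e , j) with refl , refl ← ⟪⟫-injective e with j
        ...   | inj₁ ax = axiom ax
        ...   | inj₂ (p , q , a , b , r , a< , b< , ma , mb) =
                rule r (go k a p (<-≤-trans (⊩less⇒ a<) (≤-pred i<k)) ma)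
                       (go k b q (<-≤-trans (⊩less⇒ b<) (≤-pred i<k)) mb)

    private
      rank : ∀ {c} → Der Ax Rl c → ℕ
      rank (axiom _) = 0
      rank (rule _ d e) = suc (rank d + rank e)

      node : ∀ {c} → Der Ax Rl c → ℕ
      node {c} d = ⟪ rank d , c ⟫

      nodes : ∀ {c} → Der Ax Rl c → List ℕ
      nodes d@(axiom _) = node d ∷ []
      nodes d@(rule _ d₁ d₂) = node d ∷ nodes d₁ ++ nodes d₂

      node∈ : ∀ {c} (d : Der Ax Rl c) → node d ∈ nodes d
      node∈ (axiom _) = here refl
      node∈ (rule _ _ _) = here refl

      bound : (xs : List ℕ) → ∃[ n ] ∀ {x} → x ∈ xs → x < n
      bound [] = 0 , λ ()
      bound (x ∷ xs) = let (n , b) = bound xs in suc (x + n) ,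
        λ { (here refl) → s≤s (m≤m+n x n) ; (there m) → <-≤-trans (b m) (≤-trans (m≤n+m n x) (n≤1+n _)) }

      module _ (xs : List ℕ) where
        N = proj₁ (bound xs)
        f = λ x → does (_∈?_ _≟_ x xs)
        s = fromBits f N

        in-s : ∀ {x} → x ∈ xs → x ∷ s ∷ N ∷ [] ⊩ memBelowF
        in-s {x} m = ⊩less⇐ (proj₂ (bound xs) m) , fromBits-mem f N x (proj₂ (bound xs) m) fx
          where
          fx : f x ≡ true
          fx with _∈?_ _≟_ x xs
          ... | yes _ = refl
          ... | no ¬m = ⊥-elim (¬m m)

        justify : ∀ {c} (d : Der Ax Rl c) → (∀ {x} → x ∈ nodes d → x ∈ xs) →
          ∀ {x} → x ∈ nodes d → x ∷ s ∷ N ∷ [] ⊩ justifiedF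
        justify (axiom a) sub (here refl) = _ , _ , refl , inj₁ a
        justify (rule r d e) sub (here refl) = _ , _ , refl , inj₂
          (_ , _ , rank d , rank e , r , ⊩less⇐ (s≤s (m≤m+n _ _)) , ⊩less⇐ (s≤s (m≤n+m _ (rank d))) ,
           in-s (sub (there (∈-++⁺ˡ (node∈ d)))) , in-s (sub (there (∈-++⁺ʳ (nodes d) (node∈ e)))))
        justify (rule r d e) sub (there m) with ∈-++⁻ (nodes d) m
        ... | inj₁ m′ = justify d (sub ∘ there ∘ ∈-++⁺ˡ) m′
        ... | inj₂ m′ = justify e (sub ∘ there ∘ ∈-++⁺ʳ (nodes d)) m′

    opaque
      unfolding indF

      ind-complete : ∀ {c} → Der Ax Rl c → c ∷ [] ⊩ indF
      ind-complete {c} d = s xs , N xs , rank d , in-s xs (node∈ d) , all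
        where
        xs : List ℕ
        xs = nodes d
        all : ∀ x → x < N xs → x ∷ rank d ∷ N xs ∷ s xs ∷ c ∷ [] ⊩
          call notMemF (v0 ∷ v3 ∷ []) ∨ call justifiedF (v0 ∷ v3 ∷ v2 ∷ [])
        all x x<N with _∈?_ _≟_ x xs in eq
        ... | yes m = inj₂ (justify xs d id m)
        ... | no ¬m = inj₁ (fromBits-notMem (f xs) (N xs) x x<N (cong does eq))

  open Inductive using (indF; ind-sound; ind-complete) public

  mutual
    -- Arities are left out of the index: soundness always compares a code with a program whose
    -- arity is given by its type.
    tag payload : ∀ {n} → PartRec n → ℕ
    tag zeroᶠ      = 0
    tag sucᶠ       = 1
    tag (proj _)   = 2
    tag (comp _ _) = 3
    tag (prec _ _) = 4
    tag (min _)    = 5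
    payload zeroᶠ       = 0
    payload sucᶠ        = 0
    payload (proj i)    = toℕ i
    payload (comp f gs) = ⟪ index f , indices gs ⟫
    payload (prec g h)  = ⟪ index g , index h ⟫
    payload (min f)     = index f

    index : ∀ {n} → PartRec n → ℕ
    index f = ⟪ tag f , payload f ⟫

    indices : ∀ {m n} → Vec (PartRec n) m → ℕ
    indices [] = 0
    indices (g ∷ gs) = ⟪ index g , indices gs ⟫

  code-Vec : ∀ {n} → Vec ℕ n → ℕ
  code-Vec [] = 0
  code-Vec (x ∷ xs) = ⟪ x , code-Vec xs ⟫

  nthA : Fm 1
  nthA = ∃′ (∃′ (v2 ≐ ⦅ lit 0 , ⦅ ⦅ v1 , v0 ⦆ , v1 ⦆ ⦆))

  nthR : Fm 3
  nthR = ∃′ (∃′ (∃′ (∃′ (v4 ≐ ⦅ S v3 , ⦅ ⦅ v2 , v1 ⦆ , v0 ⦆ ⦆ ∧ v5 ≐ ⦅ v3 , ⦅ v1 , v0 ⦆ ⦆ ∧ v6 ≐ v5))))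

  nthF : Fm 1
  nthF = indF nthA nthR

  nth-sound : ∀ {n c y} (xs : Vec ℕ n) i → c ≡ ⟪ toℕ i , ⟪ code-Vec xs , y ⟫ ⟫ →
    Der (Inductive.Ax nthA nthR) (Inductive.Rl nthA nthR) c → y ≡ lookup xs i
  nth-sound (x ∷ xs) zero e (axiom (x′ , xs′ , e′)) with ⟪⟫-injective (⟪⟫-injʳ (trans (sym e) e′))
  ... | p , q = trans q (sym (⟪⟫-injˡ p))
  nth-sound (x ∷ xs) (suc i) e (axiom (x′ , xs′ , e′)) with () ← ⟪⟫-injˡ (trans (sym e) e′)
  nth-sound (x ∷ xs) zero e (rule (i′ , x′ , xs′ , y′ , e′ , _) _ _) with () ← ⟪⟫-injˡ (trans (sym e) e′)
  nth-sound (x ∷ xs) (suc i) e (rule (i′ , x′ , xs′ , y′ , e′ , ep , _) d _)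
    with ⟪⟫-injective (trans (sym e) e′)
  ... | ei , er with ⟪⟫-injective er
  ... | exs , ey = nth-sound xs i
        (trans ep (cong₂ ⟪_,_⟫ (sym (suc-injective ei)) (cong₂ ⟪_,_⟫ (sym (⟪⟫-injʳ exs)) (sym ey)))) d

  nth-complete : ∀ {n} (xs : Vec ℕ n) i →
    Der (Inductive.Ax nthA nthR) (Inductive.Rl nthA nthR) ⟪ toℕ i , ⟪ code-Vec xs , lookup xs i ⟫ ⟫
  nth-complete (x ∷ xs) zero = axiom (x , code-Vec xs , refl)
  nth-complete (x ∷ xs) (suc i) =
    rule (toℕ i , x , code-Vec xs , lookup xs i , refl , refl , refl) (nth-complete xs i) (nth-complete xs i)

  private
    ev evs mn : ∀ {n} → Term n → Term n → Term n → Term n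
    ev f xs y   = ⦅ lit 0 , ⦅ f , ⦅ xs , y ⦆ ⦆ ⦆
    evs gs xs y = ⦅ lit 1 , ⦅ gs , ⦅ xs , y ⦆ ⦆ ⦆
    mn f xs j   = ⦅ lit 2 , ⦅ f , ⦅ xs , j ⦆ ⦆ ⦆

  -- `ev f xs y`: f evaluates to y at xs;  `evs`: likewise for a vector of functions;
  -- `mn f xs j`: f has positive values at (i ∷ xs) for all i < j.
  evalA : Fm 1
  evalA =
      v0 ≐ ev ⦅ lit 0 , lit 0 ⦆ (lit 0) (lit 0)
    ∨ ∃′ (v1 ≐ ev ⦅ lit 1 , lit 0 ⦆ ⦅ v0 , lit 0 ⦆ (S v0))
    ∨ ∃′ (∃′ (∃′ (v3 ≐ ev ⦅ lit 2 , v2 ⦆ v1 v0 ∧ call nthF (⦅ v2 , ⦅ v1 , v0 ⦆ ⦆ ∷ []))))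
    ∨ ∃′ (v1 ≐ evs (lit 0) v0 (lit 0))
    ∨ ∃′ (∃′ (v2 ≐ mn v1 v0 (lit 0)))

  evalR : Fm 3
  evalR =
      ∃′ (∃′ (∃′ (∃′ (∃′ (v5 ≐ ev ⦅ lit 3 , ⦅ v4 , v3 ⦆ ⦆ v2 v0
        ∧ v6 ≐ evs v3 v2 v1 ∧ v7 ≐ ev v4 v1 v0)))))
    ∨ ∃′ (∃′ (∃′ (∃′ (∃′ (v5 ≐ evs ⦅ v4 , v3 ⦆ v2 ⦅ v1 , v0 ⦆
        ∧ v6 ≐ ev v4 v2 v1 ∧ v7 ≐ evs v3 v2 v0)))))
    ∨ ∃′ (∃′ (∃′ (∃′ (v4 ≐ ev ⦅ lit 4 , ⦅ v3 , v2 ⦆ ⦆ ⦅ lit 0 , v1 ⦆ v0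
        ∧ v5 ≐ ev v3 v1 v0 ∧ v6 ≐ v5))))
    ∨ ∃′ (∃′ (∃′ (∃′ (∃′ (∃′ (v6 ≐ ev ⦅ lit 4 , ⦅ v5 , v4 ⦆ ⦆ ⦅ S v2 , v3 ⦆ v0
        ∧ v7 ≐ ev ⦅ lit 4 , ⦅ v5 , v4 ⦆ ⦆ ⦅ v2 , v3 ⦆ v1 ∧ v8 ≐ ev v4 ⦅ v2 , ⦅ v1 , v3 ⦆ ⦆ v0))))))
    ∨ ∃′ (∃′ (∃′ (v3 ≐ ev ⦅ lit 5 , v2 ⦆ v1 v0
        ∧ v4 ≐ mn v2 v1 v0 ∧ v5 ≐ ev v2 ⦅ v0 , v1 ⦆ (lit 0))))
    ∨ ∃′ (∃′ (∃′ (∃′ (v4 ≐ mn v3 v2 (S v1)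
        ∧ v5 ≐ mn v3 v2 v1 ∧ v6 ≐ ev v3 ⦅ v1 , v2 ⦆ (S v0)))))

  EvalDer : ℕ → Set
  EvalDer = Der (Inductive.Ax evalA evalR) (Inductive.Rl evalA evalR)

  private
    triple-inj : ∀ {t a b c t′ a′ b′ c′} →
      ⟪ t , ⟪ a , ⟪ b , c ⟫ ⟫ ⟫ ≡ ⟪ t′ , ⟪ a′ , ⟪ b′ , c′ ⟫ ⟫ ⟫ → t ≡ t′ × a ≡ a′ × b ≡ b′ × c ≡ c′
    triple-inj e = let (t , r) = ⟪⟫-injective e ; (a , r′) = ⟪⟫-injective r ; (b , c) = ⟪⟫-injective r′
                   in t , a , b , c

    triple : ∀ {t a b c a′ b′ c′} → a ≡ a′ → b ≡ b′ → c ≡ c′ →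
      ⟪ t , ⟪ a , ⟪ b , c ⟫ ⟫ ⟫ ≡ ⟪ t , ⟪ a′ , ⟪ b′ , c′ ⟫ ⟫ ⟫
    triple refl refl refl = refl

  mutual
    -- Recursion on the derivation. The kinds of judgement and of program carry different tags, so a
    -- code equation refutes all clauses except those for the constructor at hand. The local
    -- functions abstract the program and its arguments, so that these can be matched once the tag
    -- is known.
    ev-sound : ∀ {n c y} (f : PartRec n) xs → c ≡ ⟪ 0 , ⟪ index f , ⟪ code-Vec xs , y ⟫ ⟫ ⟫ →
      EvalDer c → f [ xs ]⇓ y
    ev-sound f xs e (axiom (inj₁ e′)) with triple-inj (trans (sym e) e′)
    ... | _ , ef , ex , ey with ⟪⟫-injective ef
    ... | t , _ = case₀ f xs t ey
      where
      case₀ : ∀ {n y} (f : PartRec n) xs → tag f ≡ 0 → y ≡ 0 → f [ xs ]⇓ y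
      case₀ zeroᶠ [] refl refl = ⇓zero
    ev-sound f xs e (axiom (inj₂ (inj₁ (x , e′)))) with triple-inj (trans (sym e) e′)
    ... | _ , ef , ex , ey with ⟪⟫-injective ef
    ... | t , _ = case₁ f xs t ex ey
      where
      case₁ : ∀ {n y x} (f : PartRec n) xs → tag f ≡ 1 → code-Vec xs ≡ ⟪ x , 0 ⟫ → y ≡ suc x → f [ xs ]⇓ y
      case₁ sucᶠ (x ∷ []) refl ex refl with refl ← ⟪⟫-injˡ ex = ⇓suc
    ev-sound f xs e (axiom (inj₂ (inj₂ (inj₁ (i , xs′ , y , e′ , nth))))) with triple-inj (trans (sym e) e′)
    ... | _ , ef , refl , refl with ⟪⟫-injective ef
    ... | t , p = case₂ f xs t p nth
      where
      case₂ : ∀ {n y i} (f : PartRec n) xs → tag f ≡ 2 → payload f ≡ i →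
        ⟪ i , ⟪ code-Vec xs , y ⟫ ⟫ ∷ [] ⊩ nthF → f [ xs ]⇓ y
      case₂ (proj i) xs refl refl d with refl ← nth-sound xs i refl (ind-sound nthA nthR d) = ⇓proj
    ev-sound f xs e (axiom (inj₂ (inj₂ (inj₂ (inj₁ (_ , e′))))))
      with () ← ⟪⟫-injˡ (trans (sym e) e′)
    ev-sound f xs e (axiom (inj₂ (inj₂ (inj₂ (inj₂ (_ , _ , e′))))))
      with () ← ⟪⟫-injˡ (trans (sym e) e′)
    ev-sound f xs e (rule (inj₁ (f′ , gs , xs′ , ys , z , e′ , ep , eq)) d d′) with triple-inj (trans (sym e) e′)
    ... | _ , ef , refl , refl with ⟪⟫-injective ef
    ... | t , p = case₃ f t p
      where
      case₃ : (f : PartRec _) → tag f ≡ 3 → payload f ≡ ⟪ f′ , gs ⟫ → f [ xs ]⇓ z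
      case₃ (comp f gs) refl p with refl , refl ← ⟪⟫-injective p
        with evs-sound gs xs ep d
      ... | ys′ , eys , ps = ⇓comp ps (ev-sound f ys′ (trans eq (triple refl eys refl)) d′)
    ev-sound f xs e (rule (inj₂ (inj₁ (_ , _ , _ , _ , _ , e′ , _))) d d′)
      with () ← ⟪⟫-injˡ (trans (sym e) e′)
    ev-sound f xs e (rule (inj₂ (inj₂ (inj₁ (g , h , xs′ , z , e′ , ep , _)))) d d′) with triple-inj (trans (sym e) e′)
    ... | _ , ef , ex , refl with ⟪⟫-injective ef
    ... | t , p = case₄ f xs t p ex
      where
      case₄ : ∀ {n} (f : PartRec n) xs → tag f ≡ 4 → payload f ≡ ⟪ g , h ⟫ → code-Vec xs ≡ ⟪ 0 , xs′ ⟫ → f [ xs ]⇓ z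
      case₄ (prec g h) (x ∷ xs) refl p ex with refl , refl ← ⟪⟫-injective p with refl , refl ← ⟪⟫-injective ex
        = ⇓prec-zero (ev-sound g xs ep d)
    ev-sound f xs e (rule (inj₂ (inj₂ (inj₂ (inj₁ (g , h , xs′ , k , y , z , e′ , ep , eq))))) d d′) with triple-inj (trans (sym e) e′)
    ... | _ , ef , ex , refl with ⟪⟫-injective ef
    ... | t , p = case₅ f xs t p ex
      where
      case₅ : ∀ {n} (f : PartRec n) xs → tag f ≡ 4 → payload f ≡ ⟪ g , h ⟫ → code-Vec xs ≡ ⟪ suc k , xs′ ⟫ → f [ xs ]⇓ z
      case₅ (prec g h) (x ∷ xs) refl p ex with refl , refl ← ⟪⟫-injective p with refl , refl ← ⟪⟫-injective ex
        = ⇓prec-suc (ev-sound (prec g h) (k ∷ xs) ep d) (ev-sound h (k ∷ y ∷ xs) eq d′)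
    ev-sound f xs e (rule (inj₂ (inj₂ (inj₂ (inj₂ (inj₁ (f′ , xs′ , k , e′ , ep , eq)))))) d d′) with triple-inj (trans (sym e) e′)
    ... | _ , ef , ex , refl with ⟪⟫-injective ef
    ... | t , p = case₆ f xs t p ex
      where
      case₆ : ∀ {n} (f : PartRec n) xs → tag f ≡ 5 → payload f ≡ f′ → code-Vec xs ≡ xs′ → f [ xs ]⇓ k
      case₆ (min f) xs refl refl refl = ⇓min (ev-sound f (k ∷ xs) eq d′) (λ j j<k → mn-sound f xs j ep d j<k)
    ev-sound f xs e (rule (inj₂ (inj₂ (inj₂ (inj₂ (inj₂ (_ , _ , _ , _ , e′ , _)))))) d d′)
      with () ← ⟪⟫-injˡ (trans (sym e) e′)

    evs-sound : ∀ {m n c Y} (gs : Vec (PartRec n) m) xs → c ≡ ⟪ 1 , ⟪ indices gs , ⟪ code-Vec xs , Y ⟫ ⟫ ⟫ →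
      EvalDer c → Σ[ ys ∈ Vec ℕ m ] (Y ≡ code-Vec ys × Pointwise (λ g y → g [ xs ]⇓ y) gs ys)
    evs-sound gs xs e (axiom (inj₁ e′)) with () ← ⟪⟫-injˡ (trans (sym e) e′)
    evs-sound gs xs e (axiom (inj₂ (inj₁ (_ , e′)))) with () ← ⟪⟫-injˡ (trans (sym e) e′)
    evs-sound gs xs e (axiom (inj₂ (inj₂ (inj₁ (_ , _ , _ , e′ , _))))) with () ← ⟪⟫-injˡ (trans (sym e) e′)
    evs-sound gs xs e (axiom (inj₂ (inj₂ (inj₂ (inj₁ (_ , e′)))))) with triple-inj (trans (sym e) e′)
    ... | _ , eg , ex , refl = nil gs eg
      where
      nil : ∀ {m} (gs : Vec (PartRec _) m) → indices gs ≡ 0 →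
        Σ[ ys ∈ Vec ℕ m ] (0 ≡ code-Vec ys × Pointwise (λ g y → g [ xs ]⇓ y) gs ys)
      nil [] eg = [] , refl , []
      nil (g ∷ gs) eg = ⊥-elim (⟪⟫≢0 eg)
    evs-sound gs xs e (axiom (inj₂ (inj₂ (inj₂ (inj₂ (_ , _ , e′)))))) with () ← ⟪⟫-injˡ (trans (sym e) e′)
    evs-sound gs xs e (rule (inj₁ (_ , _ , _ , _ , _ , e′ , _)) d d′) with () ← ⟪⟫-injˡ (trans (sym e) e′)
    evs-sound gs xs e (rule (inj₂ (inj₁ (g , gs′ , xs′ , y , ys , e′ , ep , eq))) d d′) with triple-inj (trans (sym e) e′)
    ... | _ , eg , refl , refl = cons gs eg
      where
      cons : ∀ {m} (gs : Vec (PartRec _) m) → indices gs ≡ ⟪ g , gs′ ⟫ →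
        Σ[ ys′ ∈ Vec ℕ m ] (⟪ y , ys ⟫ ≡ code-Vec ys′ × Pointwise (λ g y → g [ xs ]⇓ y) gs ys′)
      cons [] eg = ⊥-elim (⟪⟫≢0 (sym eg))
      cons (g ∷ gs) eg with refl , refl ← ⟪⟫-injective eg with evs-sound gs xs eq d′
      ... | ys′ , eys , ps = y ∷ ys′ , cong ⟪ y ,_⟫ eys , ev-sound g xs ep d ∷ ps
    evs-sound gs xs e (rule (inj₂ (inj₂ (inj₁ (_ , _ , _ , _ , e′ , _)))) d d′) with () ← ⟪⟫-injˡ (trans (sym e) e′)
    evs-sound gs xs e (rule (inj₂ (inj₂ (inj₂ (inj₁ (_ , _ , _ , _ , _ , _ , e′ , _))))) d d′) with () ← ⟪⟫-injˡ (trans (sym e) e′)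
    evs-sound gs xs e (rule (inj₂ (inj₂ (inj₂ (inj₂ (inj₁ (_ , _ , _ , e′ , _)))))) d d′) with () ← ⟪⟫-injˡ (trans (sym e) e′)
    evs-sound gs xs e (rule (inj₂ (inj₂ (inj₂ (inj₂ (inj₂ (_ , _ , _ , _ , e′ , _)))))) d d′) with () ← ⟪⟫-injˡ (trans (sym e) e′)

    mn-sound : ∀ {n c k} (f : PartRec (suc n)) xs j → c ≡ ⟪ 2 , ⟪ index f , ⟪ code-Vec xs , k ⟫ ⟫ ⟫ →
      EvalDer c → j < k → ∃[ y ] f [ j ∷ xs ]⇓ suc y
    mn-sound f xs j e (axiom (inj₁ e′)) j<k with () ← ⟪⟫-injˡ (trans (sym e) e′)
    mn-sound f xs j e (axiom (inj₂ (inj₁ (_ , e′)))) j<k with () ← ⟪⟫-injˡ (trans (sym e) e′)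
    mn-sound f xs j e (axiom (inj₂ (inj₂ (inj₁ (_ , _ , _ , e′ , _))))) j<k with () ← ⟪⟫-injˡ (trans (sym e) e′)
    mn-sound f xs j e (axiom (inj₂ (inj₂ (inj₂ (inj₁ (_ , e′)))))) j<k with () ← ⟪⟫-injˡ (trans (sym e) e′)
    mn-sound f xs j e (axiom (inj₂ (inj₂ (inj₂ (inj₂ (_ , _ , e′)))))) j<k
      with _ , _ , _ , refl ← triple-inj (trans (sym e) e′) with () ← j<k
    mn-sound f xs j e (rule (inj₁ (_ , _ , _ , _ , _ , e′ , _)) d d′) j<k with () ← ⟪⟫-injˡ (trans (sym e) e′)
    mn-sound f xs j e (rule (inj₂ (inj₁ (_ , _ , _ , _ , _ , e′ , _))) d d′) j<k with () ← ⟪⟫-injˡ (trans (sym e) e′)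
    mn-sound f xs j e (rule (inj₂ (inj₂ (inj₁ (_ , _ , _ , _ , e′ , _)))) d d′) j<k with () ← ⟪⟫-injˡ (trans (sym e) e′)
    mn-sound f xs j e (rule (inj₂ (inj₂ (inj₂ (inj₁ (_ , _ , _ , _ , _ , _ , e′ , _))))) d d′) j<k with () ← ⟪⟫-injˡ (trans (sym e) e′)
    mn-sound f xs j e (rule (inj₂ (inj₂ (inj₂ (inj₂ (inj₁ (_ , _ , _ , e′ , _)))))) d d′) j<k with () ← ⟪⟫-injˡ (trans (sym e) e′)
    mn-sound f xs j e (rule (inj₂ (inj₂ (inj₂ (inj₂ (inj₂ (f′ , xs′ , k , y , e′ , ep , eq)))))) d d′) j<k
      with _ , refl , refl , refl ← triple-inj (trans (sym e) e′) with m≤n⇒m<n∨m≡n (≤-pred j<k)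
    ... | inj₁ j<k′ = mn-sound f xs j ep d j<k′
    ... | inj₂ refl = y , ev-sound f (j ∷ xs) eq d′

  mutual
    ev-complete : ∀ {n y} {f : PartRec n} {xs} → f [ xs ]⇓ y →
      EvalDer ⟪ 0 , ⟪ index f , ⟪ code-Vec xs , y ⟫ ⟫ ⟫
    ev-complete ⇓zero = axiom (inj₁ refl)
    ev-complete ⇓suc = axiom (inj₂ (inj₁ (_ , refl)))
    ev-complete (⇓proj {i = i} {xs}) =
      axiom (inj₂ (inj₂ (inj₁ (_ , _ , _ , refl , ind-complete nthA nthR (nth-complete xs i)))))
    ev-complete (⇓comp ps d) =
      rule (inj₁ (_ , _ , _ , _ , _ , refl , refl , refl)) (evs-complete ps) (ev-complete d)
    ev-complete (⇓prec-zero d) =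
      rule (inj₂ (inj₂ (inj₁ (_ , _ , _ , _ , refl , refl , refl)))) (ev-complete d) (ev-complete d)
    ev-complete (⇓prec-suc d d′) =
      rule (inj₂ (inj₂ (inj₂ (inj₁ (_ , _ , _ , _ , _ , _ , refl , refl , refl))))) (ev-complete d) (ev-complete d′)
    ev-complete (⇓min {f = f} {xs} {k} d below) =
      rule (inj₂ (inj₂ (inj₂ (inj₂ (inj₁ (_ , _ , _ , refl , refl , refl)))))) (mn-complete k ≤-refl) (ev-complete d)
      where
      mn-complete : ∀ j → j ≤ k → EvalDer ⟪ 2 , ⟪ index f , ⟪ code-Vec xs , j ⟫ ⟫ ⟫
      mn-complete zero _ = axiom (inj₂ (inj₂ (inj₂ (inj₂ (_ , _ , refl)))))
      mn-complete (suc j) j<k =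
        rule (inj₂ (inj₂ (inj₂ (inj₂ (inj₂ (_ , _ , _ , proj₁ (below j j<k) , refl , refl , refl))))))
             (mn-complete j (<⇒≤ j<k)) (ev-complete (proj₂ (below j j<k)))

    evs-complete : ∀ {m n} {gs : Vec (PartRec n) m} {xs} {ys : Vec ℕ m} → Pointwise (λ g y → g [ xs ]⇓ y) gs ys →
      EvalDer ⟪ 1 , ⟪ indices gs , ⟪ code-Vec xs , code-Vec ys ⟫ ⟫ ⟫
    evs-complete [] = axiom (inj₂ (inj₂ (inj₂ (inj₁ (_ , refl)))))
    evs-complete (d ∷ ds) =
      rule (inj₂ (inj₁ (_ , _ , _ , _ , _ , refl , refl , refl))) (ev-complete d) (evs-complete ds)

  -- The index of the program is a parameter, so one formula enumerates all c.e. sets at once.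
  haltsF : Fm 2
  haltsF = ∃′ (call (indF evalA evalR) (⦅ lit 0 , ⦅ v1 , ⦅ ⦅ v2 , lit 0 ⦆ , v0 ⦆ ⦆ ⦆ ∷ []))

  halts-sound : ∀ (f : PartRec 1) {x} → index f ∷ x ∷ [] ⊩ haltsF → ∃[ y ] f [ x ∷ [] ]⇓ y
  halts-sound f {x} (y , h) = y , ev-sound f (x ∷ []) refl (ind-sound evalA evalR h)

  halts-complete : ∀ (f : PartRec 1) {x} → ∃[ y ] f [ x ∷ [] ]⇓ y → index f ∷ x ∷ [] ⊩ haltsF
  halts-complete f {x} (y , d) = y , ind-complete evalA evalR {⟪ 0 , ⟪ index f , ⟪ ⟪ x , 0 ⟫ , y ⟫ ⟫ ⟫} (ev-complete {f = f} {x ∷ []} d)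

-- Parity of matchings and Scarf's lemma

module ScarfLemma where

  open import Axiom.ExcludedMiddle using (ExcludedMiddle)
  open import Data.Empty using (⊥; ⊥-elim)
  open import Data.Fin using (Fin; zero; suc)
  import Data.Fin as Fin
  open import Data.List using (List; []; _∷_; length; filter; allFin; cartesianProduct; cartesianProductWith; map)
  open import Data.List.Membership.Propositional using (_∈_)
  open import Data.List.Membership.Propositional.Properties using (∈-filter⁺; ∈-filter⁻; ∈-allFin; ∈-cartesianProduct⁺; ∈-cartesianProductWith⁺; ∈-map⁺)
  open import Data.List.Relation.Unary.All using (All; []; _∷_)
  import Data.List.Relation.Unary.All as All
  open import Data.List.Relation.Unary.Any using (here; there)
  open import Data.List.Relation.Unary.AllPairs using ([]; _∷_)
  open import Data.List.Relation.Unary.Unique.Propositional using (Unique)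
  open import Data.List.Relation.Unary.Unique.Propositional.Properties using (filter⁺; allFin⁺; cartesianProduct⁺; cartesianProductWith⁺; map⁺)
  open import Data.Maybe using (Maybe; just; nothing; maybe)
  open import Data.Maybe.Properties using (just-injective)
  open import Data.Nat hiding (_⊔_)
  open import Data.Nat.Properties
  open import Data.Product using (∃; ∃-syntax; _×_; _,_; proj₁; proj₂)
  open import Data.Sum using (_⊎_; inj₁; inj₂)
  open import Data.Vec using (Vec; []; _∷_; lookup; _[_]≔_; tabulate)
  open import Data.Vec.Properties using (lookup∘tabulate; ∷-injective; lookup⇒[]=; []=⇒lookup; lookup∘update; lookup∘update′)
  open import Level using (0ℓ)
  open import Relation.Binary.PropositionalEquality
  open import Relation.Nullary using (¬_; yes; no; Dec)
  open import Relation.Nullary.Decidable using (decidable-stable)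
  open UniversalFunction using (odd≢even)

  record Removed {A : Set} (xs : List A) (y : A) : Set where
    field
      rest    : List A
      len     : length xs ≡ suc (length rest)
      unique  : Unique rest
      y∉      : ¬ y ∈ rest
      into    : ∀ {z} → z ∈ xs → z ≡ y ⊎ z ∈ rest
      outof   : ∀ {z} → z ∈ rest → z ∈ xs

  remove : ∀ {A : Set} {xs : List A} {y} → Unique xs → y ∈ xs → Removed xs y
  remove {xs = x ∷ xs} (x∉ ∷ u) (here refl) = record
    { rest = xs ; len = refl ; unique = u
    ; y∉ = λ x∈ → All.lookup x∉ x∈ refl
    ; into = λ { (here refl) → inj₁ refl ; (there m) → inj₂ m }
    ; outof = there }
  remove {xs = x ∷ xs} {y} (x∉ ∷ u) (there y∈) = record
    { rest = x ∷ R.rest ; len = cong suc R.len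
    ; unique = All.tabulate (λ z∈ → All.lookup x∉ (R.outof z∈)) ∷ R.unique
    ; y∉ = λ { (here refl) → All.lookup x∉ y∈ refl ; (there m) → R.y∉ m }
    ; into = λ { (here refl) → inj₂ (here refl)
               ; (there m) → Data.Sum.map₂ there (R.into m) }
    ; outof = λ { (here refl) → here refl ; (there m) → there (R.outof m) } }
    where module R = Removed (remove u y∈)

  Even : ℕ → Set
  Even n = ∃[ k ] n ≡ 2 * k

  module _ {A : Set} (M : A → A → Set)
    (M-sym : ∀ {x y} → M x y → M y x) (M-irrefl : ∀ {x} → ¬ M x x) where

    -- An element and its partner are removed together; functionality ensures that no remaining
    -- element was matched with either of them.
    matching-even : ∀ (xs : List A) → Unique xs →
      (∀ {x} → x ∈ xs → ∃[ y ] (y ∈ xs × M x y)) →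
      (∀ {x y z} → x ∈ xs → y ∈ xs → z ∈ xs → M x y → M x z → y ≡ z) → Even (length xs)
    matching-even xs u = go (length xs) xs ≤-refl u
      where
      go : ∀ n xs → length xs ≤ n → Unique xs →
        (∀ {x} → x ∈ xs → ∃[ y ] (y ∈ xs × M x y)) →
        (∀ {x y z} → x ∈ xs → y ∈ xs → z ∈ xs → M x y → M x z → y ≡ z) → Even (length xs)
      go n [] _ _ _ _ = 0 , refl
      go (suc n) (x ∷ xs) (s≤s len≤) (x∉ ∷ u) partner functional with partner (here refl)
      ... | y , here refl , m = ⊥-elim (M-irrefl m)
      ... | y , there y∈ , xMy =
        let (k , e) = go n R.rest (≤-trans (≤-trans (n≤1+n _) (≤-reflexive (sym R.len))) len≤) R.unique
                        partner′ (λ a b c → functional (there (R.outof a)) (there (R.outof b)) (there (R.outof c)))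
        in suc k , trans (cong suc (trans R.len (cong suc e))) (sym (*-suc 2 k))
        where
        module R = Removed (remove u y∈)
        partner′ : ∀ {z} → z ∈ R.rest → ∃[ w ] (w ∈ R.rest × M z w)
        partner′ {z} z∈ with partner (there (R.outof z∈))
        ... | w , here refl , zMx
              with refl ← functional (here refl) (there y∈) (there (R.outof z∈)) xMy (M-sym zMx)
              = ⊥-elim (R.y∉ z∈)
        ... | w , there w∈ , zMw with R.into w∈
        ...   | inj₂ w∈′ = w , w∈′ , zMw
        ...   | inj₁ refl with refl ← functional (there y∈) (here refl) (there (R.outof z∈)) (M-sym xMy) (M-sym zMw)
              = ⊥-elim (All.lookup x∉ (R.outof z∈) refl)

  allVecs : ∀ {A : Set} → List A → ∀ n → List (Vec A n)
  allVecs xs zero = [] ∷ []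
  allVecs xs (suc n) = cartesianProductWith _∷_ xs (allVecs xs n)

  allVecs-unique : ∀ {A : Set} {xs : List A} → Unique xs → ∀ n → Unique (allVecs xs n)
  allVecs-unique u zero = [] ∷ []
  allVecs-unique u (suc n) = cartesianProductWith⁺ _∷_ ∷-injective u (allVecs-unique u n)

  ∈-allVecs : ∀ {A : Set} {xs : List A} → (∀ x → x ∈ xs) → ∀ {n} (v : Vec A n) → v ∈ allVecs xs n
  ∈-allVecs h [] = here refl
  ∈-allVecs h (x ∷ v) = ∈-cartesianProductWith⁺ _∷_ (h x) (∈-allVecs h v)

  allMaybe : ∀ m → List (Maybe (Fin m))
  allMaybe m = nothing ∷ map just (allFin m)

  allMaybe-unique : ∀ m → Unique (allMaybe m)
  allMaybe-unique m = All.tabulate (λ i∈ e → noNothing (allFin m) (subst (_∈ _) (sym e) i∈)) ∷ map⁺ just-injective (allFin⁺ m)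
    where
    noNothing : ∀ (xs : List (Fin m)) → ¬ nothing ∈ map just xs
    noNothing (x ∷ xs) (there n∈) = noNothing xs n∈

  ∈-allMaybe : ∀ {m} (x : Maybe (Fin m)) → x ∈ allMaybe m
  ∈-allMaybe nothing = here refl
  ∈-allMaybe (just i) = there (∈-map⁺ just (∈-allFin i))

  lookup-ext : ∀ {A : Set} {n} {v w : Vec A n} → (∀ i → lookup v i ≡ lookup w i) → v ≡ w
  lookup-ext {v = []} {[]} h = refl
  lookup-ext {v = x ∷ v} {y ∷ w} h = cong₂ _∷_ (h zero) (lookup-ext (λ i → h (suc i)))

  module Classical (em : ExcludedMiddle 0ℓ) where

    opaque
     ¬∀⇒∃¬ : ∀ {A : Set} {P : A → Set} → ¬ (∀ x → P x) → ∃[ x ] ¬ P x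
     ¬∀⇒∃¬ {A} {P} h = decidable-stable em λ ¬∃ → h λ x → decidable-stable em λ ¬p → ¬∃ (x , ¬p)

    argmax : ∀ {m} (P : Fin m → Set) (f : Fin m → ℕ) →
      (∀ y → ¬ P y) ⊎ ∃[ w ] (P w × ∀ y → P y → f y ≤ f w)
    argmax {zero} P f = inj₁ λ ()
    argmax {suc m} P f with argmax (λ i → P (suc i)) (λ i → f (suc i)) | em {P zero}
    ... | inj₁ none | no ¬p = inj₁ λ { zero → ¬p ; (suc y) → none y }
    ... | inj₁ none | yes p = inj₂ (zero , p , λ { zero _ → ≤-refl ; (suc y) q → ⊥-elim (none y q) })
    ... | inj₂ (w , q , max) | no ¬p =
          inj₂ (suc w , q , λ { zero p → ⊥-elim (¬p p) ; (suc y) → max y })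
    ... | inj₂ (w , q , max) | yes p with ≤-total (f zero) (f (suc w))
    ...   | inj₁ ≤w = inj₂ (suc w , q , λ { zero _ → ≤w ; (suc y) → max y })
    ...   | inj₂ w≤ = inj₂ (zero , p , λ { zero _ → ≤-refl ; (suc y) r → ≤-trans (max y r) w≤ })

    argmin : ∀ {m} (P : Fin m → Set) (f : Fin m → ℕ) →
      (∀ y → ¬ P y) ⊎ ∃[ w ] (P w × ∀ y → P y → f w ≤ f y)
    argmin {zero} P f = inj₁ λ ()
    argmin {suc m} P f with argmin (λ i → P (suc i)) (λ i → f (suc i)) | em {P zero}
    ... | inj₁ none | no ¬p = inj₁ λ { zero → ¬p ; (suc y) → none y }
    ... | inj₁ none | yes p = inj₂ (zero , p , λ { zero _ → ≤-refl ; (suc y) q → ⊥-elim (none y q) })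
    ... | inj₂ (w , q , max) | no ¬p =
          inj₂ (suc w , q , λ { zero p → ⊥-elim (¬p p) ; (suc y) → max y })
    ... | inj₂ (w , q , max) | yes p with ≤-total (f (suc w)) (f zero)
    ...   | inj₁ ≤w = inj₂ (suc w , q , λ { zero _ → ≤w ; (suc y) → max y })
    ...   | inj₂ w≤ = inj₂ (zero , p , λ { zero _ → ≤-refl ; (suc y) r → ≤-trans w≤ (max y r) })

  -- Scarf's lemma: d linear orders on a finite set, given by injective ranks.  An
  -- entry `nothing` at index i stands for the i-th slack element, which is least in
  -- the i-th order and has colour i.
  module Scarf (em : ExcludedMiddle 0ℓ) {m d : ℕ}
    (r : Fin d → Fin m → ℕ) (r-inj : ∀ i {x y} → r i x ≡ r i y → x ≡ y)
    (color : Fin m → Fin d) (t₀ : Fin m) (i₀ : Fin d) where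

    open Classical em

    infix 9 _‼_
    _‼_ : ∀ {A : Set} {n} → Vec A n → Fin n → A
    _‼_ = lookup

    -- The primitive sets of Scarf. Slack entries lie below every element in their own order, which
    -- is why `dominant` has to be witnessed by a proper entry.
    record Room (x : Vec (Maybe (Fin m)) d) : Set where
      field
        minimal  : ∀ {i j p q} → x ‼ i ≡ just p → x ‼ j ≡ just q → r i p ≤ r i q
        distinct : ∀ {i j p} → x ‼ i ≡ just p → x ‼ j ≡ just p → i ≡ j
        dominant : ∀ y → ∃[ i ] ∃[ p ] (x ‼ i ≡ just p × r i y ≤ r i p)

    col : Vec (Maybe (Fin m)) d → Fin d → Fin d
    col x i = maybe color i (x ‼ i)

    Colorful : Vec (Maybe (Fin m)) d → Set
    Colorful x = ∀ k → ∃[ j ] col x j ≡ k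

    minimal< : ∀ {x} → Room x → ∀ {i j p q} → i ≢ j → x ‼ i ≡ just p → x ‼ j ≡ just q → r i p < r i q
    minimal< {x} R {i} {j} {p} {q} i≢j xi xj = ≤∧≢⇒< (Room.minimal R xi xj)
      λ e → i≢j (Room.distinct R xi (trans xj (cong just (sym (r-inj i e)))))

    -- If the entry of one room at `b` were dominated in the other room at an index other than `b`,
    -- the dominating entry would be shared, against minimality. So the two entries at `b` bound
    -- each other in order `b`.
    room-unique : ∀ {x x′} → Room x → Room x′ → ∀ b → (∀ k → k ≢ b → x ‼ k ≡ x′ ‼ k) → x ≡ x′
    room-unique {x} {x′} R R′ b agree = lookup-ext at
      where
      below : ∀ {x x′} → Room x → Room x′ → (∀ k → k ≢ b → x ‼ k ≡ x′ ‼ k) →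
        ∀ {v} → x ‼ b ≡ just v → ∃[ w ] (x′ ‼ b ≡ just w × r b v ≤ r b w)
      below {x} {x′} R R′ agree {v} xb with Room.dominant R′ v
      ... | i , p , x′i , v≤p with i Fin.≟ b
      ...   | yes refl = p , x′i , v≤p
      ...   | no i≢b = ⊥-elim (<⇒≱ (minimal< R i≢b (trans (agree i i≢b) x′i) xb) v≤p)

      agree′ = λ k k≢b → sym (agree k k≢b)

      at-b : x ‼ b ≡ x′ ‼ b
      at-b with x ‼ b in e | x′ ‼ b in e′
      ... | nothing | nothing = refl
      ... | just v  | nothing with _ , e″ , _ ← below R R′ agree e with () ← trans (sym e′) e″
      ... | nothing | just w with _ , e″ , _ ← below R′ R agree′ e′ with () ← trans (sym e) e″
      ... | just v  | just w with w′ , e₁ , v≤ ← below R R′ agree e | v′ , e₂ , w≤ ← below R′ R agree′ e′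
            with refl ← just-injective (trans (sym e′) e₁) | refl ← just-injective (trans (sym e) e₂)
            = cong just (r-inj b (≤-antisym v≤ w≤))

      at : ∀ k → x ‼ k ≡ x′ ‼ k
      at k with k Fin.≟ b
      ... | yes refl = at-b
      ... | no k≢b = agree k k≢b

    Flag : Set
    Flag = Vec (Maybe (Fin m)) d × Fin d

    -- A flag is a room with one entry marked for deletion. By counting, the conditions match the
    -- entries other than `a` bijectively with the colours other than `i₀`.
    record Door (f : Flag) : Set where
      private
        x = proj₁ f
        a = proj₂ f
      field
        room       : Room x
        surjective : ∀ k → k ≢ i₀ → ∃[ j ] (j ≢ a × col x j ≡ k)
        injective  : ∀ {j l} → j ≢ a → l ≢ a → col x j ≡ col x l → j ≡ l

    -- Two rooms sharing the door obtained by deleting the entry a, resp. b.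
    Pivot : Flag → Flag → Set
    Pivot (x , a) (x′ , b) =
      a ≢ b × (∃[ u ] (x ‼ b ≡ just u × x′ ‼ a ≡ just u)) × ∀ k → k ≢ a → k ≢ b → x ‼ k ≡ x′ ‼ k

    Pivot-sym : ∀ {f g} → Pivot f g → Pivot g f
    Pivot-sym (a≢b , (u , xb , x′a) , same) =
      ≢-sym a≢b , (u , x′a , xb) , λ k k≢b k≢a → sym (same k k≢a k≢b)

    -- The entry `u` that moves to place `a` is least there in the new room, so it is the least of
    -- the other proper entries of `x` in order `a`. This determines `u`, hence `b`, hence the new
    -- room.
    Pivot-functional : ∀ {x a g h} → Room (proj₁ g) → Room (proj₁ h) → Room x →
      Pivot (x , a) g → Pivot (x , a) h → g ≡ h
    Pivot-functional {x} {a} {x′ , b} {x″ , c} R′ R″ R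
      (a≢b , (u , xb , x′a) , same′) (a≢c , (v , xc , x″a) , same″) = result
      where
      ≤-side : ∀ {x′ b c u v} → Room x′ → a ≢ c → x ‼ b ≡ just u → x′ ‼ a ≡ just u →
        (∀ k → k ≢ a → k ≢ b → x ‼ k ≡ x′ ‼ k) → x ‼ c ≡ just v → r a u ≤ r a v
      ≤-side {b = b} {c} R′ a≢c xb x′a same xc with c Fin.≟ b
      ... | yes refl = ≤-reflexive (cong (r a) (just-injective (trans (sym xb) xc)))
      ... | no c≢b = Room.minimal R′ x′a (trans (sym (same c (≢-sym a≢c) c≢b)) xc)

      b≡c : b ≡ c
      b≡c = Room.distinct R xb (trans xc (cong just (sym (r-inj a
              (≤-antisym (≤-side R′ a≢c xb x′a same′ xc) (≤-side R″ a≢b xc x″a same″ xb))))))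

      result : (x′ , b) ≡ (x″ , c)
      result with refl ← b≡c = cong (_, b) (room-unique R′ R″ b agree)
        where
        agree : ∀ k → k ≢ b → x′ ‼ k ≡ x″ ‼ k
        agree k k≢b with k Fin.≟ a
        ... | yes refl = trans x′a (trans (sym xb) (trans xc (sym x″a)))
        ... | no k≢a = trans (sym (same′ k k≢a k≢b)) (same″ k k≢a k≢b)

    module _ {x a} (D : Door (x , a)) where
      private
        R = Door.room D

      module _ {b u} (a≢b : a ≢ b) (xb : x ‼ b ≡ just u)
        (u-min : ∀ {k v} → k ≢ a → x ‼ k ≡ just v → r a u ≤ r a v) where
        private
          base : Vec (Maybe (Fin m)) d
          base = x [ a ]≔ just u

          -- The candidates for the new entry at b.
          Y : Fin m → Set
          Y y = ∀ k → k ≢ b → ∀ s → base ‼ k ≡ just s → r k s < r k y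

          entry : Maybe (Fin m)
          entry with argmax Y (r b)
          ... | inj₁ _ = nothing
          ... | inj₂ (w , _) = just w

          entry-Y : ∀ {w} → entry ≡ just w → Y w
          entry-Y e with argmax Y (r b)
          entry-Y refl | inj₂ (w , yw , _) = yw

          entry-max : ∀ y → Y y → ∃[ w ] (entry ≡ just w × r b y ≤ r b w)
          entry-max y yy with argmax Y (r b)
          ... | inj₁ none = ⊥-elim (none y yy)
          ... | inj₂ (w , _ , max) = w , refl , max y yy

          src : ∀ {k} → k ≢ b → ∃[ j ] (j ≢ a × base ‼ k ≡ x ‼ j)
          src {k} k≢b with k Fin.≟ a
          ... | yes refl = b , ≢-sym a≢b , trans (lookup∘update a x _) (sym xb)
          ... | no k≢a = k , k≢a , lookup∘update′ k≢a x _

        -- `u`, the least remaining entry in order `a`, takes over place `a`. Its old place `b` goes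
        -- to the candidate greatest in order `b`, or to slack if there is no candidate.
        pivoted : Vec (Maybe (Fin m)) d
        pivoted = base [ b ]≔ entry

        private
          at-b : pivoted ‼ b ≡ entry
          at-b = lookup∘update b base entry

          off-b : ∀ {k} → k ≢ b → pivoted ‼ k ≡ base ‼ k
          off-b k≢b = lookup∘update′ k≢b base entry

          base-a : base ‼ a ≡ just u
          base-a = lookup∘update a x _

          base-off : ∀ {k} → k ≢ a → base ‼ k ≡ x ‼ k
          base-off k≢a = lookup∘update′ k≢a x _

          -- The old room dominates `w` at some index. Away from `a` and `b` this contradicts `w`
          -- being a candidate; at `a` the deleted entry lies below `u` in order `a`, and `w`
          -- exceeds `u` there. So the index is `b`, where the entry is `u`.
          entry≤u : ∀ {w} → Y w → r b w ≤ r b u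
          entry≤u {w} yw with Room.dominant R w
          ... | i , t , xi , w≤t with i Fin.≟ b
          ...   | yes refl = subst (λ v → r b w ≤ r b v) (just-injective (trans (sym xi) xb)) w≤t
          ...   | no i≢b with i Fin.≟ a
          ...     | yes refl = ⊥-elim (<⇒≱ (yw a a≢b u base-a) (≤-trans w≤t (Room.minimal R xi xb)))
          ...     | no i≢a = ⊥-elim (<⇒≱ (yw i i≢b t (trans (base-off i≢a) xi)) w≤t)

          min-base : ∀ {i j p q} → i ≢ b → j ≢ b → base ‼ i ≡ just p → base ‼ j ≡ just q → r i p ≤ r i q
          min-base {i} i≢b j≢b bi bj with src j≢b | i Fin.≟ a
          ... | j′ , j′≢a , e | yes refl with refl ← just-injective (trans (sym base-a) bi) =
                u-min j′≢a (trans (sym e) bj)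
          ... | j′ , j′≢a , e | no i≢a = Room.minimal R (trans (sym (base-off i≢a)) bi) (trans (sym e) bj)

          inj-base : ∀ {i j p} → i ≢ b → j ≢ b → base ‼ i ≡ just p → base ‼ j ≡ just p → i ≡ j
          inj-base {i} {j} i≢b j≢b bi bj with i Fin.≟ a | j Fin.≟ a
          ... | yes refl | yes refl = refl
          ... | no i≢a | no j≢a = Room.distinct R (trans (sym (base-off i≢a)) bi) (trans (sym (base-off j≢a)) bj)
          ... | yes refl | no j≢a = ⊥-elim (j≢b (Room.distinct R (trans (sym (base-off j≢a)) bj)
                  (trans xb (trans (sym base-a) bi))))
          ... | no i≢a | yes refl = ⊥-elim (i≢b (Room.distinct R (trans (sym (base-off i≢a)) bi)
                  (trans xb (trans (sym base-a) bj))))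

        pivoted-room : Room pivoted
        pivoted-room = record { minimal = minimal ; distinct = distinct ; dominant = dominant }
          where
          minimal : ∀ {i j p q} → pivoted ‼ i ≡ just p → pivoted ‼ j ≡ just q → r i p ≤ r i q
          minimal {i} {j} pi pj with i Fin.≟ b | j Fin.≟ b
          ... | yes refl | yes refl = ≤-reflexive (cong (r b) (just-injective (trans (sym pi) pj)))
          ... | yes refl | no j≢b = let (j′ , _ , e) = src j≢b in
                ≤-trans (entry≤u (entry-Y (trans (sym at-b) pi)))
                  (Room.minimal R xb (trans (sym e) (trans (sym (off-b j≢b)) pj)))
          ... | no i≢b | yes refl = <⇒≤ (entry-Y (trans (sym at-b) pj) i i≢b _ (trans (sym (off-b i≢b)) pi))
          ... | no i≢b | no j≢b = min-base i≢b j≢b (trans (sym (off-b i≢b)) pi) (trans (sym (off-b j≢b)) pj)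

          distinct : ∀ {i j p} → pivoted ‼ i ≡ just p → pivoted ‼ j ≡ just p → i ≡ j
          distinct {i} {j} pi pj with i Fin.≟ b | j Fin.≟ b
          ... | yes refl | yes refl = refl
          ... | yes refl | no j≢b = ⊥-elim (n≮n _ (entry-Y (trans (sym at-b) pi) j j≢b _ (trans (sym (off-b j≢b)) pj)))
          ... | no i≢b | yes refl = ⊥-elim (n≮n _ (entry-Y (trans (sym at-b) pj) i i≢b _ (trans (sym (off-b i≢b)) pi)))
          ... | no i≢b | no j≢b = inj-base i≢b j≢b (trans (sym (off-b i≢b)) pi) (trans (sym (off-b j≢b)) pj)

          dominant : ∀ y → ∃[ i ] ∃[ p ] (pivoted ‼ i ≡ just p × r i y ≤ r i p)
          dominant y with em {Y y}
          ... | yes yy = let (w , e , y≤w) = entry-max y yy in b , w , trans at-b e , y≤w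
          ... | no ¬yy with em {∃[ k ] (k ≢ b × ∃[ s ] (base ‼ k ≡ just s × r k y ≤ r k s))}
          ...   | yes (k , k≢b , s , e , y≤s) = k , s , trans (off-b k≢b) e , y≤s
          ...   | no ¬∃ = ⊥-elim (¬yy λ k k≢b s e → ≰⇒> λ y≤s → ¬∃ (k , k≢b , s , e , y≤s))

        pivoted-Pivot : Pivot (x , a) (pivoted , b)
        pivoted-Pivot = a≢b , (u , xb , trans (off-b a≢b) base-a) ,
          λ k k≢a k≢b → sym (trans (off-b k≢b) (base-off k≢a))

      -- The remaining elements are the same before and after: `u` only changes place, and the
      -- colour of a proper entry does not depend on its place.
      transfer : ∀ {x′ b} → Room x′ → Pivot (x , a) (x′ , b) → Door (x′ , b)
      transfer {x′} {b} R′ (a≢b , (u , xb , x′a) , same) = record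
        { room = R′ ; surjective = surj ; injective = inj }
        where
        col-a : col x′ a ≡ col x b
        col-a = trans (cong (maybe color a) x′a) (sym (cong (maybe color b) xb))

        col-other : ∀ {k} → k ≢ a → k ≢ b → col x′ k ≡ col x k
        col-other {k} k≢a k≢b = cong (maybe color k) (sym (same k k≢a k≢b))

        surj : ∀ k → k ≢ i₀ → ∃[ j ] (j ≢ b × col x′ j ≡ k)
        surj k k≢ with Door.surjective D k k≢
        ... | l , l≢a , e with l Fin.≟ b
        ...   | yes refl = a , a≢b , trans col-a e
        ...   | no l≢b = l , l≢b , trans (col-other l≢a l≢b) e

        inj : ∀ {j l} → j ≢ b → l ≢ b → col x′ j ≡ col x′ l → j ≡ l
        inj {j} {l} j≢b l≢b e with j Fin.≟ a | l Fin.≟ a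
        ... | yes refl | yes refl = refl
        ... | yes refl | no l≢a = ⊥-elim (l≢b (sym (Door.injective D (≢-sym a≢b) l≢a
                (trans (sym col-a) (trans e (col-other l≢a l≢b))))))
        ... | no j≢a | yes refl = ⊥-elim (j≢b (Door.injective D j≢a (≢-sym a≢b)
                (trans (sym (col-other j≢a j≢b)) (trans e col-a))))
        ... | no j≢a | no l≢a = Door.injective D j≢a l≢a
                (trans (sym (col-other j≢a j≢b)) (trans e (col-other l≢a l≢b)))

      Outer : Set
      Outer = ∀ j → j ≢ a → x ‼ j ≡ nothing

      pivot-exists : ¬ Outer → ∃[ g ] (Door g × Pivot (x , a) g)
      pivot-exists ¬outer with argmin (λ j → j ≢ a × ∃[ v ] x ‼ j ≡ just v) (λ j → maybe (r a) 0 (x ‼ j))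
      ... | inj₁ none = ⊥-elim (¬outer outer)
        where
        outer : Outer
        outer j j≢a with x ‼ j in e
        ... | nothing = refl
        ... | just v = ⊥-elim (none j (j≢a , v , e))
      ... | inj₂ (b , (b≢a , u , xb) , min) = _ , transfer (pivoted-room a≢b xb u-min) piv , piv
        where
        a≢b = ≢-sym b≢a
        u-min : ∀ {k v} → k ≢ a → x ‼ k ≡ just v → r a u ≤ r a v
        u-min {k} {v} k≢a xk = subst₂ (λ p q → maybe (r a) 0 p ≤ maybe (r a) 0 q) xb xk (min k (k≢a , v , xk))
        piv = pivoted-Pivot a≢b xb u-min

      -- A slack entry has its own index as colour, so the colour absent from an outer door is `a`.
      outer-a≡i₀ : Outer → a ≡ i₀
      outer-a≡i₀ outer with a Fin.≟ i₀
      ... | yes e = e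
      ... | no a≢ = let (j , j≢a , e) = Door.surjective D a a≢
                    in ⊥-elim (j≢a (trans (sym (cong (maybe color j) (outer j j≢a))) e))

    top : ∃[ w ] ∀ y → r i₀ y ≤ r i₀ w
    top with argmax (λ (_ : Fin m) → Fin m) (r i₀)
    ... | inj₁ none = ⊥-elim (none t₀ t₀)
    ... | inj₂ (w , _ , max) = w , λ y → max y y

    start : Vec (Maybe (Fin m)) d
    start = tabulate (λ _ → nothing) [ i₀ ]≔ just (proj₁ top)

    start-at : start ‼ i₀ ≡ just (proj₁ top)
    start-at = lookup∘update i₀ (tabulate (λ _ → nothing)) _

    start-off : ∀ {j} → j ≢ i₀ → start ‼ j ≡ nothing
    start-off {j} j≢ = trans (lookup∘update′ j≢ (tabulate (λ _ → nothing)) _) (lookup∘tabulate (λ _ → nothing) j)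

    start-only : ∀ {j p} → start ‼ j ≡ just p → j ≡ i₀
    start-only {j} e with j Fin.≟ i₀
    ... | yes e′ = e′
    ... | no j≢ with () ← trans (sym (start-off j≢)) e

    start-door : Door (start , i₀)
    start-door = record
      { room = record { minimal = minimal ; distinct = λ ei ej → trans (start-only ei) (sym (start-only ej))
                      ; dominant = λ y → i₀ , _ , start-at , proj₂ top y }
      ; surjective = λ k k≢ → k , k≢ , col-off k≢
      ; injective = λ j≢ l≢ e → trans (sym (col-off j≢)) (trans e (col-off l≢)) }
      where
      col-off : ∀ {j} → j ≢ i₀ → col start j ≡ j
      col-off {j} j≢ = cong (maybe color j) (start-off j≢)
      minimal : ∀ {i j p q} → start ‼ i ≡ just p → start ‼ j ≡ just q → r i p ≤ r i q
      minimal {i} ei ej with refl ← start-only ei | refl ← start-only ej =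
        ≤-reflexive (cong (r i) (just-injective (trans (sym ei) ej)))

    -- Within a room: the two doors left by deleting either of two entries of equal colour.
    Swap : Flag → Flag → Set
    Swap (x , a) (x′ , j) = x ≡ x′ × a ≢ j × col x a ≡ col x j

    Swap-sym : ∀ {f g} → Swap f g → Swap g f
    Swap-sym (refl , a≢j , e) = refl , ≢-sym a≢j , sym e

    module _ (no-colorful : ∀ {x} → Room x → ¬ Colorful x) where

      -- Without a colourful room the deleted entry cannot have colour `i₀`. Its colour therefore
      -- occurs once more in the room, and deleting that other occurrence gives the second door.
      swap-exists : ∀ {x a} → Door (x , a) → ∃[ g ] (Door g × Swap (x , a) g)
      swap-exists {x} {a} D with col x a Fin.≟ i₀
      ... | yes e = ⊥-elim (no-colorful (Door.room D) colorful)
        where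
        colorful : Colorful x
        colorful k with k Fin.≟ i₀
        ... | yes refl = a , e
        ... | no k≢ = let (j , _ , ej) = Door.surjective D k k≢ in j , ej
      ... | no ≢i₀ with Door.surjective D (col x a) ≢i₀
      ...   | j , j≢a , ej = (x , j) , record { room = Door.room D ; surjective = surj ; injective = inj }
                             , refl , ≢-sym j≢a , sym ej
        where
        surj : ∀ k → k ≢ i₀ → ∃[ l ] (l ≢ j × col x l ≡ k)
        surj k k≢ with Door.surjective D k k≢
        ... | l , l≢a , el with l Fin.≟ j
        ...   | yes refl = a , ≢-sym j≢a , trans (sym ej) el
        ...   | no l≢j = l , l≢j , el
        inj : ∀ {k l} → k ≢ j → l ≢ j → col x k ≡ col x l → k ≡ l
        inj {k} {l} k≢j l≢j e with k Fin.≟ a | l Fin.≟ a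
        ... | yes refl | yes refl = refl
        ... | no k≢a | no l≢a = Door.injective D k≢a l≢a e
        ... | yes refl | no l≢a = ⊥-elim (l≢j (Door.injective D l≢a j≢a (trans (sym e) (sym ej))))
        ... | no k≢a | yes refl = ⊥-elim (k≢j (Door.injective D k≢a j≢a (trans e (sym ej))))

      Swap-functional : ∀ {f g h} → Door f → Swap f g → Swap f h → g ≡ h
      Swap-functional {x , a} D (refl , a≢j , e) (refl , a≢k , e′) =
        cong (x ,_) (Door.injective D (≢-sym a≢j) (≢-sym a≢k) (trans (sym e) e′))

      private
        allFlags : List Flag
        allFlags = cartesianProduct (allVecs (allMaybe m) d) (allFin d)

        door? : (f : Flag) → Dec (Door f)
        door? f = em

        doors : List Flag
        doors = filter door? allFlags

        doors-unique : Unique doors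
        doors-unique = filter⁺ door? (cartesianProduct⁺ (allVecs-unique (allMaybe-unique m) d) (allFin⁺ d))

        ∈doors : ∀ {f} → Door f → f ∈ doors
        ∈doors {x , a} D = ∈-filter⁺ door? (∈-cartesianProduct⁺ (∈-allVecs ∈-allMaybe x) (∈-allFin a)) D

        isDoor : ∀ {f} → f ∈ doors → Door f
        isDoor f∈ = proj₂ (∈-filter⁻ door? {xs = allFlags} f∈)

        module R = Removed (remove doors-unique (∈doors start-door))

        even-all : Even (length doors)
        even-all = matching-even Swap Swap-sym (λ s → proj₁ (proj₂ s) refl) doors doors-unique
          (λ f∈ → let (g , D , s) = swap-exists (isDoor f∈) in g , ∈doors D , s)
          (λ f∈ _ _ → Swap-functional (isDoor f∈))

        partner : ∀ {f} → f ∈ R.rest → ∃[ g ] (g ∈ R.rest × Pivot f g)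
        partner {x , a} f∈ with em {Outer (isDoor (R.outof f∈))}
        -- All entries but one fix a room, so `start` with `i₀` is the only outer door, and it has
        -- been removed.
        ... | yes outer = ⊥-elim (R.y∉ (subst (_∈ R.rest) f≡ f∈))
          where
          D = isDoor (R.outof f∈)
          a≡ : a ≡ i₀
          a≡ = outer-a≡i₀ D outer
          f≡ : (x , a) ≡ (start , i₀)
          f≡ = cong₂ _,_ (room-unique (Door.room D) (Door.room start-door) i₀
                 (λ k k≢ → trans (outer k (λ e → k≢ (trans e a≡))) (sym (start-off k≢)))) a≡
        ... | no ¬outer with pivot-exists (isDoor (R.outof f∈)) ¬outer
        ...   | (x′ , b) , D′ , piv with R.into (∈doors D′)
        ...     | inj₂ g∈ = (x′ , b) , g∈ , piv
        -- `start` has a single proper entry, at `i₀`, but a pivot into it would put `u` at the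
        -- different index `a`.
        ...     | inj₁ refl = ⊥-elim (proj₁ piv (start-only (proj₂ (proj₂ (proj₁ (proj₂ piv))))))

        even-rest : Even (length R.rest)
        even-rest = matching-even Pivot (λ {f} {g} → Pivot-sym {f} {g}) (λ p → proj₁ p refl) R.rest R.unique partner
          (λ f∈ g∈ h∈ → Pivot-functional (Door.room (isDoor (R.outof g∈))) (Door.room (isDoor (R.outof h∈)))
                          (Door.room (isDoor (R.outof f∈))))

      -- Swapping pairs off all doors, pivoting all doors except `start`; their number would be both
      -- even and odd.
      absurd : ⊥
      absurd = let (j , ej) = even-all ; (k , ek) = even-rest
               in odd≢even k j (trans (cong suc (sym ek)) (trans (sym R.len) ej))

    scarf : ∃[ x ] (Room x × Colorful x)
    scarf = decidable-stable em λ none → absurd λ {x} R C → none (x , R , C)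

-- A discrete Brouwer theorem on the lattice points of a simplex

module DiscreteBrouwer where

  open import Axiom.ExcludedMiddle using (ExcludedMiddle)
  import Data.Nat.Properties as ℕₚ
  open import Algebra.Properties.Semiring.Sum ℕₚ.+-*-semiring using (sum; ∑-distrib-+; ∑-comm; sum-cong-≗; *-distribˡ-sum; *-distribʳ-sum)
  open import Data.Fin using (Fin; zero; suc; toℕ; finToFun; funToFin)
  import Data.Fin as Fin
  open import Data.Fin.Properties using (finToFun-funToFin; any?; toℕ<n; toℕ-injective)
  open import Data.Maybe using (just; nothing; maybe)
  open import Data.Nat hiding (_⊔_)
  open import Data.Nat.Properties
  open import Data.Nat.Tactic.RingSolver using (solve-∀)
  open import Data.Product using (Σ; Σ-syntax; ∃; ∃-syntax; _×_; _,_; proj₁; proj₂)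
  open import Data.Vec using (lookup)
  open import Function using (_∘_)
  open import Level using (0ℓ)
  open import Relation.Binary.PropositionalEquality
  open import Relation.Nullary using (yes; no; does)
  open UniversalFunction using (quotient-unique; bit; bit≤1)
  open ScarfLemma

  sum-mono : ∀ {n} {f g : Fin n → ℕ} → (∀ i → f i ≤ g i) → sum f ≤ sum g
  sum-mono {zero} h = z≤n
  sum-mono {suc n} h = +-mono-≤ (h zero) (sum-mono (h ∘ suc))

  sum-const : ∀ n c → sum {n} (λ _ → c) ≡ n * c
  sum-const zero c = refl
  sum-const (suc n) c = cong (c +_) (sum-const n c)

  sum-≤⇒∃ : ∀ {n} (f g : Fin n → ℕ) → Fin n → sum f ≤ sum g → ∃[ i ] f i ≤ g i
  sum-≤⇒∃ {suc n} f g _ = go n f g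
    where
    go : ∀ n (f g : Fin (suc n) → ℕ) → sum f ≤ sum g → ∃[ i ] f i ≤ g i
    go zero f g h = zero , subst₂ _≤_ (+-identityʳ _) (+-identityʳ _) h
    go (suc n) f g h with f zero ≤? g zero
    ... | yes p = zero , p
    ... | no ¬p = let (i , p) = go n (f ∘ suc) (g ∘ suc)
                        (+-cancelˡ-≤ (g zero) _ _ (≤-trans (+-monoˡ-≤ _ (<⇒≤ (≰⇒> ¬p))) h))
                  in suc i , p

  δ : ∀ {n} → Fin n → Fin n → ℕ
  δ i j = bit (does (i Fin.≟ j))

  sum-δ : ∀ {n} (χ : Fin n → ℕ) k → sum (λ i → χ i * δ k i) ≡ χ k
  sum-δ {suc n} χ zero = trans (cong₂ _+_ (*-identityʳ (χ zero))
    (trans (sum-cong-≗ (λ i → *-zeroʳ (χ (suc i)))) (trans (sum-const n 0) (*-zeroʳ n)))) (+-identityʳ _)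
  sum-δ {suc n} χ (suc k) = trans (cong₂ _+_ (*-zeroʳ (χ zero))
    (sum-cong-≗ (λ i → cong (χ (suc i) *_) (δ-suc k i)))) (sum-δ (χ ∘ suc) k)
    where
    δ-suc : ∀ {n} (k i : Fin n) → δ (suc k) (suc i) ≡ δ k i
    δ-suc k i with k Fin.≟ i
    ... | yes _ = refl
    ... | no _ = refl

  -- A map from `n` slots to `d` vertices represents the point of the simplex whose barycentric
  -- coordinates are these counts divided by `n`.
  cnt : ∀ {n d} → (Fin n → Fin d) → Fin d → ℕ
  cnt f i = sum (λ j → δ (f j) i)

  cnt-cong : ∀ {n d} {f g : Fin n → Fin d} → (∀ j → f j ≡ g j) → ∀ i → cnt f i ≡ cnt g i
  cnt-cong h i = sum-cong-≗ (λ j → cong (λ k → δ k i) (h j))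

  cnt≤ : ∀ {n d} (f : Fin n → Fin d) i → cnt f i ≤ n
  cnt≤ {n} f i = ≤-trans (sum-mono (λ j → bit≤1 (does (f j Fin.≟ i)))) (≤-reflexive (trans (sum-const n 1) (*-identityʳ n)))

  sum-weighted-cnt : ∀ {n d} (χ : Fin d → ℕ) (f : Fin n → Fin d) → sum (λ i → χ i * cnt f i) ≡ sum (χ ∘ f)
  sum-weighted-cnt χ f = begin
    sum (λ i → χ i * sum (λ j → δ (f j) i))    ≡⟨ sum-cong-≗ (λ i → *-distribˡ-sum (χ i) (λ j → δ (f j) i)) ⟩
    sum (λ i → sum (λ j → χ i * δ (f j) i))    ≡⟨ ∑-comm (λ i j → χ i * δ (f j) i) ⟩
    sum (λ j → sum (λ i → χ i * δ (f j) i))    ≡⟨ sum-cong-≗ (λ j → sum-δ χ (f j)) ⟩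
    sum (χ ∘ f)                                ∎
    where open ≡-Reasoning

  sum-cnt : ∀ {n d} (f : Fin n → Fin d) → sum (cnt f) ≡ n
  sum-cnt {n} f = trans (sum-cong-≗ (λ i → sym (*-identityˡ (cnt f i))))
    (trans (sum-weighted-cnt (λ _ → 1) f) (trans (sum-const n 1) (*-identityʳ n)))

  cnt-above : ∀ N {d} → Fin d → (b : Fin d → ℕ) → sum b ≤ N → Σ[ f ∈ (Fin N → Fin d) ] ∀ i → b i ≤ cnt f i
  cnt-above zero i₀ b h = (λ ()) , λ i → ≤-trans (≤-trans (single b i) h) z≤n
    where
    single : ∀ {d} (b : Fin d → ℕ) i → b i ≤ sum b
    single b zero = m≤m+n _ _
    single b (suc i) = ≤-trans (single (b ∘ suc) i) (m≤n+m _ (b zero))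
  cnt-above (suc N) {d} i₀ b h with any? (λ i → 1 ≤? b i)
  ... | no none = (λ _ → i₀) , λ i → ≤-trans (≤-pred (≰⇒> (λ p → none (i , p)))) z≤n
  ... | yes (i , 1≤bi) = (λ { zero → i ; (suc j) → f j }) , λ k → subst (_≤ δ i k + cnt f k) (sym (split k)) (+-monoʳ-≤ (δ i k) (f≥ k))
    where
    b′ : Fin d → ℕ
    b′ k = b k ∸ δ i k
    δ≤b : ∀ k → δ i k ≤ b k
    δ≤b k with i Fin.≟ k
    ... | yes refl = 1≤bi
    ... | no _ = z≤n
    split : ∀ k → b k ≡ δ i k + b′ k
    split k = sym (m+[n∸m]≡n (δ≤b k))
    sum-split : sum b ≡ suc (sum b′)
    sum-split = trans (sum-cong-≗ split) (trans (∑-distrib-+ (δ i) b′) (cong (_+ sum b′)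
      (trans (sum-cong-≗ (λ k → sym (*-identityˡ (δ i k)))) (sum-δ (λ _ → 1) i))))
    rest = cnt-above N i₀ b′ (≤-pred (subst (_≤ suc N) sum-split h))
    f = proj₁ rest
    f≥ = proj₂ rest

  -- Every index other than `i` contributes at most 1 to the excess of `sum g` over `sum f`.
  deviation : ∀ {d} (f g : Fin d → ℕ) → (∀ k → g k ≤ suc (f k)) → ∀ i → f i + sum g ≤ g i + sum f + d
  deviation {suc d} f g h zero = begin
    f zero + (g zero + sum (g ∘ suc))                ≡⟨ arith₁ (f zero) (g zero) _ ⟩
    g zero + f zero + sum (g ∘ suc)                  ≤⟨ +-monoʳ-≤ (g zero + f zero) (tails (f ∘ suc) (g ∘ suc) (h ∘ suc)) ⟩
    g zero + f zero + (sum (f ∘ suc) + d)            ≤⟨ +-monoʳ-≤ (g zero + f zero) (+-monoʳ-≤ (sum (f ∘ suc)) (n≤1+n d)) ⟩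
    g zero + f zero + (sum (f ∘ suc) + suc d)        ≡⟨ arith₂ (g zero) (f zero) (sum (f ∘ suc)) (suc d) ⟩
    g zero + (f zero + sum (f ∘ suc)) + suc d        ∎
    where
    open ≤-Reasoning
    arith₁ : ∀ a b c → a + (b + c) ≡ b + a + c
    arith₁ = solve-∀
    arith₂ : ∀ a b c e → a + b + (c + e) ≡ a + (b + c) + e
    arith₂ = solve-∀
    tails : ∀ {d} (f g : Fin d → ℕ) → (∀ k → g k ≤ suc (f k)) → sum g ≤ sum f + d
    tails {zero} f g h = z≤n
    tails {suc d} f g h = ≤-trans (+-mono-≤ (h zero) (tails (f ∘ suc) (g ∘ suc) (h ∘ suc)))
      (≤-reflexive (arith₃ (f zero) (sum (f ∘ suc)) d))
      where
      arith₃ : ∀ a b c → suc a + (b + c) ≡ a + b + suc c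
      arith₃ = solve-∀
  deviation {suc d} f g h (suc i) = begin
    f (suc i) + (g zero + sum (g ∘ suc))                     ≡⟨ arith₁ (f (suc i)) (g zero) _ ⟩
    g zero + (f (suc i) + sum (g ∘ suc))                     ≤⟨ +-mono-≤ (h zero) (deviation (f ∘ suc) (g ∘ suc) (h ∘ suc) i) ⟩
    suc (f zero) + (g (suc i) + sum (f ∘ suc) + d)           ≡⟨ arith₂ (f zero) (g (suc i)) (sum (f ∘ suc)) d ⟩
    g (suc i) + (f zero + sum (f ∘ suc)) + suc d             ∎
    where
    open ≤-Reasoning
    arith₁ : ∀ a b c → a + (b + c) ≡ b + (a + c)
    arith₁ = solve-∀
    arith₂ : ∀ a b c e → suc a + (b + c + e) ≡ b + (a + c) + suc e
    arith₂ = solve-∀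

  module Brouwer (em : ExcludedMiddle 0ℓ) {d : ℕ} (N : ℕ) (i₀ : Fin d) where

    Point : Set
    Point = Fin N → Fin d

    Close : Point → Point → Set
    Close t t′ = ∀ k → cnt t k ≤ cnt t′ k + suc d

    private
      m = d ^ N

      val : Fin m → Point
      val = finToFun

      -- The `i`-th order compares `i`-th coordinates; ties are broken by the code of the point,
      -- which makes the order linear.
      rank : Fin d → Fin m → ℕ
      rank i τ = m * cnt (val τ) i + toℕ τ

      rank-inj : ∀ i {τ τ′} → rank i τ ≡ rank i τ′ → τ ≡ τ′
      rank-inj i {τ} {τ′} e = toℕ-injective (+-cancelˡ-≡ (m * cnt (val τ) i) _ _
        (trans e (cong (λ c → m * c + toℕ τ′) (sym (quotient-unique m _ _ (toℕ<n τ) (toℕ<n τ′) e)))))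

      rank-≤ : ∀ i {τ τ′} → rank i τ ≤ rank i τ′ → cnt (val τ) i ≤ cnt (val τ′) i
      rank-≤ i {τ} {τ′} h = ≮⇒≥ λ c′<c → <⇒≱ (begin-strict
        m * c′ + toℕ τ′   <⟨ +-monoʳ-< (m * c′) (toℕ<n τ′) ⟩
        m * c′ + m        ≡⟨ trans (+-comm (m * c′) m) (sym (*-suc m c′)) ⟩
        m * suc c′        ≤⟨ *-monoʳ-≤ m c′<c ⟩
        m * c             ≤⟨ m≤m+n _ _ ⟩
        m * c + toℕ τ     ∎) h
        where
        open ≤-Reasoning
        c = cnt (val τ) i
        c′ = cnt (val τ′) i

    module _ (H : ℕ) (w : Point → Fin d → ℕ) (sum-w : ∀ t → sum (w t) ≡ H) where

      private opaque
        -- Both sides sum to `N * H`. As in Sperner labellings, the colour is a coordinate in which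
        -- the point does not exceed its image, after normalisation.
        color-exists : ∀ t → ∃[ i ] cnt t i * H ≤ N * w t i
        color-exists t = sum-≤⇒∃ (λ i → cnt t i * H) (λ i → N * w t i) i₀ (≤-reflexive (begin
          sum (λ i → cnt t i * H)   ≡⟨ *-distribʳ-sum H (cnt t) ⟨
          sum (cnt t) * H           ≡⟨ cong (_* H) (sum-cnt t) ⟩
          N * H                     ≡⟨ cong (N *_) (sum-w t) ⟨
          N * sum (w t)             ≡⟨ *-distribˡ-sum N (w t) ⟩
          sum (λ i → N * w t i)     ∎))
          where open ≡-Reasoning

      private
        color : Fin m → Fin d
        color τ = proj₁ (color-exists (val τ))

        t₀ : Fin m
        t₀ = funToFin {N} {d} (λ _ → i₀)

        open Scarf em rank rank-inj color t₀ i₀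

        module _ {x} (R : Room x) where
          b : Fin d → ℕ
          b i = maybe (λ u → suc (cnt (val u) i)) 0 (lookup x i)

          -- Otherwise some point would have every coordinate at least `b i`, one more than that of
          -- the proper entry at `i`, against dominance. So the minimal coordinates in a room nearly
          -- add up to `N`, which forces its entries to be close.
          N<b : N < sum b
          N<b = ≰⇒> λ b≤N →
            let (f , f≥) = cnt-above N i₀ b b≤N
                (i , u , xi , y≤u) = Room.dominant R (funToFin f)
            in <⇒≱ (subst (λ z → maybe (λ u → suc (cnt (val u) i)) 0 z ≤ cnt f i) xi (f≥ i))
                 (subst (_≤ cnt (val u) i) (cnt-cong (finToFun-funToFin f) i) (rank-≤ i y≤u))

          module _ {j t} (xj : lookup x j ≡ just t) where
            lower : ∀ i → b i ≤ suc (cnt (val t) i)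
            lower i with lookup x i in xi
            ... | nothing = z≤n
            ... | just u = s≤s (rank-≤ i (Room.minimal R xi xj))

            upper : ∀ i → cnt (val t) i ≤ b i + d
            upper i = +-cancelʳ-≤ N _ _ (begin
              c i + N              ≤⟨ +-monoʳ-≤ (c i) (<⇒≤ N<b) ⟩
              c i + sum b          ≤⟨ deviation c b lower i ⟩
              b i + sum c + d      ≡⟨ cong (λ s → b i + s + d) (sum-cnt (val t)) ⟩
              b i + N + d          ≡⟨ arith (b i) N d ⟩
              b i + d + N          ∎)
              where
              open ≤-Reasoning
              c = cnt (val t)
              arith : ∀ a b c → a + b + c ≡ a + c + b
              arith = solve-∀

          close : ∀ {j j′ t t′} → lookup x j ≡ just t → lookup x j′ ≡ just t′ → Close (val t) (val t′)
          close {t = t} {t′} xj xj′ k = begin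
            cnt (val t) k              ≤⟨ upper xj k ⟩
            b k + d                         ≤⟨ +-monoˡ-≤ d (lower xj′ k) ⟩
            suc (cnt (val t′) k) + d   ≡⟨ +-suc _ d ⟨
            cnt (val t′) k + suc d     ∎
            where open ≤-Reasoning

      -- The map `w` is arbitrary, so each coordinate has its inequality at a neighbouring point of
      -- its own, namely the entry of that colour in a colourful room.
      approximate-fixed-point : ∃[ t* ] ∀ i → ∃[ t ]
        (Close t t* × Close t* t × cnt t* i * H ≤ N * w t i + suc d * H)
      approximate-fixed-point with scarf
      -- Dominance over an arbitrary point supplies a proper entry, to serve as `t*`.
      ... | x , R , colorful with Room.dominant R t₀
      ...   | j* , u* , x* , _ = val u* , go
        where
        t* = val u*
        go : ∀ i → ∃[ t ] (Close t t* × Close t* t × cnt t* i * H ≤ N * w t i + suc d * H)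
        go i with colorful i
        ... | j , cj with lookup x j in xj
        ...   | just u with refl ← cj = val u , close R xj x* , close R x* xj , (begin
                cnt t* i * H                         ≤⟨ *-monoˡ-≤ H (close R x* xj i) ⟩
                (cnt (val u) i + suc d) * H     ≡⟨ *-distribʳ-+ H (cnt (val u) i) (suc d) ⟩
                cnt (val u) i * H + suc d * H   ≤⟨ +-monoˡ-≤ (suc d * H) (proj₂ (color-exists (val u))) ⟩
                N * w (val u) i + suc d * H     ∎)
                where open ≤-Reasoning
        -- A slack entry of colour `i` sits at index `i`, where `b` vanishes; so coordinate `i` of
        -- `t*` is at most `d` and the error term alone suffices.
        ...   | nothing with refl ← cj = t* , close R x* x* , close R x* x* , (begin
                cnt t* i * H               ≤⟨ *-monoˡ-≤ H (subst (λ z → cnt t* i ≤ maybe _ 0 z + d) xj (upper R x* i)) ⟩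
                d * H                      ≤⟨ *-monoˡ-≤ H (n≤1+n d) ⟩
                suc d * H                  ≤⟨ m≤n+m (suc d * H) (N * w t* j) ⟩
                N * w t* i + suc d * H     ∎)
                where open ≤-Reasoning

-- Approximate fixed points of averages over thresholds

module ThresholdAveraging where

  open import Axiom.ExcludedMiddle using (ExcludedMiddle)
  import Data.Nat.Properties as ℕₚ
  open import Algebra.Properties.Semiring.Sum ℕₚ.+-*-semiring using (sum; ∑-distrib-+; ∑-comm; sum-cong-≗; *-distribˡ-sum; *-distribʳ-sum)
  open import Data.Bool using (Bool; true; false; _xor_)
  open import Data.Fin using (Fin; zero; suc; toℕ; funToFin; combine)
  import Data.Fin as Fin
  open import Data.Nat hiding (_⊔_)
  open import Data.Nat.Properties
  open import Data.Nat.Tactic.RingSolver using (solve-∀)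
  open import Data.Product using (∃; ∃-syntax; _×_; _,_)
  open import Function using (_∘_)
  open import Level using (0ℓ)
  open import Relation.Binary.PropositionalEquality
  open UniversalFunction using (bit)
  open ScarfLemma
  open DiscreteBrouwer

  -- Both sequences switch from true to false at most once, and the interlacing keeps the two
  -- switching places at most one step apart.
  at-most-one-change : ∀ K (a b : ℕ → Bool) →
    (∀ k → a (suc k) ≡ true → b k ≡ true) → (∀ k → b (suc k) ≡ true → a k ≡ true) →
    (∀ k → a (suc k) ≡ true → a k ≡ true) → (∀ k → b (suc k) ≡ true → b k ≡ true) →
    sum {K} (λ k → bit (a (toℕ k) xor b (toℕ k))) ≤ 1
  at-most-one-change zero a b ab ba aa bb = z≤n
  at-most-one-change (suc K) a b ab ba aa bb with a 0 in a0 | b 0 in b0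
  ... | true  | true  = at-most-one-change K (a ∘ suc) (b ∘ suc) (ab ∘ suc) (ba ∘ suc) (aa ∘ suc) (bb ∘ suc)
  ... | false | false = at-most-one-change K (a ∘ suc) (b ∘ suc) (ab ∘ suc) (ba ∘ suc) (aa ∘ suc) (bb ∘ suc)
  ... | true  | false = s≤s (≤-reflexive (trans (sum-cong-≗ {K} (λ k → cong₂ (λ p q → bit (p xor q)) (a-false (toℕ k)) (b-false (toℕ k))))
                          (trans (sum-const K 0) (*-zeroʳ K))))
    where
    b-false : ∀ k → b (suc k) ≡ false
    b-false k with b (suc k) in e
    ... | false = refl
    ... | true = case-down k e
      where
      case-down : ∀ k → b (suc k) ≡ true → true ≡ false
      case-down zero e = trans (sym (bb 0 e)) b0
      case-down (suc k) e = case-down k (bb (suc k) e)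
    a-false : ∀ k → a (suc k) ≡ false
    a-false zero with a 1 in e
    ... | false = refl
    ... | true = trans (sym (ab 0 e)) b0
    a-false (suc k) with a (suc (suc k)) in e
    ... | false = refl
    ... | true = trans (sym (aa (suc k) e)) (a-false k)
  ... | false | true  = s≤s (≤-reflexive (trans (sum-cong-≗ {K} (λ k → cong₂ (λ p q → bit (p xor q)) (a-false (toℕ k)) (b-false (toℕ k))))
                          (trans (sum-const K 0) (*-zeroʳ K))))
    where
    a-false : ∀ k → a (suc k) ≡ false
    a-false zero with a 1 in e
    ... | false = refl
    ... | true = trans (sym (aa 0 e)) a0
    a-false (suc k) with a (suc (suc k)) in e
    ... | false = refl
    ... | true = trans (sym (aa (suc k) e)) (a-false k)
    b-false : ∀ k → b (suc k) ≡ false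
    b-false zero with b 1 in e
    ... | false = refl
    ... | true = trans (sym (ba 0 e)) a0
    b-false (suc k) with b (suc (suc k)) in e
    ... | false = refl
    ... | true = trans (sym (bb (suc k) e)) (b-false k)

  -- The hypothesis bounds `c` by `w`, the conclusion `w` by `c`. As the normalised totals agree,
  -- this is the hypothesis summed over the complement of `χ`.
  domination : ∀ {d} N H E (c w χ : Fin d → ℕ) → sum c ≡ N → sum w ≡ H → (∀ i → χ i ≤ 1) →
    (∀ i → c i * H ≤ N * w i + E) → N * sum (λ i → χ i * w i) ≤ H * sum (λ i → χ i * c i) + d * E
  domination {d} N H E c w χ sum-c sum-w χ≤1 h = +-cancelʳ-≤ (N * W′) _ _ (begin
    N * W + N * W′           ≡⟨ *-distribˡ-+ N W W′ ⟨
    N * (W + W′)             ≡⟨ cong (N *_) (trans (total w) sum-w) ⟩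
    N * H                    ≡⟨ trans (*-comm N H) (cong (H *_) (sym (trans (total c) sum-c))) ⟩
    H * (C + C′)             ≡⟨ *-distribˡ-+ H C C′ ⟩
    H * C + H * C′           ≤⟨ +-monoʳ-≤ (H * C) bound ⟩
    H * C + (N * W′ + d * E) ≡⟨ arith (H * C) (N * W′) (d * E) ⟩
    H * C + d * E + N * W′   ∎)
    where
    open ≤-Reasoning
    χ′ : Fin d → ℕ
    χ′ i = 1 ∸ χ i
    W = sum (λ i → χ i * w i)
    W′ = sum (λ i → χ′ i * w i)
    C = sum (λ i → χ i * c i)
    C′ = sum (λ i → χ′ i * c i)
    total : ∀ (f : Fin d → ℕ) → sum (λ i → χ i * f i) + sum (λ i → χ′ i * f i) ≡ sum f
    total f = trans (sym (∑-distrib-+ (λ i → χ i * f i) (λ i → χ′ i * f i))) (sum-cong-≗ λ i →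
      trans (sym (*-distribʳ-+ (f i) (χ i) (χ′ i))) (trans (cong (_* f i) (m+[n∸m]≡n (χ≤1 i))) (*-identityˡ (f i))))
    arith : ∀ a b c → a + (b + c) ≡ a + c + b
    arith = solve-∀
    arith₂ : ∀ h x c → h * (x * c) ≡ x * (c * h)
    arith₂ = solve-∀
    arith₃ : ∀ x n w e → x * (n * w + e) ≡ n * (x * w) + x * e
    arith₃ = solve-∀
    bound : H * C′ ≤ N * W′ + d * E
    bound = begin
      H * C′                                        ≡⟨ *-distribˡ-sum H (λ i → χ′ i * c i) ⟩
      sum (λ i → H * (χ′ i * c i))                  ≡⟨ sum-cong-≗ (λ i → arith₂ H (χ′ i) (c i)) ⟩
      sum (λ i → χ′ i * (c i * H))                  ≤⟨ sum-mono (λ i → *-monoʳ-≤ (χ′ i) (h i)) ⟩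
      sum (λ i → χ′ i * (N * w i + E))              ≡⟨ sum-cong-≗ (λ i → arith₃ (χ′ i) N (w i) E) ⟩
      sum (λ i → N * (χ′ i * w i) + χ′ i * E)       ≡⟨ ∑-distrib-+ (λ i → N * (χ′ i * w i)) (λ i → χ′ i * E) ⟩
      sum (λ i → N * (χ′ i * w i)) + sum (λ i → χ′ i * E)
        ≤⟨ +-mono-≤ (≤-reflexive (sym (*-distribˡ-sum N (λ i → χ′ i * w i))))
                    (sum-mono (λ i → ≤-trans (*-monoˡ-≤ E (m∸n≤m 1 (χ i))) (≤-reflexive (*-identityˡ E)))) ⟩
      N * W′ + sum {d} (λ _ → E)                    ≡⟨ cong (N * W′ +_) (sum-const d E) ⟩
      N * W′ + d * E                                ∎

  toFin2 : Bool → Fin 2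
  toFin2 false = zero
  toFin2 true  = suc zero

  -- A choice made on codes depends only on the values of `A`; a choice made on functions would
  -- require extensionality for this.
  subsetIndex : ∀ {g} → (Fin g → Bool) → Fin (2 ^ g)
  subsetIndex A = funToFin (toFin2 ∘ A)

  subsetIndex-cong : ∀ {g} {A B : Fin g → Bool} → (∀ c → A c ≡ B c) → subsetIndex A ≡ subsetIndex B
  subsetIndex-cong {zero} h = refl
  subsetIndex-cong {suc g} h = cong₂ combine (cong toFin2 (h zero)) (subsetIndex-cong (h ∘ suc))

  module Averaging (em : ExcludedMiddle 0ℓ) {d : ℕ} (N : ℕ) (i₀ : Fin d) (g K R : ℕ)
    (select : Fin (2 ^ g) → Fin R → Fin d)
    (active : (Fin N → Fin d) → ℕ → Fin g → Bool) where

    open Brouwer em N i₀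

    chosen : Point → ℕ → Fin R → Fin d
    chosen t k = select (subsetIndex (active t k))

    module _ (shift : ∀ {t t′} → Close t t′ → ∀ k c → active t (suc k) c ≡ true → active t′ k c ≡ true) where

      private
        w : Point → Fin d → ℕ
        w t i = sum {K} (λ k → cnt (chosen t (toℕ k)) i)

        weighted : ∀ (χ : Fin d → ℕ) t → sum (λ i → χ i * w t i) ≡ sum {K} (λ k → sum (χ ∘ chosen t (toℕ k)))
        weighted χ t = begin
          sum (λ i → χ i * w t i)
            ≡⟨ sum-cong-≗ (λ i → *-distribˡ-sum {K} (χ i) (λ k → cnt (chosen t (toℕ k)) i)) ⟩
          sum (λ i → sum {K} (λ k → χ i * cnt (chosen t (toℕ k)) i))
            ≡⟨ ∑-comm {d} {K} (λ i k → χ i * cnt (chosen t (toℕ k)) i) ⟩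
          sum {K} (λ k → sum (λ i → χ i * cnt (chosen t (toℕ k)) i))
            ≡⟨ sum-cong-≗ {K} (λ k → sum-weighted-cnt χ (chosen t (toℕ k))) ⟩
          sum {K} (λ k → sum (χ ∘ chosen t (toℕ k))) ∎
          where open ≡-Reasoning

        sum-w : ∀ t → sum (w t) ≡ K * R
        sum-w t = trans (sum-cong-≗ (λ i → sym (*-identityˡ (w t i)))) (trans (weighted (λ _ → 1) t)
          (trans (sum-cong-≗ {K} (λ _ → trans (sum-const R 1) (*-identityʳ R))) (sum-const K R)))

        refl-Close : ∀ t → Close t t
        refl-Close t k = m≤m+n _ _

        differ : ∀ (A B : Fin g → Bool) i →
          cnt (select (subsetIndex A)) i ≤ cnt (select (subsetIndex B)) i + R * sum (λ c → bit (A c xor B c))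
        differ A B i with sum (λ c → bit (A c xor B c)) in e
        ... | zero = ≤-trans (≤-reflexive (cong (λ s → cnt (select s) i) (subsetIndex-cong (agree A B e)))) (m≤m+n _ _)
          where
          agree : ∀ {g} (A B : Fin g → Bool) → sum (λ c → bit (A c xor B c)) ≡ 0 → ∀ c → A c ≡ B c
          agree A B e zero with A zero | B zero
          ... | true | true = refl
          ... | false | false = refl
          agree A B e (suc c) = agree (A ∘ suc) (B ∘ suc) (m+n≡0⇒n≡0 (bit (A zero xor B zero)) e) c
        ... | suc s = ≤-trans (cnt≤ (select (subsetIndex A)) i)
                        (≤-trans (≤-trans (m≤m+n R (R * s)) (≤-reflexive (sym (*-suc R s)))) (m≤n+m _ _))

        -- Between close points each of the `g` elements changes its status at no more than one of
        -- the `K` thresholds, and every change is charged with all `R` choices at that threshold.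
        w-close : ∀ {t t′} → Close t t′ → Close t′ t → ∀ i → w t i ≤ w t′ i + g * R
        w-close {t} {t′} tt′ t′t i = begin
          w t i
            ≤⟨ sum-mono {K} (λ k → differ (active t (toℕ k)) (active t′ (toℕ k)) i) ⟩
          sum {K} (λ k → cnt (chosen t′ (toℕ k)) i + R * X (toℕ k))
            ≡⟨ ∑-distrib-+ {K} (λ k → cnt (chosen t′ (toℕ k)) i) (λ k → R * X (toℕ k)) ⟩
          w t′ i + sum {K} (λ k → R * X (toℕ k))
            ≡⟨ cong (w t′ i +_) (sym (*-distribˡ-sum {K} R (X ∘ toℕ))) ⟩
          w t′ i + R * sum {K} (X ∘ toℕ)
            ≤⟨ +-monoʳ-≤ (w t′ i) (*-monoʳ-≤ R changes) ⟩
          w t′ i + R * g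
            ≡⟨ cong (w t′ i +_) (*-comm R g) ⟩
          w t′ i + g * R ∎
          where
          open ≤-Reasoning
          X : ℕ → ℕ
          X k = sum (λ c → bit (active t k c xor active t′ k c))
          changes : sum {K} (X ∘ toℕ) ≤ g
          changes = begin
            sum {K} (X ∘ toℕ) ≡⟨ ∑-comm {K} {g} (λ k c → bit (active t (toℕ k) c xor active t′ (toℕ k) c)) ⟩
            sum (λ c → sum {K} (λ k → bit (active t (toℕ k) c xor active t′ (toℕ k) c)))
              ≤⟨ sum-mono (λ c → at-most-one-change K (λ k → active t k c) (λ k → active t′ k c)
                   (λ k → shift tt′ k c) (λ k → shift t′t k c)
                   (λ k → shift (refl-Close t) k c) (λ k → shift (refl-Close t′) k c)) ⟩
            sum {g} (λ _ → 1) ≡⟨ trans (sum-const g 1) (*-identityʳ g) ⟩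
            g ∎

      private
        E : ℕ
        E = N * (g * R) + suc d * (K * R)

        split-error : ∀ n a b c → n * (a + b) + c ≡ n * a + (n * b + c)
        split-error = solve-∀

        module _ (t* : Point) (h : ∀ i → ∃[ t ]
          (Close t t* × Close t* t × cnt t* i * (K * R) ≤ N * w t i + suc d * (K * R))) where

          bound : ∀ i → cnt t* i * (K * R) ≤ N * w t* i + E
          bound i = let (t , tt* , t*t , le) = h i in
            ≤-trans le (≤-trans (+-monoˡ-≤ (suc d * (K * R)) (*-monoʳ-≤ N (w-close tt* t*t i)))
              (≤-reflexive (split-error N (w t* i) (g * R) (suc d * (K * R)))))

          conclusion : (χ : Fin d → ℕ) → (∀ i → χ i ≤ 1) →
            N * sum (λ i → χ i * w t* i) ≤ K * R * sum (λ i → χ i * cnt t* i) + d * E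
          conclusion χ χ≤1 = domination N (K * R) E (cnt t*) (w t*) χ (sum-cnt t*) (sum-w t*) χ≤1 bound

      -- Divided by `N * K * R`, the error is `d * g / K`, from the switching elements, plus
      -- `d * (d + 1) / N`, from the mesh of the simplex.
      averaged-fixed-point : ∃[ t* ] ∀ (χ : Fin d → ℕ) → (∀ i → χ i ≤ 1) →
        N * sum {K} (λ k → sum (χ ∘ chosen t* (toℕ k)))
          ≤ K * R * sum (χ ∘ t*) + d * (N * (g * R) + suc d * (K * R))
      averaged-fixed-point =
        let (t* , h) = approximate-fixed-point (K * R) w sum-w
        in t* , λ χ χ≤1 → subst₂ (λ p q → N * p ≤ K * R * q + d * E)
              (weighted χ t*) (sum-weighted-cnt χ t*) (conclusion t* h χ χ≤1)

-- Rational arithmetic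

module RationalArithmetic where

  open import Data.Integer using (ℤ; +_; -[1+_])
  import Data.Integer as ℤ
  import Data.Integer.Properties as ℤₚ
  open import Data.Integer.Tactic.RingSolver using () renaming (solve-∀ to solve-∀ᶻ)
  open import Data.Nat as ℕ using (ℕ; zero; suc)
  import Data.Nat.Properties as ℕₚ
  import Data.Nat.Coprimality as Coprime
  open import Data.Product using (∃; ∃-syntax; _,_)
  open import Data.Rational
  open import Data.Rational.Properties
  open import Data.Rational.Unnormalised using (*≡*)
  import Data.Rational.Unnormalised.Properties as ℚᵘₚ
  open import Relation.Binary.PropositionalEquality
  open import Relation.Nullary.Decidable.Core using (dec⇒maybe)
  open import Tactic.RingSolver using (solve-∀)
  open import Tactic.RingSolver.Core.AlmostCommutativeRing using (AlmostCommutativeRing; fromCommutativeRing)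

  ℚ-ring : AlmostCommutativeRing _ _
  ℚ-ring = fromCommutativeRing +-*-commutativeRing (λ x → dec⇒maybe (0ℚ ≟ x))

  -- Linear arithmetic: an inequality is verified as a sum of given ones.

  0≤- : ∀ {a b} → a ≤ b → 0ℚ ≤ b - a
  0≤- {a} {b} h = subst (_≤ b - a) (+-inverseʳ a) (+-monoˡ-≤ (- a) h)

  0<- : ∀ {a b} → a < b → 0ℚ < b - a
  0<- {a} {b} h = subst (_< b - a) (+-inverseʳ a) (+-monoˡ-< (- a) h)

  -≤ : ∀ {a b} → 0ℚ ≤ b - a → a ≤ b
  -≤ {a} {b} h = subst₂ _≤_ (+-identityˡ a) (cancel a b) (+-monoˡ-≤ a h)
    where
    cancel : ∀ a b → b - a + a ≡ b
    cancel = solve-∀ ℚ-ring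

  -< : ∀ {a b} → 0ℚ < b - a → a < b
  -< {a} {b} h = subst₂ _<_ (+-identityˡ a) (cancel a b) (+-monoˡ-< a h)
    where
    cancel : ∀ a b → b - a + a ≡ b
    cancel = solve-∀ ℚ-ring

  lin≤ : ∀ {a b a₁ b₁} → b - a ≡ b₁ - a₁ → a₁ ≤ b₁ → a ≤ b
  lin≤ e h = -≤ (subst (0ℚ ≤_) (sym e) (0≤- h))

  lin< : ∀ {a b a₁ b₁} → b - a ≡ b₁ - a₁ → a₁ < b₁ → a < b
  lin< e h = -< (subst (0ℚ <_) (sym e) (0<- h))

  lin≤² : ∀ {a b a₁ b₁ a₂ b₂} → b - a ≡ (b₁ - a₁) + (b₂ - a₂) → a₁ ≤ b₁ → a₂ ≤ b₂ → a ≤ b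
  lin≤² e h h′ = -≤ (subst (0ℚ ≤_) (sym e) (+-mono-≤ (0≤- h) (0≤- h′)))

  lin<² : ∀ {a b a₁ b₁ a₂ b₂} → b - a ≡ (b₁ - a₁) + (b₂ - a₂) → a₁ < b₁ → a₂ ≤ b₂ → a < b
  lin<² e h h′ = -< (subst (0ℚ <_) (sym e) (+-mono-<-≤ (0<- h) (0≤- h′)))

  lin≤³ : ∀ {a b a₁ b₁ a₂ b₂ a₃ b₃} → b - a ≡ (b₁ - a₁) + ((b₂ - a₂) + (b₃ - a₃)) →
    a₁ ≤ b₁ → a₂ ≤ b₂ → a₃ ≤ b₃ → a ≤ b
  lin≤³ e h h′ h″ = -≤ (subst (0ℚ ≤_) (sym e) (+-mono-≤ (0≤- h) (+-mono-≤ (0≤- h′) (0≤- h″))))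

  lin<³ : ∀ {a b a₁ b₁ a₂ b₂ a₃ b₃} → b - a ≡ (b₁ - a₁) + ((b₂ - a₂) + (b₃ - a₃)) →
    a₁ < b₁ → a₂ ≤ b₂ → a₃ ≤ b₃ → a < b
  lin<³ e h h′ h″ = -< (subst (0ℚ <_) (sym e) (+-mono-<-≤ (0<- h) (+-mono-≤ (0≤- h′) (0≤- h″))))

  opaque
    ι : ℕ → ℚ
    ι n = mkℚ (+ n) 0 (Coprime.sym (Coprime.1-coprimeTo n))

    inv : ℕ → ℚ
    inv n = mkℚ (+ 1) n (Coprime.1-coprimeTo (suc n))

    ι-+ : ∀ m n → ι (m ℕ.+ n) ≡ ι m + ι n
    ι-+ m n = toℚᵘ-injective (ℚᵘₚ.≃-sym (ℚᵘₚ.≃-trans (toℚᵘ-homo-+ (ι m) (ι n)) (*≡* (lemma (+ m) (+ n)))))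
      where
      lemma : ∀ m n → (m ℤ.* + 1 ℤ.+ n ℤ.* + 1) ℤ.* + 1 ≡ (m ℤ.+ n) ℤ.* + 1
      lemma = solve-∀ᶻ

    ι-* : ∀ m n → ι (m ℕ.* n) ≡ ι m * ι n
    ι-* m n = toℚᵘ-injective (ℚᵘₚ.≃-sym (ℚᵘₚ.≃-trans (toℚᵘ-homo-* (ι m) (ι n))
      (*≡* (cong (ℤ._* + 1) (sym (ℤₚ.pos-* m n))))))

    ι-inv : ∀ n → ι (suc n) * inv n ≡ 1ℚ
    ι-inv n = toℚᵘ-injective (ℚᵘₚ.≃-trans (toℚᵘ-homo-* (ι (suc n)) (inv n))
      (*≡* (trans (lemma (+ suc n)) (cong (λ k → + 1 ℤ.* + suc k) (sym (ℕₚ.+-identityʳ n))))))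
      where
      lemma : ∀ m → m ℤ.* + 1 ℤ.* + 1 ≡ + 1 ℤ.* m
      lemma = solve-∀ᶻ

    ι-mono-≤ : ∀ {m n} → m ℕ.≤ n → ι m ≤ ι n
    ι-mono-≤ h = *≤* (ℤₚ.*-monoʳ-≤-nonNeg (+ 1) (ℤ.+≤+ h))

    ι-mono-< : ∀ {m n} → m ℕ.< n → ι m < ι n
    ι-mono-< h = *<* (ℤₚ.*-monoʳ-<-pos (+ 1) (ℤ.+<+ h))

    ι-cancel-≤ : ∀ {m n} → ι m ≤ ι n → m ℕ.≤ n
    ι-cancel-≤ (*≤* h) = ℤₚ.drop‿+≤+ (ℤₚ.*-cancelʳ-≤-pos _ _ (+ 1) h)

    ι-cancel-< : ∀ {m n} → ι m < ι n → m ℕ.< n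
    ι-cancel-< (*<* h) = ℤₚ.drop‿+<+ (ℤₚ.*-cancelʳ-<-nonNeg (+ 1) h)

    ι0 : ι 0 ≡ 0ℚ
    ι0 = refl

    ι1 : ι 1 ≡ 1ℚ
    ι1 = refl

    inv>0 : ∀ n → 0ℚ < inv n
    inv>0 n = positive⁻¹ (inv n)

    ι-above : ∀ x → ∃[ n ] x ≤ ι n
    ι-above (mkℚ (+ n) d c) = n , *≤* (ℤₚ.*-monoˡ-≤-nonNeg (+ n) (ℤ.+≤+ (ℕ.s≤s ℕ.z≤n)))
    ι-above (mkℚ -[1+ n ] d c) = 0 , *≤* ℤ.-≤+

    *-denominator : ∀ n d .(c : Coprime.Coprime ℤ.∣ + n ∣ (suc d)) → mkℚ (+ n) d c * ι (suc d) ≡ ι n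
    *-denominator n d c = toℚᵘ-injective (ℚᵘₚ.≃-trans (toℚᵘ-homo-* (mkℚ (+ n) d c) (ι (suc d)))
      (*≡* (trans (lemma (+ n) (+ suc d)) (cong (λ k → + n ℤ.* + suc k) (sym (ℕₚ.*-identityʳ d))))))
      where
      lemma : ∀ n d → n ℤ.* d ℤ.* + 1 ≡ n ℤ.* d
      lemma = solve-∀ᶻ

  0≤ι : ∀ n → 0ℚ ≤ ι n
  0≤ι n = subst (_≤ ι n) ι0 (ι-mono-≤ ℕ.z≤n)

  0<ι : ∀ n → 0ℚ < ι (suc n)
  0<ι n = subst (_< ι (suc n)) ι0 (ι-mono-< (ℕ.s≤s ℕ.z≤n))

  *-monoʳ-≤ : ∀ {r p q} → 0ℚ ≤ r → p ≤ q → r * p ≤ r * q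
  *-monoʳ-≤ {r} h = *-monoˡ-≤-nonNeg r {{nonNegative h}}

  *-monoˡ-≤ : ∀ {r p q} → 0ℚ ≤ r → p ≤ q → p * r ≤ q * r
  *-monoˡ-≤ {r} h = *-monoʳ-≤-nonNeg r {{nonNegative h}}

  *-monoʳ-< : ∀ {r p q} → 0ℚ < r → p < q → r * p < r * q
  *-monoʳ-< {r} h = *-monoʳ-<-pos r {{positive h}}

  *-monoˡ-< : ∀ {r p q} → 0ℚ < r → p < q → p * r < q * r
  *-monoˡ-< {r} h = *-monoˡ-<-pos r {{positive h}}

  *-cancelʳ-≤ : ∀ {r p q} → 0ℚ < r → p * r ≤ q * r → p ≤ q
  *-cancelʳ-≤ {r} h = *-cancelʳ-≤-pos r {{positive h}}

  *-cancelʳ-< : ∀ {r p q} → 0ℚ < r → p * r < q * r → p < q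
  *-cancelʳ-< {r} h = *-cancelʳ-<-nonNeg r {{pos⇒nonNeg r {{positive h}}}}

  0<* : ∀ {p q} → 0ℚ < p → 0ℚ < q → 0ℚ < p * q
  0<* {p} {q} hp hq = subst (_< p * q) (*-zeroʳ p) (*-monoʳ-< hp hq)

  0≤* : ∀ {p q} → 0ℚ ≤ p → 0ℚ ≤ q → 0ℚ ≤ p * q
  0≤* {p} {q} hp hq = subst (_≤ p * q) (*-zeroʳ p) (*-monoʳ-≤ hp hq)

  archimedes : ∀ x {δ} → 0ℚ < δ → ∃[ n ] x ≤ ι n * δ
  archimedes x {δ} δ>0 =
    let instance δ≢0 = pos⇒nonZero δ {{positive δ>0}}
        (n , h) = ι-above (x * 1/ δ)
    in n , subst (_≤ ι n * δ) (trans (*-assoc x (1/ δ) δ) (trans (cong (x *_) (*-inverseˡ δ)) (*-identityʳ x)))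
         (*-monoˡ-≤ (<⇒≤ δ>0) h)

  ι*inv : ∀ x n → x * ι (suc n) * inv n ≡ x
  ι*inv x n = trans (*-assoc x (ι (suc n)) (inv n)) (trans (cong (x *_) (ι-inv n)) (*-identityʳ x))

  inv*ι : ∀ x n → x * inv n * ι (suc n) ≡ x
  inv*ι x n = trans (*-assoc x (inv n) (ι (suc n)))
    (trans (cong (x *_) (trans (*-comm (inv n) (ι (suc n))) (ι-inv n))) (*-identityʳ x))

  inv-antitone : ∀ {m n} → m ℕ.≤ n → inv n ≤ inv m
  inv-antitone {m} {n} h = *-cancelʳ-≤ (0<* (0<ι m) (0<ι n))
    (subst₂ _≤_ (sym (l (inv n) (ι (suc m)) (ι (suc n)) (ι-inv n))) (sym (r (inv m) (ι (suc m)) (ι (suc n)) (ι-inv m)))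
      (ι-mono-≤ (ℕ.s≤s h)))
    where
    rot : ∀ i a b → i * (a * b) ≡ a * (b * i)
    rot = solve-∀ ℚ-ring
    rot′ : ∀ i a b → i * (a * b) ≡ b * (a * i)
    rot′ = solve-∀ ℚ-ring
    l : ∀ i a b → b * i ≡ 1ℚ → i * (a * b) ≡ a
    l i a b e = trans (rot i a b) (trans (cong (a *_) e) (*-identityʳ a))
    r : ∀ i a b → a * i ≡ 1ℚ → i * (a * b) ≡ b
    r i a b e = trans (rot′ i a b) (trans (cong (b *_) e) (*-identityʳ b))

  inv-small : ∀ {ε} → 0ℚ < ε → ∃[ n ] ∀ m → n ℕ.≤ m → inv m < ε
  inv-small {ε} ε>0 =
    let (n , h) = archimedes 1ℚ ε>0
        1<_ : 1ℚ < ι (suc n) * ε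
        1<_ = ≤-<-trans h (*-monoˡ-< ε>0 (ι-mono-< (ℕₚ.n<1+n n)))
    in n , λ m n≤m → ≤-<-trans (inv-antitone n≤m)
         (*-cancelʳ-< (0<ι n) (subst₂ _<_ (trans (sym (ι-inv n)) (*-comm (ι (suc n)) (inv n))) (*-comm (ι (suc n)) ε) 1<_))

  opaque
    half : ℚ → ℚ
    half x = x * ½

    half+half : ∀ x → half x + half x ≡ x
    half+half x = trans (sym (*-distribˡ-+ x ½ ½)) (*-identityʳ x)

    half>0 : ∀ {x} → 0ℚ < x → 0ℚ < half x
    half>0 h = 0<* h (positive⁻¹ ½)

  -1<0 : - 1ℚ < 0ℚ
  -1<0 = negative⁻¹ (- 1ℚ)

-- Clopen sets, finite samples and compactness of Cantor space

module ClopenSets where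

  open import Defs renaming (_+_ to _+ʳ_; _≤_ to _≤ʳ_; _<_ to _<ʳ_; _≈_ to _≈ʳ_)
  import Data.Nat.Properties as ℕₚ
  open import Algebra.Properties.Semiring.Sum ℕₚ.+-*-semiring using (sum; ∑-distrib-+)
  open import Axiom.ExcludedMiddle using (ExcludedMiddle)
  open import Data.Bool using (Bool; true; false; _∧_; _∨_; not)
  import Data.Bool.Properties as Boolₚ
  open import Data.Empty using (⊥; ⊥-elim)
  open import Data.Fin using (Fin; zero; suc)
  open import Data.List using ([]; _∷_; _∷ʳ_; length)
  open import Data.List.Properties using (∷-injective; length-++)
  open import Data.Nat as ℕ using (ℕ; zero; suc)
  open import Data.Product using (Σ; Σ-syntax; ∃; ∃-syntax; _×_; _,_; proj₁; proj₂)
  open import Data.Rational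
  open import Data.Rational.Properties hiding (_≟_)
  open import Data.Sum using (_⊎_; inj₁; inj₂)
  open import Function using (_∘_)
  open import Level using (0ℓ)
  open import Relation.Binary.PropositionalEquality
  open import Relation.Nullary using (¬_; yes; no; does)
  open import Relation.Nullary.Decidable using (decidable-stable)
  open import Tactic.RingSolver using (solve-∀)
  open UniversalFunction using (bit)
  open DiscreteBrouwer using (sum-mono; sum-const)
  open RationalArithmetic
  open ScarfLemma using (module Classical)

  Agree : ℕ → Cantor → Cantor → Set
  Agree n α β = ∀ i → i ℕ.< n → α i ≡ β i

  record Clopen : Set where
    constructor clopen
    field
      mem     : Cantor → Bool
      modulus : ∃[ n ] ∀ α β → Agree n α β → mem α ≡ mem β

  open Clopen public

  infix 4 _∋_ _∌_ _⊆_

  _∋_ _∌_ : Clopen → Cantor → Set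
  K ∋ α = mem K α ≡ true
  K ∌ α = mem K α ≡ false

  _⊆_ : Clopen → Clopen → Set
  K ⊆ L = ∀ α → K ∋ α → L ∋ α

  infixr 7 _∩_
  infixr 6 _∪_

  _∩_ _∪_ : Clopen → Clopen → Clopen
  K ∩ L = clopen (λ α → mem K α ∧ mem L α)
    (proj₁ (modulus K) ℕ.+ proj₁ (modulus L) , λ α β a → cong₂ _∧_
      (proj₂ (modulus K) α β (λ i i< → a i (ℕₚ.<-≤-trans i< (ℕₚ.m≤m+n _ _))))
      (proj₂ (modulus L) α β (λ i i< → a i (ℕₚ.<-≤-trans i< (ℕₚ.m≤n+m _ _)))))
  K ∪ L = clopen (λ α → mem K α ∨ mem L α)
    (proj₁ (modulus K) ℕ.+ proj₁ (modulus L) , λ α β a → cong₂ _∨_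
      (proj₂ (modulus K) α β (λ i i< → a i (ℕₚ.<-≤-trans i< (ℕₚ.m≤m+n _ _))))
      (proj₂ (modulus L) α β (λ i i< → a i (ℕₚ.<-≤-trans i< (ℕₚ.m≤n+m _ _)))))

  ∼_ : Clopen → Clopen
  ∼ K = clopen (not ∘ mem K) (proj₁ (modulus K) , λ α β a → cong not (proj₂ (modulus K) α β a))

  full empty : Clopen
  full  = clopen (λ _ → true) (0 , λ _ _ _ → refl)
  empty = clopen (λ _ → false) (0 , λ _ _ _ → refl)

  ∪-introˡ : ∀ K L → K ⊆ K ∪ L
  ∪-introˡ K L α e rewrite e = refl

  ∪-introʳ : ∀ K L → L ⊆ K ∪ L
  ∪-introʳ K L α e rewrite e = Boolₚ.∨-zeroʳ _

  ∪-elim : ∀ K L {α} → K ∪ L ∋ α → K ∋ α ⊎ L ∋ α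
  ∪-elim K L {α} e with mem K α
  ... | true = inj₁ refl
  ... | false = inj₂ e

  ∩-intro : ∀ K L {α} → K ∋ α → L ∋ α → K ∩ L ∋ α
  ∩-intro K L a b rewrite a = b

  ∩-elim : ∀ K L {α} → K ∩ L ∋ α → K ∋ α × L ∋ α
  ∩-elim K L {α} e with mem K α
  ... | true = refl , e

  ∼-intro : ∀ K {α} → ¬ K ∋ α → ∼ K ∋ α
  ∼-intro K {α} h with mem K α
  ... | true = ⊥-elim (h refl)
  ... | false = refl

  ∼-elim : ∀ K {α} → ∼ K ∋ α → ¬ K ∋ α
  ∼-elim K {α} e with mem K α
  ... | false = λ ()

  inCylinder : String → Cantor → Bool
  inCylinder [] α = true
  inCylinder (b ∷ σ) α = does (α 0 Boolₚ.≟ b) ∧ inCylinder σ (α ∘ suc)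

  inCylinder-agree : ∀ σ α β → Agree (length σ) α β → inCylinder σ α ≡ inCylinder σ β
  inCylinder-agree [] α β a = refl
  inCylinder-agree (b ∷ σ) α β a = cong₂ _∧_ (cong (λ c → does (c Boolₚ.≟ b)) (a 0 (ℕ.s≤s ℕ.z≤n)))
    (inCylinder-agree σ (α ∘ suc) (β ∘ suc) (λ i i< → a (suc i) (ℕ.s≤s i<)))

  [_]ᶜ : String → Clopen
  [ σ ]ᶜ = clopen (inCylinder σ) (length σ , inCylinder-agree σ)

  cylinder⇒ : ∀ σ {α} → ⟦ cylinder σ ⟧ α → [ σ ]ᶜ ∋ α
  cylinder⇒ [] e = refl
  cylinder⇒ (b ∷ σ) {α} e with refl , e′ ← ∷-injective e with α 0 Boolₚ.≟ α 0
  ... | yes _ = cylinder⇒ σ e′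
  ... | no ¬e = ⊥-elim (¬e refl)

  cylinder⇐ : ∀ σ {α} → [ σ ]ᶜ ∋ α → ⟦ cylinder σ ⟧ α
  cylinder⇐ [] e = refl
  cylinder⇐ (b ∷ σ) {α} e with α 0 Boolₚ.≟ b
  ... | yes refl = cong (α 0 ∷_) (cylinder⇐ σ e)

  inCylinder-∷ʳ : ∀ σ b {α} → [ σ ∷ʳ b ]ᶜ ∋ α → [ σ ]ᶜ ∋ α × α (length σ) ≡ b
  inCylinder-∷ʳ [] b {α} e with α 0 Boolₚ.≟ b
  ... | yes p = refl , p
  inCylinder-∷ʳ (c ∷ σ) b {α} e with α 0 Boolₚ.≟ c
  ... | yes _ = inCylinder-∷ʳ σ b e

  inCylinder-extend : ∀ σ {α} → [ σ ]ᶜ ∋ α → [ σ ∷ʳ α (length σ) ]ᶜ ∋ α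
  inCylinder-extend [] {α} e with α 0 Boolₚ.≟ α 0
  ... | yes _ = refl
  ... | no ¬e = ⊥-elim (¬e refl)
  inCylinder-extend (c ∷ σ) {α} e with α 0 Boolₚ.≟ c
  ... | yes _ = inCylinder-extend σ e

  -- A uniform distribution on finitely many points; repetitions act as multiplicities, and the
  -- successor keeps it nonempty.
  Sample : Set
  Sample = Σ[ n ∈ ℕ ] (Fin (suc n) → Cantor)

  hits : Sample → Clopen → ℕ
  hits (n , x) K = sum (λ j → bit (mem K (x j)))

  opaque
    mean : Sample → Clopen → ℚ
    mean s K = ι (hits s K) * inv (proj₁ s)

    mean-ι : ∀ s K → mean s K * ι (suc (proj₁ s)) ≡ ι (hits s K)
    mean-ι s K = inv*ι (ι (hits s K)) (proj₁ s)

    mean-≤+ : ∀ s K L M → (∀ α → bit (mem K α) ℕ.≤ bit (mem L α) ℕ.+ bit (mem M α)) → mean s K ≤ mean s L + mean s M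
    mean-≤+ s@(n , x) K L M h = subst (mean s K ≤_) (*-distribʳ-+ (inv n) (ι (hits s L)) (ι (hits s M)))
      (*-monoˡ-≤ (<⇒≤ (inv>0 n)) (subst (ι (hits s K) ≤_) (ι-+ (hits s L) (hits s M))
        (ι-mono-≤ (ℕₚ.≤-trans (sum-mono (λ j → h (x j)))
          (ℕₚ.≤-reflexive (∑-distrib-+ (λ j → bit (mem L (x j))) (λ j → bit (mem M (x j)))))))))

    mean-+≤ : ∀ s K L M → (∀ α → bit (mem L α) ℕ.+ bit (mem M α) ℕ.≤ bit (mem K α)) → mean s L + mean s M ≤ mean s K
    mean-+≤ s@(n , x) K L M h = subst (_≤ mean s K) (*-distribʳ-+ (inv n) (ι (hits s L)) (ι (hits s M)))
      (*-monoˡ-≤ (<⇒≤ (inv>0 n)) (subst (_≤ ι (hits s K)) (ι-+ (hits s L) (hits s M))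
        (ι-mono-≤ (ℕₚ.≤-trans (ℕₚ.≤-reflexive (sym (∑-distrib-+ (λ j → bit (mem L (x j))) (λ j → bit (mem M (x j))))))
          (sum-mono (λ j → h (x j)))))))

    mean-full : ∀ s → mean s full ≡ 1ℚ
    mean-full (n , x) = trans (cong (λ k → ι k * inv n) (trans (sum-const (suc n) 1) (ℕₚ.*-identityʳ (suc n)))) (ι-inv n)

    mean-empty : ∀ s → mean s empty ≡ 0ℚ
    mean-empty (n , x) = trans (cong (λ k → ι k * inv n) (trans (sum-const (suc n) 0) (ℕₚ.*-zeroʳ (suc n))))
      (trans (cong (_* inv n) ι0) (*-zeroˡ (inv n)))

    mean≥0 : ∀ s K → 0ℚ ≤ mean s K
    mean≥0 s K = 0≤* (0≤ι (hits s K)) (<⇒≤ (inv>0 (proj₁ s)))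

  bit-mono : ∀ {a b} → (a ≡ true → b ≡ true) → bit a ℕ.≤ bit b
  bit-mono {false} h = ℕ.z≤n
  bit-mono {true} h rewrite h refl = ℕₚ.≤-refl

  mean-mono : ∀ s {K L} → K ⊆ L → mean s K ≤ mean s L
  mean-mono s {K} {L} h = subst (mean s K ≤_) (trans (cong (mean s L +_) (mean-empty s)) (+-identityʳ _))
    (mean-≤+ s K L empty (λ α → ℕₚ.≤-trans (bit-mono (h α)) (ℕₚ.m≤m+n _ _)))

  mean-∪ : ∀ s K L → mean s (K ∪ L) ≤ mean s K + mean s L
  mean-∪ s K L = mean-≤+ s (K ∪ L) K L λ α → lemma (mem K α) (mem L α)
    where
    lemma : ∀ a b → bit (a ∨ b) ℕ.≤ bit a ℕ.+ bit b
    lemma true b = ℕ.s≤s ℕ.z≤n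
    lemma false b = ℕₚ.≤-refl

  mean-split : ∀ s K L → mean s (K ∩ L) + mean s (K ∩ ∼ L) ≤ mean s K
  mean-split s K L = mean-+≤ s K (K ∩ L) (K ∩ ∼ L) λ α → lemma (mem K α) (mem L α)
    where
    lemma : ∀ a b → bit (a ∧ b) ℕ.+ bit (a ∧ not b) ℕ.≤ bit a
    lemma true true = ℕₚ.≤-refl
    lemma true false = ℕₚ.≤-refl
    lemma false b = ℕ.z≤n

  Eventually : (ℕ → Set) → Set
  Eventually P = ∃[ N ] ∀ n → N ℕ.≤ n → P n

  always : ∀ {P : ℕ → Set} → (∀ n → P n) → Eventually P
  always h = 0 , λ n _ → h n

  ev-map : ∀ {P Q : ℕ → Set} → (∀ n → P n → Q n) → Eventually P → Eventually Q
  ev-map f (N , h) = N , λ n N≤n → f n (h n N≤n)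

  ev-map₂ : ∀ {P Q R : ℕ → Set} → (∀ n → P n → Q n → R n) → Eventually P → Eventually Q → Eventually R
  ev-map₂ f (N , h) (M , g) = N ℕ.+ M , λ n ≤n →
    f n (h n (ℕₚ.≤-trans (ℕₚ.m≤m+n N M) ≤n)) (g n (ℕₚ.≤-trans (ℕₚ.m≤n+m M N) ≤n))

  ev-witness : ∀ {P : ℕ → Set} → Eventually P → ∃ P
  ev-witness (N , h) = N , h N ℕₚ.≤-refl

  total : (ℕ → ℚ) → ℕ → ℚ
  total r zero = 0ℚ
  total r (suc n) = total r n + r n

  total-shift : ∀ r n → total r (suc n) ≡ r 0 + total (r ∘ suc) n
  total-shift r zero = +-comm 0ℚ (r 0)
  total-shift r (suc n) = trans (cong (_+ r (suc n)) (total-shift r n)) (+-assoc (r 0) (total (r ∘ suc) n) (r (suc n)))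

  total-mono : ∀ {r s} n → (∀ i → i ℕ.< n → r i ≤ s i) → total r n ≤ total s n
  total-mono zero h = ≤-refl
  total-mono (suc n) h = +-mono-≤ (total-mono n (λ i i< → h i (ℕₚ.m<n⇒m<1+n i<))) (h n ℕₚ.≤-refl)

  total-+ : ∀ r s n → total (λ i → r i + s i) n ≡ total r n + total s n
  total-+ r s zero = refl
  total-+ r s (suc n) = trans (cong (_+ (r n + s n)) (total-+ r s n)) (swap (total r n) (total s n) (r n) (s n))
    where
    swap : ∀ a b c d → a + b + (c + d) ≡ a + c + (b + d)
    swap = solve-∀ ℚ-ring

  total-increasing : ∀ {r} → (∀ i → 0ℚ ≤ r i) → ∀ {m n} → m ℕ.≤ n → total r m ≤ total r n
  total-increasing {r} h {m} {n} m≤n = go (ℕₚ.≤⇒≤′ m≤n)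
    where
    go : ∀ {n} → m ℕ.≤′ n → total r m ≤ total r n
    go ℕ.≤′-refl = ≤-refl
    go (ℕ.≤′-step {n} p) = ≤-trans (go p) (subst (_≤ total r n + r n) (+-identityʳ _) (+-monoʳ-≤ (total r n) (h n)))

  geometric : ℚ → ℕ → ℚ
  geometric c zero = half c
  geometric c (suc i) = half (geometric c i)

  geometric>0 : ∀ {c} → 0ℚ < c → ∀ i → 0ℚ < geometric c i
  geometric>0 h zero = half>0 h
  geometric>0 h (suc i) = half>0 (geometric>0 h i)

  total-geometric : ∀ {c} → 0ℚ < c → ∀ n → total (geometric c) n ≤ c
  total-geometric {c} h zero = <⇒≤ h
  total-geometric {c} h (suc n) = subst (_≤ c) (sym (total-shift (geometric c) n))
    (≤-trans (+-monoʳ-≤ (half c) (≤-trans (≤-reflexive (total-cong n)) (total-geometric (half>0 h) n)))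
      (≤-reflexive (half+half c)))
    where
    geometric-half : ∀ i → geometric c (suc i) ≡ geometric (half c) i
    geometric-half zero = refl
    geometric-half (suc i) = cong half (geometric-half i)
    total-cong : ∀ n → total (geometric c ∘ suc) n ≡ total (geometric (half c)) n
    total-cong zero = refl
    total-cong (suc n) = cong₂ _+_ (total-cong n) (geometric-half n)

  module Limits (em : ExcludedMiddle 0ℓ) where

    open Classical em

    opaque
     -- König's lemma: a string is bad if no stage covers the part of `K` in its cylinder. A bad
     -- string has a bad child, which yields a branch through bad strings. The branch lies in `K`,
     -- hence in some stage, which by its modulus contains a whole cylinder along the branch.
     compactness : ∀ (V : ℕ → Clopen) → (∀ k → V k ⊆ V (suc k)) → ∀ K →
       (∀ α → K ∋ α → ∃[ k ] V k ∋ α) → ∃[ k ] K ⊆ V k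
     compactness V V-mono K cover = decidable-stable em λ ¬sub →
       let open Search ¬sub in contradiction
       where
       V-mono* : ∀ {m n} → m ℕ.≤ n → V m ⊆ V n
       V-mono* m≤n = go (ℕₚ.≤⇒≤′ m≤n)
         where
         go : ∀ {m n} → m ℕ.≤′ n → V m ⊆ V n
         go ℕ.≤′-refl α e = e
         go (ℕ.≤′-step p) α e = V-mono _ α (go p α e)

       Bad : String → Set
       Bad σ = ∀ k → ∃[ α ] ([ σ ]ᶜ ∋ α × K ∋ α × ¬ V k ∋ α)

       step : ∀ σ → Bad σ → ∃[ b ] Bad (σ ∷ʳ b)
       step σ bad with em {Bad (σ ^0)} | em {Bad (σ ^1)}
       ... | yes b | _ = false , b
       ... | no _ | yes b = true , b
       ... | no ¬b₀ | no ¬b₁ with ¬∀⇒∃¬ ¬b₀ | ¬∀⇒∃¬ ¬b₁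
       ...   | k₀ , none₀ | k₁ , none₁ with bad (k₀ ℕ.+ k₁)
       ...     | α , inσ , inK , out with α (length σ) | inCylinder-extend σ inσ
       ...       | false | inσ′ = ⊥-elim (none₀ (α , inσ′ , inK , λ e → out (V-mono* (ℕₚ.m≤m+n k₀ k₁) α e)))
       ...       | true  | inσ′ = ⊥-elim (none₁ (α , inσ′ , inK , λ e → out (V-mono* (ℕₚ.m≤n+m k₁ k₀) α e)))

       module Search (¬sub : ¬ (∃[ k ] K ⊆ V k)) where
         node : ℕ → Σ String Bad
         node zero = [] , λ k → let (α , h) = ¬∀⇒∃¬ (λ sub → ¬sub (k , sub)) in
           α , refl , decidable-stable (_ Boolₚ.≟ true) (λ ∉K → h (⊥-elim ∘ ∉K)) , λ e → h (λ _ → e)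
         node (suc n) = let (b , bad) = step (proj₁ (node n)) (proj₂ (node n)) in proj₁ (node n) ∷ʳ b , bad

         branch : ℕ → Bool
         branch n = proj₁ (step (proj₁ (node n)) (proj₂ (node n)))

         node-length : ∀ n → length (proj₁ (node n)) ≡ n
         node-length zero = refl
         node-length (suc n) = trans (length-++ (proj₁ (node n)) {branch n ∷ []}) (trans (ℕₚ.+-comm _ 1) (cong suc (node-length n)))

         node-agree : ∀ n {γ} → [ proj₁ (node n) ]ᶜ ∋ γ → Agree n branch γ
         node-agree (suc n) {γ} e i i< with inCylinder-∷ʳ (proj₁ (node n)) (branch n) e | ℕₚ.m≤n⇒m<n∨m≡n (ℕₚ.≤-pred i<)
         ... | e′ , _ | inj₁ i<n = node-agree n e′ i i<n
         ... | _ , eb | inj₂ refl = trans (sym eb) (cong γ (node-length i))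

         contradiction : ⊥
         contradiction =
           let (n , n-mod) = modulus K
               (γ , inσ , inK , _) = proj₂ (node n) 0
               (k , inV) = cover branch (trans (n-mod branch γ (node-agree n inσ)) inK)
               (m , m-mod) = modulus (V k)
               (δ , inσ′ , _ , out) = proj₂ (node m) k
           in out (trans (sym (m-mod branch δ (node-agree m inσ′))) inV)

     -- A substitute for the infimum of an upward closed set, accurate to `δ`: a descent from `b` in
     -- steps of `δ` has to leave the set by the time it reaches `a`.
     gap : (P : ℚ → Set) → (∀ {r s} → r ≤ s → P r → P s) → ∀ {a b δ} → P b → ¬ P a → 0ℚ < δ →
       ∃[ r ] (¬ P r × P (r + δ))
     gap P up {a} {b} {δ} Pb ¬Pa δ>0 = let (n , h) = archimedes (b - a) δ>0 in go n b Pb (lin≤ (move a b (ι n * δ)) h)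
       where
       move : ∀ a b c → a - (b - c) ≡ c - (b - a)
       move = solve-∀ ℚ-ring
       regroup : ∀ b δ → b - δ + δ ≡ b
       regroup = solve-∀ ℚ-ring
       expand : ∀ b x δ → b - (1ℚ + x) * δ ≡ b - δ - x * δ
       expand = solve-∀ ℚ-ring
       go : ∀ n b → P b → b - ι n * δ ≤ a → ∃[ r ] (¬ P r × P (r + δ))
       go zero b Pb h = ⊥-elim (¬Pa (up (subst (_≤ a) (trans (cong (λ x → b - x * δ) ι0) (trans (cong (λ x → b - x) (*-zeroˡ δ)) (+-identityʳ b))) h) Pb))
       go (suc n) b Pb h with em {P (b - δ)}
       ... | yes P′ = go n (b - δ) P′ (subst (_≤ a) (trans (cong (λ x → b - x * δ) (trans (ι-+ 1 n) (cong (_+ ι n) ι1))) (expand b (ι n) δ)) h)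
       ... | no ¬P = b - δ , ¬P , subst P (sym (regroup b δ)) Pb

-- Carathéodory's extension by way of approximation by clopen sets

module CaratheodoryExtension where

  open import Defs renaming (_+_ to _+ʳ_; _≤_ to _≤ʳ_; _<_ to _<ʳ_; _≈_ to _≈ʳ_)
  open import Axiom.ExcludedMiddle using (ExcludedMiddle)
  open import Data.Bool using (true)
  import Data.Bool.Properties as Boolₚ
  open import Data.Empty using (⊥-elim)
  open import Data.Fin using (zero; suc)
  open import Data.List using ([])
  open import Data.Nat as ℕ using (ℕ; zero; suc)
  import Data.Nat.Properties as ℕₚ
  open import Data.Product using (Σ; Σ-syntax; ∃; ∃-syntax; _×_; _,_; proj₁; proj₂)
  open import Data.Rational
  open import Data.Rational.Properties hiding (_≟_)
  open import Data.Sum using (_⊎_; inj₁; inj₂; [_,_]′)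
  open import Function using (_∘_; id)
  open import Level using (0ℓ)
  open import Relation.Binary.PropositionalEquality
  open import Relation.Nullary using (¬_; yes; no)
  open import Relation.Nullary.Decidable using (decidable-stable)
  open import Relation.Unary using (Pred)
  open import Tactic.RingSolver using (solve-∀)
  open RationalArithmetic
  open ClopenSets
  open ScarfLemma using (module Classical)

  module Extension (em : ExcludedMiddle 0ℓ) (X : ℕ → Sample)
    (decided : ∀ K r → Eventually (λ n → mean (X n) K ≤ r) ⊎ Eventually (λ n → r < mean (X n) K)) where

    open Classical em
    open Limits em

    infix 4 _≲_

    -- The limit of the means is handled only through comparisons with rationals, each of which
    -- `decided` settles from some index on.
    _≲_ : Clopen → ℚ → Set
    K ≲ r = Eventually (λ n → mean (X n) K ≤ r)

    ≲-⊆ : ∀ {K L r} → K ⊆ L → L ≲ r → K ≲ r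
    ≲-⊆ {K} {L} h = ev-map (λ n → ≤-trans (mean-mono (X n) {K} {L} h))

    ≲-up : ∀ {K r s} → r ≤ s → K ≲ r → K ≲ s
    ≲-up r≤s = ev-map (λ n h → ≤-trans h r≤s)

    ≲-∪ : ∀ {K L r s} → K ≲ r → L ≲ s → K ∪ L ≲ r + s
    ≲-∪ {K} {L} = ev-map₂ (λ n h h′ → ≤-trans (mean-∪ (X n) K L) (+-mono-≤ h h′))

    ≲⇒≥0 : ∀ {K r} → K ≲ r → 0ℚ ≤ r
    ≲⇒≥0 {K} h = let (n , h′) = ev-witness h in ≤-trans (mean≥0 (X n) K) h′

    empty≲0 : empty ≲ 0ℚ
    empty≲0 = always (λ n → ≤-reflexive (mean-empty (X n)))

    full≲1 : full ≲ 1ℚ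
    full≲1 = always (λ n → ≤-reflexive (mean-full (X n)))

    full≲⇒ : ∀ {r} → full ≲ r → 1ℚ ≤ r
    full≲⇒ h = let (n , h′) = ev-witness h in ≤-trans (≤-reflexive (sym (mean-full (X n)))) h′

    ¬≲⇒> : ∀ {K r} → ¬ K ≲ r → Eventually (λ n → r < mean (X n) K)
    ¬≲⇒> {K} {r} h = [ ⊥-elim ∘ h , id ]′ (decided K r)

    >⇒¬≲ : ∀ {K r} → Eventually (λ n → r < mean (X n) K) → ¬ K ≲ r
    >⇒¬≲ h h′ = let (n , g , g′) = ev-witness (ev-map₂ (λ n a b → a , b) h h′) in <⇒≱ g g′

    -- Outer measure at most `r`: an open cover exhausted by clopen stages. The stages replace
    -- infinite sums of cylinder masses.
    record Out (A : Pred Cantor 0ℓ) (r : ℚ) : Set where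
      field
        stage      : ℕ → Clopen
        increasing : ∀ k → stage k ⊆ stage (suc k)
        covers     : ∀ α → A α → ∃[ k ] stage k ∋ α
        mass       : ∀ k → stage k ≲ r

      increasing* : ∀ {m n} → m ℕ.≤ n → stage m ⊆ stage n
      increasing* m≤n = go (ℕₚ.≤⇒≤′ m≤n)
        where
        go : ∀ {m n} → m ℕ.≤′ n → stage m ⊆ stage n
        go ℕ.≤′-refl α e = e
        go (ℕ.≤′-step p) α e = increasing _ α (go p α e)

    open Out

    out-up : ∀ {A r s} → r ≤ s → Out A r → Out A s
    out-up r≤s O = record
      { stage = stage O ; increasing = increasing O ; covers = covers O ; mass = λ k → ≲-up {stage O k} r≤s (mass O k) }

    out-sub : ∀ {A B r} → (∀ α → B α → A α) → Out A r → Out B r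
    out-sub h O = record
      { stage = stage O ; increasing = increasing O ; covers = λ α b → covers O α (h α b) ; mass = mass O }

    out-clopen : ∀ {K r} → K ≲ r → Out (K ∋_) r
    out-clopen {K} h = record
      { stage = λ _ → K ; increasing = λ _ _ → id ; covers = λ α e → 0 , e ; mass = λ _ → h }

    -- By compactness one stage already contains `K`. This is why the outer measure extends the
    -- limit of the means.
    out-compact : ∀ {A r K} → Out A r → (∀ α → K ∋ α → A α) → K ≲ r
    out-compact {A} {r} {K} O h =
      let (k , sub) = compactness (stage O) (increasing O) K (λ α e → covers O α (h α e))
      in ≲-⊆ {K} {stage O k} sub (mass O k)

    out≥0 : ∀ {A r} → Out A r → 0ℚ ≤ r
    out≥0 O = ≲⇒≥0 {stage O 0} (mass O 0)

    out-1 : ∀ {A} → Out A 1ℚ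
    out-1 = out-sub {full ∋_} (λ _ _ → refl) (out-clopen full≲1)

    ¬out-neg : ∀ {A r} → r < 0ℚ → ¬ Out A r
    ¬out-neg r<0 O = <⇒≱ r<0 (out≥0 O)

    out-∪ : ∀ {A B r s} → Out A r → Out B s → Out (λ α → A α ⊎ B α) (r + s)
    out-∪ {A} {B} O P = record
      { stage = λ k → stage O k ∪ stage P k
      ; increasing = λ k α e → [ ∪-introˡ (stage O (suc k)) (stage P (suc k)) α ∘ increasing O k α
                               , ∪-introʳ (stage O (suc k)) (stage P (suc k)) α ∘ increasing P k α ]′
                               (∪-elim (stage O k) (stage P k) e)
      ; covers = λ { α (inj₁ a) → let (k , e) = covers O α a in k , ∪-introˡ (stage O k) (stage P k) α e
                   ; α (inj₂ b) → let (k , e) = covers P α b in k , ∪-introʳ (stage O k) (stage P k) α e }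
      ; mass = λ k → ≲-∪ {stage O k} {stage P k} (mass O k) (mass P k) }

    out-∩ : ∀ {A r} (K : Clopen) (O : Out A r) {s} → (∀ k → stage O k ∩ K ≲ s) → Out (λ α → A α × K ∋ α) s
    out-∩ K O h = record
      { stage = λ k → stage O k ∩ K
      ; increasing = λ k α e → let (a , b) = ∩-elim (stage O k) K e in ∩-intro (stage O (suc k)) K (increasing O k α a) b
      ; covers = λ α (a , b) → let (k , e) = covers O α a in k , ∩-intro (stage O k) K e b
      ; mass = h }

    unions : (ℕ → Clopen) → ℕ → Clopen
    unions K zero = empty
    unions K (suc n) = unions K n ∪ K n

    ∈-unions : ∀ K {i n α} → i ℕ.< n → K i ∋ α → unions K n ∋ α
    ∈-unions K {i} {suc n} {α} i<n e with ℕₚ.m≤n⇒m<n∨m≡n (ℕₚ.≤-pred i<n)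
    ... | inj₁ i<n′ = ∪-introˡ (unions K n) (K n) α (∈-unions K i<n′ e)
    ... | inj₂ refl = ∪-introʳ (unions K n) (K n) α e

    unions-∈ : ∀ K n {α} → unions K n ∋ α → ∃[ i ] (i ℕ.< n × K i ∋ α)
    unions-∈ K (suc n) {α} e with ∪-elim (unions K n) (K n) e
    ... | inj₁ e′ = let (i , i<n , h) = unions-∈ K n e′ in i , ℕₚ.m<n⇒m<1+n i<n , h
    ... | inj₂ h = n , ℕₚ.≤-refl , h

    unions-≲ : ∀ K {r} n → (∀ i → K i ≲ r i) → unions K n ≲ total r n
    unions-≲ K zero h = empty≲0
    unions-≲ K (suc n) h = ≲-∪ {unions K n} {K n} (unions-≲ K n h) (h n)

    unions-increasing : ∀ K {m n} → m ℕ.≤ n → unions K m ⊆ unions K n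
    unions-increasing K {m} m≤n α e =
      let (i , i<m , h) = unions-∈ K m e in ∈-unions K (ℕₚ.<-≤-trans i<m m≤n) h

    -- The stages are diagonal: stage `k` joins the `k`-th stages of the first `k` covers and so
    -- remains clopen.
    out-⋃ : ∀ {A : ℕ → Pred Cantor 0ℓ} {r s} → (∀ i → Out (A i) (r i)) → (∀ n → total r n ≤ s) →
      Out (λ α → ∃[ i ] A i α) s
    out-⋃ O h = record
      { stage = V
      ; increasing = λ k α e → let (i , i<k , e′) = unions-∈ (λ i → stage (O i) k) k e
                               in ∈-unions (λ i → stage (O i) (suc k)) (ℕₚ.m<n⇒m<1+n i<k) (increasing (O i) k α e′)
      ; covers = λ α (i , a) → let (k , e) = covers (O i) α a
                               in suc i ℕ.+ k , ∈-unions (λ j → stage (O j) (suc i ℕ.+ k)) (ℕₚ.m≤m+n (suc i) k)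
                                    (increasing* (O i) (ℕₚ.m≤n+m k (suc i)) α e)
      ; mass = λ k → ≲-up {V k} (h k) (unions-≲ (λ i → stage (O i) k) k (λ i → mass (O i) k)) }
      where
      V : ℕ → Clopen
      V k = unions (λ i → stage (O i) k) k

    Differ : Pred Cantor 0ℓ → Clopen → Pred Cantor 0ℓ
    Differ A K α = (A α × ¬ K ∋ α) ⊎ (¬ A α × K ∋ α)

    -- Measurability in the spirit of Littlewood's principle: the set is clopen up to arbitrarily
    -- small outer measure.
    Approximable : Pred Cantor 0ℓ → Set
    Approximable A = ∀ {ε} → 0ℚ < ε → ∃[ K ] Out (Differ A K) ε

    approximable-∁ : ∀ {A} → Approximable A → Approximable (λ α → ¬ A α)
    approximable-∁ {A} app ε>0 = let (K , O) = app ε>0 in ∼ K , out-sub (λ α →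
      λ { (inj₁ (¬a , ¬k)) → inj₂ (¬a , decidable-stable (_ Boolₚ.≟ true) (λ k → ¬k (∼-intro K k)))
        ; (inj₂ (¬¬a , k)) → inj₁ (decidable-stable em ¬¬a , ∼-elim K k) }) O

    approximable-cylinder : ∀ σ → Approximable ⟦ cylinder σ ⟧
    approximable-cylinder σ ε>0 = [ σ ]ᶜ , out-sub
      (λ α → λ { (inj₁ (a , ¬k)) → ⊥-elim (¬k (cylinder⇒ σ a)) ; (inj₂ (¬a , k)) → ⊥-elim (¬a (cylinder⇐ σ k)) })
      (out-up (<⇒≤ ε>0) (out-clopen {empty} empty≲0))

    private
      middle : ∀ {qn qkn qn′ d d′ r e} → qn′ + d′ ≤ qkn → r < qn → qkn ≤ r + e → qn ≤ qn′ → d ≤ d′ → d ≤ e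
      middle {qn} {qkn} {qn′} {d} {d′} {r} {e} a b c f g =
        lin≤³ (eq qn′ d d′ r e) (≤-trans a c) (≤-trans (<⇒≤ b) f) g
        where
        eq : ∀ qn′ d d′ r e → e - d ≡ (r + e - (qn′ + d′)) + ((qn′ - r) + (d′ - d))
        eq = solve-∀ ℚ-ring

    difference-≲ : ∀ {V W L r η} → ¬ W ∩ L ≲ r → V ≲ r + η → W ⊆ V → V ∩ ∼ L ≲ η
    difference-≲ {V} {W} {L} W≰ V≤ W⊆V = ev-map₂ (λ n above below →
        middle (mean-split (X n) V L) above below
          (mean-mono (X n) {W ∩ L} {V ∩ L} (λ α e → let (a , b) = ∩-elim W L e in ∩-intro V L (W⊆V α a) b)) ≤-refl)
      (¬≲⇒> {W ∩ L} W≰) V≤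

    module _ (K : ℕ → Clopen) where
      outside-stage : ∀ {N r η} → ¬ unions K N ≲ r → (∀ n → unions K n ≲ r + η) →
        Out (λ α → ∃[ k ] (unions K k ∩ ∼ unions K N ∋ α)) η
      outside-stage {N} {r} {η} N≰ all≤ = record
        { stage = λ k → Q k ∩ ∼ Q N
        ; increasing = λ k α e → let (a , b) = ∩-elim (Q k) (∼ Q N) e in
            ∩-intro (Q (suc k)) (∼ Q N) (∪-introˡ (Q k) (K k) α a) b
        ; covers = λ α c → c
        ; mass = λ k → ≲-⊆ {Q k ∩ ∼ Q N} {Q (k ℕ.+ N) ∩ ∼ Q N}
            (λ α e → let (a , b) = ∩-elim (Q k) (∼ Q N) e in
              ∩-intro (Q (k ℕ.+ N)) (∼ Q N) (unions-increasing K (ℕₚ.m≤m+n k N) α a) b)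
            (difference-≲ {Q (k ℕ.+ N)} {Q (k ℕ.+ N)} {Q N}
              (λ h → N≰ (≲-⊆ {Q N} {Q (k ℕ.+ N) ∩ Q N}
                (λ α e → ∩-intro (Q (k ℕ.+ N)) (Q N) (unions-increasing K (ℕₚ.m≤n+m N k) α e) e) h))
              (all≤ (k ℕ.+ N)) (λ _ → id)) }
        where
        Q = unions K

      -- The masses of the finite unions are bounded by 1, so some union comes within `η` of their
      -- supremum; whatever later unions add to it has mass at most `η`.
      exhausting-stage : ∀ {η} → 0ℚ < η → ∃[ N ] Out (λ α → ∃[ k ] (unions K k ∩ ∼ unions K N ∋ α)) η
      exhausting-stage {η} η>0 =
        let (r , ¬P , Pη) = gap (λ r → ∀ n → unions K n ≲ r) (λ r≤s p n → ≲-up {unions K n} r≤s (p n))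
              (λ n → ≲-⊆ {unions K n} {full} (λ _ _ → refl) full≲1)
              (λ p → <⇒≱ -1<0 (≲⇒≥0 {unions K 0} (p 0))) η>0
            (N , N≰) = ¬∀⇒∃¬ ¬P
        in N , outside-stage N≰ Pη

      union-difference : ∀ {A : ℕ → Pred Cantor 0ℓ} {N} α → Differ (λ α → ∃[ i ] A i α) (unions K N) α →
        (∃[ i ] Differ (A i) (K i) α) ⊎ (∃[ k ] (unions K k ∩ ∼ unions K N ∋ α))
      union-difference {N = N} α (inj₂ (¬a , inQ)) =
        let (i , _ , k) = unions-∈ K N inQ in inj₁ (i , inj₂ ((λ a → ¬a (i , a)) , k))
      union-difference {N = N} α (inj₁ ((i , a) , ¬q)) with mem (K i) α Boolₚ.≟ true
      ... | yes e = inj₂ (suc i , ∩-intro (unions K (suc i)) (∼ unions K N) (∪-introʳ (unions K i) (K i) α e) (∼-intro (unions K N) ¬q))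
      ... | no ¬e = inj₁ (i , inj₁ (a , ¬e))

    -- Half of `ε` is shared geometrically among the errors for the single sets; the other half pays
    -- for truncating the union of the approximations.
    approximable-⋃ : ∀ {A : ℕ → Pred Cantor 0ℓ} → (∀ i → Approximable (A i)) → Approximable (λ α → ∃[ i ] A i α)
    approximable-⋃ {A} app {ε} ε>0 =
      let h>0 = half>0 ε>0
          (N , tail) = exhausting-stage K h>0
          errors = out-⋃ {A = λ i → Differ (A i) (K i)} (λ i → proj₂ (app i (geometric>0 h>0 i))) (total-geometric h>0)
      in unions K N , out-up (≤-reflexive (half+half ε)) (out-sub (union-difference K {A} {N}) (out-∪ errors tail))
      where
      K : ℕ → Clopen
      K i = proj₁ (app i (geometric>0 (half>0 ε>0) i))

    approximable : ∀ B → Approximable ⟦ B ⟧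
    approximable (cylinder σ) = approximable-cylinder σ
    approximable (∁ B) = approximable-∁ (approximable B)
    approximable (⋃ B) = approximable-⋃ (λ i → approximable (B i))

    module _ {A B : Pred Cantor 0ℓ} {K : Clopen} {η r s : ℚ} (D : Out (Differ A K) η) (O : Out B r) where
      private
        V = stage O

      split-by : ¬ (∀ k → V k ∩ K ≲ s) → (∀ k → V k ∩ K ≲ s + η) →
        Out (λ α → A α × B α) (s + η + η) × Out (λ α → ¬ A α × B α) (r - s + η)
      split-by ¬P Pη =
        out-sub (λ α (a , b) → inside α a b) (out-∪ (out-∩ K O Pη) D) ,
        out-sub (λ α (¬a , b) → outside α ¬a b) (out-∪ (out-∩ (∼ K) O (λ k → rest k (¬∀⇒∃¬ ¬P))) D)
        where
        regroup : ∀ r s → r ≡ s + (r - s)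
        regroup = solve-∀ ℚ-ring

        rest : ∀ k → ∃[ k₀ ] ¬ V k₀ ∩ K ≲ s → V k ∩ ∼ K ≲ r - s
        rest k (k₀ , ¬≲) = ≲-⊆ {V k ∩ ∼ K} {V (k ℕ.+ k₀) ∩ ∼ K}
          (λ α e → let (a , b) = ∩-elim (V k) (∼ K) e in
            ∩-intro (V (k ℕ.+ k₀)) (∼ K) (increasing* O (ℕₚ.m≤m+n k k₀) α a) b)
          (difference-≲ {V (k ℕ.+ k₀)} {V k₀} {K} ¬≲ (≲-up {V (k ℕ.+ k₀)} (≤-reflexive (regroup r s)) (mass O (k ℕ.+ k₀)))
            (increasing* O (ℕₚ.m≤n+m k₀ k)))

        inside : ∀ α → A α → B α → (B α × K ∋ α) ⊎ Differ A K α
        inside α a b with mem K α Boolₚ.≟ true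
        ... | yes e = inj₁ (b , e)
        ... | no ¬e = inj₂ (inj₁ (a , ¬e))

        outside : ∀ α → ¬ A α → B α → (B α × ∼ K ∋ α) ⊎ Differ A K α
        outside α ¬a b with mem K α Boolₚ.≟ true
        ... | yes e = inj₂ (inj₂ (¬a , e))
        ... | no ¬e = inj₁ (b , ∼-intro K ¬e)

    opaque
      -- A cover of `B` is cut along a clopen `K` close to `A`. One `η` is lost to the choice of
      -- `s`, and one on either side to the difference of `A` and `K`; with `η` a quarter of `δ`
      -- this stays within the tolerance.
      carathéodory : ∀ {A B r δ} → Approximable A → Out B r → 0ℚ < δ →
        ∃[ s ] ∃[ t ] (Out (λ α → A α × B α) s × Out (λ α → ¬ A α × B α) t × s + t ≤ r + δ)
      carathéodory {A} {B} {r} {δ} app O δ>0 =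
        let η = half (half δ)
            η>0 = half>0 (half>0 δ>0)
            (K , D) = app η>0
            (s , ¬P , Pη) = gap (λ s → ∀ k → stage O k ∩ K ≲ s) (λ r≤s p k → ≲-up {stage O k ∩ K} r≤s (p k))
              (λ k → ≲-⊆ {stage O k ∩ K} {stage O k} (λ α e → proj₁ (∩-elim (stage O k) K e)) (mass O k))
              (λ p → <⇒≱ -1<0 (≲⇒≥0 {stage O 0 ∩ K} (p 0))) η>0
            (Os , Ot) = split-by {A} {B} {K} {η} {r} {s} D O ¬P Pη
        in s + η + η , r - s + η , Os , Ot ,
           lin≤ (eq r s η δ (trans (cong₂ _+_ (half+half (half δ)) (half+half (half δ))) (half+half δ))) (<⇒≤ η>0)
        where
        eq : ∀ r s η δ → η + η + (η + η) ≡ δ → r + δ - (s + η + η + (r - s + η)) ≡ η - 0ℚ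
        eq r s η δ refl = ring r s η
          where
          ring : ∀ r s η → r + (η + η + (η + η)) - (s + η + η + (r - s + η)) ≡ η - 0ℚ
          ring = solve-∀ ℚ-ring

    Disjoint : (ℕ → Pred Cantor 0ℓ) → Set
    Disjoint A = ∀ {m n} → m ≢ n → ∀ α → ¬ (A m α × A n α)

    prepend : ℚ → (ℕ → ℚ) → ℕ → ℚ
    prepend s u zero = s
    prepend s u (suc i) = u i

    split-step : ∀ {A : ℕ → Pred Cantor 0ℓ} {r δ s t u n} →
      Out (A 0) s → (∀ i → i ℕ.< n → Out (A (suc i)) (u i)) → s + t ≤ r + half δ → total u n ≤ t + half δ →
      (∀ i → i ℕ.< suc n → Out (A i) (prepend s u i)) × total (prepend s u) (suc n) ≤ r + δ
    split-step {A} {r} {δ} {s} {t} {u} {n} Os Ou st≤ u≤ = all , subst (_≤ r + δ) (sym (total-shift (prepend s u) n))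
      (lin≤² (eq s t (total u n) r δ (half δ) (half+half δ)) st≤ u≤)
      where
      all : ∀ i → i ℕ.< suc n → Out (A i) (prepend s u i)
      all zero _ = Os
      all (suc i) i< = Ou i (ℕₚ.≤-pred i<)
      eq : ∀ s t u r δ h → h + h ≡ δ → r + δ - (s + u) ≡ (r + h - (s + t)) + (t + h - u)
      eq s t u r δ h refl = ring s t u r h
        where
        ring : ∀ s t u r h → r + (h + h) - (s + u) ≡ (r + h - (s + t)) + (t + h - u)
        ring = solve-∀ ℚ-ring

    -- `A 0` is split off with half of the tolerance; by disjointness the other part of the cover
    -- still covers the remaining sets.
    split-finite : ∀ n (A : ℕ → Pred Cantor 0ℓ) → (∀ i → Approximable (A i)) → Disjoint A →
      ∀ {r δ} → Out (λ α → ∃[ i ] A i α) r → 0ℚ < δ →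
      Σ[ s ∈ (ℕ → ℚ) ] ((∀ i → i ℕ.< n → Out (A i) (s i)) × total s n ≤ r + δ)
    split-finite zero A app disj {r} {δ} O δ>0 =
      (λ _ → 0ℚ) , (λ _ ()) , ≤-trans (out≥0 O) (subst (_≤ r + δ) (+-identityʳ r) (+-monoʳ-≤ r (<⇒≤ δ>0)))
    split-finite (suc n) A app disj {r} {δ} O δ>0 with carathéodory {A 0} {_} {r} {half δ} (app 0) O (half>0 δ>0)
    ... | s , t , Os , Ot , st≤
        with split-finite n (λ i → A (suc i)) (λ i → app (suc i)) (λ m≢n → disj (m≢n ∘ ℕₚ.suc-injective))
               (out-sub (λ α (i , a) → (λ a₀ → disj {0} {suc i} (λ ()) α (a₀ , a)) , suc i , a) Ot) (half>0 δ>0)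
    ...   | u , Ou , u≤ = prepend s u , split-step {A} {r} {δ} {s} {t} {u} {n} (out-sub (λ α a → a , 0 , a) Os) Ou st≤ u≤

    outer : Pred Cantor 0ℓ → ℝ
    outer A = record
      { Below = λ q → ∃[ q′ ] (q < q′ × ¬ Out A q′)
      ; nonempty = - 1ℚ + - 1ℚ , - 1ℚ , subst (- 1ℚ + - 1ℚ <_) (+-identityʳ (- 1ℚ)) (+-monoʳ-< (- 1ℚ) -1<0) ,
                   ¬out-neg -1<0
      ; bounded = 1ℚ , λ (q , 1<q , ¬o) → ¬o (out-up (<⇒≤ 1<q) out-1)
      ; downward = λ p<q (q′ , q<q′ , ¬o) → q′ , <-trans p<q q<q′ , ¬o
      ; noMaximum = λ (q′ , p<q′ , ¬o) → let (m , p<m , m<q′) = <-dense p<q′ in m , p<m , q′ , m<q′ , ¬o }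

    out⇒¬below : ∀ {A r} → Out A r → ¬ ℝ.Below (outer A) r
    out⇒¬below O (q′ , r<q′ , ¬o) = ¬o (out-up (<⇒≤ r<q′) O)

    outer-mono : ∀ {A B} → (∀ α → A α → B α) → outer A ≤ʳ outer B
    outer-mono h (q′ , q<q′ , ¬o) = q′ , q<q′ , λ O → ¬o (out-sub h O)

    partial-upper : ∀ {A : ℕ → Pred Cantor 0ℓ} {r} n → (∀ i → i ℕ.< n → Out (A i) (r i)) →
      ¬ ℝ.Below (partialSum (λ i → outer (A i)) n) (total r n)
    partial-upper zero O b = <-irrefl refl b
    partial-upper {A} {r} (suc n) O (p , q , p∈ , q∈ , le) =
      <⇒≱ (+-mono-< (above (partialSum (λ i → outer (A i)) n) p∈ (partial-upper n (λ i i< → O i (ℕₚ.m<n⇒m<1+n i<))))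
            (above (outer (A n)) q∈ (out⇒¬below (O n ℕₚ.≤-refl)))) le

    partial-lower : ∀ {A : ℕ → Pred Cantor 0ℓ} {r} n → (∀ i → ¬ Out (A i) (r i)) → ∀ {q} → q < total r n →
      ℝ.Below (partialSum (λ i → outer (A i)) n) q
    partial-lower zero h q< = q<
    partial-lower {A} {r} (suc n) h {q} q< =
      total r n - t , r n - t , partial-lower n h (lin< (eq₁ (total r n) t) t>0) ,
      (r n , lin< (eq₁ (r n) t) t>0 , h n) , ≤-reflexive (eq₂ (total r n) (r n) t q (half+half (total r n + r n - q)))
      where
      t = half (total r n + r n - q)
      t>0 = half>0 (0<- q<)
      eq₁ : ∀ a t → a - (a - t) ≡ t - 0ℚ
      eq₁ = solve-∀ ℚ-ring
      eq₂ : ∀ a b t q → t + t ≡ a + b - q → q ≡ a - t + (b - t)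
      eq₂ a b t q e = trans (ring₁ a b q) (trans (cong (λ x → a + b - x) (sym e)) (ring₂ a b t))
        where
        ring₁ : ∀ a b q → q ≡ a + b - (a + b - q)
        ring₁ = solve-∀ ℚ-ring
        ring₂ : ∀ a b t → a + b - (t + t) ≡ a - t + (b - t)
        ring₂ = solve-∀ ℚ-ring

    near : ∀ A {δ} → 0ℚ < δ → ∃[ r ] (¬ Out A r × Out A (r + δ))
    near A = gap (Out A) out-up out-1 (¬out-neg -1<0)

    module _ {A : ℕ → Pred Cantor 0ℓ} (app : ∀ i → Approximable (A i)) (disj : Disjoint A) where
      private
        U : Pred Cantor 0ℓ
        U α = ∃[ i ] A i α

      module _ {h : ℚ} (h>0 : 0ℚ < h) where

        private
          -- Eight times `h` leaves room for the errors in both directions.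
          ε = h + h + (h + h) + (h + h + (h + h))

        finite-≤ : ∀ n → partialSum (λ i → outer (A i)) n <ʳ outer U +ʳ fromℚ ε
        finite-≤ n =
          let (r , ¬o , O) = near U {h} h>0
              (s , Os , s≤) = split-finite n A app disj O h>0
          in r + h + h , (λ b → partial-upper n Os (below-≤ (partialSum (λ i → outer (A i)) n) s≤ b)) ,
             r - h , h + h + h + h , (r , lin< (eq₁ r h) h>0 , ¬o) ,
             lin<³ (eq₂ h) h>0 (<⇒≤ h>0) (<⇒≤ (+-mono-< h>0 h>0)) , lin≤ (eq₃ r h) (<⇒≤ h>0)
          where
          eq₁ : ∀ r h → r - (r - h) ≡ h - 0ℚ
          eq₁ = solve-∀ ℚ-ring
          eq₂ : ∀ h → h + h + (h + h) + (h + h + (h + h)) - (h + h + h + h) ≡ (h - 0ℚ) + ((h - 0ℚ) + ((h + h) - (0ℚ + 0ℚ)))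
          eq₂ = solve-∀ ℚ-ring
          eq₃ : ∀ r h → r - h + (h + h + h + h) - (r + h + h) ≡ h - 0ℚ
          eq₃ = solve-∀ ℚ-ring

        private
          e : ℕ → ℚ
          e = geometric h

          pick : ∀ i → ∃[ r ] (¬ Out (A i) r × Out (A i) (r + e i))
          pick i = near (A i) (geometric>0 h>0 i)

          r : ℕ → ℚ
          r i = proj₁ (pick i) + e i

          r≥0 : ∀ i → 0ℚ ≤ r i
          r≥0 i = out≥0 (proj₂ (proj₂ (pick i)))

          lower≡ : ∀ n → total (λ i → proj₁ (pick i)) n + total e n ≡ total r n
          lower≡ n = sym (total-+ (λ i → proj₁ (pick i)) e n)

          P : ℚ → Set
          P s = ∀ n → total r n ≤ s

          -- Disjointness keeps the totals bounded: covers of finitely many members, split off from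
          -- the whole space, have total mass at most 1 up to `h`, and the chosen masses exceed
          -- theirs by no more than the geometric errors.
          P-bound : P (1ℚ + h + h)
          P-bound n =
            let (s , Os , s≤) = split-finite n A app disj out-1 h>0
                low : total (λ i → proj₁ (pick i)) n ≤ total s n
                low = total-mono n (λ i i<n → ≮⇒≥ (λ s<p → proj₁ (proj₂ (pick i)) (out-up (<⇒≤ s<p) (Os i i<n))))
            in subst (_≤ 1ℚ + h + h) (lower≡ n) (+-mono-≤ (≤-trans low s≤) (total-geometric h>0 n))

          found : ∃[ s ] (¬ P s × P (s + h))
          found = gap P (λ r≤s p n → ≤-trans (p n) r≤s)  P-bound
            (λ p → <⇒≱ -1<0 (p 0)) h>0

        -- From some `N` on the totals of the cover masses `r i` are within `h` of their supremum.
        -- Joining the covers bounds the union by the supremum; the partial sums are bounded below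
        -- because covers smaller by `e i` do not exist.
        countable-≤ : ∃[ N ] ∀ n → N ℕ.≤ n → outer U <ʳ partialSum (λ i → outer (A i)) n +ʳ fromℚ ε
        countable-≤ =
          let (s , ¬P , Ps) = found
              (N , ¬le) = ¬∀⇒∃¬ ¬P
          in N , λ n N≤n → s + h , out⇒¬below (out-⋃ (λ i → proj₂ (proj₂ (pick i))) Ps) ,
               s - h , h + h ,
               partial-lower n (λ i → proj₁ (proj₂ (pick i)))
                 (lin<³ (eq₁ s h (total (λ i → proj₁ (pick i)) n) (total e n) (total r n) {total r N} (lower≡ n))
                   (≰⇒> ¬le) (total-increasing r≥0 N≤n) (total-geometric h>0 n)) ,
               lin<³ (eq₂ h) h>0 (<⇒≤ h>0) (<⇒≤ (+-mono-< (+-mono-< h>0 h>0) (+-mono-< h>0 h>0))) , ≤-reflexive (eq₃ s h)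
          where
          eq₁ : ∀ s h a b c {d} → a + b ≡ c → a - (s - h) ≡ (d - s) + ((c - d) + (h - b))
          eq₁ s h a b c {d} refl = ring s h a b d
            where
            ring : ∀ s h a b d → a - (s - h) ≡ (d - s) + ((a + b - d) + (h - b))
            ring = solve-∀ ℚ-ring
          eq₂ : ∀ h → h + h + (h + h) + (h + h + (h + h)) - (h + h) ≡ (h - 0ℚ) + ((h - 0ℚ) + ((h + h + (h + h)) - (0ℚ + 0ℚ + (0ℚ + 0ℚ))))
          eq₂ = solve-∀ ℚ-ring
          eq₃ : ∀ s h → s + h ≡ s - h + (h + h)
          eq₃ = solve-∀ ℚ-ring

      σ-additive : partialSum (λ i → outer (A i)) ConvergesTo outer U
      σ-additive ε ε>0 = subst (λ ε → ∃[ N ] ∀ n → N ℕ.≤ n →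
          (partialSum (λ i → outer (A i)) n <ʳ outer U +ʳ fromℚ ε) × (outer U <ʳ partialSum (λ i → outer (A i)) n +ʳ fromℚ ε))
        (trans (cong₂ _+_ (trans (cong₂ _+_ (half+half q) (half+half q)) (half+half (half ε)))
          (trans (cong₂ _+_ (half+half q) (half+half q)) (half+half (half ε)))) (half+half ε))
        (let (N , c) = countable-≤ h>0 in N , λ n N≤n → finite-≤ h>0 n , c n N≤n)
        where
        q = half (half ε)
        h>0 = half>0 (half>0 (half>0 ε>0))

    measure : ProbabilityMeasure
    measure = record
      { measure     = λ B → outer ⟦ B ⟧
      ; cong        = λ (A⊆B , B⊆A) → outer-mono (λ α → A⊆B) , outer-mono (λ α → B⊆A)
      ; nonnegative = λ B {q} q<0 → let (m , q<m , m<0) = <-dense q<0 in m , q<m , ¬out-neg m<0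
      ; total       = (λ (q′ , q<q′ , ¬o) → <-≤-trans q<q′ (≮⇒≥ (λ 1<q′ → ¬o (out-up (<⇒≤ 1<q′) out-1)))) ,
                      (λ {q} q<1 → let (m , q<m , m<1) = <-dense q<1 in m , q<m , λ O →
                         <⇒≱ m<1 (full≲⇒ (out-compact {K = full} O (λ α _ → refl))))
      ; σ-additive  = λ B disj → σ-additive (λ i → approximable (B i)) disj }

    measure-below⇒ : ∀ {σ q} → ℝ.Below (measure ⟨ σ ⟩) q → ∃[ q′ ] (q < q′ × Eventually (λ n → q′ < mean (X n) [ σ ]ᶜ))
    measure-below⇒ {σ} (q′ , q<q′ , ¬o) =
      q′ , q<q′ , ¬≲⇒> {[ σ ]ᶜ} (λ h → ¬o (out-sub (λ α → cylinder⇒ σ) (out-clopen {[ σ ]ᶜ} h)))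

    measure-below⇐ : ∀ {σ q q′} → q < q′ → Eventually (λ n → q′ < mean (X n) [ σ ]ᶜ) → ℝ.Below (measure ⟨ σ ⟩) q
    measure-below⇐ {σ} {q} {q′} q<q′ h = q′ , q<q′ , λ O →
      >⇒¬≲ {[ σ ]ᶜ} h (out-compact {K = [ σ ]ᶜ} O (λ α → cylinder⇐ σ))

-- Convergent subsequences of samples and their limit measures

module LimitMeasures where

  open import Defs renaming (_+_ to _+ʳ_; _≤_ to _≤ʳ_; _<_ to _<ʳ_; _≈_ to _≈ʳ_)
  open import Axiom.ExcludedMiddle using (ExcludedMiddle)
  open import Data.Bool using (Bool; true; false; _∧_; _∨_)
  import Data.Bool.Properties as Boolₚ
  open import Data.Empty using (⊥; ⊥-elim)
  open import Data.Integer using (+_; -[1+_])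
  open import Data.List using (List; []; _∷_; _++_; length; map)
  open import Data.Nat as ℕ using (ℕ; zero; suc)
  import Data.Nat.Properties as ℕₚ
  open import Data.Product using (Σ; Σ-syntax; ∃; ∃-syntax; _×_; _,_; proj₁; proj₂)
  open import Data.Rational
  open import Data.Rational.Properties hiding (_≟_)
  open import Data.Sum using (_⊎_; inj₁; inj₂; [_,_]′)
  open import Function using (_∘_)
  open import Level using (0ℓ)
  open import Relation.Binary.PropositionalEquality
  open import Relation.Nullary using (¬_; Dec; yes; no; does)
  open import Tactic.RingSolver using (solve-∀)
  open UniversalFunction using (odd≢even; pair-injective; ⟪⟫≢0)
  open SigmaOneFormulas using (⟪⟫≡pair)
  open RationalArithmetic
  open ClopenSets
  open CaratheodoryExtension
  open ScarfLemma using (module Classical)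

  Injective : ∀ {A : Set} → Coding A → Set
  Injective c = ∀ {a b} → c a ≡ c b → a ≡ b

  pair≢0 : ∀ a b → pair a b ≢ 0
  pair≢0 a b e = ⟪⟫≢0 (trans (⟪⟫≡pair a b) e)

  code-List-injective : ∀ {A : Set} {c : Coding A} → Injective c → Injective (code-List c)
  code-List-injective inj {[]} {[]} e = refl
  code-List-injective {c = c} inj {[]} {y ∷ ys} e = ⊥-elim (pair≢0 (c y) (code-List c ys) (sym e))
  code-List-injective {c = c} inj {x ∷ xs} {[]} e = ⊥-elim (pair≢0 (c x) (code-List c xs) e)
  code-List-injective {c = c} inj {x ∷ xs} {y ∷ ys} e =
    let (p , q) = pair-injective (c x) (code-List c xs) e in cong₂ _∷_ (inj p) (code-List-injective inj q)

  code-×-injective : ∀ {A B : Set} {c : Coding A} {d : Coding B} → Injective c → Injective d → Injective (code-× c d)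
  code-×-injective {c = c} {d} c-inj d-inj {a , b} e =
    let (p , q) = pair-injective (c a) (d b) e in cong₂ _,_ (c-inj p) (d-inj q)

  code-Bool-injective : Injective code-Bool
  code-Bool-injective {false} {false} e = refl
  code-Bool-injective {true} {true} e = refl

  code-ℤ-injective : Injective code-ℤ
  code-ℤ-injective {+ m} {+ n} e = cong +_ (ℕₚ.*-cancelˡ-≡ m n 2 e)
  code-ℤ-injective {+ m} { -[1+ n ]} e = ⊥-elim (odd≢even n m (sym e))
  code-ℤ-injective { -[1+ m ]} {+ n} e = ⊥-elim (odd≢even m n e)
  code-ℤ-injective { -[1+ m ]} { -[1+ n ]} e = cong -[1+_] (ℕₚ.*-cancelˡ-≡ m n 2 (ℕₚ.suc-injective e))

  code-ℚ-injective : Injective code-ℚ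
  code-ℚ-injective {p@(mkℚ n d c)} {q@(mkℚ n′ d′ c′)} e
    with pair-injective (code-ℤ n) d {code-ℤ n′} {d′} e
  ... | en , refl with refl ← code-ℤ-injective {n} {n′} en = refl

  code-String-injective : Injective code-String
  code-String-injective = code-List-injective code-Bool-injective

  cylinders : List String → Clopen
  cylinders [] = empty
  cylinders (σ ∷ ℓ) = [ σ ]ᶜ ∪ cylinders ℓ

  cylinders-++ : ∀ ℓ ℓ′ α → mem (cylinders (ℓ ++ ℓ′)) α ≡ mem (cylinders ℓ) α ∨ mem (cylinders ℓ′) α
  cylinders-++ [] ℓ′ α = refl
  cylinders-++ (σ ∷ ℓ) ℓ′ α = trans (cong (inCylinder σ α ∨_) (cylinders-++ ℓ ℓ′ α)) (sym (Boolₚ.∨-assoc (inCylinder σ α) _ _))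

  cylinders-map : ∀ b ℓ α → mem (cylinders (map (b ∷_) ℓ)) α ≡ does (α 0 Boolₚ.≟ b) ∧ mem (cylinders ℓ) (α ∘ suc)
  cylinders-map b [] α = sym (Boolₚ.∧-zeroʳ _)
  cylinders-map b (σ ∷ ℓ) α = trans (cong (inCylinder (b ∷ σ) α ∨_) (cylinders-map b ℓ α))
    (sym (Boolₚ.∧-distribˡ-∨ (does (α 0 Boolₚ.≟ b)) (inCylinder σ (α ∘ suc)) (mem (cylinders ℓ) (α ∘ suc))))

  infixr 5 _◂_
  _◂_ : Bool → Cantor → Cantor
  (b ◂ α) zero = b
  (b ◂ α) (suc i) = α i

  -- Hence clopen sets, though given by functions, are countable up to equality, and a diagonal
  -- argument can settle all comparisons of their means.
  finite-union : ∀ n (f : Cantor → Bool) → (∀ α β → Agree n α β → f α ≡ f β) →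
    ∃[ ℓ ] ∀ α → f α ≡ mem (cylinders ℓ) α
  finite-union zero f m with f (λ _ → false) in e
  ... | true  = ([] ∷ []) , λ α → trans (m α (λ _ → false) (λ _ ())) e
  ... | false = [] , λ α → trans (m α (λ _ → false) (λ _ ())) e
  finite-union (suc n) f m =
    let (ℓ₀ , h₀) = part false ; (ℓ₁ , h₁) = part true
    in map (false ∷_) ℓ₀ ++ map (true ∷_) ℓ₁ , λ α → trans (choose α ℓ₀ ℓ₁ h₀ h₁) (sym (trans
         (cylinders-++ (map (false ∷_) ℓ₀) (map (true ∷_) ℓ₁) α)
         (cong₂ _∨_ (cylinders-map false ℓ₀ α) (cylinders-map true ℓ₁ α))))
    where
    part : ∀ b → ∃[ ℓ ] ∀ α → f (b ◂ α) ≡ mem (cylinders ℓ) α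
    part b = finite-union n (λ α → f (b ◂ α)) λ α β a → m (b ◂ α) (b ◂ β)
      λ { zero _ → refl ; (suc i) i< → a i (ℕₚ.≤-pred i<) }
    split : ∀ α i → α i ≡ (α 0 ◂ (α ∘ suc)) i
    split α zero = refl
    split α (suc i) = refl
    choose : ∀ α ℓ₀ ℓ₁ → (∀ α → f (false ◂ α) ≡ mem (cylinders ℓ₀) α) → (∀ α → f (true ◂ α) ≡ mem (cylinders ℓ₁) α) →
      f α ≡ does (α 0 Boolₚ.≟ false) ∧ mem (cylinders ℓ₀) (α ∘ suc) ∨ does (α 0 Boolₚ.≟ true) ∧ mem (cylinders ℓ₁) (α ∘ suc)
    choose α ℓ₀ ℓ₁ h₀ h₁ with α 0 in e
    ... | false = trans (m α (false ◂ (α ∘ suc)) (λ { zero _ → e ; (suc i) _ → refl }))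
                    (trans (h₀ (α ∘ suc)) (sym (Boolₚ.∨-identityʳ _)))
    ... | true  = trans (m α (true ◂ (α ∘ suc)) (λ { zero _ → e ; (suc i) _ → refl })) (h₁ (α ∘ suc))

  module Subsequences (em : ExcludedMiddle 0ℓ) where

    open Classical em

    Infinite : (ℕ → Set) → Set
    Infinite Q = ∀ N → ∃[ n ] (N ℕ.≤ n × Q n)

    module _ (P : ℕ → ℕ → Set) where

      -- The diagonal method: at step `k` the infinite set of surviving indices is cut down to those
      -- where `P k` holds or, if these are finitely many, to those where it fails.
      stages : ℕ → Σ (ℕ → Set) Infinite
      refine : (k : ℕ) (Q : ℕ → Set) → Infinite Q → Dec (Infinite (λ n → Q n × P k n)) → Σ (ℕ → Set) Infinite

      stages zero = (λ _ → ℕ) , λ N → N , ℕₚ.≤-refl , N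
      stages (suc k) = refine k (proj₁ (stages k)) (proj₂ (stages k)) em

      refine k Q inf (yes inf′) = (λ n → Q n × P k n) , inf′
      refine k Q inf (no ¬inf) = (λ n → Q n × ¬ P k n) , λ N →
        let (M , none) = ¬∀⇒∃¬ ¬inf
            (n , le , q) = inf (N ℕ.+ M)
        in n , ℕₚ.≤-trans (ℕₚ.m≤m+n N M) le , q , λ p → none (n , ℕₚ.≤-trans (ℕₚ.m≤n+m M N) le , q , p)

      refine-⊆ : ∀ k Q inf d {n} → proj₁ (refine k Q inf d) n → Q n
      refine-⊆ k Q inf (yes _) = proj₁
      refine-⊆ k Q inf (no _) = proj₁

      refine-decides : ∀ k Q inf d → (∀ n → proj₁ (refine k Q inf d) n → P k n) ⊎ (∀ n → proj₁ (refine k Q inf d) n → ¬ P k n)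
      refine-decides k Q inf (yes _) = inj₁ (λ _ → proj₂)
      refine-decides k Q inf (no _) = inj₂ (λ _ → proj₂)

      stages-⊆ : ∀ {j k} → j ℕ.≤ k → ∀ {n} → proj₁ (stages k) n → proj₁ (stages j) n
      stages-⊆ {j} j≤k = go (ℕₚ.≤⇒≤′ j≤k)
        where
        go : ∀ {k} → j ℕ.≤′ k → ∀ {n} → proj₁ (stages k) n → proj₁ (stages j) n
        go ℕ.≤′-refl q = q
        go (ℕ.≤′-step {k} p) q = go p (refine-⊆ k (proj₁ (stages k)) (proj₂ (stages k)) em q)

      -- The terms are kept large only in the sense of `n ≤ diagonal n`, by which eventual
      -- properties of the original sequence carry over.
      diagonal : ℕ → ℕ
      diagonal n = proj₁ (proj₂ (stages n) n)

      diagonal≥ : ∀ n → n ℕ.≤ diagonal n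
      diagonal≥ n = proj₁ (proj₂ (proj₂ (stages n) n))

      diagonal-decides : ∀ k → Eventually (λ n → P k (diagonal n)) ⊎ Eventually (λ n → ¬ P k (diagonal n))
      diagonal-decides k with refine-decides k (proj₁ (stages k)) (proj₂ (stages k)) em
      ... | inj₁ h = inj₁ (suc k , λ n le → h _ (stages-⊆ le (proj₂ (proj₂ (proj₂ (stages n) n)))))
      ... | inj₂ h = inj₂ (suc k , λ n le → h _ (stages-⊆ le (proj₂ (proj₂ (proj₂ (stages n) n)))))

    module _ (X : ℕ → Sample) where
      private
        Test : Set
        Test = List String × ℚ

        code-Test : Coding Test
        code-Test = code-× (code-List code-String) code-ℚ

        holds : Test → ℕ → Set
        holds (ℓ , r) n = mean (X n) (cylinders ℓ) ≤ r

        -- Comparisons are listed by their codes; at a number that codes none, `P` holds vacuously.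
        P : ℕ → ℕ → Set
        P k n = ∀ t → code-Test t ≡ k → holds t n

        P⇔ : ∀ t n → (P (code-Test t) n → holds t n) × (holds t n → P (code-Test t) n)
        P⇔ t n = (λ p → p t refl) , λ h t′ e →
          subst (λ t → holds t n) (sym (code-×-injective {c = code-List code-String} {code-ℚ}
            (code-List-injective code-String-injective) code-ℚ-injective {t′} {t} e)) h

      subsequence : ℕ → ℕ
      subsequence = diagonal P

      private
        mean-ext : ∀ n {K L} → (∀ α → mem K α ≡ mem L α) → mean (X n) K ≤ mean (X n) L
        mean-ext n {K} {L} h = mean-mono (X n) {K} {L} (λ α e → trans (sym (h α)) e)

        decided : ∀ K r → Eventually (λ n → mean (X (subsequence n)) K ≤ r) ⊎ Eventually (λ n → r < mean (X (subsequence n)) K)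
        decided K r with finite-union (proj₁ (modulus K)) (mem K) (proj₂ (modulus K))
        ... | ℓ , h with diagonal-decides P (code-Test (ℓ , r))
        ...   | inj₁ ev = inj₁ (ev-map (λ n p → ≤-trans (mean-ext (subsequence n) {K} {cylinders ℓ} h)
                                  (proj₁ (P⇔ (ℓ , r) (subsequence n)) p)) ev)
        ...   | inj₂ ev = inj₂ (ev-map (λ n ¬p → <-≤-trans (≰⇒> (¬p ∘ proj₂ (P⇔ (ℓ , r) (subsequence n))))
                                  (mean-ext (subsequence n) {cylinders ℓ} {K} (λ α → sym (h α)))) ev)

        module E = Extension em (X ∘ subsequence) decided

      opaque
        limitMeasure : ProbabilityMeasure
        limitMeasure = E.measure

        limit-below⇒ : ∀ {σ q} → ℝ.Below (limitMeasure ⟨ σ ⟩) q →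
          ∃[ q′ ] (q < q′ × Eventually (λ n → q′ < mean (X (subsequence n)) [ σ ]ᶜ))
        limit-below⇒ {σ} = E.measure-below⇒ {σ}

        limit-below⇐ : ∀ {σ q q′} → q < q′ → Eventually (λ n → q′ < mean (X (subsequence n)) [ σ ]ᶜ) →
          ℝ.Below (limitMeasure ⟨ σ ⟩) q
        limit-below⇐ {σ} = E.measure-below⇐ {σ}

        subsequence≥ : ∀ n → n ℕ.≤ subsequence n
        subsequence≥ = diagonal≥ P

    private
      sample-decided : ∀ s K r → Eventually (λ _ → mean s K ≤ r) ⊎ Eventually (λ _ → r < mean s K)
      sample-decided s K r with mean s K ≤? r
      ... | yes p = inj₁ (always (λ _ → p))
      ... | no ¬p = inj₂ (always (λ _ → ≰⇒> ¬p))

    opaque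
      -- A finite sample as a Borel measure, by extending a constant sequence. Tests speak only
      -- about Borel measures, so this is the form in which samples can be fed to them.
      sampleMeasure : Sample → ProbabilityMeasure
      sampleMeasure s = Extension.measure em (λ _ → s) (sample-decided s)

      sample-below : ∀ s {σ q} → q < mean s [ σ ]ᶜ → ℝ.Below (sampleMeasure s ⟨ σ ⟩) q
      sample-below s {σ} {q} q< = let (q′ , q<q′ , q′<) = <-dense q< in
        Extension.measure-below⇐ em (λ _ → s) (sample-decided s) {σ} {q} {q′} q<q′ (always (λ _ → q′<))

  -- Nonnegativity of a term places just the negative rationals below it; the drop from `x` to `y`
  -- pays for using one of them at each step.
  partialSum-below : ∀ (a : ℕ → ℝ) → (∀ n → 0ℝ ≤ʳ a n) → ∀ {m n} → m ℕ.≤ n → ∀ {x y} → y < x →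
    ℝ.Below (partialSum a m) x → ℝ.Below (partialSum a n) y
  partialSum-below a a≥0 {m} m≤n = go (ℕₚ.≤⇒≤′ m≤n)
    where
    cancel : ∀ z y → y ≡ z + (y - z)
    cancel = solve-∀ ℚ-ring
    flip : ∀ y z → 0ℚ - (y - z) ≡ z - y
    flip = solve-∀ ℚ-ring
    go : ∀ {n} → m ℕ.≤′ n → ∀ {x y} → y < x → ℝ.Below (partialSum a m) x → ℝ.Below (partialSum a n) y
    go ℕ.≤′-refl y<x b = ℝ.downward (partialSum a m) y<x b
    go (ℕ.≤′-step {n} p) {x} {y} y<x b =
      let (z , y<z , z<x) = <-dense y<x
      in z , y - z , go p z<x b , a≥0 n (lin< (flip y z) y<z) , ≤-reflexive (cancel z y)

  -- σ-additivity is applied to the two halves followed by empty sets. Its error is absorbed by the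
  -- slack between `p` and a larger rational `p₁` below the value at `σ ^0`.
  cylinder-superadditive : ∀ (μ : ProbabilityMeasure) σ → μ ⟨ σ ^0 ⟩ +ʳ μ ⟨ σ ^1 ⟩ ≤ʳ μ ⟨ σ ⟩
  cylinder-superadditive μ σ {q} (p , q′ , p∈ , q′∈ , q≤) =
    below-≤ (μ ⟨ σ ⟩) q≤ (proj₁ (measure-cong {⋃ B} {cylinder σ} (union⊆ , union⊇)) (above-bound (ℝ.noMaximum (μ ⟨ σ ^0 ⟩) p∈)))
    where
    open ProbabilityMeasure μ using (measure; nonnegative) renaming (σ-additive to additive; cong to measure-cong)

    B : ℕ → Borel
    B 0 = cylinder (σ ^0)
    B 1 = cylinder (σ ^1)
    B (suc (suc _)) = ∁ (cylinder [])

    union⊆ : ∀ {α} → ⟦ ⋃ B ⟧ α → ⟦ cylinder σ ⟧ α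
    union⊆ (0 , e) = cylinder⇐ σ (proj₁ (inCylinder-∷ʳ σ false (cylinder⇒ (σ ^0) e)))
    union⊆ (1 , e) = cylinder⇐ σ (proj₁ (inCylinder-∷ʳ σ true (cylinder⇒ (σ ^1) e)))
    union⊆ (suc (suc _) , ¬e) = ⊥-elim (¬e refl)

    union⊇ : ∀ {α} → ⟦ cylinder σ ⟧ α → ⟦ ⋃ B ⟧ α
    union⊇ {α} e with α (length σ) | inCylinder-extend σ (cylinder⇒ σ e)
    ... | false | h = 0 , cylinder⇐ (σ ^0) h
    ... | true  | h = 1 , cylinder⇐ (σ ^1) h

    clash : ∀ {α} → ⟦ cylinder (σ ^0) ⟧ α → ⟦ cylinder (σ ^1) ⟧ α → ⊥
    clash e e′ with trans (sym (proj₂ (inCylinder-∷ʳ σ false (cylinder⇒ (σ ^0) e)))) (proj₂ (inCylinder-∷ʳ σ true (cylinder⇒ (σ ^1) e′)))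
    ... | ()

    disjoint : PairwiseDisjoint B
    disjoint {0} {0} m≢n α _ = m≢n refl
    disjoint {0} {1} m≢n α (e , e′) = clash e e′
    disjoint {1} {0} m≢n α (e , e′) = clash e′ e
    disjoint {1} {1} m≢n α _ = m≢n refl
    disjoint {suc (suc _)} {_} m≢n α (¬e , _) = ¬e refl
    disjoint {0} {suc (suc _)} m≢n α (_ , ¬e) = ¬e refl
    disjoint {1} {suc (suc _)} m≢n α (_ , ¬e) = ¬e refl

    a : ℕ → ℝ
    a n = measure (B n)

    above-bound : ∃[ p₁ ] (p < p₁ × ℝ.Below (μ ⟨ σ ^0 ⟩) p₁) → ℝ.Below (measure (⋃ B)) (p + q′)
    above-bound (p₁ , p<p₁ , p₁∈) with <-dense p<p₁
    ... | p₂ , p<p₂ , p₂<p₁ with <-dense p₂<p₁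
    ... | p₃ , p₂<p₃ , p₃<p₁ with additive B disjoint (p₂ - p) (0<- p<p₂)
    -- The added 2 makes sure that the partial sum contains both halves.
    ... | N , conv with conv (2 ℕ.+ N) (ℕₚ.m≤n+m N 2)
    ... | (r , r∉ , (u , v , u∈ , v<ε , r≤)) , _ =
      below-≤ (measure (⋃ B)) (<⇒≤ (lin<³ (eq p p₂ q′ u v r) p₂+q′<r r≤ (<⇒≤ v<ε))) u∈
      where
      cancel : ∀ x y → y ≡ (y - x) + x
      cancel = solve-∀ ℚ-ring
      flip : ∀ x y → 0ℚ - (y - x) ≡ x - y
      flip = solve-∀ ℚ-ring
      two : ℝ.Below (partialSum a 2) (p₃ + q′)
      two = p₃ , q′ , (p₃ - p₁ , p₁ , lin< (flip p₁ p₃) p₃<p₁ , p₁∈ , ≤-reflexive (cancel p₁ p₃)) , q′∈ , ≤-refl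
      p₂+q′<r : p₂ + q′ < r
      p₂+q′<r = above (partialSum a (2 ℕ.+ N))
        (partialSum-below a (λ n → nonnegative (B n)) {2} {2 ℕ.+ N} (ℕₚ.m≤m+n 2 N) {p₃ + q′} (+-monoˡ-< q′ p₂<p₃) two) r∉
      eq : ∀ p p₂ q′ u v r → u - (p + q′) ≡ (r - (p₂ + q′)) + ((u + v - r) + (p₂ - p - v))
      eq = solve-∀ ℚ-ring

-- Mass generated by finitely many conditions and its realisation by lists of strings

module GeneratedMass where

  open import Defs renaming (_+_ to _+ʳ_; _≤_ to _≤ʳ_; _<_ to _<ʳ_; _≈_ to _≈ʳ_)
  open import Data.Bool using (Bool; true; false; _∧_)
  import Data.Bool.Properties as Boolₚ
  open import Data.Empty using (⊥-elim)
  open import Data.Fin using (zero; suc)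
  open import Data.List using (List; []; _∷_; _∷ʳ_; _++_; length; map; replicate; lookup)
  open import Data.List.Properties using (∷ʳ-++; length-++; length-replicate; ++-identityʳ; length-map; ≡-dec)
  open import Data.List.Membership.Propositional using (_∈_)
  open import Data.List.Relation.Unary.Any using (here; there)
  open import Data.List.Relation.Unary.All using (All; []; _∷_)
  import Data.List.Relation.Unary.All as All
  import Data.List.Relation.Unary.All.Properties as Allₚ
  open import Data.Nat hiding (_⊔_; _≟_)
  open import Data.Nat.Properties
  open import Data.Nat.Tactic.RingSolver using (solve-∀)
  open import Data.Product using (∃; ∃-syntax; _×_; _,_; proj₁; proj₂)
  open import Data.Sum using (_⊎_; inj₁; inj₂; [_,_]′)
  open import Function using (_∘_)
  open import Relation.Binary.PropositionalEquality
  open import Relation.Nullary using (yes; no; does)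
  open UniversalFunction using (bit)
  open ClopenSets using (Sample; hits; [_]ᶜ; _∋_; inCylinder; bit-mono)
  open import Algebra.Properties.Semiring.Sum +-*-semiring using (sum)

  -- Cl B σ a: at σ, the semimeasure generated by the conditions B is at least a units of a fixed fraction.

  data Cl (B : String → ℕ → Set) : String → ℕ → Set where
    base  : ∀ {σ a} → B σ a → Cl B σ a
    none  : ∀ {σ} → Cl B σ 0
    split : ∀ {σ a b} → Cl B (σ ^0) a → Cl B (σ ^1) b → Cl B σ (a + b)

  Cl-map : ∀ {B C : String → ℕ → Set} → (∀ {σ a} → B σ a → C σ a) → ∀ {σ a} → Cl B σ a → Cl C σ a
  Cl-map f (base b) = base (f b)
  Cl-map f none = none
  Cl-map f (split d e) = split (Cl-map f d) (Cl-map f e)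

  Cl-bind : ∀ {B C : String → ℕ → Set} → (∀ {σ a} → B σ a → Cl C σ a) → ∀ {σ a} → Cl B σ a → Cl C σ a
  Cl-bind f (base b) = f b
  Cl-bind f none = none
  Cl-bind f (split d e) = split (Cl-bind f d) (Cl-bind f e)

  isPrefix : String → String → Bool
  isPrefix [] ρ = true
  isPrefix (b ∷ σ) [] = false
  isPrefix (b ∷ σ) (c ∷ ρ) = does (b Boolₚ.≟ c) ∧ isPrefix σ ρ

  isPrefix-refl : ∀ σ → isPrefix σ σ ≡ true
  isPrefix-refl [] = refl
  isPrefix-refl (b ∷ σ) with b Boolₚ.≟ b
  ... | yes _ = isPrefix-refl σ
  ... | no ¬e = ⊥-elim (¬e refl)

  isPrefix-++ : ∀ σ τ ρ → isPrefix (σ ++ τ) ρ ≡ true → isPrefix σ ρ ≡ true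
  isPrefix-++ [] τ ρ e = refl
  isPrefix-++ (b ∷ σ) τ (c ∷ ρ) e with b Boolₚ.≟ c
  ... | yes _ = isPrefix-++ σ τ ρ e

  pad : String → Cantor
  pad [] _ = false
  pad (b ∷ σ) zero = b
  pad (b ∷ σ) (suc i) = pad σ i

  isPrefix-pad : ∀ τ ρ → isPrefix τ ρ ≡ true → [ τ ]ᶜ ∋ pad ρ
  isPrefix-pad [] ρ e = refl
  isPrefix-pad (b ∷ τ) (c ∷ ρ) e with b Boolₚ.≟ c
  ... | yes refl with b Boolₚ.≟ b
  ...   | yes _ = isPrefix-pad τ ρ e
  ...   | no ¬e = ⊥-elim (¬e refl)

  count : String → List String → ℕ
  count τ [] = 0
  count τ (ρ ∷ M) = bit (isPrefix τ ρ) + count τ M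

  count-++ : ∀ τ M M′ → count τ (M ++ M′) ≡ count τ M + count τ M′
  count-++ τ [] M′ = refl
  count-++ τ (ρ ∷ M) M′ = trans (cong (bit (isPrefix τ ρ) +_) (count-++ τ M M′)) (sym (+-assoc (bit (isPrefix τ ρ)) _ _))

  count-all : ∀ {τ M} → All (λ ρ → isPrefix τ ρ ≡ true) M → count τ M ≡ length M
  count-all [] = refl
  count-all (p ∷ ps) = cong₂ _+_ (cong bit p) (count-all ps)

  module _ (L : List (String × ℕ)) where

    Listed : String → ℕ → Set
    Listed σ a = (σ , a) ∈ L

    largest : ∀ σ → ∃[ m ] ((m ≡ 0 ⊎ Listed σ m) × ∀ {b} → Listed σ b → b ≤ m)
    largest σ = go L
      where
      go : ∀ K → ∃[ m ] ((m ≡ 0 ⊎ (σ , m) ∈ K) × ∀ {b} → (σ , b) ∈ K → b ≤ m)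
      go [] = 0 , inj₁ refl , λ ()
      go ((τ , c) ∷ K) with go K | ≡-dec Boolₚ._≟_ σ τ
      ... | m , w , max | no σ≢τ = m , [ inj₁ , inj₂ ∘ there ]′ w ,
            λ { (here refl) → ⊥-elim (σ≢τ refl) ; (there i) → max i }
      ... | m , w , max | yes refl with ≤-total c m
      ...   | inj₁ c≤m = m , [ inj₁ , inj₂ ∘ there ]′ w , λ { (here refl) → c≤m ; (there i) → max i }
      ...   | inj₂ m≤c = c , inj₂ (here refl) , λ { (here refl) → ≤-refl ; (there i) → ≤-trans (max i) m≤c }

    -- Strings are units of mass placed at nodes; `derived` says that no more of them are placed
    -- than the conditions force.
    record Filled (σ : String) : Set where
      field
        strings : List String
        below   : All (λ ρ → isPrefix σ ρ ≡ true) strings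
        derived : Cl Listed σ (length strings)
        counts  : ∀ {b} ρ → Listed (σ ++ ρ) b → b ≤ count (σ ++ ρ) strings

    assemble : ∀ σ (M₀ M₁ : List String) → All (λ ρ → isPrefix (σ ^0) ρ ≡ true) M₀ → All (λ ρ → isPrefix (σ ^1) ρ ≡ true) M₁ →
      Cl Listed σ (length M₀ + length M₁) →
      (∀ {b} c ρ → Listed (σ ++ c ∷ ρ) b → b ≤ count (σ ++ c ∷ ρ) M₀ + count (σ ++ c ∷ ρ) M₁) → Filled σ
    assemble σ M₀ M₁ b₀ b₁ d h with largest σ
    ... | m , w , max = record
      { strings = M ; below = M-below ; derived = derived ; counts = counts }
      where
      -- Units to be added at `σ` itself when the largest demand there exceeds what the children
      -- already supply; truncated subtraction gives zero otherwise.
      extra = m ∸ (length M₀ + length M₁)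
      M = replicate extra σ ++ (M₀ ++ M₁)

      M-below : All (λ ρ → isPrefix σ ρ ≡ true) M
      M-below = Allₚ.++⁺ (Allₚ.replicate⁺ extra (isPrefix-refl σ))
        (Allₚ.++⁺ (All.map (λ {ρ} → isPrefix-++ σ _ ρ) b₀) (All.map (λ {ρ} → isPrefix-++ σ _ ρ) b₁))

      M-length : length M ≡ extra + (length M₀ + length M₁)
      M-length = trans (length-++ (replicate extra σ)) (cong₂ _+_ (length-replicate extra) (length-++ M₀))

      derived : Cl Listed σ (length M)
      derived = go (≤-total (length M₀ + length M₁) m) w
        where
        go : length M₀ + length M₁ ≤ m ⊎ m ≤ length M₀ + length M₁ → m ≡ 0 ⊎ Listed σ m → Cl Listed σ (length M)
        go (inj₂ m≤) _ = subst (Cl Listed σ) (sym (trans M-length (cong (_+ (length M₀ + length M₁)) (m≤n⇒m∸n≡0 m≤)))) d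
        go (inj₁ ≤m) (inj₂ l) = base (subst (Listed σ) (sym (trans M-length (m∸n+n≡m ≤m))) l)
        go (inj₁ ≤m) (inj₁ e) = subst (Cl Listed σ) (sym (trans M-length (trans (m∸n+n≡m ≤m) e))) none

      m≤M : m ≤ length M
      m≤M = ≤-trans (m≤n+m∸n m (length M₀ + length M₁)) (≤-reflexive (trans (+-comm (length M₀ + length M₁) extra) (sym M-length)))

      counts : ∀ {b} ρ → Listed (σ ++ ρ) b → b ≤ count (σ ++ ρ) M
      counts [] l rewrite ++-identityʳ σ = ≤-trans (max l) (≤-trans m≤M (≤-reflexive (sym (count-all M-below))))
      counts (c ∷ ρ) l = ≤-trans (h c ρ l) (≤-trans (≤-reflexive (sym (count-++ τ M₀ M₁)))
        (≤-trans (m≤n+m _ (count τ (replicate extra σ))) (≤-reflexive (sym (count-++ τ (replicate extra σ) (M₀ ++ M₁))))))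
        where τ = σ ++ c ∷ ρ

    fillAt : ∀ D σ → (∀ {b} ρ → Listed (σ ++ ρ) b → length ρ ≤ D) → Filled σ
    fillAt zero σ bound = assemble σ [] [] [] [] none (λ c ρ l → ⊥-elim (1+n≰n (≤-trans (s≤s z≤n) (bound (c ∷ ρ) l))))
    fillAt (suc D) σ bound = assemble σ F₀.strings F₁.strings F₀.below F₁.below (split F₀.derived F₁.derived) counts
      where
      child : ∀ c → Filled (σ ∷ʳ c)
      child c = fillAt D (σ ∷ʳ c) (λ {b} ρ l → ≤-pred (bound (c ∷ ρ) (subst (λ τ → Listed τ b) (∷ʳ-++ σ c ρ) l)))
      module F₀ = Filled (child false)
      module F₁ = Filled (child true)
      counts : ∀ {b} c ρ → Listed (σ ++ c ∷ ρ) b → b ≤ count (σ ++ c ∷ ρ) F₀.strings + count (σ ++ c ∷ ρ) F₁.strings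
      counts {b} false ρ l = ≤-trans (subst (λ τ → Listed τ b → b ≤ count τ F₀.strings) (∷ʳ-++ σ false ρ) (F₀.counts ρ) l) (m≤m+n _ _)
      counts {b} true ρ l = ≤-trans (subst (λ τ → Listed τ b → b ≤ count τ F₁.strings) (∷ʳ-++ σ true ρ) (F₁.counts ρ) l) (m≤n+m _ _)

    depth : ∃[ D ] ∀ {τ b} → Listed τ b → length τ ≤ D
    depth = go L
      where
      go : ∀ K → ∃[ D ] ∀ {τ b} → (τ , b) ∈ K → length τ ≤ D
      go [] = 0 , λ ()
      go ((τ , c) ∷ K) = let (D , h) = go K in length τ + D ,
        λ { (here refl) → m≤m+n _ _ ; (there i) → ≤-trans (h i) (m≤n+m _ _) }

    fill : ∃[ M ] (Cl Listed [] (length M) × ∀ {τ b} → Listed τ b → b ≤ count τ M)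
    fill = F.strings , F.derived , λ {τ} l → F.counts τ l
      where module F = Filled (fillAt (proj₁ depth) [] (λ ρ l → proj₂ depth l))

    fill-≤ : ∀ N → (∀ {a} → Cl Listed [] a → a ≤ N) → ∃[ M ] (length M ≡ N × ∀ {τ b} → Listed τ b → b ≤ count τ M)
    fill-≤ N h with fill
    ... | M , d , c = replicate (N ∸ length M) [] ++ M ,
      trans (length-++ (replicate (N ∸ length M) [])) (trans (cong (_+ length M) (length-replicate (N ∸ length M))) (m∸n+n≡m (h d))) ,
      λ {τ} l → ≤-trans (c l) (≤-trans (m≤n+m _ _) (≤-reflexive (sym (count-++ τ (replicate (N ∸ length M) []) M))))

    private
      copies : ℕ → List String → List String
      copies zero M = []
      copies (suc k) M = M ++ copies k M

      length-copies : ∀ k M → length (copies k M) ≡ k * length M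
      length-copies zero M = refl
      length-copies (suc k) M = trans (length-++ M) (cong (length M +_) (length-copies k M))

      count-copies : ∀ k τ M → count τ (copies k M) ≡ k * count τ M
      count-copies zero τ M = refl
      count-copies (suc k) τ M = trans (count-++ τ M (copies k M)) (cong (count τ M +_) (count-copies k τ M))

      count-heads : ∀ (K : List (String × ℕ)) {τ b} → (τ , b) ∈ K → 1 ≤ count τ (map proj₁ K)
      count-heads ((τ , b) ∷ K) (here refl) = ≤-trans (≤-reflexive (sym (cong bit (isPrefix-refl τ)))) (m≤m+n _ _)
      count-heads ((τ , b) ∷ K) {τ′} (there i) = ≤-trans (count-heads K i) (m≤n+m _ (bit (isPrefix τ′ τ)))

    -- Strictness comes from repetition: fewer than `N` units, taken `k` times, leave at least `k`
    -- of the `k * N` units free, enough to add one string for every listed condition.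
    fill-< : ∀ N → (∀ {a} → Cl Listed [] a → a < N) →
      ∃[ M ] ((∃[ m ] length M ≡ suc m) × (∀ {τ b} → Listed τ b → b * length M < count τ M * N))
    fill-< N h with fill
    ... | M , d , c = M′ , nonempty N (h d) M′-length , strict
      where
      k = suc (length L)
      heads = map proj₁ L
      padding = replicate (k * N ∸ (k * length M + length L)) []
      M′ = copies k M ++ (heads ++ padding)

      room : k * length M + length L ≤ k * N
      room = begin
        k * length M + length L    ≤⟨ +-monoʳ-≤ (k * length M) (n≤1+n (length L)) ⟩
        k * length M + k           ≡⟨ trans (+-comm (k * length M) k) (sym (*-suc k (length M))) ⟩
        k * suc (length M)         ≤⟨ *-monoʳ-≤ k (h d) ⟩
        k * N                      ∎
        where open ≤-Reasoning

      M′-length : length M′ ≡ k * N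
      M′-length = trans (length-++ (copies k M)) (trans (cong₂ _+_ (length-copies k M)
        (trans (length-++ heads) (cong₂ _+_ (length-map proj₁ L) (length-replicate (k * N ∸ (k * length M + length L))))))
        (trans (sym (+-assoc (k * length M) (length L) _)) (m+[n∸m]≡n room)))

      nonempty : ∀ N → length M < N → length M′ ≡ k * N → ∃[ m ] length M′ ≡ suc m
      nonempty (suc N) _ e = _ , e

      count≥ : ∀ {τ b} → Listed τ b → suc (k * b) ≤ count τ M′
      count≥ {τ} {b} l = begin
        suc (k * b)                                      ≡⟨ +-comm 1 (k * b) ⟩
        k * b + 1                                        ≤⟨ +-mono-≤ (*-monoʳ-≤ k (c l)) (≤-trans (count-heads L l) (m≤m+n _ (count τ padding))) ⟩
        k * count τ M + (count τ heads + count τ padding) ≡⟨ cong₂ _+_ (count-copies k τ M) (count-++ τ heads padding) ⟨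
        count τ (copies k M) + count τ (heads ++ padding) ≡⟨ count-++ τ (copies k M) (heads ++ padding) ⟨
        count τ M′                                       ∎
        where open ≤-Reasoning

      strict : ∀ {τ b} → Listed τ b → b * length M′ < count τ M′ * N
      strict {τ} {b} l = begin-strict
        b * length M′        ≡⟨ cong (b *_) M′-length ⟩
        b * (k * N)          ≡⟨ rearrange b k N ⟩
        k * b * N            <⟨ m<n+m (k * b * N) (≤-trans (s≤s z≤n) (h d)) ⟩
        N + k * b * N        ≡⟨⟩
        suc (k * b) * N      ≤⟨ *-monoˡ-≤ N (count≥ l) ⟩
        count τ M′ * N       ∎
        where
        open ≤-Reasoning
        rearrange : ∀ b k n → b * (k * n) ≡ k * b * n
        rearrange = solve-∀

  -- The head `ρ` keeps the sample nonempty, and strings become points by padding with zeros.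
  uniform : List String → String → Sample
  uniform M ρ = length M , λ j → pad (lookup (ρ ∷ M) j)

  count≤hits : ∀ M ρ τ → count τ (ρ ∷ M) ≤ hits (uniform M ρ) [ τ ]ᶜ
  count≤hits M ρ τ = go (ρ ∷ M)
    where
    go : ∀ M → count τ M ≤ sum {length M} (λ j → bit (inCylinder τ (pad (lookup M j))))
    go [] = z≤n
    go (ρ ∷ M) = +-mono-≤ (bit-mono (isPrefix-pad τ ρ)) (go M)

-- Rational conditions as integer weights

module Weights where

  open import Defs renaming (_+_ to _+ʳ_; _≤_ to _≤ʳ_; _<_ to _<ʳ_; _≈_ to _≈ʳ_)
  open import Data.Integer using (+_; -[1+_])
  open import Data.List using (List; []; _∷_; length)
  open import Data.List.Membership.Propositional using (_∈_)
  open import Data.List.Relation.Unary.Any using (here; there)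
  open import Data.List.Relation.Unary.All using (All; []; _∷_)
  import Data.List.Relation.Unary.All as All
  open import Data.Nat as ℕ using (ℕ; zero; suc)
  import Data.Nat.Properties as ℕₚ
  open import Data.Product using (∃; ∃-syntax; _×_; _,_; proj₂)
  open import Data.Rational
  open import Data.Rational.Properties hiding (_≟_)
  open import Data.Sum using (_⊎_; inj₁; inj₂; [_,_]′)
  open import Relation.Binary.PropositionalEquality
  open import Tactic.RingSolver using (solve-∀)
  open RationalArithmetic
  open ClopenSets using (mean; mean-ι; mean≥0; hits; [_]ᶜ)
  open GeneratedMass

  module _ (v : String → ℝ) (v≥0 : ∀ σ → 0ℝ ≤ʳ v σ) (super : ∀ σ → v (σ ^0) +ʳ v (σ ^1) ≤ʳ v σ) (N : ℕ) where

    -- Zero is a case of its own, since 0 does not lie strictly below a value that may be 0.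
    Mass : String → ℕ → Set
    Mass σ a = a ≡ 0 ⊎ ∃[ r ] (ι a ≤ r * ι N × ℝ.Below (v σ) r)

    Cl-mass : ∀ {B : String → ℕ → Set} → (∀ {σ a} → B σ a → Mass σ a) → ∀ {σ a} → Cl B σ a → Mass σ a
    Cl-mass h (base b) = h b
    Cl-mass h none = inj₁ refl
    Cl-mass h (split {σ} {a} {b} d e) with Cl-mass h d | Cl-mass h e
    ... | inj₁ refl | inj₁ refl = inj₁ refl
    ... | inj₁ refl | inj₂ (r , le , r∈) =
          -- The child without mass offers only negative numbers, so the other is moved up to `r′`
          -- and the negative difference is charged to the first.
          let (r′ , r<r′ , r′∈) = ℝ.noMaximum (v (σ ^1)) r∈
          in inj₂ (r , le , super σ (r - r′ , r′ , v≥0 (σ ^0) (lin< (eq r r′) r<r′) , r′∈ , ≤-reflexive (cancel r r′)))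
      where
      eq : ∀ r r′ → 0ℚ - (r - r′) ≡ r′ - r
      eq = solve-∀ ℚ-ring
      cancel : ∀ r r′ → r ≡ r - r′ + r′
      cancel = solve-∀ ℚ-ring
    ... | inj₂ (r , le , r∈) | inj₁ refl =
          let (r′ , r<r′ , r′∈) = ℝ.noMaximum (v (σ ^0)) r∈
          in inj₂ (r , subst (λ c → ι c ≤ r * ι N) (sym (ℕₚ.+-identityʳ a)) le ,
               super σ (r′ , r - r′ , r′∈ , v≥0 (σ ^1) (lin< (eq r r′) r<r′) , ≤-reflexive (cancel r r′)))
      where
      eq : ∀ r r′ → 0ℚ - (r - r′) ≡ r′ - r
      eq = solve-∀ ℚ-ring
      cancel : ∀ r r′ → r ≡ r′ + (r - r′)
      cancel = solve-∀ ℚ-ring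
    ... | inj₂ (r , le , r∈) | inj₂ (r′ , le′ , r′∈) = inj₂ (r + r′ ,
          subst₂ _≤_ (sym (ι-+ a b)) (sym (*-distribʳ-+ (ι N) r r′)) (+-mono-≤ le le′) ,
          super σ (r , r′ , r∈ , r′∈ , ≤-refl))

    -- Strictness survives up to the root, so the full mass is never generated. This serves for
    -- semimeasures and for the cylinder values of measures alike.
    Cl-root : v [] ≤ʳ 1ℝ → 0 ℕ.< N → ∀ {B : String → ℕ → Set} → (∀ {σ a} → B σ a → Mass σ a) → ∀ {a} → Cl B [] a → a ℕ.< N
    Cl-root root 0<N h d with Cl-mass h d
    ... | inj₁ refl = 0<N
    ... | inj₂ (r , le , r∈) = ι-cancel-< (≤-<-trans le (subst (r * ι N <_) (*-identityˡ (ι N))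
          (*-monoˡ-< (subst (_< ι N) ι0 (ι-mono-< 0<N)) (root r∈))))

  Num : ℚ → ℕ → ℕ → Set
  Num q n d = ℚ.numerator q ≡ + n × ℚ.denominator-1 q ≡ d

  Num-ι : ∀ {q n d} → Num q n d → q * ι (suc d) ≡ ι n
  Num-ι {mkℚ (+ n) d c} (refl , refl) = *-denominator n d c

  Num-≤ : ∀ {q n d a N} → Num q n d → a ℕ.* suc d ℕ.≤ n ℕ.* N → ι a ≤ q * ι N
  Num-≤ {q} {n} {d} {a} {N} num le = *-cancelʳ-≤ (0<ι d) (subst₂ _≤_ (ι-* a (suc d))
    (trans (trans (ι-* n N) (cong (_* ι N) (sym (Num-ι {q} num)))) (swap q (ι (suc d)) (ι N))) (ι-mono-≤ le))
    where
    swap : ∀ q d n → q * d * n ≡ q * n * d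
    swap = solve-∀ ℚ-ring

  Num-≤⁻¹ : ∀ {q n d a N} → Num q n d → ι a ≤ q * ι N → a ℕ.* suc d ℕ.≤ n ℕ.* N
  Num-≤⁻¹ {q} {n} {d} {a} {N} num le = ι-cancel-≤ (subst₂ _≤_ (sym (ι-* a (suc d)))
    (sym (trans (trans (ι-* n N) (cong (_* ι N) (sym (Num-ι {q} num)))) (swap q (ι (suc d)) (ι N))))
    (*-monoˡ-≤ (<⇒≤ (0<ι d)) le))
    where
    swap : ∀ q d n → q * d * n ≡ q * n * d
    swap = solve-∀ ℚ-ring

  Num-≥ : ∀ {q n d a N} → Num q n d → n ℕ.* N ℕ.≤ a ℕ.* suc d → q * ι N ≤ ι a
  Num-≥ {q} {n} {d} {a} {N} num le = *-cancelʳ-≤ (0<ι d) (subst₂ _≤_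
    (trans (trans (ι-* n N) (cong (_* ι N) (sym (Num-ι {q} num)))) (swap q (ι (suc d)) (ι N))) (ι-* a (suc d)) (ι-mono-≤ le))
    where
    swap : ∀ q d n → q * d * n ≡ q * n * d
    swap = solve-∀ ℚ-ring

  Num-≥⁻¹ : ∀ {q n d a N} → Num q n d → q * ι N ≤ ι a → n ℕ.* N ℕ.≤ a ℕ.* suc d
  Num-≥⁻¹ {q} {n} {d} {a} {N} num le = ι-cancel-≤ (subst₂ _≤_
    (sym (trans (trans (ι-* n N) (cong (_* ι N) (sym (Num-ι {q} num)))) (swap q (ι (suc d)) (ι N)))) (sym (ι-* a (suc d)))
    (*-monoˡ-≤ (<⇒≤ (0<ι d)) le))
    where
    swap : ∀ q d n → q * d * n ≡ q * n * d
    swap = solve-∀ ℚ-ring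

  Num->⁻¹ : ∀ {q n d a N} → Num q n d → q * ι N < ι a → n ℕ.* N ℕ.< a ℕ.* suc d
  Num->⁻¹ {q} {n} {d} {a} {N} num lt = ι-cancel-< (subst₂ _<_
    (sym (trans (trans (ι-* n N) (cong (_* ι N) (sym (Num-ι {q} num)))) (swap q (ι (suc d)) (ι N)))) (sym (ι-* a (suc d)))
    (*-monoˡ-< (0<ι d) lt))
    where
    swap : ∀ q d n → q * d * n ≡ q * n * d
    swap = solve-∀ ℚ-ring

  Num-> : ∀ {q n d a N} → Num q n d → n ℕ.* N ℕ.< a ℕ.* suc d → q * ι N < ι a
  Num-> {q} {n} {d} {a} {N} num lt = *-cancelʳ-< (0<ι d) (subst₂ _<_
    (trans (trans (ι-* n N) (cong (_* ι N) (sym (Num-ι {q} num)))) (swap q (ι (suc d)) (ι N))) (ι-* a (suc d)) (ι-mono-< lt))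
    where
    swap : ∀ q d n → q * d * n ≡ q * n * d
    swap = solve-∀ ℚ-ring

  sign : ∀ q → q < 0ℚ ⊎ ∃[ n ] ∃[ d ] Num q n d
  sign (mkℚ (+ n) d c) = inj₂ (n , d , refl , refl)
  sign q@(mkℚ -[1+ n ] d c) = inj₁ (negative⁻¹ q)

  -- `Weight q N b`: the condition "mass at least q" reads "at least b of N units".
  Weight : ℚ → ℕ → ℕ → Set
  Weight q N b = (q < 0ℚ × b ≡ 0) ⊎ (0ℚ ≤ q × q * ι N ≡ ι b)

  Weight-≤ : ∀ {q N b} → Weight q N b → q * ι N ≤ ι b
  Weight-≤ {q} {N} (inj₁ (q<0 , refl)) = ≤-trans (*-monoˡ-≤ (0≤ι N) (<⇒≤ q<0)) (≤-reflexive (trans (*-zeroˡ (ι N)) (sym ι0)))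
  Weight-≤ (inj₂ (_ , e)) = ≤-reflexive e

  Weight-scale : ∀ {q N b} k → Weight q N b → Weight q (N ℕ.* k) (b ℕ.* k)
  Weight-scale k (inj₁ (q<0 , refl)) = inj₁ (q<0 , refl)
  Weight-scale {q} {N} {b} k (inj₂ (0≤q , e)) = inj₂ (0≤q , trans (cong (q *_) (ι-* N k))
    (trans (sym (*-assoc q (ι N) (ι k))) (trans (cong (_* ι k) e) (sym (ι-* b k)))))

  Weighted : ℕ → List Condition → Set
  Weighted N cs = All (λ c → ∃[ b ] Weight (proj₂ c) N b) cs

  common-denominator : ∀ cs → ∃[ N ] Weighted (suc N) cs
  common-denominator [] = 0 , []
  common-denominator ((σ , q) ∷ cs) with common-denominator cs | sign q
  ... | N , ws | inj₁ q<0 = N , (0 , inj₁ (q<0 , refl)) ∷ ws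
  ... | N , ws | inj₂ (n , d , num) = d ℕ.+ N ℕ.* suc d ,
        (suc N ℕ.* n , inj₂ (0≤q , trans (cong (q *_) (ι-* (suc N) (suc d))) (trans (swap q (ι (suc N)) (ι (suc d)))
          (trans (cong (ι (suc N) *_) (Num-ι {q} num)) (sym (ι-* (suc N) n)))))) ∷
        All.map (λ (b , w) → b ℕ.* suc d , Weight-scale (suc d) w) ws
    where
    swap : ∀ q x y → q * (x * y) ≡ x * (q * y)
    swap = solve-∀ ℚ-ring
    0≤q : 0ℚ ≤ q
    0≤q = *-cancelʳ-≤ (0<ι d) (subst₂ _≤_ (sym (*-zeroˡ (ι (suc d)))) (sym (Num-ι {q} num)) (0≤ι n))

  weights : ∀ {N} cs → Weighted N cs → List (String × ℕ)
  weights [] [] = []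
  weights ((σ , q) ∷ cs) ((b , _) ∷ ws) = (σ , b) ∷ weights cs ws

  ∈-weights⁻ : ∀ {N cs} (ws : Weighted N cs) {σ b} → (σ , b) ∈ weights cs ws → ∃[ q ] ((σ , q) ∈ cs × Weight q N b)
  ∈-weights⁻ {cs = (σ , q) ∷ cs} ((b , w) ∷ ws) (here refl) = q , here refl , w
  ∈-weights⁻ {cs = (σ , q) ∷ cs} ((b , w) ∷ ws) (there i) = let (q′ , i′ , w′) = ∈-weights⁻ ws i in q′ , there i′ , w′

  ∈-weights⁺ : ∀ {N cs} (ws : Weighted N cs) {σ q} → (σ , q) ∈ cs → ∃[ b ] ((σ , b) ∈ weights cs ws × Weight q N b)
  ∈-weights⁺ {cs = (σ , q) ∷ cs} ((b , w) ∷ ws) (here refl) = b , here refl , w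
  ∈-weights⁺ {cs = (σ , q) ∷ cs} ((b , w) ∷ ws) (there i) = let (b′ , i′ , w′) = ∈-weights⁺ ws i in b′ , there i′ , w′

  -- All conditions lie below `f`, so together they generate no more than its mass at the root, and
  -- the greedy filling turns them into a single uniform distribution.
  conditions-feasible : (f : Semimeasure) → ∀ {N} cs → Weighted (suc N) cs →
    (∀ {σ q} → (σ , q) ∈ cs → ℝ.Below (Semimeasure.value f σ) q) →
    ∃[ M ] (length M ≡ suc N × ∀ {σ q} → (σ , q) ∈ cs → q * ι (suc N) ≤ ι (count σ M))
  conditions-feasible f {N} cs ws below =
    let (M , len , cnt) = fill-≤ (weights cs ws) (suc N) (λ d → ℕₚ.<⇒≤
          (Cl-root value nonnegative superadditive (suc N) (atMostOne []) (ℕ.s≤s ℕ.z≤n) mass d))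
    in M , len , λ i → let (b , i′ , w) = ∈-weights⁺ ws i in ≤-trans (Weight-≤ w) (ι-mono-≤ (cnt i′))
    where
    open Semimeasure f
    mass : ∀ {σ a} → (σ , a) ∈ weights cs ws → Mass value nonnegative superadditive (suc N) σ a
    mass i with ∈-weights⁻ ws i
    ... | q , i′ , inj₁ (_ , e) = inj₁ e
    ... | q , i′ , inj₂ (_ , e) = inj₂ (q , ≤-reflexive (sym e) , below i′)

  -- Less than the full mass leaves room for strictness, as in `fill-<`; negative bounds hold in any
  -- sample.
  conditions-fulfilled : ∀ {N} cs (ws : Weighted (suc N) cs) →
    (∀ {a} → Cl (λ σ a → (σ , a) ∈ weights cs ws) [] a → a ℕ.< suc N) →
    ∃[ s ] ∀ {σ q} → (σ , q) ∈ cs → q < mean s [ σ ]ᶜ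
  conditions-fulfilled {N} cs ws h with fill-< (weights cs ws) (suc N) h
  ... | ρ ∷ M , _ , counts = s , sat
    where
    s = uniform M ρ
    m = length M
    sat : ∀ {σ q} → (σ , q) ∈ cs → q < mean s [ σ ]ᶜ
    sat {σ} {q} i with ∈-weights⁺ ws i
    ... | b , i′ , inj₁ (q<0 , _) = <-≤-trans q<0 (mean≥0 s [ σ ]ᶜ)
    ... | b , i′ , inj₂ (_ , e) = *-cancelʳ-< (0<ι m) (*-cancelʳ-< (0<ι N) (begin-strict
      q * ι (suc m) * ι (suc N)              ≡⟨ swap q (ι (suc m)) (ι (suc N)) ⟩
      q * ι (suc N) * ι (suc m)              ≡⟨ cong (_* ι (suc m)) e ⟩
      ι b * ι (suc m)                        ≡⟨ ι-* b (suc m) ⟨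
      ι (b ℕ.* suc m)                        <⟨ ι-mono-< (counts i′) ⟩
      ι (count σ (ρ ∷ M) ℕ.* suc N)          ≤⟨ ι-mono-≤ (ℕₚ.*-monoˡ-≤ (suc N) (count≤hits M ρ σ)) ⟩
      ι (hits s [ σ ]ᶜ ℕ.* suc N)            ≡⟨ ι-* (hits s [ σ ]ᶜ) (suc N) ⟩
      ι (hits s [ σ ]ᶜ) * ι (suc N)          ≡⟨ cong (_* ι (suc N)) (mean-ι s [ σ ]ᶜ) ⟨
      mean s [ σ ]ᶜ * ι (suc m) * ι (suc N)  ∎))
      where
      open ≤-Reasoning
      swap : ∀ q x y → q * x * y ≡ q * y * x
      swap = solve-∀ ℚ-ring

-- Formulas for lists, strings, rationals and generated mass

module CodeFormulas where

  open import Defs renaming (_+_ to _+ʳ_; _≤_ to _≤ʳ_; _<_ to _<ʳ_; _≈_ to _≈ʳ_)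
  open import Data.Bool using (true; false)
  import Data.Bool.Properties as Boolₚ
  open import Data.Empty using (⊥-elim)
  open import Data.Integer using (+_; -[1+_])
  open import Data.List using (List; []; _∷_; _∷ʳ_; map; length)
  open import Data.List.Properties using (map-++; map-cong; map-injective)
  open import Data.List.Membership.Propositional using (_∈_)
  open import Data.List.Relation.Unary.All using (All; []; _∷_)
  import Data.List.Relation.Unary.All as All
  import Data.List.Relation.Unary.All.Properties as Allₚ
  open import Data.List.Relation.Unary.Any using (Any; here; there)
  import Data.List.Relation.Unary.Any as Any
  import Data.List.Relation.Unary.Any.Properties as Anyₚ
  open import Data.Nat hiding (_⊔_)
  open import Data.Nat.Properties
  open import Data.Nat.Coprimality using (Coprime; coprime-Bézout; Bézout-coprime; recompute)
  open import Data.Nat.GCD using (module Bézout)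
  open import Data.Product using (∃; ∃-syntax; _×_; _,_)
  open import Data.Rational using (ℚ; mkℚ)
  import Data.Rational as ℚ
  open import Data.Sum using (_⊎_; inj₁; inj₂)
  open import Data.Vec using ([]; _∷_)
  open import Function using (_∘_)
  open import Relation.Binary.PropositionalEquality
  open import Relation.Nullary using (yes; no)
  open SigmaOneFormulas
  open UniversalFunction
  open LimitMeasures using (Injective; code-Bool-injective; code-ℤ-injective)
  open GeneratedMass

  codeL : List ℕ → ℕ
  codeL [] = 0
  codeL (x ∷ xs) = ⟪ x , codeL xs ⟫

  codeL-injective : ∀ {xs ys} → codeL xs ≡ codeL ys → xs ≡ ys
  codeL-injective {[]} {[]} e = refl
  codeL-injective {[]} {y ∷ ys} e = ⊥-elim (⟪⟫≢0 (sym e))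
  codeL-injective {x ∷ xs} {[]} e = ⊥-elim (⟪⟫≢0 e)
  codeL-injective {x ∷ xs} {y ∷ ys} e = let (p , q) = ⟪⟫-injective e in cong₂ _∷_ p (codeL-injective q)

  code-List≡ : ∀ {A : Set} (c : Coding A) xs → code-List c xs ≡ codeL (map c xs)
  code-List≡ c [] = refl
  code-List≡ c (x ∷ xs) = trans (cong (pair (c x)) (code-List≡ c xs)) (sym (⟪⟫≡pair (c x) _))

  codeS : String → ℕ
  codeS σ = codeL (map code-Bool σ)

  codeQ : ℚ → ℕ
  codeQ q = ⟪ code-ℤ (ℚ.numerator q) , ℚ.denominator-1 q ⟫

  codeC : Condition → ℕ
  codeC (σ , q) = ⟪ codeS σ , codeQ q ⟫

  codeCs : List Condition → ℕ
  codeCs cs = codeL (map codeC cs)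

  codeE : TestElement → ℕ
  codeE (cs , c) = ⟪ codeCs cs , codeC c ⟫

  codeS-injective : Injective codeS
  codeS-injective = map-injective code-Bool-injective ∘ codeL-injective

  codeQ-injective : Injective codeQ
  codeQ-injective {mkℚ n d c} {mkℚ n′ d′ c′} e with ⟪⟫-injective {code-ℤ n} {d} {code-ℤ n′} {d′} e
  ... | en , refl with refl ← code-ℤ-injective {n} {n′} en = refl

  codeC-injective : Injective codeC
  codeC-injective {σ , q} {τ , r} e =
    let (p , s) = ⟪⟫-injective e in cong₂ _,_ (codeS-injective p) (codeQ-injective {q} {r} s)

  codeCs-injective : Injective codeCs
  codeCs-injective = map-injective (λ {c} {c′} → codeC-injective {c} {c′}) ∘ codeL-injective

  codeE-injective : Injective codeE
  codeE-injective {cs , c} {cs′ , c′} e =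
    let (p , s) = ⟪⟫-injective e in cong₂ _,_ (codeCs-injective p) (codeC-injective {c} {c′} s)

  code-TestElement≡ : ∀ e → code-TestElement e ≡ codeE e
  code-TestElement≡ (cs , c) = trans (cong₂ pair
      (trans (code-List≡ (code-× code-String code-ℚ) cs) (cong codeL (map-cong cond cs))) (cond c))
    (sym (⟪⟫≡pair (codeCs cs) (codeC c)))
    where
    cond : ∀ c → code-× code-String code-ℚ c ≡ codeC c
    cond (σ , q) = trans (cong₂ pair (code-List≡ code-Bool σ) (sym (⟪⟫≡pair (code-ℤ (ℚ.numerator q)) (ℚ.denominator-1 q))))
      (sym (⟪⟫≡pair (codeS σ) (codeQ q)))

  module ListQuantifiers (φ : Fm 2) where

    anyA allA : Fm 1
    anyR allR : Fm 3
    anyA = ∃′ (∃′ (∃′ (v3 ≐ ⦅ v2 , ⦅ v1 , v0 ⦆ ⦆ ∧ call φ (v2 ∷ v1 ∷ []))))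
    anyR = ∃′ (∃′ (∃′ (v3 ≐ ⦅ v2 , ⦅ v1 , v0 ⦆ ⦆ ∧ v4 ≐ ⦅ v2 , v0 ⦆ ∧ v5 ≐ v4)))
    allA = ∃′ (v1 ≐ ⦅ v0 , lit 0 ⦆)
    allR = ∃′ (∃′ (∃′ (v3 ≐ ⦅ v2 , ⦅ v1 , v0 ⦆ ⦆ ∧ v4 ≐ ⦅ v2 , v0 ⦆ ∧ v5 ≐ v4 ∧ call φ (v2 ∷ v1 ∷ []))))

    anyF allF : Fm 2
    anyF = call (indF anyA anyR) (⦅ v0 , v1 ⦆ ∷ [])
    allF = call (indF allA allR) (⦅ v0 , v1 ⦆ ∷ [])

    private
      Φ : ℕ → ℕ → Set
      Φ p x = p ∷ x ∷ [] ⊩ φ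

    any-sound : ∀ {p} xs → p ∷ codeL xs ∷ [] ⊩ anyF → Any (Φ p) xs
    any-sound {p} xs h = go xs refl (ind-sound anyA anyR h)
      where
      go : ∀ {c} xs → c ≡ ⟪ p , codeL xs ⟫ → Der (Inductive.Ax anyA anyR) (Inductive.Rl anyA anyR) c → Any (Φ p) xs
      go xs e (axiom (p′ , x , l , e′ , φx)) with ⟪⟫-injective (trans (sym e) e′)
      go [] e (axiom (p′ , x , l , e′ , φx)) | ep , el = ⊥-elim (⟪⟫≢0 (sym el))
      go (y ∷ ys) e (axiom (p′ , x , l , e′ , φx)) | ep , el = here (subst₂ Φ (sym ep) (sym (⟪⟫-injˡ el)) φx)
      go xs e (rule (p′ , x , l , e′ , eq , _) d _) with ⟪⟫-injective (trans (sym e) e′)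
      go [] e (rule (p′ , x , l , e′ , eq , _) d _) | ep , el = ⊥-elim (⟪⟫≢0 (sym el))
      go (y ∷ ys) e (rule (p′ , x , l , e′ , eq , _) d _) | ep , el =
        there (go ys (trans eq (cong₂ ⟪_,_⟫ (sym ep) (sym (⟪⟫-injʳ el)))) d)

    any-complete : ∀ {p xs} → Any (Φ p) xs → p ∷ codeL xs ∷ [] ⊩ anyF
    any-complete {p} a = ind-complete anyA anyR (go a)
      where
      go : ∀ {xs} → Any (Φ p) xs → Der (Inductive.Ax anyA anyR) (Inductive.Rl anyA anyR) ⟪ p , codeL xs ⟫
      go (here φx) = axiom (_ , _ , _ , refl , φx)
      go (there a) = rule (_ , _ , _ , refl , refl , refl) (go a) (go a)

    -- Unlike `any-sound` it starts from an arbitrary number and recovers the list; this is how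
    -- formulas check that a number is a code.
    all-sound : ∀ {p l} → p ∷ l ∷ [] ⊩ allF → ∃[ xs ] (l ≡ codeL xs × All (Φ p) xs)
    all-sound {p} h = go refl (ind-sound allA allR h)
      where
      go : ∀ {c l} → c ≡ ⟪ p , l ⟫ → Der (Inductive.Ax allA allR) (Inductive.Rl allA allR) c →
        ∃[ xs ] (l ≡ codeL xs × All (Φ p) xs)
      go e (axiom (_ , e′)) = [] , ⟪⟫-injʳ (trans (sym e) e′) , []
      go e (rule (p′ , x , l , e′ , eq , _ , φx) d _) with ⟪⟫-injective (trans (sym e) e′)
      ... | refl , el = let (xs , e″ , all) = go eq d in x ∷ xs , trans el (cong ⟪ x ,_⟫ e″) , φx ∷ all

    all-complete : ∀ {p xs} → All (Φ p) xs → p ∷ codeL xs ∷ [] ⊩ allF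
    all-complete {p} a = ind-complete allA allR (go a)
      where
      go : ∀ {xs} → All (Φ p) xs → Der (Inductive.Ax allA allR) (Inductive.Rl allA allR) ⟪ p , codeL xs ⟫
      go [] = axiom (_ , refl)
      go (φx ∷ a) = rule (_ , _ , _ , refl , refl , refl , φx) (go a) (go a)

  open ListQuantifiers using (anyF; allF; any-sound; any-complete; all-sound; all-complete) public

  memberF subsetF : Fm 2
  memberF = anyF (v0 ≐ v1)
  subsetF = allF (call memberF (v1 ∷ v0 ∷ []))

  subset-sound : ∀ {cs cs′} → codeCs cs ∷ codeCs cs′ ∷ [] ⊩ subsetF → ∀ {c} → c ∈ cs′ → c ∈ cs
  subset-sound {cs} {cs′} h {c} c∈ with all-sound (call memberF (v1 ∷ v0 ∷ [])) h
  ... | xs , e , all with codeL-injective {map codeC cs′} {xs} e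
  ... | refl = Any.map (λ {c′} e → codeC-injective {c} {c′} e) (Anyₚ.map⁻ (any-sound (v0 ≐ v1) (map codeC cs) (All.lookup (Allₚ.map⁻ all) c∈)))

  subset-complete : ∀ {cs cs′} → (∀ {c} → c ∈ cs′ → c ∈ cs) → codeCs cs ∷ codeCs cs′ ∷ [] ⊩ subsetF
  subset-complete h = all-complete (call memberF (v1 ∷ v0 ∷ [])) (Allₚ.map⁺ (All.tabulate λ c∈ →
    any-complete (v0 ≐ v1) (Anyₚ.map⁺ (Any.map (cong codeC) (h c∈)))))

  snocA : Fm 1
  snocA = ∃′ (v1 ≐ ⦅ lit 0 , ⦅ v0 , ⦅ v0 , lit 0 ⦆ ⦆ ⦆)

  snocR : Fm 3
  snocR = ∃′ (∃′ (∃′ (∃′ (v4 ≐ ⦅ ⦅ v3 , v2 ⦆ , ⦅ v1 , ⦅ v3 , v0 ⦆ ⦆ ⦆ ∧ v5 ≐ ⦅ v2 , ⦅ v1 , v0 ⦆ ⦆ ∧ v6 ≐ v5))))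

  -- Codes of strings grow at the front, whereas children are formed at the back.
  snocF : Fm 3
  snocF = call (indF snocA snocR) (⦅ v0 , ⦅ v1 , v2 ⦆ ⦆ ∷ [])

  snoc-sound : ∀ {b l} xs → codeL xs ∷ b ∷ l ∷ [] ⊩ snocF → l ≡ codeL (xs ∷ʳ b)
  snoc-sound {b} xs h = go xs refl (ind-sound snocA snocR h)
    where
    go : ∀ {c l} xs → c ≡ ⟪ codeL xs , ⟪ b , l ⟫ ⟫ → Der (Inductive.Ax snocA snocR) (Inductive.Rl snocA snocR) c →
      l ≡ codeL (xs ∷ʳ b)
    go xs e (axiom (b′ , e′)) with ⟪⟫-injective (trans (sym e) e′)
    go [] e (axiom (b′ , e′)) | _ , r = let (p , q) = ⟪⟫-injective r in trans q (cong ⟪_, 0 ⟫ (sym p))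
    go (x ∷ xs) e (axiom (b′ , e′)) | el , _ = ⊥-elim (⟪⟫≢0 el)
    go xs e (rule (x′ , l′ , b′ , m , e′ , ep , _) d _) with ⟪⟫-injective (trans (sym e) e′)
    go [] e (rule _ d _) | el , _ = ⊥-elim (⟪⟫≢0 (sym el))
    go (x ∷ xs) e (rule (x′ , l′ , b′ , m , e′ , ep , _) d _) | el , r =
      let (p , q) = ⟪⟫-injective el ; (s , t) = ⟪⟫-injective r
      in trans t (cong₂ ⟪_,_⟫ (sym p) (go xs (trans ep (cong₂ ⟪_,_⟫ (sym q) (cong ⟪_, m ⟫ (sym s)))) d))

  snoc-complete : ∀ xs b → codeL xs ∷ b ∷ codeL (xs ∷ʳ b) ∷ [] ⊩ snocF
  snoc-complete xs b = ind-complete snocA snocR (go xs)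
    where
    go : ∀ xs → Der (Inductive.Ax snocA snocR) (Inductive.Rl snocA snocR) ⟪ codeL xs , ⟪ b , codeL (xs ∷ʳ b) ⟫ ⟫
    go [] = axiom (b , refl)
    go (x ∷ xs) = rule (_ , _ , _ , _ , refl , refl , refl) (go xs) (go xs)

  codeS-∷ʳ : ∀ σ b → codeL (map code-Bool σ ∷ʳ code-Bool b) ≡ codeS (σ ∷ʳ b)
  codeS-∷ʳ σ b = cong codeL (sym (map-++ code-Bool σ (b ∷ [])))

  module Closure (β : Fm 3) where

    clA : Fm 1
    clA = ∃′ (∃′ (∃′ (v3 ≐ ⦅ v2 , ⦅ v1 , v0 ⦆ ⦆ ∧ (v0 ≐ lit 0 ∨ call β (v2 ∷ v1 ∷ v0 ∷ [])))))

    clR : Fm 3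
    clR = ∃′ (∃′ (∃′ (∃′ (∃′ (∃′ (v6 ≐ ⦅ v5 , ⦅ v4 , v3 ⊕ v2 ⦆ ⦆
      ∧ call snocF (v4 ∷ lit 0 ∷ v1 ∷ []) ∧ call snocF (v4 ∷ lit 1 ∷ v0 ∷ [])
      ∧ v7 ≐ ⦅ v5 , ⦅ v1 , v3 ⦆ ⦆ ∧ v8 ≐ ⦅ v5 , ⦅ v0 , v2 ⦆ ⦆))))))

    clF : Fm 3
    clF = call (indF clA clR) (⦅ v0 , ⦅ v1 , v2 ⦆ ⦆ ∷ [])

    Base : ℕ → String → ℕ → Set
    Base k σ a = k ∷ codeS σ ∷ a ∷ [] ⊩ β

    cl-sound : ∀ {k a} σ → k ∷ codeS σ ∷ a ∷ [] ⊩ clF → Cl (Base k) σ a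
    cl-sound {k} σ h = go σ refl (ind-sound clA clR h)
      where
      go : ∀ {c a} σ → c ≡ ⟪ k , ⟪ codeS σ , a ⟫ ⟫ → Der (Inductive.Ax clA clR) (Inductive.Rl clA clR) c → Cl (Base k) σ a
      go σ e (axiom (k′ , s , a′ , e′ , b)) with ⟪⟫-injective (trans (sym e) e′)
      ... | refl , r with ⟪⟫-injective r
      go σ e (axiom (k′ , s , a′ , e′ , inj₁ refl)) | refl , r | refl , refl = none
      go σ e (axiom (k′ , s , a′ , e′ , inj₂ b)) | refl , r | refl , refl = base b
      go σ e (rule (k′ , s , a , b , s₀ , s₁ , e′ , h₀ , h₁ , ep , eq) d₀ d₁) with ⟪⟫-injective (trans (sym e) e′)
      ... | refl , r with ⟪⟫-injective r
      ... | refl , refl = split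
            (go (σ ^0) (trans ep (cong (λ x → ⟪ k , ⟪ x , a ⟫ ⟫) (trans (snoc-sound (map code-Bool σ) h₀) (codeS-∷ʳ σ false)))) d₀)
            (go (σ ^1) (trans eq (cong (λ x → ⟪ k , ⟪ x , b ⟫ ⟫) (trans (snoc-sound (map code-Bool σ) h₁) (codeS-∷ʳ σ true)))) d₁)

    cl-complete : ∀ {k σ a} → Cl (Base k) σ a → k ∷ codeS σ ∷ a ∷ [] ⊩ clF
    cl-complete {k} d = ind-complete clA clR (go d)
      where
      go : ∀ {σ a} → Cl (Base k) σ a → Der (Inductive.Ax clA clR) (Inductive.Rl clA clR) ⟪ k , ⟪ codeS σ , a ⟫ ⟫
      go (base b) = axiom (_ , _ , _ , refl , inj₂ b)
      go none = axiom (_ , _ , _ , refl , inj₁ refl)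
      go (split {σ} d₀ d₁) = rule (_ , _ , _ , _ , _ , _ , refl ,
        subst (λ l → codeS σ ∷ 0 ∷ l ∷ [] ⊩ snocF) (codeS-∷ʳ σ false) (snoc-complete (map code-Bool σ) 0) ,
        subst (λ l → codeS σ ∷ 1 ∷ l ∷ [] ⊩ snocF) (codeS-∷ʳ σ true) (snoc-complete (map code-Bool σ) 1) ,
        refl , refl) (go d₀) (go d₁)

  open Closure using (clF; Base; cl-sound; cl-complete) public

  prefixA : Fm 1
  prefixA = ∃′ (v1 ≐ ⦅ lit 0 , v0 ⦆)

  prefixR : Fm 3
  prefixR = ∃′ (∃′ (∃′ (v3 ≐ ⦅ ⦅ v2 , v1 ⦆ , ⦅ v2 , v0 ⦆ ⦆ ∧ v4 ≐ ⦅ v1 , v0 ⦆ ∧ v5 ≐ v4)))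

  prefixF : Fm 2
  prefixF = call (indF prefixA prefixR) (⦅ v0 , v1 ⦆ ∷ [])

  prefix-sound : ∀ σ ρ → codeS σ ∷ codeS ρ ∷ [] ⊩ prefixF → isPrefix σ ρ ≡ true
  prefix-sound σ ρ h = go σ ρ refl (ind-sound prefixA prefixR h)
    where
    go : ∀ {c} σ ρ → c ≡ ⟪ codeS σ , codeS ρ ⟫ → Der (Inductive.Ax prefixA prefixR) (Inductive.Rl prefixA prefixR) c →
      isPrefix σ ρ ≡ true
    go [] ρ e d = refl
    go (b ∷ σ) ρ e (axiom (_ , e′)) = ⊥-elim (⟪⟫≢0 (⟪⟫-injˡ (trans (sym e) e′)))
    go (b ∷ σ) [] e (rule (_ , _ , _ , e′ , _) d _) = ⊥-elim (⟪⟫≢0 (sym (⟪⟫-injʳ (trans (sym e) e′))))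
    go (b ∷ σ) (c ∷ ρ) e (rule (b′ , s , r , e′ , ep , _) d _) with ⟪⟫-injective (trans (sym e) e′)
    ... | p , q with b Boolₚ.≟ c
    ...   | yes _ = go σ ρ (trans ep (cong₂ ⟪_,_⟫ (sym (⟪⟫-injʳ p)) (sym (⟪⟫-injʳ q)))) d
    ...   | no b≢c = ⊥-elim (b≢c (code-Bool-injective (trans (⟪⟫-injˡ p) (sym (⟪⟫-injˡ q)))))

  prefix-complete : ∀ σ ρ → isPrefix σ ρ ≡ true → codeS σ ∷ codeS ρ ∷ [] ⊩ prefixF
  prefix-complete σ ρ e = ind-complete prefixA prefixR (go σ ρ e)
    where
    go : ∀ σ ρ → isPrefix σ ρ ≡ true → Der (Inductive.Ax prefixA prefixR) (Inductive.Rl prefixA prefixR) ⟪ codeS σ , codeS ρ ⟫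
    go [] ρ e = axiom (_ , refl)
    go (b ∷ σ) (c ∷ ρ) e with b Boolₚ.≟ c
    ... | yes refl = rule (_ , _ , _ , refl , refl , refl) (go σ ρ e) (go σ ρ e)

  countA : Fm 1
  countA = ∃′ (v1 ≐ ⦅ v0 , ⦅ lit 0 , ⦅ lit 0 , lit 0 ⦆ ⦆ ⦆)

  -- The variables stand for the string, a member of the list, the rest of the list,
  -- the old and the new count, and the length.
  countR : Fm 3
  countR = ∃′ (∃′ (∃′ (∃′ (∃′ (∃′ (v6 ≐ ⦅ v5 , ⦅ ⦅ v4 , v3 ⦆ , ⦅ v1 , S v0 ⦆ ⦆ ⦆
    ∧ v7 ≐ ⦅ v5 , ⦅ v3 , ⦅ v2 , v0 ⦆ ⦆ ⦆ ∧ v8 ≐ v7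
    ∧ (v1 ≐ v2 ∨ v1 ≐ S v2 ∧ call prefixF (v5 ∷ v4 ∷ []))))))))

  countF : Fm 4
  countF = call (indF countA countR) (⦅ v0 , ⦅ v1 , ⦅ v2 , v3 ⦆ ⦆ ⦆ ∷ [])

  codeStrings : List String → ℕ
  codeStrings M = codeL (map codeS M)

  -- A step may decline to count a string, so the formula certifies lower bounds on the count only.
  -- In return it never has to express that a string is not a prefix of another.
  count-sound : ∀ {k n} σ M → codeS σ ∷ codeStrings M ∷ k ∷ n ∷ [] ⊩ countF → k ≤ count σ M × n ≡ length M
  count-sound σ M h = go M refl (ind-sound countA countR h)
    where
    go : ∀ {c k n} M → c ≡ ⟪ codeS σ , ⟪ codeStrings M , ⟪ k , n ⟫ ⟫ ⟫ →
      Der (Inductive.Ax countA countR) (Inductive.Rl countA countR) c → k ≤ count σ M × n ≡ length M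
    go M e (axiom (s , e′)) with ⟪⟫-injective (⟪⟫-injʳ (trans (sym e) e′))
    go [] e (axiom (s , e′)) | _ , r = let (p , q) = ⟪⟫-injective r in ≤-reflexive p , q
    go (_ ∷ M) e (axiom (s , e′)) | el , _ = ⊥-elim (⟪⟫≢0 el)
    go M e (rule (s , r , m , k , k′ , n , e′ , ep , _ , step) d _) with ⟪⟫-injective (trans (sym e) e′)
    ... | es , rest with ⟪⟫-injective rest
    go [] e (rule _ d _) | es , rest | el , _ = ⊥-elim (⟪⟫≢0 (sym el))
    go (ρ ∷ M) e (rule (s , r , m , k , k′ , n , e′ , ep , _ , step) d _) | es , rest | el , kn
      with ⟪⟫-injective el | ⟪⟫-injective kn
    ... | eρ , em | refl , en =
        let (le , len) = go M (trans ep (cong₂ ⟪_,_⟫ (sym es) (cong₂ ⟪_,_⟫ (sym em) refl))) d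
        in bound step le , trans en (cong suc len)
      where
      bound : k′ ≡ k ⊎ (k′ ≡ suc k × s ∷ r ∷ [] ⊩ prefixF) → k ≤ count σ M → k′ ≤ bit (isPrefix σ ρ) + count σ M
      bound (inj₁ refl) le = ≤-trans le (m≤n+m _ _)
      bound (inj₂ (refl , p)) le = +-mono-≤ {1} (≤-reflexive (sym (cong bit (prefix-sound σ ρ
        (subst₂ (λ s r → s ∷ r ∷ [] ⊩ prefixF) (sym es) (sym eρ) p))))) le

  count-complete : ∀ σ M → codeS σ ∷ codeStrings M ∷ count σ M ∷ length M ∷ [] ⊩ countF
  count-complete σ M = ind-complete countA countR (go M)
    where
    go : ∀ M → Der (Inductive.Ax countA countR) (Inductive.Rl countA countR)
      ⟪ codeS σ , ⟪ codeStrings M , ⟪ count σ M , length M ⟫ ⟫ ⟫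
    go [] = axiom (_ , refl)
    go (ρ ∷ M) with isPrefix σ ρ in e
    ... | true  = rule (_ , _ , _ , _ , _ , _ , refl , refl , refl , inj₂ (refl , prefix-complete σ ρ e)) (go M) (go M)
    ... | false = rule (_ , _ , _ , _ , _ , _ , refl , refl , refl , inj₁ refl) (go M) (go M)

  validBitF : Fm 2
  validBitF = v1 ≐ lit 0 ∨ v1 ≐ lit 1

  validStringF validRationalF validConditionF validElementF : Fm 1
  validStringF = call (allF validBitF) (lit 0 ∷ v0 ∷ [])

  -- Coprimality of n and d + 1 is witnessed by Bézout coefficients.
  coprimeF : Fm 2
  coprimeF = ∃′ (∃′ (lit 1 ⊕ v0 ⊗ S v3 ≐ v1 ⊗ v2 ∨ lit 1 ⊕ v1 ⊗ v2 ≐ v0 ⊗ S v3))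

  validRationalF = ∃′ (∃′ (
      v2 ≐ ⦅ lit 2 ⊗ v1 , v0 ⦆ ∧ call coprimeF (v1 ∷ v0 ∷ [])
    ∨ v2 ≐ ⦅ S (lit 2 ⊗ v1) , v0 ⦆ ∧ call coprimeF (S v1 ∷ v0 ∷ [])))

  validConditionF = ∃′ (∃′ (v2 ≐ ⦅ v1 , v0 ⦆ ∧ call validStringF (v1 ∷ []) ∧ call validRationalF (v0 ∷ [])))

  validStringsF : Fm 1
  validStringsF = call (allF (call validStringF (v1 ∷ []))) (lit 0 ∷ v0 ∷ [])

  validElementF = ∃′ (∃′ (v2 ≐ ⦅ v1 , v0 ⦆
    ∧ call (allF (call validConditionF (v1 ∷ []))) (lit 0 ∷ v1 ∷ []) ∧ call validConditionF (v0 ∷ [])))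

  decode-all : ∀ {A : Set} {c : Coding A} {P : ℕ → Set} → (∀ {x} → P x → ∃[ a ] x ≡ c a) →
    ∀ {xs} → All P xs → ∃[ as ] xs ≡ map c as
  decode-all h [] = [] , refl
  decode-all h (p ∷ ps) = let (a , e) = h p ; (as , es) = decode-all h ps in a ∷ as , cong₂ _∷_ e es

  validString-sound : ∀ {x} → x ∷ [] ⊩ validStringF → ∃[ σ ] x ≡ codeS σ
  validString-sound h =
    let (xs , e , all) = all-sound validBitF h
        (σ , e′) = decode-all (λ { (inj₁ e) → false , e ; (inj₂ e) → true , e }) all
    in σ , trans e (cong codeL e′)

  validString-complete : ∀ σ → codeS σ ∷ [] ⊩ validStringF
  validString-complete σ = all-complete validBitF (Allₚ.map⁺ (All.tabulate {xs = σ} λ {b} _ → bit-valid b))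
    where
    bit-valid : ∀ b → 0 ∷ code-Bool b ∷ [] ⊩ validBitF
    bit-valid false = inj₁ refl
    bit-valid true = inj₂ refl

  validStrings-sound : ∀ {x} → x ∷ [] ⊩ validStringsF → ∃[ M ] x ≡ codeStrings M
  validStrings-sound h =
    let (xs , e , all) = all-sound (call validStringF (v1 ∷ [])) h
        (M , e′) = decode-all validString-sound all
    in M , trans e (cong codeL e′)

  validStrings-complete : ∀ M → codeStrings M ∷ [] ⊩ validStringsF
  validStrings-complete M = all-complete (call validStringF (v1 ∷ [])) (Allₚ.map⁺ (All.tabulate {xs = M} λ {σ} _ → validString-complete σ))

  coprime-sound : ∀ {n d} → n ∷ d ∷ [] ⊩ coprimeF → Coprime n (suc d)
  coprime-sound {n} {d} (u , v , h) = Bézout-coprime {d = 1} {n} {suc d} (identity h)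
    where
    identity : 1 + v * suc d ≡ u * n ⊎ 1 + u * n ≡ v * suc d → Bézout.Identity 1 (n * 1) (suc d * 1)
    identity (inj₁ e) = Bézout.+- u v (subst₂ (λ m k → 1 + v * m ≡ u * k) (sym (*-identityʳ (suc d))) (sym (*-identityʳ n)) e)
    identity (inj₂ e) = Bézout.-+ u v (subst₂ (λ m k → 1 + u * k ≡ v * m) (sym (*-identityʳ (suc d))) (sym (*-identityʳ n)) e)

  coprime-complete : ∀ {n d} → Coprime n (suc d) → n ∷ d ∷ [] ⊩ coprimeF
  coprime-complete c with coprime-Bézout c
  ... | Bézout.+- u v e = u , v , inj₁ e
  ... | Bézout.-+ u v e = u , v , inj₂ e

  validRational-sound : ∀ {x} → x ∷ [] ⊩ validRationalF → ∃[ q ] x ≡ codeQ q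
  validRational-sound (n , d , inj₁ (e , c)) = mkℚ (+ n) d (coprime-sound c) , e
  validRational-sound (n , d , inj₂ (e , c)) = mkℚ -[1+ n ] d (coprime-sound c) , e

  -- The coprimality stored in a rational is irrelevant and has to be recomputed before Bézout
  -- coefficients can be taken from it.
  validRational-complete : ∀ q → codeQ q ∷ [] ⊩ validRationalF
  validRational-complete (mkℚ (+ n) d c) = n , d , inj₁ (refl , coprime-complete (recompute c))
  validRational-complete (mkℚ -[1+ n ] d c) = n , d , inj₂ (refl , coprime-complete (recompute c))

  validCondition-sound : ∀ {x} → x ∷ [] ⊩ validConditionF → ∃[ c ] x ≡ codeC c
  validCondition-sound (s , r , e , hs , hr) =
    let (σ , eσ) = validString-sound hs ; (q , eq) = validRational-sound hr
    in (σ , q) , trans e (cong₂ ⟪_,_⟫ eσ eq)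

  validCondition-complete : ∀ c → codeC c ∷ [] ⊩ validConditionF
  validCondition-complete (σ , q) = _ , _ , refl , validString-complete σ , validRational-complete q

  validElement-sound : ∀ {x} → x ∷ [] ⊩ validElementF → ∃[ e ] x ≡ codeE e
  validElement-sound (l , c , e , hl , hc) =
    let (xs , el , all) = all-sound (call validConditionF (v1 ∷ [])) hl
        (cs , ecs) = decode-all validCondition-sound all
        (c′ , ec) = validCondition-sound hc
    in (cs , c′) , trans e (cong₂ ⟪_,_⟫ (trans el (cong codeL ecs)) ec)

  validElement-complete : ∀ e → codeE e ∷ [] ⊩ validElementF
  validElement-complete (cs , c) = _ , _ , refl ,
    all-complete (call validConditionF (v1 ∷ [])) (Allₚ.map⁺ (All.tabulate {xs = cs} λ {c} _ → validCondition-complete c)) ,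
    validCondition-complete c

-- Trimming of c.e. sets, and the universal test as a formula

module TrimmedTests where

  open import Defs renaming (_+_ to _+ʳ_; _≤_ to _≤ʳ_; _<_ to _<ʳ_; _≈_ to _≈ʳ_)
  open import Data.Empty using (⊥-elim)
  open import Data.Integer using (+_; -[1+_])
  open import Data.List using (List; []; _∷_; map; length)
  open import Data.List.Membership.Propositional using (_∈_)
  open import Data.List.Relation.Unary.All using ([]; _∷_)
  import Data.List.Relation.Unary.All as All
  open import Data.List.Relation.Unary.Any using (Any; here; there)
  import Data.List.Relation.Unary.Any as Any
  import Data.List.Relation.Unary.Any.Properties as Anyₚ
  open import Data.Nat hiding (_⊔_; _≟_)
  open import Data.Nat.Properties
  open import Data.Product using (∃; ∃-syntax; _×_; _,_; proj₁; proj₂)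
  open import Data.Rational using (ℚ; mkℚ; 0ℚ)
  import Data.Rational as ℚ
  import Data.Rational.Properties as ℚₚ
  open import Data.Sum using (_⊎_; inj₁; inj₂; [_,_]′)
  open import Data.Vec using (Vec; []; _∷_)
  open import Relation.Binary.PropositionalEquality
  open SigmaOneFormulas renaming (_≐_ to _≐ₜ_)
  open UniversalFunction
  open RationalArithmetic renaming (*-monoˡ-≤ to *-monoˡ-≤ᵠ)
  open ClopenSets hiding (_⊆_; total)
  open LimitMeasures
  open GeneratedMass
  open Weights
  open CodeFormulas

  codeQ-nonneg : ∀ {q n d} → codeQ q ≡ ⟪ 2 * n , d ⟫ → Num q n d
  codeQ-nonneg {mkℚ z d c} {n} {d′} e with ⟪⟫-injective {code-ℤ z} {d} {2 * n} {d′} e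
  ... | ez , ed = code-ℤ-injective {z} {+ n} ez , ed

  codeQ-neg : ∀ {q n d} → codeQ q ≡ ⟪ suc (2 * n) , d ⟫ → q ℚ.< 0ℚ
  codeQ-neg {mkℚ z d c} {n} {d′} e with ⟪⟫-injective {code-ℤ z} {d} {suc (2 * n)} {d′} e
  ... | ez , ed with code-ℤ-injective {z} { -[1+ n ]} ez
  ... | refl = ℚₚ.negative⁻¹ (mkℚ -[1+ n ] d c)

  Num-code : ∀ {q n d} → Num q n d → codeQ q ≡ ⟪ 2 * n , d ⟫
  Num-code (e , e′) = cong₂ ⟪_,_⟫ (cong code-ℤ e) e′

  code-sign : ∀ q → (q ℚ.< 0ℚ × ∃[ n ] ∃[ d ] codeQ q ≡ ⟪ suc (2 * n) , d ⟫) ⊎ ∃[ n ] ∃[ d ] Num q n d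
  code-sign (mkℚ (+ n) d c) = inj₂ (n , d , refl , refl)
  code-sign q@(mkℚ -[1+ n ] d c) = inj₁ (ℚₚ.negative⁻¹ q , n , d , refl)

  Num≥0 : ∀ {q n d} → Num q n d → 0ℚ ℚ.≤ q
  Num≥0 {mkℚ (+ n) d c} (refl , refl) = ℚₚ.nonNegative⁻¹ (mkℚ (+ n) d c)

  -- Trimming the e-th computably enumerable set to a consistent one.  A number A below
  -- 2 ^ s stands for a set of elements enumerated before stage s.

  enumF : Fm 2
  enumF = call validElementF (v1 ∷ []) ∧ call haltsF (v0 ∷ v1 ∷ [])

  opaque
    -- A computable function in place of a formula: that a number is not enumerated by stage `s` can
    -- then be asserted positively, as a successor value.
    enumStage : Vec ℕ 3 → ℕ
    enumStage = bounded enumF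

    enumStageᶜ : Computable enumStage
    enumStageᶜ = boundedᶜ enumF

    enumStage-mono : ∀ {e s s′ x} → s ≤ s′ → enumStage (s ∷ e ∷ x ∷ []) ≡ 0 → enumStage (s′ ∷ e ∷ x ∷ []) ≡ 0
    enumStage-mono {e} {x = x} = bounded-mono enumF (e ∷ x ∷ [])

    enumStage-sound : ∀ {e s x} → enumStage (s ∷ e ∷ x ∷ []) ≡ 0 → e ∷ x ∷ [] ⊩ enumF
    enumStage-sound {e} {s} {x} = bounded-sound enumF {s} (e ∷ x ∷ [])

    enumStage-complete : ∀ {e x} → e ∷ x ∷ [] ⊩ enumF → ∃[ s ] enumStage (s ∷ e ∷ x ∷ []) ≡ 0
    enumStage-complete {e} {x} = bounded-complete enumF (e ∷ x ∷ [])

  stage : ∀ {n} → Term n → Term n → Term n → Term n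
  stage e s x = app enumStage enumStageᶜ (s ∷ e ∷ x ∷ [])

  -- In the next three: M is a list of N + 1 strings.
  boundF : Fm 4
  boundF =
      ∃′ (∃′ (v3 ≐ₜ ⦅ S (lit 2 ⊗ v1) , v0 ⦆))
    ∨ ∃′ (∃′ (∃′ (v4 ≐ₜ ⦅ lit 2 ⊗ v2 , v1 ⦆ ∧ call countF (v3 ∷ v5 ∷ v0 ∷ S v6 ∷ [])
        ∧ call leqF (v2 ⊗ S v6 ∷ v0 ⊗ S v1 ∷ []))))

  fitsF : Fm 3
  fitsF = ∃′ (∃′ (∃′ (v3 ≐ₜ ⦅ v2 , ⦅ v1 , v0 ⦆ ⦆ ∧ call boundF (v1 ∷ v0 ∷ v4 ∷ v5 ∷ []))))

  feasibleF : Fm 2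
  feasibleF = ∃′ (∃′ (call validStringsF (v1 ∷ []) ∧ ∃′ (call countF (lit 0 ∷ v2 ∷ v0 ∷ S v1 ∷ []))
    ∧ ∀< v3 (call notMemF (v0 ∷ v3 ∷ []) ∨ call fitsF (v0 ∷ v2 ∷ v1 ∷ []))))

  -- The list has a condition at the string that is worth at least `a` of `N + 1` units. Negative
  -- bounds are skipped, as they hold in every measure.
  hasInputF requiresF : Fm 4
  hasInputF = ∃′ (∃′ (call memberF (⦅ v3 , ⦅ lit 2 ⊗ v1 , v0 ⦆ ⦆ ∷ v2 ∷ []) ∧ call leqF (v4 ⊗ S v0 ∷ v1 ⊗ S v5 ∷ [])))
  requiresF = ∃′ (∃′ (v2 ≐ₜ ⦅ v1 , v0 ⦆ ∧ call hasInputF (v1 ∷ v3 ∷ v4 ∷ v5 ∷ [])))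

  inputF : Fm 3
  inputF = ∃′ (∃′ (∃′ (v3 ≐ₜ ⦅ v2 , ⦅ v1 , v0 ⦆ ⦆
    ∧ ∃′ (call lessF (v0 ∷ v2 ∷ []) ∧ call memF (v0 ∷ v3 ∷ []) ∧ call requiresF (v0 ∷ v5 ∷ v6 ∷ v1 ∷ [])))))

  -- For some `N` the inputs force `N + 1` or more units out of `N + 1` at the root; a probability
  -- measure strictly above them would stay below that.
  infeasibleF : Fm 2
  infeasibleF = ∃′ (∃′ (call leqF (S v1 ∷ v0 ∷ []) ∧ call (clF inputF) (⦅ v2 , ⦅ v3 , v1 ⦆ ⦆ ∷ lit 0 ∷ v0 ∷ [])))

  -- Sets of numbers below `s` have codes below 2^s, so the quantifier over them is bounded and the
  -- property stays Σ₁. The first clause discards sets with a member not yet enumerated.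
  consistentF : Fm 2
  consistentF = ∀< ⦅ v1 , lit 0 ⦆
    ( ∃′ (call lessF (v0 ∷ v3 ∷ []) ∧ call memF (v0 ∷ v1 ∷ []) ∧ ∃′ (stage v3 v4 v1 ≐ₜ S v0))
    ∨ call feasibleF (v0 ∷ v2 ∷ [])
    ∨ call infeasibleF (v0 ∷ v2 ∷ []))

  trimmedF : Fm 2
  trimmedF = ∃′ (call lessF (v2 ∷ v0 ∷ []) ∧ stage v1 v0 v2 ≐ₜ lit 0 ∧ call consistentF (v1 ∷ v0 ∷ []))

  -- The universal test is the semimeasure generated by the e-th trimmed sets, scaled by 2^-(e+1).

  genF : Fm 4
  genF = ∃′ (∃′ (∃′ (∃′ (call trimmedF (v3 ∷ ⦅ v2 , ⦅ v6 , ⦅ lit 2 ⊗ v1 , v0 ⦆ ⦆ ⦆ ∷ [])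
    ∧ call subsetF (v4 ∷ v2 ∷ []) ∧ call leqF (v7 ⊗ (S v0 ⊗ ⦅ S v3 , lit 0 ⦆) ∷ v1 ⊗ v5 ∷ [])))))

  generatedF : Fm 3
  generatedF = ∃′ (∃′ (v2 ≐ₜ ⦅ v1 , v0 ⦆ ∧ call genF (v1 ∷ v0 ∷ v3 ∷ v4 ∷ [])))

  -- A nonnegative `q` has to be exceeded strictly by the generated mass, so that the implied bounds
  -- have no maximum; a negative `q` is always implied.
  impliesF : Fm 3
  impliesF =
      ∃′ (∃′ (v4 ≐ₜ ⦅ S (lit 2 ⊗ v1) , v0 ⦆))
    ∨ ∃′ (∃′ (∃′ (∃′ (v6 ≐ₜ ⦅ lit 2 ⊗ v3 , v2 ⦆ ∧ call (clF generatedF) (⦅ v4 , v1 ⦆ ∷ v5 ∷ v0 ∷ [])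
        ∧ call lessF (v3 ⊗ v1 ∷ v0 ⊗ S v2 ∷ [])))))

  universalF : Fm 1
  universalF = ∃′ (∃′ (∃′ (v3 ≐ₜ ⦅ v2 , ⦅ v1 , v0 ⦆ ⦆ ∧ call impliesF (v2 ∷ v1 ∷ v0 ∷ []))))

  Enumerated : ℕ → ℕ → ℕ → Set
  Enumerated e s x = enumStage (s ∷ e ∷ x ∷ []) ≡ 0

  Consistent : ℕ → ℕ → Set
  Consistent e s = e ∷ s ∷ [] ⊩ consistentF

  Trimmed : ℕ → TestElement → Set
  Trimmed e el = e ∷ codeE el ∷ [] ⊩ trimmedF

  Enumerated-valid : ∀ {e s x} → Enumerated e s x → ∃[ el ] x ≡ codeE el
  Enumerated-valid h = validElement-sound (proj₁ (enumStage-sound h))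

  Feasible : ℕ → ℕ → Set
  Feasible A s = ∃[ M ] ∃[ N ] (length M ≡ suc N ×
    ∀ {cs σ q} → codeE (cs , σ , q) < s → Mem (codeE (cs , σ , q)) A → q ℚ.* ι (suc N) ℚ.≤ ι (count σ M))

  feasible-sound : ∀ {A s} → A ∷ s ∷ [] ⊩ feasibleF → Feasible A s
  feasible-sound {A} {s} (m , N , valid , (k , len) , all) with validStrings-sound valid
  ... | M , refl = M , N , sym (proj₂ (count-sound [] M len)) , λ {cs} {σ} {q} → holds {cs} {σ} {q}
    where
    holds : ∀ {cs σ q} → codeE (cs , σ , q) < s → Mem (codeE (cs , σ , q)) A → q ℚ.* ι (suc N) ℚ.≤ ι (count σ M)
    holds {cs} {σ} {q} x<s x∈ with all _ x<s
    ... | inj₁ x∉ = ⊥-elim (mem-exclusive x∈ x∉)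
    ... | inj₂ (_ , σ′ , q′ , e , b) with ⟪⟫-injective (⟪⟫-injʳ e)
    ...   | refl , refl with b
    ...     | inj₁ (n , d , e′) = ℚₚ.≤-trans (*-monoˡ-≤ᵠ (0≤ι (suc N)) (ℚₚ.<⇒≤ (codeQ-neg {q} {n} {d} e′)))
                  (ℚₚ.≤-trans (ℚₚ.≤-reflexive (ℚₚ.*-zeroˡ (ι (suc N)))) (0≤ι (count σ M)))
    ...     | inj₂ (n , d , k′ , e′ , c , le) = Num-≥ {q} (codeQ-nonneg {q} {n} {d} e′)
                  (≤-trans (⊩leq⇒ le) (*-monoˡ-≤ (suc d) (proj₁ (count-sound σ M c))))

  feasible-complete : ∀ {A s} (M : List String) N → length M ≡ suc N →
    (∀ x → x < s → Mem x A → ∃[ cs ] ∃[ σ ] ∃[ q ] (x ≡ codeE (cs , σ , q) × q ℚ.* ι (suc N) ℚ.≤ ι (count σ M))) →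
    (∀ x → Mem x A ⊎ NotMem x A) → A ∷ s ∷ [] ⊩ feasibleF
  feasible-complete {A} {s} M N len h dec = codeStrings M , N , validStrings-complete M ,
    (count [] M , subst (λ n → 0 ∷ codeStrings M ∷ count [] M ∷ n ∷ [] ⊩ countF) len (count-complete [] M)) , all
    where
    bound : ∀ σ q → q ℚ.* ι (suc N) ℚ.≤ ι (count σ M) → codeS σ ∷ codeQ q ∷ codeStrings M ∷ N ∷ [] ⊩ boundF
    bound σ q le with code-sign q
    ... | inj₁ (_ , n , d , e) = inj₁ (n , d , e)
    ... | inj₂ (n , d , num) = inj₂ (n , d , count σ M , Num-code {q} num ,
            subst (λ n → codeS σ ∷ codeStrings M ∷ count σ M ∷ n ∷ [] ⊩ countF) len (count-complete σ M) ,
            ⊩leq⇐ (Num-≥⁻¹ {q} num le))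
    all : ∀ x → x < s → x ∷ N ∷ codeStrings M ∷ A ∷ s ∷ [] ⊩ call notMemF (v0 ∷ v3 ∷ []) ∨ call fitsF (v0 ∷ v2 ∷ v1 ∷ [])
    all x x<s with dec x
    ... | inj₂ x∉ = inj₁ x∉
    ... | inj₁ x∈ with h x x<s x∈
    ...   | cs , σ , q , refl , le = inj₂ (_ , _ , _ , refl , bound σ q le)

  Input : ℕ → ℕ → ℕ → String → ℕ → Set
  Input A s N σ a = ∃[ x ] (x < s × Mem x A × ∃[ l ] ∃[ c ] (x ≡ ⟪ l , c ⟫ × l ∷ codeS σ ∷ a ∷ N ∷ [] ⊩ hasInputF))

  infeasible-sound : ∀ {A s} → A ∷ s ∷ [] ⊩ infeasibleF → ∃[ N ] ∃[ a ] (suc N ≤ a × Cl (Input A s N) [] a)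
  infeasible-sound {A} {s} (N , a , le , c) = N , a , ⊩leq⇒ le , Cl-map (λ {σ} {b} → conv {σ} {b}) (cl-sound inputF [] c)
    where
    conv : ∀ {σ a} → Base inputF ⟪ A , ⟪ s , N ⟫ ⟫ σ a → Input A s N σ a
    conv (A′ , s′ , N′ , e , x , x<s , x∈ , r) with ⟪⟫-injective e
    ... | refl , e′ with ⟪⟫-injective e′
    ... | refl , refl = x , ⊩less⇒ x<s , x∈ , r

  infeasible-complete : ∀ {A s N a} → suc N ≤ a → Cl (Input A s N) [] a → A ∷ s ∷ [] ⊩ infeasibleF
  infeasible-complete {A} {s} {N} {a} le c = N , a , ⊩leq⇐ le ,
    cl-complete inputF (Cl-map (λ {σ} {b} → conv {σ} {b}) c)
    where
    conv : ∀ {σ b} → Input A s N σ b → Base inputF ⟪ A , ⟪ s , N ⟫ ⟫ σ b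
    conv (x , x<s , x∈ , r) = A , s , N , refl , x , ⊩less⇐ x<s , x∈ , r

  hasInput-sound : ∀ {cs σ a N} → codeCs cs ∷ codeS σ ∷ a ∷ N ∷ [] ⊩ hasInputF →
    ∃[ q ] ((σ , q) ∈ cs × ι a ℚ.≤ q ℚ.* ι (suc N))
  hasInput-sound {cs} {σ} {a} {N} (n , d , m , le) with Anyₚ.map⁻ (any-sound (v0 ≐ₜ v1) (map codeC cs) m)
  ... | found = go cs found
    where
    go : ∀ cs → Any (λ c → ⟪ codeS σ , ⟪ 2 * n , d ⟫ ⟫ ≡ codeC c) cs → ∃[ q ] ((σ , q) ∈ cs × ι a ℚ.≤ q ℚ.* ι (suc N))
    go ((τ , q) ∷ cs) (here e) with ⟪⟫-injective e
    ... | eσ , eq with refl ← codeS-injective {σ} {τ} eσ = q , here refl , Num-≤ {q} (codeQ-nonneg {q} {n} {d} (sym eq)) (⊩leq⇒ le)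
    go (c ∷ cs) (there m) = let (q , i , h) = go cs m in q , there i , h

  hasInput-complete : ∀ {cs σ q n d a N} → (σ , q) ∈ cs → Num q n d → ι a ℚ.≤ q ℚ.* ι (suc N) →
    codeCs cs ∷ codeS σ ∷ a ∷ N ∷ [] ⊩ hasInputF
  hasInput-complete {cs} {σ} {q} {n} {d} i num le = n , d ,
    any-complete (v0 ≐ₜ v1) (Anyₚ.map⁺ (Any.map (λ e → trans (cong ⟪ codeS σ ,_⟫ (sym (Num-code {q} num))) (cong codeC e)) i)) ,
    ⊩leq⇐ (Num-≤⁻¹ {q} num le)

  -- Stage 0 is the default for c.e. sets from which a derivation takes nothing.
  consistent-0 : ∀ e → Consistent e 0
  consistent-0 e A _ = inj₂ (inj₁ (feasible-empty A))
    where
    feasible-empty : ∀ A → A ∷ 0 ∷ [] ⊩ feasibleF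
    feasible-empty A = codeStrings ([] ∷ []) , 0 , validStrings-complete ([] ∷ []) , (_ , count-complete [] ([] ∷ [])) , λ _ ()

  trimmed-stage : ∀ {e el} → Trimmed e el → ∃[ s ] (codeE el < s × Enumerated e s (codeE el) × Consistent e s)
  trimmed-stage (s , lt , l , c) = s , ⊩less⇒ lt , l , c

  Generated : List Condition → ℕ → String → ℕ → Set
  Generated cs N σ a = ∃[ e ] ∃[ cs′ ] ∃[ q ] ∃[ n ] ∃[ d ] (Num q n d × Trimmed e (cs′ , σ , q)
    × (∀ {c} → c ∈ cs′ → c ∈ cs) × a * (suc d * 2 ^ suc e) ≤ n * N)

  generated-sound : ∀ {cs N σ a} → Base generatedF ⟪ codeCs cs , N ⟫ σ a → Generated cs N σ a
  generated-sound {cs} {N} {σ} {a} (l , N′ , e , ei , l′ , n , d , t , sub , le) with ⟪⟫-injective e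
  ... | refl , refl with Enumerated-valid (proj₁ (proj₂ (proj₂ t)))
  ... | (cs′ , τ , q) , e′ with ⟪⟫-injective e′
  ... | refl , ec with ⟪⟫-injective ec
  ... | eσ , eq with refl ← codeS-injective {σ} {τ} eσ = ei , cs′ , q , n , d , num ,
        subst (λ c → ei ∷ ⟪ codeCs cs′ , ⟪ codeS σ , c ⟫ ⟫ ∷ [] ⊩ trimmedF) (sym (Num-code {q} num)) t ,
        subset-sound {cs} {cs′} sub ,
        subst (λ p → a * (suc d * p) ≤ n * N) (pow≡ (suc ei)) (⊩leq⇒ le)
        where num = codeQ-nonneg {q} {n} {d} (sym eq)

  generated-complete : ∀ {cs N σ a} → Generated cs N σ a → Base generatedF ⟪ codeCs cs , N ⟫ σ a
  generated-complete {cs} {N} {σ} {a} (e , cs′ , q , n , d , num , t , sub , le) =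
    codeCs cs , N , refl , e , codeCs cs′ , n , d ,
    subst (λ c → e ∷ ⟪ codeCs cs′ , ⟪ codeS σ , c ⟫ ⟫ ∷ [] ⊩ trimmedF) (Num-code {q} num) t ,
    subset-complete {cs} {cs′} sub ,
    ⊩leq⇐ (subst (λ p → a * (suc d * p) ≤ n * N) (sym (pow≡ (suc e))) le)

  Implies : List Condition → String → ℚ → Set
  Implies cs σ q = ∃[ N ] ∃[ a ] (Cl (Generated cs N) σ a × q ℚ.* ι N ℚ.< ι a)

  universal-sound : ∀ {cs σ q} → codeE (cs , σ , q) ∷ [] ⊩ universalF → Implies cs σ q
  universal-sound {cs} {σ} {q} (_ , _ , _ , e , h) with ⟪⟫-injective e
  ... | refl , e′ with ⟪⟫-injective e′
  ... | refl , refl with h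
  ...   | inj₁ (n , d , eq) = 1 , 0 , none , subst₂ ℚ._<_ (sym (trans (cong (q ℚ.*_) ι1) (ℚₚ.*-identityʳ q))) (sym ι0) (codeQ-neg {q} {n} {d} eq)
  ...   | inj₂ (n , d , N , a , eq , c , lt) = N , a , Cl-map (λ {τ} {b} → generated-sound {cs} {N} {τ} {b}) (cl-sound generatedF σ c) ,
          Num-> {q} (codeQ-nonneg {q} {n} {d} eq) (⊩less⇒ lt)

  universal-complete : ∀ {cs σ q} → Implies cs σ q → codeE (cs , σ , q) ∷ [] ⊩ universalF
  universal-complete {cs} {σ} {q} (N , a , c , lt) = _ , _ , _ , refl , implied (code-sign q)
    where
    implied : (q ℚ.< 0ℚ × ∃[ n ] ∃[ d ] codeQ q ≡ ⟪ suc (2 * n) , d ⟫) ⊎ ∃[ n ] ∃[ d ] Num q n d →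
      codeCs cs ∷ codeS σ ∷ codeQ q ∷ [] ⊩ impliesF
    implied (inj₁ (_ , n , d , e)) = inj₁ (n , d , e)
    implied (inj₂ (n , d , num)) = inj₂ (n , d , N , a , Num-code {q} num ,
      cl-complete generatedF (Cl-map (λ {τ} {b} → generated-complete {cs} {N} {τ} {b}) c) , ⊩less⇐ (Num->⁻¹ {q} num lt))

-- The universal test is a test

module UniversalTests where

  open import Defs renaming (_+_ to _+ʳ_; _≤_ to _≤ʳ_; _<_ to _<ʳ_; _≈_ to _≈ʳ_)
  open import Axiom.ExcludedMiddle using (ExcludedMiddle)
  open import Data.Bool using (Bool; true; false)
  open import Data.Empty using (⊥; ⊥-elim)
  open import Data.List using (List; []; _∷_; _++_; length)
  open import Data.List.Membership.Propositional using (_∈_)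
  open import Data.List.Membership.Propositional.Properties using (∈-++⁺ˡ; ∈-++⁺ʳ)
  open import Data.List.Relation.Unary.All using (All; []; _∷_)
  import Data.List.Relation.Unary.All as All
  import Data.List.Relation.Unary.All.Properties as Allₚ
  open import Data.Nat hiding (_≟_)
  import Data.Nat as ℕ
  open import Data.Nat.Properties hiding (<⇒≱)
  open import Data.Nat.Tactic.RingSolver using (solve-∀)
  open import Data.Product using (∃; ∃-syntax; _×_; _,_; proj₁; proj₂)
  open import Data.Rational using (ℚ; 0ℚ; 1ℚ)
  import Data.Rational as ℚ
  import Data.Rational.Properties as ℚₚ
  open import Data.Sum using (inj₁; inj₂; [_,_]′)
  open import Data.Vec using ([]; _∷_)
  open import Function using (_∘_)
  open import Level using (0ℓ)
  open import Relation.Binary.PropositionalEquality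
  open import Relation.Nullary using (yes; no; does)
  open import Tactic.RingSolver renaming (solve-∀ to solve-∀-over)
  open SigmaOneFormulas using (_⊩_; formula-CE)
  open UniversalFunction
  open RationalArithmetic renaming (*-monoʳ-≤ to *-monoʳ-≤ᵠ; *-monoˡ-≤ to *-monoˡ-≤ᵠ; *-monoˡ-< to *-monoˡ-<ᵠ; *-cancelʳ-≤ to *-cancelʳ-≤ᵠ; *-cancelʳ-< to *-cancelʳ-<ᵠ)
  open ClopenSets using (total; total-mono; total-+; geometric; geometric>0; total-geometric)
  open LimitMeasures
  open GeneratedMass
  open Weights
  open CodeFormulas
  open TrimmedTests
  open ScarfLemma using (module Classical)

  <ʳ⇒Below : ∀ {q} x → fromℚ q <ʳ x → ℝ.Below x q
  <ʳ⇒Below x (r , r≮q , r∈) = below-≤ x (ℚₚ.≮⇒≥ r≮q) r∈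

  Below⇒<ʳ : ∀ {q} x → ℝ.Below x q → fromℚ q <ʳ x
  Below⇒<ʳ {q} x q∈ = q , ℚₚ.<-irrefl refl , q∈

  total-term : ∀ {r : ℕ → ℚ} → (∀ i → 0ℚ ℚ.≤ r i) → ∀ {i n} → i < n → r i ℚ.≤ total r n
  total-term {r} r≥0 {i} {suc n} i<n with m≤n⇒m<n∨m≡n (≤-pred i<n)
  ... | inj₁ i<n′ = ℚₚ.≤-trans (total-term r≥0 i<n′)
        (subst (ℚ._≤ total r n ℚ.+ r n) (ℚₚ.+-identityʳ (total r n)) (ℚₚ.+-monoʳ-≤ (total r n) (r≥0 n)))
  ... | inj₂ refl = subst (ℚ._≤ total r n ℚ.+ r n) (ℚₚ.+-identityˡ (r n)) (ℚₚ.+-monoˡ-≤ (r n) (total≥0 n))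
    where
    total≥0 : ∀ n → 0ℚ ℚ.≤ total r n
    total≥0 zero = ℚₚ.≤-refl
    total≥0 (suc n) = ℚₚ.+-mono-≤ (total≥0 n) (r≥0 n)

  opaque
    weight : ℕ → ℚ
    weight = geometric 1ℚ

    weight>0 : ∀ e → 0ℚ ℚ.< weight e
    weight>0 = geometric>0 (ℚₚ.positive⁻¹ 1ℚ)

    total-weight : ∀ n → total weight n ℚ.≤ 1ℚ
    total-weight = total-geometric (ℚₚ.positive⁻¹ 1ℚ)

    weight-ι : ∀ e → weight e ℚ.* ι (2 ^ suc e) ≡ 1ℚ
    weight-ι e = trans (cong (weight e ℚ.*_) (ι-* 2 (2 ^ e))) (go e)
      where
      ι2 : ι 2 ≡ 1ℚ ℚ.+ 1ℚ
      ι2 = trans (ι-+ 1 1) (cong₂ ℚ._+_ ι1 ι1)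
      ring : ∀ h x → h ℚ.* ((1ℚ ℚ.+ 1ℚ) ℚ.* x) ≡ (h ℚ.+ h) ℚ.* x
      ring = solve-∀-over ℚ-ring
      double : ∀ x y → half x ℚ.* (ι 2 ℚ.* y) ≡ x ℚ.* y
      double x y = trans (cong (λ t → half x ℚ.* (t ℚ.* y)) ι2) (trans (ring (half x) y) (cong (ℚ._* y) (half+half x)))
      go : ∀ e → weight e ℚ.* (ι 2 ℚ.* ι (2 ^ e)) ≡ 1ℚ
      go zero = trans (double 1ℚ (ι 1)) (trans (ℚₚ.*-identityˡ (ι 1)) ι1)
      go (suc e) = trans (double (weight e) (ι (2 ^ suc e))) (trans (cong (weight e ℚ.*_) (ι-* 2 (2 ^ e))) (go e))

  module UniversalTest (em : ExcludedMiddle 0ℓ) where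

    open Classical em
    open Subsequences em

    module _ (μ : ProbabilityMeasure) where

      module _ {e s : ℕ} (consistent : Consistent e s) where
        private
          Satisfied : ℕ → Set
          Satisfied x = Enumerated e s x × ∃[ cs ] ∃[ c ] (x ≡ codeE (cs , c) × All (μ ⊨_) cs)

          f : ℕ → Bool
          f x = does (em {Satisfied x})

          A : ℕ
          A = fromBits f s

          f-true : ∀ {x} → Satisfied x → f x ≡ true
          f-true {x} h with em {Satisfied x}
          ... | yes _ = refl
          ... | no ¬h = ⊥-elim (¬h h)

          member⇒ : ∀ {x} → x < s → Mem x A → Satisfied x
          member⇒ {x} x<s x∈ with em {Satisfied x} in eq
          ... | yes h = h
          ... | no _ = ⊥-elim (mem-exclusive x∈ (fromBits-notMem f s x x<s (cong does eq)))

          member⇐ : ∀ {x} → x < s → Satisfied x → Mem x A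
          member⇐ x<s h = fromBits-mem f s _ x<s (f-true h)

          possible : ∀ {N a} → suc N ≤ a → Cl (Input A s N) [] a → ⊥
          possible {N} le c = 1+n≰n (≤-trans (Cl-root (μ ⟨_⟩) (λ σ → ProbabilityMeasure.nonnegative μ (cylinder σ))
              (cylinder-superadditive μ) (suc N) (proj₁ (ProbabilityMeasure.total μ)) (s≤s z≤n) mass c) le)
            where
            mass : ∀ {σ a} → Input A s N σ a →
              Mass (μ ⟨_⟩) (λ σ → ProbabilityMeasure.nonnegative μ (cylinder σ)) (cylinder-superadditive μ) (suc N) σ a
            mass {σ} (x , x<s , x∈ , l , c , e , h) with member⇒ x<s x∈
            ... | _ , cs , c′ , e′ , sat with ⟪⟫-injective (trans (sym e) e′)
            ... | refl , _ with hasInput-sound {cs} {σ} h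
            ... | q , i , le = inj₂ (q , le , <ʳ⇒Below (μ ⟨ σ ⟩) (All.lookup sat i))

        -- Consistency is applied to the set of elements enumerated by stage `s` whose inputs hold
        -- at `μ`. The first alternative fails by the choice of this set and the last because `μ`
        -- itself satisfies the inputs, so the outputs are jointly realised.
        certificate : ∃[ M ] ∃[ N ] (length M ≡ suc N × ∀ {cs σ q} → codeE (cs , σ , q) < s →
          Enumerated e s (codeE (cs , σ , q)) → All (μ ⊨_) cs → q ℚ.* ι (suc N) ℚ.≤ ι (count σ M))
        certificate with consistent A (subst (A <_) (sym (pow≡ s)) (fromBits< f s))
        ... | inj₁ (x , x<s , x∈ , y , e) with () ← trans (sym (proj₁ (member⇒ (⊩less⇒ x<s) x∈))) e
        ... | inj₂ (inj₂ inf) = let (N , a , le , c) = infeasible-sound {A} {s} inf in ⊥-elim (possible le c)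
        ... | inj₂ (inj₁ feas) = let (M , N , len , h) = feasible-sound {A} {s} feas in
              M , N , len , λ {cs} {σ} {q} lt en sat → h {cs} {σ} {q} lt (member⇐ lt (en , cs , (σ , q) , refl , sat))

    -- st e is the stage up to which the e-th set is enumerated.
    GeneratedBy : (ℕ → ℕ) → ℕ → List Condition → ℕ → String → ℕ → Set
    GeneratedBy st E cs N σ a = ∃[ e ] (e < E × ∃[ cs′ ] ∃[ q ] ∃[ n ] ∃[ d ] (Num q n d ×
      codeE (cs′ , σ , q) < st e × Enumerated e (st e) (codeE (cs′ , σ , q)) ×
      (∀ {c} → c ∈ cs′ → c ∈ cs) × a * (suc d * 2 ^ suc e) ≤ n * N))

    generatedBy-mono : ∀ {st st′ E E′ cs N σ a} → (∀ e → st e ≤ st′ e) → E ≤ E′ →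
      GeneratedBy st E cs N σ a → GeneratedBy st′ E′ cs N σ a
    generatedBy-mono st≤ E≤ (e , e<E , cs′ , q , n , d , num , lt , en , sub , le) =
      e , <-≤-trans e<E E≤ , cs′ , q , n , d , num , <-≤-trans lt (st≤ e) , enumStage-mono (st≤ e) en , sub , le

    -- A derivation may use the same c.e. set at several stages. Consistency may be lost at later
    -- stages, but the larger of two stages is one of them, and enumeration is monotone.
    collect-stages : ∀ {cs N σ a} → Cl (Generated cs N) σ a →
      ∃[ st ] ∃[ E ] ((∀ e → Consistent e (st e)) × Cl (GeneratedBy st E cs N) σ a)
    collect-stages none = (λ _ → 0) , 0 , consistent-0 , none
    collect-stages {cs} {N} (split {σ} c d) with collect-stages c | collect-stages d
    ... | st , E , con , c′ | st′ , E′ , con′ , d′ =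
          (λ e → st e ⊔ st′ e) , E ⊔ E′ , con″ ,
          split (Cl-map (λ {τ} {b} → generatedBy-mono {st} {λ e → st e ⊔ st′ e} {cs = cs} {N} {τ} {b} (λ e → m≤m⊔n (st e) (st′ e)) (m≤m⊔n E E′)) c′)
                (Cl-map (λ {τ} {b} → generatedBy-mono {st′} {λ e → st e ⊔ st′ e} {cs = cs} {N} {τ} {b} (λ e → m≤n⊔m (st e) (st′ e)) (m≤n⊔m E E′)) d′)
      where
      con″ : ∀ e → Consistent e (st e ⊔ st′ e)
      con″ e with ⊔-sel (st e) (st′ e)
      ... | inj₁ eq = subst (Consistent e) (sym eq) (con e)
      ... | inj₂ eq = subst (Consistent e) (sym eq) (con′ e)
    collect-stages {cs} {N} (base {σ} (e , cs′ , q , n , d , num , t , sub , le)) with trimmed-stage {e} {cs′ , σ , q} t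
    ... | s , lt , en , con = st , suc e , con′ ,
          base (e , ≤-refl , cs′ , q , n , d , num , subst (codeE (cs′ , σ , q) <_) (sym st-e) lt ,
                subst (λ s → Enumerated e s (codeE (cs′ , σ , q))) (sym st-e) en , sub , le)
      where
      st : ℕ → ℕ
      st e′ with e′ ℕ.≟ e
      ... | yes _ = s
      ... | no _ = 0
      st-e : st e ≡ s
      st-e with e ℕ.≟ e
      ... | yes _ = refl
      ... | no ¬p = ⊥-elim (¬p refl)
      con′ : ∀ e′ → Consistent e′ (st e′)
      con′ e′ with e′ ℕ.≟ e
      ... | yes refl = con
      ... | no _ = consistent-0 e′

    module Bound (μ : ProbabilityMeasure) {cs : List Condition} (sat : All (μ ⊨_) cs)
      (st : ℕ → ℕ) (E : ℕ) (con : ∀ e → Consistent e (st e)) where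

      private
        M : ℕ → List String
        M e = proj₁ (certificate μ (con e))

        N : ℕ → ℕ
        N e = proj₁ (proj₂ (certificate μ (con e)))

        M-length : ∀ e → length (M e) ≡ suc (N e)
        M-length e = proj₁ (proj₂ (proj₂ (certificate μ (con e))))

        M-count : ∀ e {cs σ q} → codeE (cs , σ , q) < st e → Enumerated e (st e) (codeE (cs , σ , q)) →
          All (μ ⊨_) cs → q ℚ.* ι (suc (N e)) ℚ.≤ ι (count σ (M e))
        M-count e {cs} {σ} {q} = proj₂ (proj₂ (proj₂ (certificate μ (con e)))) {cs} {σ} {q}

      opaque
        density : ℕ → String → ℚ
        density e σ = ι (count σ (M e)) ℚ.* inv (N e)

        density≥0 : ∀ e σ → 0ℚ ℚ.≤ density e σ
        density≥0 e σ = 0≤* (0≤ι (count σ (M e))) (ℚₚ.<⇒≤ (inv>0 (N e)))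

        density≤1 : ∀ e σ → density e σ ℚ.≤ 1ℚ
        density≤1 e σ = subst (density e σ ℚ.≤_) (ι-inv (N e))
          (*-monoˡ-≤ᵠ (ℚₚ.<⇒≤ (inv>0 (N e))) (ι-mono-≤ (≤-trans (count≤length σ (M e)) (≤-reflexive (M-length e)))))
          where
          count≤length : ∀ σ M → count σ M ≤ length M
          count≤length σ [] = z≤n
          count≤length σ (ρ ∷ M) = +-mono-≤ (bit≤1 (isPrefix σ ρ)) (count≤length σ M)

        density-super : ∀ e σ → density e (σ ^0) ℚ.+ density e (σ ^1) ℚ.≤ density e σ
        density-super e σ = subst (ℚ._≤ density e σ) (ℚₚ.*-distribʳ-+ (inv (N e)) (ι (count (σ ^0) (M e))) (ι (count (σ ^1) (M e))))
          (*-monoˡ-≤ᵠ (ℚₚ.<⇒≤ (inv>0 (N e))) (subst (ℚ._≤ ι (count σ (M e))) (ι-+ (count (σ ^0) (M e)) (count (σ ^1) (M e)))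
            (ι-mono-≤ (count-super σ (M e)))))
          where
          extend : ∀ σ ρ → bit (isPrefix (σ ^0) ρ) + bit (isPrefix (σ ^1) ρ) ≤ bit (isPrefix σ ρ)
          extend [] [] = z≤n
          extend [] (false ∷ ρ) = ≤-refl
          extend [] (true ∷ ρ) = ≤-refl
          extend (b ∷ σ) [] = z≤n
          extend (false ∷ σ) (false ∷ ρ) = extend σ ρ
          extend (false ∷ σ) (true ∷ ρ) = z≤n
          extend (true ∷ σ) (false ∷ ρ) = z≤n
          extend (true ∷ σ) (true ∷ ρ) = extend σ ρ
          swap : ∀ a b c d → a + b + (c + d) ≡ a + c + (b + d)
          swap = solve-∀
          count-super : ∀ σ M → count (σ ^0) M + count (σ ^1) M ≤ count σ M
          count-super σ [] = z≤n
          count-super σ (ρ ∷ M) = ≤-trans (≤-reflexive (swap (bit (isPrefix (σ ^0) ρ)) (count (σ ^0) M) (bit (isPrefix (σ ^1) ρ)) (count (σ ^1) M)))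
            (+-mono-≤ (extend σ ρ) (count-super σ M))

        density-condition : ∀ e {cs′ σ q} → codeE (cs′ , σ , q) < st e → Enumerated e (st e) (codeE (cs′ , σ , q)) →
          All (μ ⊨_) cs′ → q ℚ.≤ density e σ
        density-condition e {cs′} {σ} {q} lt en sat′ = *-cancelʳ-≤ᵠ (0<ι (N e))
          (subst (q ℚ.* ι (suc (N e)) ℚ.≤_) (sym (inv*ι (ι (count σ (M e))) (N e))) (M-count e {cs′} {σ} {q} lt en sat′))

      -- A rational semimeasure above all that the derivation generates: set `e` contributes the
      -- distribution certified at its stage, with weight 2^-(e+1), and the weights add up to at
      -- most 1.
      mixture : String → ℚ
      mixture σ = total (λ e → weight e ℚ.* density e σ) E

      mixture≥0 : ∀ σ → 0ℚ ℚ.≤ mixture σ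
      mixture≥0 σ = go E
        where
        go : ∀ E → 0ℚ ℚ.≤ total (λ e → weight e ℚ.* density e σ) E
        go zero = ℚₚ.≤-refl
        go (suc E) = ℚₚ.+-mono-≤ (go E) (0≤* (ℚₚ.<⇒≤ (weight>0 E)) (density≥0 E σ))

      mixture≤1 : ∀ σ → mixture σ ℚ.≤ 1ℚ
      mixture≤1 σ = ℚₚ.≤-trans (total-mono E (λ e _ → subst (weight e ℚ.* density e σ ℚ.≤_) (ℚₚ.*-identityʳ (weight e))
        (*-monoʳ-≤ᵠ (ℚₚ.<⇒≤ (weight>0 e)) (density≤1 e σ)))) (total-weight E)

      mixture-super : ∀ σ → mixture (σ ^0) ℚ.+ mixture (σ ^1) ℚ.≤ mixture σ
      mixture-super σ = subst (ℚ._≤ mixture σ) (total-+ (λ e → weight e ℚ.* density e (σ ^0)) (λ e → weight e ℚ.* density e (σ ^1)) E)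
        (total-mono E (λ e _ → subst (ℚ._≤ weight e ℚ.* density e σ) (ℚₚ.*-distribˡ-+ (weight e) (density e (σ ^0)) (density e (σ ^1)))
          (*-monoʳ-≤ᵠ (ℚₚ.<⇒≤ (weight>0 e)) (density-super e σ))))

      private
        rescale : ∀ {ia w p q n g} → w ℚ.* p ≡ 1ℚ → ia ℚ.* p ℚ.≤ q ℚ.* n → q ℚ.≤ g → 0ℚ ℚ.≤ w → 0ℚ ℚ.≤ n →
          ia ℚ.≤ w ℚ.* g ℚ.* n
        rescale {ia} {w} {p} {q} {n} {g} wp le q≤g 0≤w 0≤n =
          ℚₚ.≤-trans (ℚₚ.≤-reflexive (trans (sym (ℚₚ.*-identityʳ ia)) (trans (cong (ia ℚ.*_) (sym wp)) (ring₁ ia w p))))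
            (ℚₚ.≤-trans (*-monoʳ-≤ᵠ 0≤w (ℚₚ.≤-trans le (*-monoˡ-≤ᵠ 0≤n q≤g))) (ℚₚ.≤-reflexive (sym (ℚₚ.*-assoc w g n))))
          where
          ring₁ : ∀ ia w p → ia ℚ.* (w ℚ.* p) ≡ w ℚ.* (ia ℚ.* p)
          ring₁ = solve-∀-over ℚ-ring

      mixture-bound : ∀ {K σ a} → Cl (GeneratedBy st E cs K) σ a → ι a ℚ.≤ mixture σ ℚ.* ι K
      mixture-bound {K} {σ} none = subst (ℚ._≤ mixture σ ℚ.* ι K) (sym ι0) (0≤* (mixture≥0 σ) (0≤ι K))
      mixture-bound {K} {σ} (split {a = a} {b} c d) = ℚₚ.≤-trans (ℚₚ.≤-reflexive (ι-+ a b))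
        (ℚₚ.≤-trans (ℚₚ.+-mono-≤ (mixture-bound c) (mixture-bound d))
          (ℚₚ.≤-trans (ℚₚ.≤-reflexive (sym (ℚₚ.*-distribʳ-+ (ι K) (mixture (σ ^0)) (mixture (σ ^1)))))
            (*-monoˡ-≤ᵠ (0≤ι K) (mixture-super σ))))
      mixture-bound {K} {σ} {a} (base (e , e<E , cs′ , q , n , d , num , lt , en , sub , le)) =
        ℚₚ.≤-trans (rescale {ι a} {weight e} {ι (2 ^ suc e)} {q} {ι K} {density e σ} (weight-ι e)
            (subst (ℚ._≤ q ℚ.* ι K) (ι-* a (2 ^ suc e)) (Num-≤ {q} num (≤-trans (≤-reflexive (ring a (2 ^ suc e) (suc d))) le)))
            (density-condition e {cs′} {σ} {q} lt en (All.tabulate (λ i → All.lookup sat (sub i)))) (ℚₚ.<⇒≤ (weight>0 e)) (0≤ι K))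
          (*-monoˡ-≤ᵠ (0≤ι K) (total-term (λ i → 0≤* (ℚₚ.<⇒≤ (weight>0 i)) (density≥0 i σ)) e<E))
        where
        ring : ∀ a p d → a * p * d ≡ a * (d * p)
        ring = solve-∀

    generated-bound : ∀ μ {cs N σ a} → All (μ ⊨_) cs → Cl (Generated cs N) σ a → a ≤ N
    generated-bound μ {cs} {N} {σ} {a} sat c =
      let (st , E , con , c′) = collect-stages c
          open Bound μ sat st E con
      in ι-cancel-≤ (ℚₚ.≤-trans (mixture-bound c′)
           (subst (mixture σ ℚ.* ι N ℚ.≤_) (ℚₚ.*-identityˡ (ι N)) (*-monoˡ-≤ᵠ (0≤ι N) (mixture≤1 σ))))

    implies-bound : ∀ μ {cs σ q} → All (μ ⊨_) cs → Implies cs σ q → q ℚ.< 1ℚ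
    implies-bound μ {cs} {σ} {q} sat (N , a , c , lt) = ℚₚ.≰⇒> λ 1≤q → <⇒≱
      (ℚₚ.<-≤-trans lt (ι-mono-≤ (generated-bound μ sat c)))
      (subst (ℚ._≤ q ℚ.* ι N) (ℚₚ.*-identityˡ (ι N)) (*-monoˡ-≤ᵠ (0≤ι N) 1≤q))

    implies-positive : ∀ μ {cs σ q N a} → All (μ ⊨_) cs → Cl (Generated cs N) σ a → q ℚ.* ι N ℚ.< ι a → 0 < N
    implies-positive μ {cs} {σ} {q} {zero} sat c lt = ⊥-elim (<⇒≱ lt (ℚₚ.≤-trans (ι-mono-≤ (generated-bound μ sat c))
      (ℚₚ.≤-reflexive (sym (trans (cong (q ℚ.*_) ι0) (trans (ℚₚ.*-zeroʳ q) (sym ι0)))))))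
    implies-positive μ {N = suc N} sat c lt = s≤s z≤n

    generated-scale : ∀ {cs N σ a} k → Cl (Generated cs N) σ a → Cl (Generated cs (N * k)) σ (a * k)
    generated-scale k none = none
    generated-scale {cs} {N} k (split {σ} {a} {b} c d) =
      subst (Cl (Generated cs (N * k)) σ) (sym (*-distribʳ-+ k a b)) (split (generated-scale k c) (generated-scale k d))
    generated-scale {cs} {N} {σ} {a} k (base (e , cs′ , q , n , d , num , t , sub , le)) =
      base (e , cs′ , q , n , d , num , t , sub ,
        ≤-trans (≤-reflexive (ring a k (suc d * 2 ^ suc e))) (≤-trans (*-monoˡ-≤ k le) (≤-reflexive (*-assoc n N k))))
      where
      ring : ∀ a k x → a * k * x ≡ a * x * k
      ring = solve-∀

    generated-⊆ : ∀ {cs cs″ N σ a} → (∀ {c} → c ∈ cs → c ∈ cs″) → Cl (Generated cs N) σ a → Cl (Generated cs″ N) σ a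
    generated-⊆ sub = Cl-map (λ (e , cs′ , q , n , d , num , t , sub′ , le) → e , cs′ , q , n , d , num , t , sub ∘ sub′ , le)

    implies-negative : ∀ {σ q} → q ℚ.< 0ℚ → Implies [] σ q
    implies-negative {σ} {q} q<0 = 1 , 0 , none , subst₂ ℚ._<_ (sym (trans (cong (q ℚ.*_) ι1) (ℚₚ.*-identityʳ q))) (sym ι0) q<0

    -- The masses are added over the common denominator `N * N′`. Both factors are positive, since
    -- the conditions hold in a measure, and this keeps the inequalities strict.
    implies-split : ∀ μ {cs cs′ σ p q} → All (μ ⊨_) cs → All (μ ⊨_) cs′ → Implies cs (σ ^0) p → Implies cs′ (σ ^1) q →
      Implies (cs ++ cs′) σ (p ℚ.+ q)
    implies-split μ {cs} {cs′} {σ} {p} {q} sat sat′ (N , a , c , lt) (N′ , a′ , c′ , lt′) =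
      N * N′ , a * N′ + a′ * N ,
      split (generated-⊆ ∈-++⁺ˡ (generated-scale N′ c))
            (subst (λ K → Cl (Generated (cs ++ cs′) K) (σ ^1) (a′ * N)) (*-comm N′ N) (generated-⊆ (∈-++⁺ʳ cs) (generated-scale N c′))) ,
      subst₂ ℚ._<_ (sym (trans (cong ((p ℚ.+ q) ℚ.*_) (ι-* N N′)) (ring p q (ι N) (ι N′))))
        (sym (trans (ι-+ (a * N′) (a′ * N)) (cong₂ ℚ._+_ (ι-* a N′) (ι-* a′ N))))
        (ℚₚ.+-mono-< (*-monoˡ-<ᵠ (ι>0 (implies-positive μ {q = q} sat′ c′ lt′)) lt) (*-monoˡ-<ᵠ (ι>0 (implies-positive μ {q = p} sat c lt)) lt′))
      where
      ι>0 : ∀ {n} → 0 < n → 0ℚ ℚ.< ι n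
      ι>0 {n} h = subst (ℚ._< ι n) ι0 (ι-mono-< h)
      ring : ∀ p q n n′ → (p ℚ.+ q) ℚ.* (n ℚ.* n′) ≡ p ℚ.* n ℚ.* n′ ℚ.+ q ℚ.* n′ ℚ.* n
      ring = solve-∀-over ℚ-ring

    implied : ProbabilityMeasure → String → ℝ
    implied μ σ = record
      { Below = λ q → ∃[ cs ] (Implies cs σ q × All (μ ⊨_) cs)
      ; nonempty = ℚ.- 1ℚ , [] , implies-negative -1<0 , []
      ; bounded = 1ℚ , λ (cs , i , sat) → ℚₚ.<-irrefl refl (implies-bound μ {cs} {σ} sat i)
      ; downward = λ p<q (cs , (N , a , c , lt) , sat) →
          cs , (N , a , c , ℚₚ.≤-<-trans (*-monoˡ-≤ᵠ (0≤ι N) (ℚₚ.<⇒≤ p<q)) lt) , sat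
      ; noMaximum = λ {q} (cs , (N , a , c , lt) , sat) → larger q cs N a c lt sat (implies-positive μ {q = q} sat c lt) }
      where
      larger : ∀ q cs N a → Cl (Generated cs N) σ a → q ℚ.* ι N ℚ.< ι a → All (μ ⊨_) cs → 0 < N →
        ∃[ q′ ] (q ℚ.< q′ × ∃[ cs ] (Implies cs σ q′ × All (μ ⊨_) cs))
      larger q cs (suc N) a c lt sat _ =
        let (m , qN<m , m<a) = ℚₚ.<-dense lt
            q′N≡m = inv*ι m N
        in m ℚ.* inv N , *-cancelʳ-<ᵠ (0<ι N) (subst (q ℚ.* ι (suc N) ℚ.<_) (sym q′N≡m) qN<m) ,
           cs , (suc N , a , c , subst (ℚ._< ι a) (sym q′N≡m) m<a) , sat

    impliedSemimeasure : ProbabilityMeasure → Semimeasure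
    impliedSemimeasure μ = record
      { value = implied μ
      ; nonnegative = λ σ q<0 → [] , implies-negative q<0 , []
      ; atMostOne = λ σ (cs , i , sat) → implies-bound μ {cs} {σ} sat i
      ; superadditive = λ σ {r} (p , q , (cs , i , sat) , (cs′ , i′ , sat′) , r≤) →
          below-≤ (implied μ σ) r≤ (cs ++ cs′ , implies-split μ {cs} {cs′} {σ} {p} {q} sat sat′ i i′ , Allₚ.++⁺ sat sat′) }

    U : CETest
    U = record
      { elements = λ el → code-TestElement el ∷ [] ⊩ universalF
      ; ce = formula-CE code-TestElement universalF
      ; isTest = λ μ → impliedSemimeasure μ ,
          (λ { {σ , q} (cs , u , sat) → Below⇒<ʳ (implied μ σ)
                 (cs , universal-sound {cs} {σ} {q} (subst (λ x → x ∷ [] ⊩ universalF) (code-TestElement≡ (cs , σ , q)) u) , sat) }) ,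
          (λ { {σ , q} lt → let (cs , i , sat) = <ʳ⇒Below (implied μ σ) lt in
                 cs , subst (λ x → x ∷ [] ⊩ universalF) (sym (code-TestElement≡ (cs , σ , q))) (universal-complete {cs} {σ} {q} i) , sat }) }

-- Universality: tests survive the trimming

module UniversalityProof where

  open import Defs renaming (_+_ to _+ʳ_; _≤_ to _≤ʳ_; _<_ to _<ʳ_; _≈_ to _≈ʳ_)
  open import Axiom.ExcludedMiddle using (ExcludedMiddle)
  open import Data.Empty using (⊥-elim)
  open import Data.List using (List; []; _∷_; length; map; concatMap)
  open import Data.List.Membership.Propositional using (_∈_; find; lose)
  open import Data.List.Membership.Propositional.Properties using (∈-map⁺; ∈-map⁻; ∈-concatMap⁺; ∈-concatMap⁻)
  open import Data.List.Relation.Unary.All using (All; []; _∷_)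
  import Data.List.Relation.Unary.All as All
  open import Data.List.Relation.Unary.Any using (here; there)
  open import Data.Nat hiding (_≟_)
  open import Data.Nat.Properties hiding (<⇒≱)
  open import Data.Nat.DivMod using (m≡m%n+[m/n]*n; m%n<n)
  open import Data.Product using (∃; ∃-syntax; _×_; _,_; proj₁; proj₂)
  open import Data.Rational using (ℚ; 0ℚ)
  import Data.Rational as ℚ
  import Data.Rational.Properties as ℚₚ
  open import Data.Sum using (_⊎_; inj₁; inj₂; [_,_]′)
  open import Data.Vec using ([]; _∷_)
  open import Function using (id)
  open import Function.Bundles using (module Equivalence)
  open import Level using (0ℓ)
  open import Relation.Binary.PropositionalEquality
  open import Relation.Nullary using (¬_; yes; no)
  open import Relation.Nullary.Decidable using (decidable-stable)
  open import Tactic.RingSolver renaming (solve-∀ to solve-∀-over)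
  open SigmaOneFormulas using (⟪_,_⟫; _⊩_)
  open UniversalFunction
  open RationalArithmetic renaming (*-monoʳ-< to *-monoʳ-<ᵠ; *-monoˡ-< to *-monoˡ-<ᵠ)
  open ClopenSets using ([_]ᶜ; mean)
  open LimitMeasures
  open GeneratedMass
  open Weights
  open CodeFormulas
  open TrimmedTests
  open UniversalTests
  open ScarfLemma using (module Classical)

  even-or-odd : ∀ n → ∃[ h ] (n ≡ 2 * h ⊎ n ≡ suc (2 * h))
  even-or-odd zero = 0 , inj₁ refl
  even-or-odd (suc n) with even-or-odd n
  ... | h , inj₁ e = h , inj₂ (cong suc e)
  ... | h , inj₂ e = suc h , inj₁ (trans (cong suc e) (sym (*-suc 2 h)))

  mem-or-notMem : ∀ x A → Mem x A ⊎ NotMem x A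
  mem-or-notMem x A = go (even-or-odd (A / 2 ^ x))
    where
    instance
      2^x≢0 : NonZero (2 ^ x)
      2^x≢0 = m^n≢0 2 x
    A≡ : ∀ {k} → A / 2 ^ x ≡ k → A ≡ 2 ^ x * k + A % 2 ^ x
    A≡ {k} e = trans (m≡m%n+[m/n]*n A (2 ^ x)) (trans (+-comm (A % 2 ^ x) _) (cong (_+ A % 2 ^ x) (trans (*-comm _ (2 ^ x)) (cong (2 ^ x *_) e))))
    remainder< : A % 2 ^ x ∷ ⟪ x , 0 ⟫ ∷ [] ⊩ lessF
    remainder< = ⊩less⇐ (subst (A % 2 ^ x <_) (sym (pow≡ x)) (m%n<n A (2 ^ x)))
    go : ∃[ h ] (A / 2 ^ x ≡ 2 * h ⊎ A / 2 ^ x ≡ suc (2 * h)) → Mem x A ⊎ NotMem x A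
    go (h , inj₁ e) = inj₂ (h , A % 2 ^ x , trans (A≡ e) (cong (λ p → p * (2 * h) + A % 2 ^ x) (sym (pow≡ x))) , remainder<)
    go (h , inj₂ e) = inj₁ (h , A % 2 ^ x , trans (A≡ e) (cong (_+ A % 2 ^ x) (sym (pow*≡ x h))) , remainder<)

  module Universality (em : ExcludedMiddle 0ℓ) where

    open Classical em
    open Subsequences em
    open UniversalTest em

    module _ (T : CETest) where
      open CETest T

      private
        f = proj₁ ce

      e : ℕ
      e = index f

      enumerates : ∀ {el} → elements el → ∃[ s ] Enumerated e s (codeE el)
      enumerates {el} t = enumStage-complete (validElement-complete el ,
        subst (λ x → e ∷ x ∷ [] ⊩ haltsF) (code-TestElement≡ el) (halts-complete f (Equivalence.to (proj₂ ce el) t)))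

      enumerated⇒ : ∀ {s el} → Enumerated e s (codeE el) → elements el
      enumerated⇒ {s} {el} h = Equivalence.from (proj₂ ce el) (halts-sound f
        (subst (λ x → e ∷ x ∷ [] ⊩ haltsF) (sym (code-TestElement≡ el)) (proj₂ (enumStage-sound h))))

      module _ (s A : ℕ) (all-enumerated : ∀ x → x < s → Mem x A → Enumerated e s x) where

        -- The set coded by `A` is decoded into elements of `T`, from which finite lists of inputs
        -- and outputs can be read off.
        record Members (k : ℕ) : Set where
          field
            list  : List TestElement
            every : ∀ x → x < k → Mem x A → ∃[ el ] (el ∈ list × x ≡ codeE el)
            only  : ∀ {el} → el ∈ list → elements el × codeE el < s × Mem (codeE el) A

        members : ∀ k → k ≤ s → Members k
        members zero _ = record { list = [] ; every = λ _ () ; only = λ () }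
        members (suc k) k<s with members k (<⇒≤ k<s) | mem-or-notMem k A
        ... | ms | inj₂ k∉ = record { list = Members.list ms ; only = Members.only ms ; every = every }
          where
          every : ∀ x → x < suc k → Mem x A → ∃[ el ] (el ∈ Members.list ms × x ≡ codeE el)
          every x x≤k x∈ with m≤n⇒m<n∨m≡n (≤-pred x≤k)
          ... | inj₁ x<k = Members.every ms x x<k x∈
          ... | inj₂ refl = ⊥-elim (mem-exclusive x∈ k∉)
        ... | ms | inj₁ k∈ with Enumerated-valid (all-enumerated k k<s k∈)
        ...   | el , refl = record
          { list = el ∷ Members.list ms
          ; every = every
          ; only = λ { (here refl) → enumerated⇒ {s} (all-enumerated (codeE el) k<s k∈) , k<s , k∈
                     ; (there i) → Members.only ms i } }
          where
          every : ∀ x → x < suc (codeE el) → Mem x A → ∃[ el′ ] (el′ ∈ el ∷ Members.list ms × x ≡ codeE el′)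
          every x x≤k x∈ with m≤n⇒m<n∨m≡n (≤-pred x≤k)
          ... | inj₁ x<k = let (el′ , i , eq) = Members.every ms x x<k x∈ in el′ , there i , eq
          ... | inj₂ refl = el , here refl , refl

        module _ (ms : Members s) where
          open Members ms

          inputs outputs : List Condition
          inputs  = concatMap proj₁ list
          outputs = map proj₂ list

          input∈ : ∀ {c el} → c ∈ proj₁ el → el ∈ list → c ∈ inputs
          input∈ c∈ el∈ = ∈-concatMap⁺ proj₁ (lose el∈ c∈)

          inputs∈ : ∀ {c} → c ∈ inputs → ∃[ el ] (el ∈ list × c ∈ proj₁ el)
          inputs∈ c∈ = find (∈-concatMap⁻ proj₁ {xs = list} c∈)

          to-input : ∀ {N} (ws : Weighted (suc N) inputs) → ∀ {σ a} → (σ , a) ∈ weights inputs ws → Cl (Input A s N) σ a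
          to-input {N} ws {σ} {a} i with ∈-weights⁻ ws i
          ... | q , i′ , inj₁ (_ , eq) = subst (Cl (Input A s N) σ) (sym eq) none
          ... | q , i′ , inj₂ (0≤q , eq) with code-sign q
          ...   | inj₁ (q<0 , _) = ⊥-elim (<⇒≱ q<0 0≤q)
          ...   | inj₂ (n , d , num) with inputs∈ i′
          ...     | (cs , c) , el∈ , c∈ = let (_ , lt , m) = only el∈ in
                    base (codeE (cs , c) , lt , m , codeCs cs , codeC c , refl ,
                      hasInput-complete {cs} {σ} {q} {n} {d} {a} {N} c∈ num (ℚₚ.≤-reflexive (sym eq)))

          output-below : ∀ μ → (∀ {σ q} → (σ , q) ∈ inputs → ℝ.Below (μ ⟨ σ ⟩) q) → ∀ {σ q} →
            (σ , q) ∈ outputs → ℝ.Below (Semimeasure.value (T at μ) σ) q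
          output-below μ below {σ} {q} i with ∈-map⁻ proj₂ i
          ... | (cs , _) , el∈ , refl = <ʳ⇒Below (Semimeasure.value (T at μ) σ)
            (proj₁ (proj₂ (isTest μ)) {σ , q} (cs , proj₁ (only el∈) ,
              All.tabulate (λ {c} c∈ → Below⇒<ʳ (μ ⟨ proj₁ c ⟩) (below {proj₁ c} {proj₂ c} (input∈ c∈ el∈)))))

          feasible-list : ∀ M N → length M ≡ suc N →
            (∀ {σ q} → (σ , q) ∈ outputs → q ℚ.* ι (suc N) ℚ.≤ ι (count σ M)) → A ∷ s ∷ [] ⊩ feasibleF
          feasible-list M N len h = feasible-complete {A} {s} M N len member (λ x → mem-or-notMem x A)
            where
            member : ∀ x → x < s → Mem x A →
              ∃[ cs ] ∃[ σ ] ∃[ q ] (x ≡ codeE (cs , σ , q) × q ℚ.* ι (suc N) ℚ.≤ ι (count σ M))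
            member x x<s x∈ with every x x<s x∈
            ... | (cs , σ , q) , el∈ , eq = cs , σ , q , eq , h {σ} {q} (∈-map⁺ proj₂ el∈)

          -- The test is consulted at the sample measure: its value there is a single semimeasure
          -- exceeding all the outputs, and these are then realised together.
          feasible-fulfilled : ∀ sm → (∀ {σ q} → (σ , q) ∈ inputs → q ℚ.< mean sm [ σ ]ᶜ) → A ∷ s ∷ [] ⊩ feasibleF
          feasible-fulfilled sm sat with common-denominator outputs
          ... | N , ws with conditions-feasible (T at sampleMeasure sm) {N} outputs ws (λ {σ} {q} → output-below (sampleMeasure sm) (λ {τ} {r} i → sample-below sm {τ} {r} (sat i)) {σ} {q})
          ...   | M , len , h = feasible-list M N len (λ {σ} {q} → h {σ} {q})

          -- Inputs that never force mass 1 hold strictly in some finite sample; negative bounds,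
          -- absent from `Input`, count as zero units.
          feasible : (∀ {N a} → suc N ≤ a → ¬ Cl (Input A s N) [] a) → A ∷ s ∷ [] ⊩ feasibleF
          feasible possible with common-denominator inputs
          ... | N , ws with conditions-fulfilled {N} inputs ws (λ {a} c → ≰⇒> (λ le → possible {N} {a} le (Cl-bind (λ {σ} {b} → to-input {N} ws {σ} {b}) c)))
          ...   | sm , sat = feasible-fulfilled sm (λ {σ} {q} → sat {σ} {q})

        consistent-set : A ∷ s ∷ [] ⊩ feasibleF ⊎ A ∷ s ∷ [] ⊩ infeasibleF
        consistent-set with em {∃[ N ] ∃[ a ] (suc N ≤ a × Cl (Input A s N) [] a)}
        ... | yes (N , a , le , c) = inj₂ (infeasible-complete {A} {s} {N} {a} le c)
        ... | no ¬inf = inj₁ (feasible (members s ≤-refl) (λ {N} {a} le c → ¬inf (N , a , le , c)))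

      consistent : ∀ s → Consistent e s
      consistent s A _ with em {∃[ x ] (x < s × Mem x A × ¬ Enumerated e s x)}
      ... | yes (x , x<s , x∈ , ¬en) = inj₁ (x , ⊩less⇐ x<s , x∈ , positive (enumStage (s ∷ e ∷ x ∷ [])) refl)
        where
        positive : ∀ k → enumStage (s ∷ e ∷ x ∷ []) ≡ k → ∃[ y ] enumStage (s ∷ e ∷ x ∷ []) ≡ suc y
        positive zero eq = ⊥-elim (¬en eq)
        positive (suc y) eq = y , eq
      ... | no none′ = inj₂ (consistent-set s A (λ x x<s x∈ → decidable-stable em (λ ¬en → none′ (x , x<s , x∈ , ¬en))))

      -- The stage is raised above the code of the element; every stage of a test is consistent, so
      -- no element is lost.
      trimmed : ∀ {el} → elements el → Trimmed e el
      trimmed {el} t = let (s , en) = enumerates t in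
        s ⊔ suc (codeE el) , ⊩less⇐ (m≤n⊔m s (suc (codeE el))) , enumStage-mono (m≤m⊔n s (suc (codeE el))) en ,
        consistent (s ⊔ suc (codeE el))

      private
        c>0 : ℚ.Positive (weight e)
        c>0 = ℚ.positive (weight>0 e)

      dominated : ∀ μ σ → _·_ (weight e) {{c>0}} (Semimeasure.value (T at μ) σ) ≤ʳ implied μ σ
      dominated μ σ {r} (p , p∈ , r≤) with ℝ.noMaximum (Semimeasure.value (T at μ) σ) p∈
      ... | p′ , p<p′ , p′∈ with proj₂ (proj₂ (isTest μ)) {σ , p′} (Below⇒<ʳ (Semimeasure.value (T at μ) σ) p′∈)
      ... | cs , t , sat with code-sign p′
      ...   | inj₁ (p′<0 , _) = [] , implies-negative (ℚₚ.≤-<-trans r≤ (ℚₚ.<-trans (*-monoʳ-<ᵠ (weight>0 e) p<p′)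
                (subst (weight e ℚ.* p′ ℚ.<_) (ℚₚ.*-zeroʳ (weight e)) (*-monoʳ-<ᵠ (weight>0 e) p′<0)))) , []
      -- With this denominator the scaled value of `p′` is exactly `n` units; strictness comes from
      -- `p < p′`.
      ...   | inj₂ (n , d , num) = cs , (suc d * 2 ^ suc e , n ,
                base (e , cs , p′ , n , d , num , trimmed t , id , ≤-refl) , bound) , sat
        where
        D = suc d * 2 ^ suc e
        D>0 : 0ℚ ℚ.< ι D
        D>0 = subst (ℚ._< ι D) ι0 (ι-mono-< (*-mono-≤ {1} {suc d} (s≤s z≤n) (m^n>0 2 (suc e))))
        ring : ∀ w p x y → w ℚ.* p ℚ.* (x ℚ.* y) ≡ w ℚ.* y ℚ.* (p ℚ.* x)
        ring = solve-∀-over ℚ-ring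
        exact : weight e ℚ.* p′ ℚ.* ι D ≡ ι n
        exact = trans (cong (weight e ℚ.* p′ ℚ.*_) (ι-* (suc d) (2 ^ suc e)))
          (trans (ring (weight e) p′ (ι (suc d)) (ι (2 ^ suc e)))
            (trans (cong₂ ℚ._*_ (weight-ι e) (Num-ι {p′} num)) (ℚₚ.*-identityˡ (ι n))))
        bound : r ℚ.* ι D ℚ.< ι n
        bound = subst (r ℚ.* ι D ℚ.<_) exact (*-monoˡ-<ᵠ D>0 (ℚₚ.≤-<-trans r≤ (*-monoʳ-<ᵠ (weight>0 e) p<p′)))

    U-universal : Universal U
    U-universal T = weight (e T) , ℚ.positive (weight>0 (e T)) , λ μ σ → dominated T μ σ

-- A measure passing a given c.e. test

module PassingMeasures where

  open import Defs renaming (_+_ to _+ʳ_; _≤_ to _≤ʳ_; _<_ to _<ʳ_; _≈_ to _≈ʳ_)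
  import Data.Nat.Properties as ℕₚ
  open import Algebra.Properties.Semiring.Sum ℕₚ.+-*-semiring using (sum; ∑-distrib-+; sum-cong-≗)
  open import Axiom.ExcludedMiddle using (ExcludedMiddle)
  open import Data.Bool using (Bool; true; false)
  open import Data.Empty using (⊥-elim)
  open import Data.Fin using (Fin; zero; suc; toℕ; combine; remQuot; finToFun)
  import Data.Fin as Fin
  open import Data.Fin.Properties using (remQuot-combine; finToFun-funToFin; toℕ<n)
  open import Data.List using (List; []; _∷_; length; map; lookup; filter; allFin)
  open import Data.List.Membership.Propositional using (_∈_)
  open import Data.List.Membership.Propositional.Properties using (∈-map⁺; ∈-map⁻; ∈-filter⁺; ∈-filter⁻; ∈-allFin; ∈-lookup)
  open import Data.List.Relation.Unary.All using (All; []; _∷_)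
  import Data.List.Relation.Unary.All as All
  open import Data.List.Relation.Unary.Any using (here; there; index)
  open import Data.List.Relation.Unary.Any.Properties using (lookup-index)
  open import Data.Nat as ℕ using (ℕ; zero; suc)
  open import Data.Product using (∃; ∃-syntax; _×_; _,_; proj₁; proj₂)
  open import Data.Rational
  open import Data.Rational.Properties hiding (_≟_)
  open import Data.Sum using (inj₁; inj₂; [_,_]′)
  open import Function using (_∘_)
  open import Level using (0ℓ)
  open import Relation.Binary.PropositionalEquality
  open import Relation.Nullary using (Dec; yes; no; does)
  open import Tactic.RingSolver using (solve-∀)
  open UniversalFunction using (bit; bit≤1)
  open DiscreteBrouwer
  open ThresholdAveraging
  open RationalArithmetic
  open ClopenSets using (Sample; [_]ᶜ; mean; mean-ι; inCylinder; bit-mono; Eventually; ev-map₂; always)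
  open LimitMeasures
  open GeneratedMass
  open Weights
  open CodeFormulas using (codeE; codeE-injective)
  open UniversalTests using (<ʳ⇒Below; Below⇒<ʳ)
  open ScarfLemma using (module Classical)

  inv-scaled : ∀ x {δ} → 0ℚ < δ → ∃[ n ] ∀ m → n ℕ.≤ m → x * inv m ≤ δ
  inv-scaled x {δ} δ>0 = let (n , h) = archimedes x δ>0 in n , λ m n≤m →
    subst (x * inv m ≤_) (trans (cong (_* inv m) (*-comm (ι (suc m)) δ)) (ι*inv δ m))
      (*-monoˡ-≤ (<⇒≤ (inv>0 m)) (≤-trans h (*-monoˡ-≤ (<⇒≤ δ>0) (ι-mono-≤ (ℕₚ.≤-trans n≤m (ℕₚ.n≤1+n m))))))

  strings : ∀ {R} (M : List String) → length M ≡ R → Fin R → String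
  strings M refl = lookup M

  count-strings : ∀ {R} σ M (e : length M ≡ R) → count σ M ≡ sum (λ j → bit (isPrefix σ (strings M e j)))
  count-strings σ M refl = go M
    where
    go : ∀ M → count σ M ≡ sum (λ j → bit (isPrefix σ (lookup M j)))
    go [] = refl
    go (ρ ∷ M) = cong (bit (isPrefix σ ρ) ℕ.+_) (go M)

  sum-close : ∀ {n d} (χ : Fin d → ℕ) → (∀ i → χ i ℕ.≤ 1) → (t t′ : Fin n → Fin d) →
    (∀ k → cnt t k ℕ.≤ cnt t′ k ℕ.+ suc d) → sum (χ ∘ t) ℕ.≤ sum (χ ∘ t′) ℕ.+ d ℕ.* suc d
  sum-close {d = d} χ χ≤1 t t′ close = begin
    sum (χ ∘ t)                                             ≡⟨ sum-weighted-cnt χ t ⟨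
    sum (λ i → χ i ℕ.* cnt t i)                             ≤⟨ sum-mono (λ i → ℕₚ.*-monoʳ-≤ (χ i) (close i)) ⟩
    sum (λ i → χ i ℕ.* (cnt t′ i ℕ.+ suc d))                ≡⟨ sum-cong-≗ (λ i → ℕₚ.*-distribˡ-+ (χ i) (cnt t′ i) (suc d)) ⟩
    sum (λ i → χ i ℕ.* cnt t′ i ℕ.+ χ i ℕ.* suc d)          ≡⟨ ∑-distrib-+ (λ i → χ i ℕ.* cnt t′ i) (λ i → χ i ℕ.* suc d) ⟩
    sum (λ i → χ i ℕ.* cnt t′ i) ℕ.+ sum (λ i → χ i ℕ.* suc d)
      ≤⟨ ℕₚ.+-mono-≤ (ℕₚ.≤-reflexive (sum-weighted-cnt χ t′))
           (sum-mono (λ i → ℕₚ.≤-trans (ℕₚ.*-monoˡ-≤ (suc d) (χ≤1 i)) (ℕₚ.≤-reflexive (ℕₚ.*-identityˡ (suc d))))) ⟩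
    sum (χ ∘ t′) ℕ.+ sum {d} (λ _ → suc d)                  ≡⟨ cong (sum (χ ∘ t′) ℕ.+_) (sum-const d (suc d)) ⟩
    sum (χ ∘ t′) ℕ.+ d ℕ.* suc d                            ∎
    where open ℕₚ.≤-Reasoning

  sum-lower : ∀ K {b : ℚ} (f : Fin K → ℕ) → (∀ k → b ≤ ι (f k)) → ι K * b ≤ ι (sum f)
  sum-lower zero {b} f h = ≤-reflexive (trans (cong (_* b) ι0) (trans (*-zeroˡ b) (sym ι0)))
  sum-lower (suc K) {b} f h = ≤-trans (≤-reflexive (trans (cong (_* b) (trans (ι-+ 1 K) (cong (_+ ι K) ι1))) (ring (ι K) b)))
    (≤-trans (+-mono-≤ (h zero) (sum-lower K (f ∘ suc) (h ∘ suc))) (≤-reflexive (sym (ι-+ (f zero) (sum (f ∘ suc))))))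
    where
    ring : ∀ k b → (1ℚ + k) * b ≡ b + k * b
    ring = solve-∀ ℚ-ring

  Hold : Sample → ℚ → List Condition → Set
  Hold s ε cs = ∀ c → c ∈ cs → proj₂ c + ε < mean s [ proj₁ c ]ᶜ

  -- A margin on the inputs and a tolerance on the output bring the condition within reach of finite
  -- samples; both vanish in the limit.
  Approximates : Sample → ℚ → TestElement → Set
  Approximates s ε el = Hold s ε (proj₁ el) → proj₂ (proj₂ el) ≤ mean s [ proj₁ (proj₂ el) ]ᶜ + ε

  module PassingMeasure (em : ExcludedMiddle 0ℓ) (T : CETest) where

    open Classical em
    open Subsequences em
    open CETest T

    outputs-below : ∀ μ {cs σ q} → elements (cs , σ , q) → (∀ {τ r} → (τ , r) ∈ cs → ℝ.Below (μ ⟨ τ ⟩) r) →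
      ℝ.Below (Semimeasure.value (T at μ) σ) q
    outputs-below μ {cs} {σ} {q} t below = <ʳ⇒Below (Semimeasure.value (T at μ) σ) (proj₁ (proj₂ (isTest μ)) {σ , q}
      (cs , t , All.tabulate (λ {c} i → Below⇒<ʳ (μ ⟨ proj₁ c ⟩) (below i))))

    -- Obtained by excluded middle: effectiveness is claimed for the class, not for the measure
    -- found in it.
    record Initial (n : ℕ) : Set where
      field
        list  : List TestElement
        every : ∀ {el} → elements el → codeE el ℕ.< n → el ∈ list
        only  : ∀ {el} → el ∈ list → elements el

    initial : ∀ n → Initial n
    initial zero = record { list = [] ; every = λ _ () ; only = λ () }
    initial (suc n) with initial n | em {∃[ el ] (elements el × codeE el ≡ n)}
    ... | I | no none′ = record { list = Initial.list I ; only = Initial.only I ; every = every }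
      where
      every : ∀ {el} → elements el → codeE el ℕ.< suc n → el ∈ Initial.list I
      every {el} t lt with ℕₚ.m≤n⇒m<n∨m≡n (ℕₚ.≤-pred lt)
      ... | inj₁ lt′ = Initial.every I t lt′
      ... | inj₂ eq = ⊥-elim (none′ (el , t , eq))
    ... | I | yes (el′ , t′ , eq′) = record
      { list = el′ ∷ Initial.list I ; every = every ; only = λ { (here refl) → t′ ; (there i) → Initial.only I i } }
      where
      every : ∀ {el} → elements el → codeE el ℕ.< suc n → el ∈ el′ ∷ Initial.list I
      every {el} t lt with ℕₚ.m≤n⇒m<n∨m≡n (ℕₚ.≤-pred lt)
      ... | inj₁ lt′ = there (Initial.every I t lt′)
      ... | inj₂ eq = here (codeE-injective {el} {el′} (trans eq (sym eq′)))

    module _ (G : List TestElement) (G⊆ : ∀ {el} → el ∈ G → elements el) {NR : ℕ} (ws : Weighted (suc NR) (map proj₂ G)) where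

      private
        g R d : ℕ
        g = length G
        R = suc NR
        -- The vertices of the simplex are pairs of a set of elements and one of the `R` strings
        -- chosen for it.
        d = 2 ℕ.^ g ℕ.* R

        inputs : Fin g → List Condition
        inputs c = proj₁ (lookup G c)

        output : Fin g → Condition
        output c = proj₂ (lookup G c)

        _∈ˢ_ : Fin g → Fin (2 ℕ.^ g) → Set
        c ∈ˢ A = finToFun {2} {g} A c ≡ suc zero

        Fulfilled : Fin (2 ℕ.^ g) → Set
        Fulfilled A = ∃[ s ] ∀ c → c ∈ˢ A → ∀ {σ q} → (σ , q) ∈ inputs c → q < mean s [ σ ]ᶜ

        Dominating : Fin (2 ℕ.^ g) → (Fin R → String) → Set
        Dominating A ρ = ∀ c → c ∈ˢ A → proj₂ (output c) * ι R ≤ ι (sum (λ j → bit (isPrefix (proj₁ (output c)) (ρ j))))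

        members : Fin (2 ℕ.^ g) → List (Fin g)
        members A = filter (λ c → finToFun {2} {g} A c Fin.≟ suc zero) (allFin g)

        outputs : Fin (2 ℕ.^ g) → List Condition
        outputs A = map output (members A)

        outputs-weighted : ∀ A → Weighted (suc NR) (outputs A)
        outputs-weighted A = All.tabulate (λ {c} i → let (k , _ , e) = ∈-map⁻ output i in
          subst (λ c → ∃[ b ] Weight (proj₂ c) (suc NR) b) (sym e) (All.lookup ws (∈-map⁺ proj₂ (∈-lookup {xs = G} k))))

        below-outputs : ∀ A (f : Fulfilled A) {σ q} → (σ , q) ∈ outputs A →
          ℝ.Below (Semimeasure.value (T at sampleMeasure (proj₁ f)) σ) q
        below-outputs A (s , sat) {σ} {q} i with ∈-map⁻ output i
        ... | c , c∈ , refl = outputs-below (sampleMeasure s) (G⊆ (∈-lookup {xs = G} c))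
                (λ {τ} {r} j → sample-below s {τ} {r} (sat c (proj₂ (∈-filter⁻ (λ c → finToFun {2} {g} A c Fin.≟ suc zero) {xs = allFin g} c∈)) {τ} {r} j))

        output∈ : ∀ {A} c → c ∈ˢ A → output c ∈ outputs A
        output∈ {A} c c∈ = ∈-map⁺ output (∈-filter⁺ (λ c → finToFun {2} {g} A c Fin.≟ suc zero) (∈-allFin c) c∈)

        strings-dominate : ∀ A M (len : length M ≡ R) →
          (∀ {σ q} → (σ , q) ∈ outputs A → q * ι R ≤ ι (count σ M)) → Dominating A (strings M len)
        strings-dominate A M len h c c∈ = ≤-trans (h {proj₁ (output c)} {proj₂ (output c)} (output∈ {A} c c∈))
          (≤-reflexive (cong ι (count-strings (proj₁ (output c)) M len)))

        -- A sample satisfying the inputs of `A` puts the outputs of `A` below one semimeasure. The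
        -- number `R` of strings is the same for every `A`, being a common denominator of all
        -- outputs.
        dominating : ∀ A → Fulfilled A → ∃[ ρ ] Dominating A ρ
        dominating A f = strings (proj₁ feasible) (proj₁ (proj₂ feasible)) ,
          strings-dominate A (proj₁ feasible) (proj₁ (proj₂ feasible)) (λ {σ} {q} → proj₂ (proj₂ feasible) {σ} {q})
          where
          feasible : ∃[ M ] (length M ≡ R × ∀ {σ q} → (σ , q) ∈ outputs A → q * ι R ≤ ι (count σ M))
          feasible = conditions-feasible (T at sampleMeasure (proj₁ f)) {NR} (outputs A) (outputs-weighted A)
            (λ {σ} {q} → below-outputs A f {σ} {q})

        chooseStrings : ∀ A → Dec (Fulfilled A) → Fin R → String
        chooseStrings A (yes f) = proj₁ (dominating A f)
        -- A default for sets whose inputs no sample fulfils; sets of active elements are always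
        -- fulfilled.
        chooseStrings A (no _) = λ _ → []

        opaque
          chosenStrings : Fin (2 ℕ.^ g) → Fin R → String
          chosenStrings A = chooseStrings A em

          chosenStrings-dominate : ∀ A → Fulfilled A → Dominating A (chosenStrings A)
          chosenStrings-dominate A f = go em
            where
            go : (dec : Dec (Fulfilled A)) → Dominating A (chooseStrings A dec)
            go (yes f′) = proj₂ (dominating A f′)
            go (no ¬f) = ⊥-elim (¬f f)

        opaque
          leaf : Fin d → String
          leaf i = chosenStrings (proj₁ (remQuot {2 ℕ.^ g} R i)) (proj₂ (remQuot {2 ℕ.^ g} R i))

          leaf-combine : ∀ A j → leaf (combine A j) ≡ chosenStrings A j
          leaf-combine A j = cong (λ p → chosenStrings (proj₁ p) (proj₂ p)) (remQuot-combine {2 ℕ.^ g} {R} A j)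

        χ : String → Fin d → ℕ
        χ σ i = bit (inCylinder σ (pad (leaf i)))

        i₀ : Fin d
        i₀ = combine (subsetIndex {g} (λ _ → false)) zero

      -- The first two bounds hold the two error terms of the averaging to half of `ε` each; the
      -- third makes close points differ by at most the spacing of the thresholds.
      module _ {ε : ℚ} (ε>0 : 0ℚ < ε) (K′ N′ : ℕ)
        (K-large : ι (d ℕ.* g) * inv K′ ≤ half ε)
        (N-large : ι (d ℕ.* suc d) * inv N′ ≤ half ε)
        (N-larger : ι (d ℕ.* suc d) * inv N′ ≤ ε * inv K′) where

        private
          K N : ℕ
          K = suc K′
          N = suc N′

          -- The spacing of the thresholds: `K` steps add up to `ε`.
          δ′ : ℚ
          δ′ = ε * inv K′

          δ′≥0 : 0ℚ ≤ δ′
          δ′≥0 = <⇒≤ (0<* ε>0 (inv>0 K′))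

          Kδ≡ε : ι K * δ′ ≡ ε
          Kδ≡ε = trans (ring (ι K) ε (inv K′)) (ι*inv ε K′)
            where
            ring : ∀ k e i → k * (e * i) ≡ e * k * i
            ring = solve-∀ ℚ-ring

          sample : (Fin N → Fin d) → Sample
          sample t = N′ , λ j → pad (leaf (t j))

          Active : (Fin N → Fin d) → ℕ → Fin g → Set
          Active t k c = ∀ {σ q} → (σ , q) ∈ inputs c → q + ι k * δ′ < mean (sample t) [ σ ]ᶜ

          active : (Fin N → Fin d) → ℕ → Fin g → Bool
          active t k c = does (em {Active t k c})

          active⇒ : ∀ {t k c} → active t k c ≡ true → Active t k c
          active⇒ {t} {k} {c} e with em {Active t k c}
          ... | yes a = a

          active⇐ : ∀ {t k c} → Active t k c → active t k c ≡ true
          active⇐ {t} {k} {c} a with em {Active t k c}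
          ... | yes _ = refl
          ... | no ¬a = ⊥-elim (¬a a)

          open Brouwer em {d} N i₀ using (Close)

          mean-close : ∀ {t t′} → Close t t′ → ∀ σ → mean (sample t) [ σ ]ᶜ ≤ mean (sample t′) [ σ ]ᶜ + δ′
          mean-close {t} {t′} close σ = *-cancelʳ-≤ (0<ι N′) (≤-trans (≤-reflexive (mean-ι (sample t) [ σ ]ᶜ))
            (≤-trans (ι-mono-≤ (sum-close (χ σ) (λ i → bit≤1 (inCylinder σ (pad (leaf i)))) t t′ close))
              (≤-trans (≤-reflexive (ι-+ (sum (χ σ ∘ t′)) (d ℕ.* suc d)))
                (≤-trans (+-monoʳ-≤ (ι (sum (χ σ ∘ t′))) small)
                  (≤-reflexive (trans (cong (_+ δ′ * ι N) (sym (mean-ι (sample t′) [ σ ]ᶜ))) (sym (*-distribʳ-+ (ι N) (mean (sample t′) [ σ ]ᶜ) δ′))))))))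
            where
            small : ι (d ℕ.* suc d) ≤ δ′ * ι N
            small = subst (_≤ δ′ * ι N) (inv*ι (ι (d ℕ.* suc d)) N′) (*-monoˡ-≤ (0≤ι N) N-larger)

          -- Cylinder masses at close points differ by at most one threshold step, so lowering the
          -- threshold by one step absorbs the move.
          shift : ∀ {t t′} → Close t t′ → ∀ k c → active t (suc k) c ≡ true → active t′ k c ≡ true
          shift {t} {t′} close k c a = active⇐ {t′} {k} {c} λ {σ} {q} i →
            lin<² (eq q (ι k) δ′ (mean (sample t) [ σ ]ᶜ) (mean (sample t′) [ σ ]ᶜ) (trans (ι-+ 1 k) (cong (_+ ι k) ι1)))
              (active⇒ {t} {suc k} {c} a {σ} {q} i) (mean-close {t} {t′} close σ)
            where
            eq : ∀ q k δ m m′ {k₁} → k₁ ≡ 1ℚ + k → m′ - (q + k * δ) ≡ (m - (q + k₁ * δ)) + (m′ + δ - m)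
            eq q k δ m m′ refl = ring q k δ m m′
              where
              ring : ∀ q k δ m m′ → m′ - (q + k * δ) ≡ (m - (q + (1ℚ + k) * δ)) + (m′ + δ - m)
              ring = solve-∀ ℚ-ring

          open Averaging em N i₀ g K R combine active using (chosen; averaged-fixed-point)

          active-member : ∀ {t k c} → Active t k c → c ∈ˢ subsetIndex (active t k)
          active-member {t} {k} {c} a = trans (finToFun-funToFin (toFin2 ∘ active t k) c) (cong toFin2 (active⇐ {t} {k} {c} a))

          member-active : ∀ {t k c} → c ∈ˢ subsetIndex (active t k) → Active t k c
          member-active {t} {k} {c} e = active⇒ {t} {k} {c} (isTrue (active t k c) (trans (sym (finToFun-funToFin (toFin2 ∘ active t k) c)) e))
            where
            isTrue : ∀ b → toFin2 b ≡ suc zero → b ≡ true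
            isTrue true _ = refl

          fulfilled : ∀ t k → Fulfilled (subsetIndex (active t k))
          fulfilled t k = sample t , λ c c∈ {σ} {q} i → ≤-<-trans
            (subst (_≤ q + ι k * δ′) (+-identityʳ q) (+-monoʳ-≤ q (0≤* (0≤ι k) δ′≥0)))
            (member-active {t} {k} {c} c∈ {σ} {q} i)

          chosen-count : ∀ t k c → Active t k c →
            proj₂ (output c) * ι R ≤ ι (sum (χ (proj₁ (output c)) ∘ chosen t k))
          chosen-count t k c a = ≤-trans (chosenStrings-dominate (subsetIndex (active t k)) (fulfilled t k) c (active-member {t} {k} {c} a))
            (ι-mono-≤ (sum-mono (λ j → bit-mono (λ p → subst (λ ρ → inCylinder σ (pad ρ) ≡ true) (sym (leaf-combine (subsetIndex (active t k)) j))
              (isPrefix-pad σ (chosenStrings (subsetIndex (active t k)) j) p)))))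
            where σ = proj₁ (output c)

        Approximate : Sample → Set
        Approximate s = ∀ c → (∀ {σ q} → (σ , q) ∈ inputs c → q + ε < mean s [ σ ]ᶜ) →
          proj₂ (output c) ≤ mean s [ proj₁ (output c) ]ᶜ + ε

        private
          -- Clears the denominators `r`, `K` and `N` of the averaged inequality; each half of `ε`
          -- takes one error term.
          divide : ∀ q m h n k r g d D → m * n ≡ h → d * g * inv K′ ≤ half ε → d * D * inv N′ ≤ half ε →
            n ≡ ι N → k ≡ ι K → 0ℚ < r → n * (k * (q * r)) ≤ k * r * h + d * (n * (g * r) + D * (k * r)) → q ≤ m + ε
          divide q m h n k r g d D mn≡h a b refl refl r>0 le = *-cancelʳ-≤ r>0 (*-cancelʳ-≤ (0<ι K′) (*-cancelʳ-≤ (0<ι N′)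
            (≤-trans (≤-reflexive (ring₁ q r (ι K) (ι N))) (≤-trans le (≤-trans (≤-reflexive (trans (cong (λ h → ι K * r * h + d * (ι N * (g * r) + D * (ι K * r))) (sym mn≡h))
                (ring₂ m (ι N) (ι K) r g d D)))
              (≤-trans (+-monoʳ-≤ (m * r * ι K * ι N) (+-mono-≤
                  (*-monoˡ-≤ (0≤ι N) (*-monoˡ-≤ (<⇒≤ r>0) (subst (_≤ half ε * ι K) (inv*ι (d * g) K′) (*-monoˡ-≤ (0≤ι K) a))))
                  (*-monoˡ-≤ (0≤ι K) (*-monoˡ-≤ (<⇒≤ r>0) (subst (_≤ half ε * ι N) (inv*ι (d * D) N′) (*-monoˡ-≤ (0≤ι N) b))))))
                (≤-reflexive (trans (ring₃ m r (ι K) (ι N) (half ε)) (cong (λ e → (m + e) * r * ι K * ι N) (half+half ε))))))))))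
            where
            ring₁ : ∀ q r k n → q * r * k * n ≡ n * (k * (q * r))
            ring₁ = solve-∀ ℚ-ring
            ring₂ : ∀ m n k r g d D → k * r * (m * n) + d * (n * (g * r) + D * (k * r)) ≡ m * r * k * n + (d * g * r * n + d * D * r * k)
            ring₂ = solve-∀ ℚ-ring
            ring₃ : ∀ m r k n e → m * r * k * n + (e * k * r * n + e * n * r * k) ≡ (m + (e + e)) * r * k * n
            ring₃ = solve-∀ ℚ-ring

          cast-bound : ∀ {S h} → N ℕ.* S ℕ.≤ K ℕ.* R ℕ.* h ℕ.+ d ℕ.* (N ℕ.* (g ℕ.* R) ℕ.+ suc d ℕ.* (K ℕ.* R)) →
            ι N * ι S ≤ ι K * ι R * ι h + ι d * (ι N * (ι g * ι R) + ι (suc d) * (ι K * ι R))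
          cast-bound {S} {h} le = subst₂ _≤_ (ι-* N S)
            (trans (ι-+ (K ℕ.* R ℕ.* h) _) (cong₂ _+_ (trans (ι-* (K ℕ.* R) h) (cong (_* ι h) (ι-* K R)))
              (trans (ι-* d _) (cong (ι d *_) (trans (ι-+ (N ℕ.* (g ℕ.* R)) _)
                (cong₂ _+_ (trans (ι-* N (g ℕ.* R)) (cong (ι N *_) (ι-* g R)))
                  (trans (ι-* (suc d) (K ℕ.* R)) (cong (ι (suc d) *_) (ι-* K R)))))))))
            (ι-mono-≤ le)

          -- Inputs that hold with margin `ε` hold at all `K` thresholds, so the output is realised
          -- in every term of the average.
          point-approximate : ∀ t* → (∀ (ψ : Fin d → ℕ) → (∀ i → ψ i ℕ.≤ 1) →
              N ℕ.* sum {K} (λ k → sum (ψ ∘ chosen t* (toℕ k)))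
                ℕ.≤ K ℕ.* R ℕ.* sum (ψ ∘ t*) ℕ.+ d ℕ.* (N ℕ.* (g ℕ.* R) ℕ.+ suc d ℕ.* (K ℕ.* R))) →
            Approximate (sample t*)
          point-approximate t* h c sat = divide q (mean (sample t*) [ σ ]ᶜ) (ι (sum (χ σ ∘ t*))) (ι N) (ι K) (ι R) (ι g) (ι d) (ι (suc d))
            (mean-ι (sample t*) [ σ ]ᶜ)
            (subst (λ x → x * inv K′ ≤ half ε) (ι-* d g) K-large) (subst (λ x → x * inv N′ ≤ half ε) (ι-* d (suc d)) N-large)
            refl refl (0<ι NR)
            (≤-trans (*-monoʳ-≤ (0≤ι N) (sum-lower K {q * ι R} (λ k → sum (χ σ ∘ chosen t* (toℕ k)))
                (λ k → chosen-count t* (toℕ k) c (λ {τ} {r} i → ≤-<-trans (+-monoʳ-≤ r (kδ≤ε k)) (sat {τ} {r} i)))))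
              (cast-bound {sum {K} (λ k → sum (χ σ ∘ chosen t* (toℕ k)))} {sum (χ σ ∘ t*)}
                (h (χ σ) (λ i → bit≤1 (inCylinder σ (pad (leaf i)))))))
            where
            σ = proj₁ (output c)
            q = proj₂ (output c)
            kδ≤ε : ∀ (k : Fin K) → ι (toℕ k) * δ′ ≤ ε
            kδ≤ε k = subst (ι (toℕ k) * δ′ ≤_) Kδ≡ε (*-monoˡ-≤ δ′≥0 (ι-mono-≤ (ℕₚ.<⇒≤ (toℕ<n k))))

        approximate-sample : ∃[ s ] Approximate s
        approximate-sample = let (t* , h) = averaged-fixed-point shift in sample t* , point-approximate t* h

      approximation : ∀ {ε} → 0ℚ < ε → ∃[ s ] ∀ c → Approximates s ε (lookup G c)
      approximation {ε} ε>0 with inv-scaled (ι (d ℕ.* g)) (half>0 ε>0)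
      ... | K′ , hK with inv-scaled (ι (d ℕ.* suc d)) (half>0 ε>0) | inv-scaled (ι (d ℕ.* suc d)) (0<* ε>0 (inv>0 K′))
      ...   | N₁ , h₁ | N₂ , h₂ = let (s , h) = approximate-sample ε>0 K′ (N₁ ℕ.+ N₂) (hK K′ ℕₚ.≤-refl)
                                        (h₁ (N₁ ℕ.+ N₂) (ℕₚ.m≤m+n N₁ N₂)) (h₂ (N₁ ℕ.+ N₂) (ℕₚ.m≤n+m N₂ N₁))
                                  in s , λ c hold → h c (λ {σ} {q} i → hold (σ , q) i)

    opaque
      -- Sample `n` handles only the finitely many elements with code below `n`, to precision
      -- `1 / (n + 1)`. Every element is thus handled from some index on, with errors tending to 0.
      approximateAt : ∀ n → ∃[ s ] ∀ {el} → elements el → codeE el ℕ.< n → Approximates s (inv n) el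
      approximateAt n = proj₁ approx , λ {el} t lt → at (Initial.every I {el} t lt)
        where
        I : Initial n
        I = initial n
        approx : ∃[ s ] ∀ c → Approximates s (inv n) (lookup (Initial.list I) c)
        approx = approximation (Initial.list I) (λ {el} → Initial.only I {el}) (proj₂ (common-denominator (map proj₂ (Initial.list I)))) (inv>0 n)
        at : ∀ {el} → el ∈ Initial.list I → Approximates (proj₁ approx) (inv n) el
        at i = subst (Approximates (proj₁ approx) (inv n)) (sym (lookup-index i)) (proj₂ approx (index i))

    private
      X : ℕ → Sample
      X n = proj₁ (approximateAt n)

      φ : ℕ → ℕ
      φ = subsequence X

    passing : ProbabilityMeasure
    passing = limitMeasure X

    private
      small : ∀ {ε} → 0ℚ < ε → Eventually (λ n → inv (φ n) < ε)
      small ε>0 = let (N , h) = inv-small ε>0 in N , λ n N≤n → h (φ n) (ℕₚ.≤-trans N≤n (subsequence≥ X n))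

      -- A strict inequality in the limit leaves a fixed gap, which the margin eventually undercuts.
      inputs-hold : ∀ cs → All (passing ⊨_) cs → Eventually (λ n → Hold (X (φ n)) (inv (φ n)) cs)
      inputs-hold [] [] = always (λ n c ())
      inputs-hold ((τ , r) ∷ cs) (sat ∷ sats) = ev-map₂ cons (first (limit-below⇒ X {τ} {r} (<ʳ⇒Below (passing ⟨ τ ⟩) sat))) (inputs-hold cs sats)
        where
        eq : ∀ r r′ i m → m - (r + i) ≡ (m - r′) + (r′ - r - i)
        eq = solve-∀ ℚ-ring
        first : ∃[ r′ ] (r < r′ × Eventually (λ n → r′ < mean (X (φ n)) [ τ ]ᶜ)) →
          Eventually (λ n → r + inv (φ n) < mean (X (φ n)) [ τ ]ᶜ)
        first (r′ , r<r′ , ev) = ev-map₂ (λ n a b → lin<² (eq r r′ (inv (φ n)) (mean (X (φ n)) [ τ ]ᶜ)) a (<⇒≤ b)) ev (small (0<- r<r′))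
        cons : ∀ n → r + inv (φ n) < mean (X (φ n)) [ τ ]ᶜ → Hold (X (φ n)) (inv (φ n)) cs → Hold (X (φ n)) (inv (φ n)) ((τ , r) ∷ cs)
        cons n a rest c (here refl) = a
        cons n a rest c (there i) = rest c i

      output-holds : ∀ {cs σ q m} → elements (cs , σ , q) → All (passing ⊨_) cs → m < q →
        Eventually (λ n → m < mean (X (φ n)) [ σ ]ᶜ)
      output-holds {cs} {σ} {q} {m} t sat m<q = ev-map₂ (λ n (lt , i) hold → bound n lt i hold)
        (ev-map₂ (λ n a b → a , b) late (small (0<- m<q))) (inputs-hold cs sat)
        where
        late : Eventually (λ n → codeE (cs , σ , q) ℕ.< φ n)
        late = suc (codeE (cs , σ , q)) , λ n le → ℕₚ.≤-trans le (subsequence≥ X n)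
        eq : ∀ m q i x → x - m ≡ (q - m - i) + (x + i - q)
        eq = solve-∀ ℚ-ring
        bound : ∀ n → codeE (cs , σ , q) ℕ.< φ n → inv (φ n) < q - m → Hold (X (φ n)) (inv (φ n)) cs → m < mean (X (φ n)) [ σ ]ᶜ
        bound n lt i hold = lin<² (eq m q (inv (φ n)) (mean (X (φ n)) [ σ ]ᶜ)) i (proj₂ (approximateAt (φ n)) {cs , σ , q} t lt hold)

    -- Enlarging `q` to `q₁` makes room for the tolerance on the output, which tends to 0.
    passing-passes : passing Passes T
    passing-passes σ {q} q∈ =
      let (q₁ , q<q₁ , q₁∈) = ℝ.noMaximum (Semimeasure.value (T at passing) σ) q∈
          (cs , t , sat) = proj₂ (proj₂ (isTest passing)) {σ , q₁} (Below⇒<ʳ (Semimeasure.value (T at passing) σ) q₁∈)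
          (m , q<m , m<q₁) = <-dense q<q₁
      in limit-below⇐ X {σ} {q} {m} q<m (output-holds {cs} {σ} {q₁} {m} t sat m<q₁)

-- The class of measures passing the universal test

module NeutralClasses where

  open import Defs renaming (_+_ to _+ʳ_; _≤_ to _≤ʳ_; _<_ to _<ʳ_; _≈_ to _≈ʳ_)
  open import Axiom.ExcludedMiddle using (ExcludedMiddle)
  open import Data.Bool using (true; false)
  open import Data.Empty using (⊥-elim)
  open import Data.List using (List; []; _∷_; map)
  open import Data.List.Properties using (map-cong)
  open import Data.List.Reverse using (Reverse; reverseView; []; _∶_∶ʳ_)
  open import Data.List.Relation.Unary.All using (All; []; _∷_)
  import Data.List.Relation.Unary.All as All
  import Data.List.Relation.Unary.All.Properties as Allₚ
  open import Data.Nat as ℕ using (ℕ; zero; suc)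
  import Data.Nat.Properties as ℕₚ
  open import Data.Product using (Σ; Σ-syntax; ∃; ∃-syntax; _×_; _,_; proj₁; proj₂)
  open import Data.Rational
  open import Data.Rational.Properties hiding (_≟_)
  open import Data.Sum using (inj₁; inj₂)
  open import Data.Vec using ([]; _∷_)
  open import Function using (_∘_)
  open import Function.Bundles using (mk⇔)
  open import Level using (0ℓ)
  open import Relation.Binary.PropositionalEquality
  open import Relation.Nullary using (¬_; yes; no)
  open import Relation.Nullary.Decidable using (decidable-stable)
  open import Relation.Unary using (Pred)
  open import Tactic.RingSolver using (solve-∀)
  open SigmaOneFormulas renaming (_≐_ to _≐ₜ_)
  open UniversalFunction
  open RationalArithmetic
  open LimitMeasures
  open Weights
  open CodeFormulas
  open TrimmedTests
  open UniversalTests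
  open UniversalityProof
  open PassingMeasures

  module _ (μ : ProbabilityMeasure) where

    cylinder-≤ : ∀ σ b → μ ⟨ σ Data.List.∷ʳ b ⟩ ≤ʳ μ ⟨ σ ⟩
    cylinder-≤ σ b {q} q∈ = let (q′ , q<q′ , q′∈) = ℝ.noMaximum (μ ⟨ σ Data.List.∷ʳ b ⟩) q∈ in
      cylinder-superadditive μ σ (sum b q′ q<q′ q′∈)
      where
      flip : ∀ q q′ → 0ℚ - (q - q′) ≡ q′ - q
      flip = solve-∀ ℚ-ring
      cancel : ∀ q q′ → q ≡ q - q′ + q′
      cancel = solve-∀ ℚ-ring
      below-neg : ∀ τ q′ → q < q′ → ℝ.Below (μ ⟨ τ ⟩) (q - q′)
      below-neg τ q′ q<q′ = ProbabilityMeasure.nonnegative μ (cylinder τ) (lin< (flip q q′) q<q′)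
      sum : ∀ b q′ → q < q′ → ℝ.Below (μ ⟨ σ Data.List.∷ʳ b ⟩) q′ → ℝ.Below (μ ⟨ σ ^0 ⟩ +ʳ μ ⟨ σ ^1 ⟩) q
      sum false q′ q<q′ q′∈ = q′ , q - q′ , q′∈ , below-neg (σ ^1) q′ q<q′ , ≤-reflexive (trans (cancel q q′) (+-comm (q - q′) q′))
      sum true  q′ q<q′ q′∈ = q - q′ , q′ , below-neg (σ ^0) q′ q<q′ , q′∈ , ≤-reflexive (cancel q q′)

    cylinder-≤1 : ∀ σ → μ ⟨ σ ⟩ ≤ʳ 1ℝ
    cylinder-≤1 σ = go (reverseView σ)
      where
      go : ∀ {σ} → Reverse σ → μ ⟨ σ ⟩ ≤ʳ 1ℝ
      go [] = proj₁ (ProbabilityMeasure.total μ)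
      go (σ ∶ r ∶ʳ b) = go r ∘ cylinder-≤ σ b

  -- A violated element: inputs above their bounds, output below its bound.  The unused
  -- sides of these two-sided constraints are 2 and -1, which no measure of a cylinder attains.

  codeK : Constraint → ℕ
  codeK (σ , p , q) = ⟪ codeS σ , ⟪ codeQ p , codeQ q ⟫ ⟫

  code-Constraints≡ : ∀ ks → code-Constraints ks ≡ codeL (map codeK ks)
  code-Constraints≡ ks = trans (code-List≡ _ ks) (cong codeL (map-cong constraint ks))
    where
    codeQ≡ : ∀ q → code-ℚ q ≡ codeQ q
    codeQ≡ q = sym (⟪⟫≡pair _ _)
    constraint : ∀ k → code-× code-String (code-× code-ℚ code-ℚ) k ≡ codeK k
    constraint (σ , p , q) = trans (cong₂ pair (code-List≡ code-Bool σ) (trans (cong₂ pair (codeQ≡ p) (codeQ≡ q)) (sym (⟪⟫≡pair _ _)))) (sym (⟪⟫≡pair _ _))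

  upper : Condition → Constraint
  upper (σ , q) = σ , q , ι 2

  below2F : Fm 1
  below2F = ∃′ (∃′ (v2 ≐ₜ ⦅ S (lit 2 ⊗ v1) , v0 ⦆)) ∨ ∃′ (∃′ (v2 ≐ₜ ⦅ lit 2 ⊗ v1 , v0 ⦆ ∧ call lessF (v1 ⊗ lit 1 ∷ lit 2 ⊗ S v0 ∷ [])))

  below2-sound : ∀ {q} → codeQ q ∷ [] ⊩ below2F → q < ι 2
  below2-sound {q} (inj₁ (n , d , e)) = <-trans (codeQ-neg {q} {n} {d} e) (0<ι 1)
  below2-sound {q} (inj₂ (n , d , e , lt)) = subst (_< ι 2) (trans (cong (q *_) ι1) (*-identityʳ q))
    (Num-> {q} {n} {d} {2} {1} (codeQ-nonneg {q} {n} {d} e) (⊩less⇒ lt))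

  below2-complete : ∀ {q} → q < ι 2 → codeQ q ∷ [] ⊩ below2F
  below2-complete {q} lt with code-sign q
  ... | inj₁ (_ , n , d , e) = inj₁ (n , d , e)
  ... | inj₂ (n , d , num) = inj₂ (n , d , Num-code {q} num ,
        ⊩less⇐ (Num->⁻¹ {q} {n} {d} {2} {1} num (subst (_< ι 2) (sym (trans (cong (q *_) ι1) (*-identityʳ q))) lt)))

  upperA : Fm 1
  upperA = v0 ≐ₜ ⦅ lit 0 , lit 0 ⦆

  upperR : Fm 3
  upperR = ∃′ (∃′ (∃′ (∃′ (v4 ≐ₜ ⦅ ⦅ ⦅ v3 , v2 ⦆ , v1 ⦆ , ⦅ ⦅ v3 , ⦅ v2 , lit (codeQ (ι 2)) ⦆ ⦆ , v0 ⦆ ⦆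
    ∧ v5 ≐ₜ ⦅ v1 , v0 ⦆ ∧ v6 ≐ₜ v5 ∧ call below2F (v2 ∷ [])))))

  upperF : Fm 2
  upperF = call (indF upperA upperR) (⦅ v0 , v1 ⦆ ∷ [])

  -- This makes the intervals with upper end 2 proper.
  Small : List Condition → Set
  Small cs = All (λ c → proj₂ c < ι 2) cs

  upper-sound : ∀ {l} ks → l ∷ codeL (map codeK ks) ∷ [] ⊩ upperF → ∃[ cs ] (l ≡ codeCs cs × ks ≡ map upper cs × Small cs)
  upper-sound ks h = go ks refl (ind-sound upperA upperR h)
    where
    go : ∀ {c l} ks → c ≡ ⟪ l , codeL (map codeK ks) ⟫ → Der (Inductive.Ax upperA upperR) (Inductive.Rl upperA upperR) c →
      ∃[ cs ] (l ≡ codeCs cs × ks ≡ map upper cs × Small cs)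
    go [] e (axiom e′) = [] , ⟪⟫-injˡ (trans (sym e) e′) , refl , []
    go (k ∷ ks) e (axiom e′) = ⊥-elim (⟪⟫≢0 (⟪⟫-injʳ (trans (sym e) e′)))
    go [] e (rule (s , r , l′ , m , e′ , _) d _) = ⊥-elim (⟪⟫≢0 (sym (⟪⟫-injʳ (trans (sym e) e′))))
    go ((σ , p , q) ∷ ks) e (rule (s , r , l′ , m , e′ , ep , _ , lt) d _) with ⟪⟫-injective (trans (sym e) e′)
    ... | el , ek with ⟪⟫-injective ek
    ... | ec , em with ⟪⟫-injective ec
    ... | eσ , epq with ⟪⟫-injective epq
    ... | eq , e2 with refl ← codeQ-injective {q} {ι 2} e2
        with go ks (trans ep (cong ⟪ l′ ,_⟫ (sym em))) d
    ... | cs , el′ , eks , small = (σ , p) ∷ cs ,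
          trans el (cong₂ ⟪_,_⟫ (cong₂ ⟪_,_⟫ (sym eσ) (sym eq)) el′) , cong ((σ , p , ι 2) ∷_) eks ,
          below2-sound {p} (subst (λ x → x ∷ [] ⊩ below2F) (sym eq) lt) ∷ small

  upper-complete : ∀ {cs} → Small cs → codeCs cs ∷ codeL (map codeK (map upper cs)) ∷ [] ⊩ upperF
  upper-complete small = ind-complete upperA upperR (go small)
    where
    go : ∀ {cs} → Small cs → Der (Inductive.Ax upperA upperR) (Inductive.Rl upperA upperR)
      ⟪ codeCs cs , codeL (map codeK (map upper cs)) ⟫
    go [] = axiom refl
    go {(σ , q) ∷ cs} (lt ∷ small) = rule (_ , _ , _ , _ , refl , refl , refl , below2-complete {q} lt) (go small) (go small)

  -- The inner pair of quantifiers makes the violated bound nonnegative, so that the interval from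
  -- -1 to it is proper. Nothing is lost, as a negative output bound cannot fail.
  classF : Fm 1
  classF = ∃′ (∃′ (∃′ (∃′ (v4 ≐ₜ ⦅ ⦅ v3 , ⦅ lit (codeQ (- 1ℚ)) , v2 ⦆ ⦆ , v1 ⦆
    ∧ ∃′ (∃′ (v4 ≐ₜ ⦅ lit 2 ⊗ v1 , v0 ⦆)) ∧ call upperF (v0 ∷ v1 ∷ []) ∧ call universalF (⦅ v0 , ⦅ v3 , v2 ⦆ ⦆ ∷ [])))))

  Violation : List Constraint → Set
  Violation ks = ∃[ cs ] ∃[ σ ] ∃[ q ] (ks ≡ (σ , - 1ℚ , q) ∷ map upper cs × 0ℚ ≤ q × Small cs × codeE (cs , σ , q) ∷ [] ⊩ universalF)

  class-sound : ∀ ks → codeL (map codeK ks) ∷ [] ⊩ classF → Violation ks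
  class-sound [] (_ , _ , _ , _ , e , _) = ⊥-elim (⟪⟫≢0 (sym e))
  class-sound ((σ , p , q) ∷ ks) (s , r , m , l , e , (n , d , eq) , up , u) with ⟪⟫-injective e
  ... | ek , em with ⟪⟫-injective ek
  ... | eσ , epq with ⟪⟫-injective epq
  ... | ep , eq′ with refl ← codeQ-injective {p} { - 1ℚ} ep
      with upper-sound ks (subst (λ x → l ∷ x ∷ [] ⊩ upperF) (sym em) up)
  ... | cs , refl , eks , small = cs , σ , q , cong ((σ , - 1ℚ , q) ∷_) eks ,
        Num≥0 {q} {n} {d} (codeQ-nonneg {q} {n} {d} (trans eq′ eq)) , small ,
        subst (λ x → ⟪ codeCs cs , x ⟫ ∷ [] ⊩ universalF) (cong₂ ⟪_,_⟫ (sym eσ) (sym eq′)) u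

  class-complete : ∀ {ks} → Violation ks → codeL (map codeK ks) ∷ [] ⊩ classF
  class-complete (cs , σ , q , refl , 0≤q , small , u) with code-sign q
  ... | inj₁ (q<0 , _) = ⊥-elim (<⇒≱ q<0 0≤q)
  ... | inj₂ (n , d , num) = codeS σ , codeQ q , codeL (map codeK (map upper cs)) , codeCs cs , refl , (n , d , Num-code {q} num) , upper-complete small , u

  module NeutralClass (em : ExcludedMiddle 0ℓ) where

    open UniversalTest em
    open Universality em

    Class : Pred ProbabilityMeasure 0ℓ
    Class μ = μ Passes U

    W : Pred (List Constraint) 0ℓ
    W ks = code-Constraints ks ∷ [] ⊩ classF

    W⇒ : ∀ {ks} → W ks → Violation ks
    W⇒ {ks} w = class-sound ks (subst (λ x → x ∷ [] ⊩ classF) (code-Constraints≡ ks) w)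

    W⇐ : ∀ {ks} → Violation ks → W ks
    W⇐ {ks} v = subst (λ x → x ∷ [] ⊩ classF) (sym (code-Constraints≡ ks)) (class-complete v)

    proper : ∀ {ks} → W ks → All ProperInterval ks
    proper {ks} w with W⇒ {ks} w
    ... | cs , σ , q , refl , 0≤q , small , _ = <-≤-trans -1<0 0≤q ∷ Allₚ.map⁺ small

    module _ (μ : ProbabilityMeasure) where

      1<2 : 1ℚ < ι 2
      1<2 = subst (_< ι 2) ι1 (ι-mono-< (ℕₚ.≤-refl {2}))

      fails⇒ : ¬ Class μ → ∃[ ks ] (W ks × BasicOpen ks μ)
      fails⇒ ¬pass with em {∃[ σ ] ∃[ q ] (ℝ.Below (implied μ σ) q × ¬ ℝ.Below (μ ⟨ σ ⟩) q)}
      ... | no none′ = ⊥-elim (¬pass λ σ {q} b → decidable-stable em λ ¬b → none′ (σ , q , b , ¬b))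
      ... | yes (σ , q , b , ¬b) with ℝ.noMaximum (implied μ σ) b
      -- Failure at `q` only says that the measure of the cylinder is at most `q`; the larger `q₁`
      -- turns this into the strict upper constraint.
      ...   | q₁ , q<q₁ , (cs , i , sat) = (σ , - 1ℚ , q₁) ∷ map upper cs ,
              W⇐ (cs , σ , q₁ , refl , ≤-trans 0≤q (<⇒≤ q<q₁) , All.map (λ {c} s → <-trans (cylinder-≤1 μ (proj₁ c) (<ʳ⇒Below (μ ⟨ proj₁ c ⟩) s)) 1<2) sat ,
                  universal-complete {cs} {σ} {q₁} i) ,
              (Below⇒<ʳ (μ ⟨ σ ⟩) (ProbabilityMeasure.nonnegative μ (cylinder σ) -1<0) , q , ¬b , q<q₁) ∷
              Allₚ.map⁺ (All.map (λ {c} s → s , 1ℚ , (λ b → <-irrefl refl (cylinder-≤1 μ (proj₁ c) b)) , 1<2) sat)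
        where
        0≤q : 0ℚ ≤ q
        0≤q = ≮⇒≥ (λ q<0 → ¬b (ProbabilityMeasure.nonnegative μ (cylinder σ) q<0))

      fails⇐ : ∃[ ks ] (W ks × BasicOpen ks μ) → ¬ Class μ
      fails⇐ (ks , w , open′) pass with W⇒ {ks} w
      fails⇐ (ks , w , (_ , (r , ¬b , r<q)) ∷ rest) pass | cs , σ , q , refl , _ , _ , u =
        ¬b (ℝ.downward (μ ⟨ σ ⟩) r<q (pass σ (cs , universal-sound {cs} {σ} {q} u , All.map proj₁ (Allₚ.map⁻ rest))))

    class-Π⁰₁ : IsΠ⁰₁ Class
    class-Π⁰₁ = W , formula-CE code-Constraints classF , proper , λ μ → mk⇔ (fails⇒ μ) (fails⇐ μ)

open import Defs
open import Axiom.ExcludedMiddle using (ExcludedMiddle)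
open import Data.Product using (Σ-syntax; ∃; _×_; _,_)
open import Level using (0ℓ)
open import Relation.Unary using (Pred)
open NeutralClasses using (module NeutralClass)
open UniversalTests using (module UniversalTest)
open UniversalityProof using (module Universality)
open PassingMeasures using (module PassingMeasure)

-- The same test `U` witnesses neutrality for every member of the class.
corollary4p4 : (∀ {ℓ} → ExcludedMiddle ℓ) →
    Σ[ C ∈ Pred ProbabilityMeasure 0ℓ ]
    (IsΠ⁰₁ C × ∃ C × (∀ μ → C μ → Neutral μ))
corollary4p4 em = Class , class-Π⁰₁ , (passing , passing-passes) , λ μ pass → U , U-universal , pass
  where
  open NeutralClass em
  open UniversalTest em using (U)
  open Universality em using (U-universal)
  open PassingMeasure em U using (passing; passing-passes)
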